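{- Let $a$ be a prime of the form $a=2^r\cdot 3+1$ with $r\in\{1,2,5,6,8,12,18,30,36,41,66,189,201,209,276,353,408,438,534,2208,2816,3168,3189,3912\}$ (equivalently, $a$ is any prime of the form $2^r\cdot 3+1$ with $r$ a positive integer, $r\le 3912$). Let $b,c$ be positive integers with $b>1$ such that $a,b,c$ are relatively prime. Then the equation $a^x-b^y=c$ has at most one solution in positive integers $x,y$, except for $(a,b,c)=(13,3,10)$, in which case there are exactly two solutions. -}

module Defs where

open import Data.Nat using (ℕ; _+_; _*_; _^_)
open import Data.Nat.Primality using (Prime)
open import Data.Product using (_×_; ∃-syntax)
open import Data.List using (List; _∷_; [])
open import Data.List.Membership.Propositional using (_∈_)
open import Relation.Binary.PropositionalEquality using (_≡_)

rList : List ℕ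
rList = 1 ∷ 2 ∷ 5 ∷ 6 ∷ 8 ∷ 12 ∷ 18 ∷ 30 ∷ 36 ∷ 41 ∷ 66 ∷ 189 ∷ 201 ∷ 209 ∷ 276
      ∷ 353 ∷ 408 ∷ 438 ∷ 534 ∷ 2208 ∷ 2816 ∷ 3168 ∷ 3189 ∷ 3912 ∷ []

AdmissibleA : ℕ → Set
AdmissibleA a = Prime a × ∃[ r ] (r ∈ rList × a ≡ 2 ^ r * 3 + 1)

-- (x , y) is a solution in positive integers of a^x - b^y = c
-- (written additively over ℕ: a^x = b^y + c).
Solution : ℕ → ℕ → ℕ → ℕ → ℕ → Set
Solution a b c x y = 1 Data.Nat.≤ x × 1 Data.Nat.≤ y × a ^ x ≡ b ^ y + c

{-# OPTIONS --safe #-}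
-- Let x < X and y < Y be two solutions, d = Y - y, D = X - x, so that a^x (a^D - 1) = b^y (b^d - 1).
-- If d = 2e is even, then √(b^y) + √-c generates all elements of norm a power of a, whence √(b^Y) + √-c
-- is up to sign an odd power of it, and comparing the coefficients modulo the primes dividing b leaves
-- only a = 13, b = 3, c = 10 (for c = 1 divisibility of geometric sums suffices).
-- If d is odd, Fermat gives b^3 ≡ 1 (mod a), because a - 1 = 3·2^r and d has no common factor with 2^r.
-- Write n₀ for the order of b modulo a, d = n₀ δ, b^n₀ = 1 + a^g η and δ = a^s d′; lifting the exponent
-- gives x = g + s. The second-order terms of the lifting allow b to be eliminated: a^g ≤ 6561 δ⁴.
-- Conversely b^(y+d) + c is divisible by a high power of a, so δ is small by an a-adic Baker-type argument:
-- Siegel's lemma yields an auxiliary exponential polynomial with small coefficients whose values at many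
-- points are divisible by large powers of a, hence vanish, against a zero estimate.
-- For r ≥ 66 the two bounds contradict each other; for smaller r they leave a finite search, because b is
-- 1 or a primitive cube root of unity modulo a^g and b < a^x.

module Submission where

open import Defs
open import Data.Nat using (ℕ; _≤_; _<_)
open import Data.Nat.Coprimality using (Coprime)
open import Data.Product using (_×_; _,_; ∃-syntax)
open import Data.Sum using (_⊎_)
open import Relation.Nullary using (¬_)
open import Relation.Binary.PropositionalEquality using (_≡_)

open import Data.Nat.Base as ℕ using (zero; suc; s≤s; z≤n; NonZero)
import Data.Nat.Properties as ℕ
import Data.Nat.Divisibility as ℕ
import Data.Nat.DivMod as ℕ
import Data.Nat.Tactic.RingSolver as ℕ-Ring
open import Data.Nat.Primality using (Prime)
open import Data.Product using (proj₁; proj₂; Σ-syntax)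
open import Data.Sum as Sum using (inj₁; inj₂; [_,_]′)
open import Data.Empty using (⊥; ⊥-elim)
open import Relation.Nullary using (Dec; yes; no)
open import Relation.Binary.PropositionalEquality hiding (_≡_)

-- The usual tool here is a lower bound for linear forms in two p-adic logarithms. It is replaced by
-- pure integer arithmetic: modulo powers of G = a^g the function ξ^z, with ξ = b^n₀ ≡ 1, behaves
-- like an analytic one, since its i-th difference is divisible by G^i. Differences at 0 play the
-- part of derivatives, and a number divisible by G^τ but smaller than G^τ is zero.
--
-- On the elimination side the obstacle is y = 1: the congruence modulo G still contains b, which
-- may be as large as G. The congruence modulo G² supplies a second equation, and b, a root of b² +
-- b + 1 modulo G, disappears in a resultant. The fourth power of δ arises there; 6561 = 9⁴ comes
-- from the case δ = 1.
--
-- The two bounds can meet because the criterion for δ improves as G grows: with u = 1 and m = 2 it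
-- gives δ ≤ 3552 whatever a is.
--
-- Denominators are avoided by fixed factors: κ! for binomial polynomials, 6 in the lifting of
-- exponents, 3 in the expansions modulo B².

module Powers where
  open import Data.Nat.Base
  open import Data.Nat.Properties
  open import Data.Nat.Tactic.RingSolver using (solve-∀)

  ^-distribʳ-* : ∀ x y n → (x * y) ^ n ≡ x ^ n * y ^ n
  ^-distribʳ-* x y zero    = refl
  ^-distribʳ-* x y (suc n) = trans (cong (x * y *_) (^-distribʳ-* x y n)) (lem x y (x ^ n) (y ^ n))
    where
    lem : ∀ x y p q → x * y * (p * q) ≡ x * p * (y * q)
    lem = solve-∀

-- Polynomial functions on the naturals: degree, leading coefficient, roots

module TopDegree where
  open import Data.Integer.Base hiding (suc)
  open import Data.Integer.Properties
  open import Data.Integer.Tactic.RingSolver using (solve-∀)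
  open import Data.List.Base using ([]; _∷_; length)
  open import Data.List.Relation.Unary.All as All using (All; []; _∷_)
  open import Data.List.Relation.Unary.AllPairs using (AllPairs; []; _∷_)

  -- Horner form: f agrees on the naturals with an integer polynomial of formal degree d whose
  -- coefficient of z^d is t, and t may be zero. Working with functions keeps shifts and products
  -- pointwise; the leading coefficient is the only one that the type exposes.
  Top : ℕ → (ℕ → ℤ) → ℤ → Set
  Top zero    f t = ∀ z → f z ≡ t
  Top (suc d) f t = Σ[ c ∈ ℤ ] Σ[ g ∈ (ℕ → ℤ) ] (Top d g t × (∀ z → f z ≡ c + + z * g z))

  top-cong : ∀ d {f f′ t t′} → (∀ z → f z ≡ f′ z) → t ≡ t′ → Top d f t → Top d f′ t′
  top-cong zero    e refl p z = trans (sym (e z)) (p z)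
  top-cong (suc d) e refl (c , g , p , q) = c , g , p , λ z → trans (sym (e z)) (q z)

  top-raise : ∀ d {f t} → Top d f t → Top (suc d) f 0ℤ
  top-raise zero {t = t} p = t , (λ _ → 0ℤ) , (λ _ → refl) , λ z → trans (p z) (lem t (+ z))
    where
    lem : ∀ t z → t ≡ t + z * 0ℤ
    lem = solve-∀
  top-raise (suc d) (c , g , p , q) = c , g , top-raise d p , q

  top-raiseBy : ∀ k d {f t} → Top d f t → Top (suc k ℕ.+ d) f 0ℤ
  top-raiseBy zero    d p = top-raise d p
  top-raiseBy (suc k) d p = top-raise (suc k ℕ.+ d) (top-raiseBy k d p)

  top-add : ∀ d {f f′ t t′} → Top d f t → Top d f′ t′ → Top d (λ z → f z + f′ z) (t + t′)
  top-add zero    p p′ z = cong₂ _+_ (p z) (p′ z)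
  top-add (suc d) (c , g , p , q) (c′ , g′ , p′ , q′) =
    c + c′ , (λ z → g z + g′ z) , top-add d p p′ , λ z → trans (cong₂ _+_ (q z) (q′ z)) (lem c c′ (+ z) (g z) (g′ z))
    where
    lem : ∀ c c′ z g g′ → (c + z * g) + (c′ + z * g′) ≡ (c + c′) + z * (g + g′)
    lem = solve-∀

  top-scale : ∀ d a {f t} → Top d f t → Top d (λ z → a * f z) (a * t)
  top-scale zero    a p z = cong (a *_) (p z)
  top-scale (suc d) a (c , g , p , q) =
    a * c , (λ z → a * g z) , top-scale d a p , λ z → trans (cong (a *_) (q z)) (lem a c (+ z) (g z))
    where
    lem : ∀ a c z g → a * (c + z * g) ≡ a * c + z * (a * g)
    lem = solve-∀

  top-z : ∀ d {f t} → Top d f t → Top (suc d) (λ z → + z * f z) t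
  top-z d {f} p = 0ℤ , f , p , λ z → sym (+-identityˡ _)

  top-mul : ∀ d e {f g t u} → Top d f t → Top e g u → Top (d ℕ.+ e) (λ z → f z * g z) (t * u)
  top-mul zero e {f} {g} {t} p q = top-cong e (λ z → cong (_* g z) (sym (p z))) refl (top-scale e t q)
  top-mul (suc d) e {f} {g} {t} {u} (c , h , p , r) q =
    top-cong (suc (d ℕ.+ e)) (λ z → trans (lem c (+ z) (h z) (g z)) (cong (_* g z) (sym (r z)))) (+-identityʳ _)
      (top-add (suc (d ℕ.+ e)) (top-z (d ℕ.+ e) (top-mul d e p q)) (top-raiseBy d e (top-scale e c q)))
    where
    lem : ∀ c z h g → z * (h * g) + c * g ≡ (c + z * h) * g
    lem = solve-∀

  top-shift : ∀ d i {f t} → Top d f t → Top d (λ z → f (z ℕ.+ i)) t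
  top-shift zero    i p z = p (z ℕ.+ i)
  top-shift (suc d) i {f} {t} (c , g , p , q) =
    top-cong (suc d) (λ z → trans (lem c (+ z) (+ i) (g (z ℕ.+ i))) (sym (trans (q (z ℕ.+ i)) (cong (λ w → c + w * g (z ℕ.+ i)) (pos-+ z i)))))
      (trans (+-identityʳ _) refl)
      (top-add (suc d) (c , (λ z → g (z ℕ.+ i)) , top-shift d i p , λ _ → refl) (top-raise d (top-scale d (+ i) (top-shift d i p))))
    where
    lem : ∀ c z i g → (c + z * g) + i * g ≡ c + (z + i) * g
    lem = solve-∀

  -- Synthetic division at x. The quotient keeps the top coefficient t, so that `top-roots` can
  -- conclude something about t as well as about f.
  top-factor : ∀ d x {f t} → Top (suc d) f t →
    Σ[ g ∈ (ℕ → ℤ) ] (Top d g t × (∀ z → f z ≡ f x + (+ z - + x) * g z))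
  top-factor zero x {f} {t} (c , g , p , q) = g , p , λ z → begin
    f z ≡⟨ q z ⟩
    c + + z * g z ≡⟨ cong (λ w → c + + z * w) (p z) ⟩
    c + + z * t ≡⟨ lem c (+ z) (+ x) t ⟩
    c + + x * t + (+ z - + x) * t ≡⟨ cong₂ (λ u v → c + + x * u + (+ z - + x) * v) (sym (p x)) (sym (p z)) ⟩
    c + + x * g x + (+ z - + x) * g z ≡⟨ cong (_+ (+ z - + x) * g z) (sym (q x)) ⟩
    f x + (+ z - + x) * g z ∎
    where
    open ≡-Reasoning
    lem : ∀ c z x t → c + z * t ≡ c + x * t + (z - x) * t
    lem = solve-∀
  top-factor (suc d) x {f} {t} (c , h , p , q) with top-factor d x p
  ... | h′ , p′ , r = (λ z → h x + + z * h′ z) , (h x , h′ , p′ , λ _ → refl) , λ z → begin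
    f z ≡⟨ q z ⟩
    c + + z * h z ≡⟨ cong (λ w → c + + z * w) (r z) ⟩
    c + + z * (h x + (+ z - + x) * h′ z) ≡⟨ lem c (+ z) (+ x) (h x) (h′ z) ⟩
    (c + + x * h x) + (+ z - + x) * (h x + + z * h′ z) ≡⟨ cong (_+ (+ z - + x) * (h x + + z * h′ z)) (sym (q x)) ⟩
    f x + (+ z - + x) * (h x + + z * h′ z) ∎
    where
    open ≡-Reasoning
    lem : ∀ c z x k k′ → c + z * (k + (z - x) * k′) ≡ (c + x * k) + (z - x) * (k + z * k′)
    lem = solve-∀

  cancel : ∀ {x y : ℤ} → x * y ≡ 0ℤ → x ≢ 0ℤ → y ≡ 0ℤ
  cancel {x} {y} e ne with i*j≡0⇒i≡0∨j≡0 x e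
  ... | inj₁ p = ⊥-elim (ne p)
  ... | inj₂ p = p

  -- One root is divided out at a time; at the other roots the factor z - x is non-zero. In the zero
  -- estimate t = 0 drives the leading-term argument, the vanishing of f the identities.
  top-roots : ∀ d {f t} xs → Top d f t → length xs ≡ suc d → AllPairs _≢_ xs →
    All (λ x → f x ≡ 0ℤ) xs → t ≡ 0ℤ × (∀ z → f z ≡ 0ℤ)
  top-roots zero (x ∷ []) p _ _ (e ∷ []) = t≡0 , λ z → trans (p z) t≡0
    where t≡0 = trans (sym (p x)) e
  top-roots (suc d) {f} {t} (x ∷ xs) p len (ne ∷ ap) (e ∷ es) with top-factor d x p
  ... | g , q , r = proj₁ rec , λ z → trans (f≡ z) (trans (cong ((+ z - + x) *_) (proj₂ rec z)) (*-zeroʳ (+ z - + x)))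
    where
    f≡ : ∀ z → f z ≡ (+ z - + x) * g z
    f≡ z = trans (r z) (trans (cong (_+ (+ z - + x) * g z) e) (+-identityˡ _))
    rec = top-roots d xs q (ℕ.suc-injective len) ap
      (All.zipWith (λ {y} (x≢y , fy) → cancel (trans (sym (f≡ y)) fy) (λ z → x≢y (sym (+-injective (i-j≡0⇒i≡j (+ y) (+ x) z))))) (ne , es))

-- Finite sums, Siegel's lemma and homogeneous linear systems

module Siegel where
  open import Data.Fin.Base as Fin using (Fin; toℕ; fromℕ<)
  import Data.Fin.Properties as Fin
  open import Data.Integer.Base hiding (suc; NonZero)
  open import Data.Integer.Properties
  open import Data.Integer.DivMod using (_%ℕ_; _/ℕ_; n%ℕd<d; a≡a%ℕn+[a/ℕn]*n)
  open import Data.Integer.Divisibility.Signed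
  open import Data.Integer.Tactic.RingSolver using (solve-∀)
  open import Data.List.Base using (List; []; _∷_; length; map)
  open import Data.List.Relation.Unary.All as All using (All; []; _∷_)
  import Data.List.Relation.Unary.All.Properties as All
  open Powers using (^-distribʳ-*)

  Σ< : ℕ → (ℕ → ℤ) → ℤ
  Σ< zero    f = 0ℤ
  Σ< (suc n) f = Σ< n f + f n

  Σ<-cong : ∀ n {f g} → (∀ {i} → i ℕ.< n → f i ≡ g i) → Σ< n f ≡ Σ< n g
  Σ<-cong zero    e = refl
  Σ<-cong (suc n) e = cong₂ _+_ (Σ<-cong n (λ p → e (ℕ.m<n⇒m<1+n p))) (e (ℕ.n<1+n n))

  Σ<-zero : ∀ n {f} → (∀ {i} → i ℕ.< n → f i ≡ 0ℤ) → Σ< n f ≡ 0ℤ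
  Σ<-zero zero    e = refl
  Σ<-zero (suc n) e = cong₂ _+_ (Σ<-zero n (λ p → e (ℕ.m<n⇒m<1+n p))) (e (ℕ.n<1+n n))

  Σ<-+ : ∀ n f g → Σ< n (λ i → f i + g i) ≡ Σ< n f + Σ< n g
  Σ<-+ zero    f g = refl
  Σ<-+ (suc n) f g = trans (cong (_+ (f n + g n)) (Σ<-+ n f g)) (lem (Σ< n f) (Σ< n g) (f n) (g n))
    where
    lem : ∀ a b c d → (a + b) + (c + d) ≡ (a + c) + (b + d)
    lem = solve-∀

  Σ<-* : ∀ n a f → Σ< n (λ i → a * f i) ≡ a * Σ< n f
  Σ<-* zero    a f = sym (*-zeroʳ a)
  Σ<-* (suc n) a f = trans (cong (_+ a * f n) (Σ<-* n a f)) (sym (*-distribˡ-+ a (Σ< n f) (f n)))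

  Σ<-*ʳ : ∀ n a f → Σ< n (λ i → f i * a) ≡ Σ< n f * a
  Σ<-*ʳ n a f = trans (Σ<-cong n (λ {i} _ → *-comm (f i) a)) (trans (Σ<-* n a f) (*-comm a (Σ< n f)))

  Σ<-swap : ∀ m n (f : ℕ → ℕ → ℤ) → Σ< m (λ i → Σ< n (f i)) ≡ Σ< n (λ j → Σ< m (λ i → f i j))
  Σ<-swap zero    n f = sym (Σ<-zero n (λ _ → refl))
  Σ<-swap (suc m) n f = trans (cong (_+ Σ< n (f m)) (Σ<-swap m n f)) (sym (Σ<-+ n _ _))

  Σ<-split : ∀ m n f → Σ< (m ℕ.+ n) f ≡ Σ< m f + Σ< n (λ i → f (m ℕ.+ i))
  Σ<-split m zero    f = trans (cong (λ k → Σ< k f) (ℕ.+-identityʳ m)) (sym (+-identityʳ _))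
  Σ<-split m (suc n) f = trans (cong (λ k → Σ< k f) (ℕ.+-suc m n))
    (trans (cong (_+ f (m ℕ.+ n)) (Σ<-split m n f)) (+-assoc (Σ< m f) _ _))

  -- Siegel's lemma numbers its unknowns by a single index; unknowns with two indices i < m and j <
  -- n are packed as i n + j.
  Σ<-flatten : ∀ m n f → Σ< (m ℕ.* n) f ≡ Σ< m (λ i → Σ< n (λ j → f (i ℕ.* n ℕ.+ j)))
  Σ<-flatten zero    n f = refl
  Σ<-flatten (suc m) n f = trans (cong (λ k → Σ< k f) (ℕ.+-comm n (m ℕ.* n)))
    (trans (Σ<-split (m ℕ.* n) n f) (cong (_+ Σ< n (λ j → f (m ℕ.* n ℕ.+ j))) (Σ<-flatten m n f)))

  Σ<-∣ : ∀ n {k f} → (∀ {i} → i ℕ.< n → k ∣ f i) → k ∣ Σ< n f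
  Σ<-∣ zero    {k} d = divides 0ℤ refl
  Σ<-∣ (suc n) d = ∣m∣n⇒∣m+n (Σ<-∣ n (λ p → d (ℕ.m<n⇒m<1+n p))) (d (ℕ.n<1+n n))

  Σ<-bound : ∀ n {f} M → (∀ {i} → i ℕ.< n → ∣ f i ∣ ℕ.≤ M) → ∣ Σ< n f ∣ ℕ.≤ n ℕ.* M
  Σ<-bound zero    M b = z≤n
  Σ<-bound (suc n) {f} M b = begin
    ∣ Σ< n f + f n ∣         ≤⟨ ∣i+j∣≤∣i∣+∣j∣ (Σ< n f) (f n) ⟩
    ∣ Σ< n f ∣ ℕ.+ ∣ f n ∣   ≤⟨ ℕ.+-mono-≤ (Σ<-bound n M (λ p → b (ℕ.m<n⇒m<1+n p))) (b (ℕ.n<1+n n)) ⟩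
    n ℕ.* M ℕ.+ M            ≡⟨ ℕ.+-comm (n ℕ.* M) M ⟩
    suc n ℕ.* M              ∎
    where open ℕ.≤-Reasoning

  ∣∧<⇒≡0 : ∀ {M v} → + M ∣ v → ∣ v ∣ ℕ.< M → v ≡ 0ℤ
  ∣∧<⇒≡0 {M} {v} d lt with ∣ v ∣ in eq
  ... | zero  = ∣i∣≡0⇒i≡0 eq
  ... | suc k = ⊥-elim (ℕ.<⇒≱ lt (ℕ.∣⇒≤ (subst (M ℕ.∣_) eq (∣⇒∣ᵤ d))))

  -- A linear form with the modulus at which it has to vanish. The moduli may differ, because the
  -- conditions on the differences of the auxiliary function weaken as their order grows.
  record Form : Set where
    constructor form
    field
      modulus : ℕ
      {{modulus≢0}} : NonZero modulus
      coef : ℕ → ℤ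
  open Form

  moduli : List Form → ℕ
  moduli []       = 1
  moduli (φ ∷ φs) = modulus φ ℕ.* moduli φs

  private
    -- Numbers below H^N stand for vectors of N coordinates below H, so that the pigeonhole
    -- principle for `Fin` applies.
    digit : (H : ℕ) .{{_ : NonZero H}} → ℕ → ℕ → ℕ
    digit H t zero    = t ℕ.% H
    digit H t (suc j) = digit H (t ℕ./ H) j

    digit< : ∀ H .{{_ : NonZero H}} t j → digit H t j ℕ.< H
    digit< H t zero    = ℕ.m%n<n t H
    digit< H t (suc j) = digit< H (t ℕ./ H) j

    digit-inj : ∀ N H .{{_ : NonZero H}} {t t′} → t ℕ.< H ℕ.^ N → t′ ℕ.< H ℕ.^ N →
      (∀ j → j ℕ.< N → digit H t j ≡ digit H t′ j) → t ≡ t′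
    digit-inj zero H (s≤s z≤n) (s≤s z≤n) _ = refl
    digit-inj (suc N) H {t} {t′} lt lt′ e = begin
      t                                 ≡⟨ ℕ.m≡m%n+[m/n]*n t H ⟩
      t ℕ.% H ℕ.+ t ℕ./ H ℕ.* H         ≡⟨ cong₂ (λ u v → u ℕ.+ v ℕ.* H) (e 0 (s≤s z≤n)) rec ⟩
      t′ ℕ.% H ℕ.+ t′ ℕ./ H ℕ.* H       ≡⟨ sym (ℕ.m≡m%n+[m/n]*n t′ H) ⟩
      t′ ∎
      where
      open ≡-Reasoning
      low : ∀ {t} → t ℕ.< H ℕ.* H ℕ.^ N → t ℕ./ H ℕ.< H ℕ.^ N
      low {t} p = ℕ.m<n*o⇒m/o<n (subst (t ℕ.<_) (ℕ.*-comm H (H ℕ.^ N)) p)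
      rec = digit-inj N H (low lt) (low lt′) (λ j p → e (suc j) (s≤s p))

    val : ℕ → (ℕ → ℕ) → (ℕ → ℤ) → ℤ
    val N x c = Σ< N (λ j → + x j * c j)

    -- All residues of the forms at x, packed into one number in mixed radix.
    code : ℕ → (ℕ → ℕ) → List Form → ℕ
    code N x []       = 0
    code N x (φ ∷ φs) = val N x (coef φ) %ℕ modulus φ ℕ.+ modulus φ ℕ.* code N x φs

    code< : ∀ N x φs → code N x φs ℕ.< moduli φs
    code< N x []       = s≤s z≤n
    code< N x (φ ∷ φs) = begin-strict
      val N x (coef φ) %ℕ modulus φ ℕ.+ modulus φ ℕ.* code N x φs
        <⟨ ℕ.+-monoˡ-< _ (n%ℕd<d (val N x (coef φ)) (modulus φ)) ⟩
      modulus φ ℕ.+ modulus φ ℕ.* code N x φs ≡⟨ sym (ℕ.*-suc (modulus φ) _) ⟩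
      modulus φ ℕ.* suc (code N x φs) ≤⟨ ℕ.*-monoʳ-≤ (modulus φ) (code< N x φs) ⟩
      modulus φ ℕ.* moduli φs ∎
      where open ℕ.≤-Reasoning

    mixed-radix : ∀ {m r r′ k k′} .{{_ : NonZero m}} → r ℕ.< m → r′ ℕ.< m →
      r ℕ.+ m ℕ.* k ≡ r′ ℕ.+ m ℕ.* k′ → r ≡ r′ × k ≡ k′
    mixed-radix {m} {r} {r′} {k} {k′} lt lt′ e = r≡ , ℕ.*-cancelˡ-≡ k k′ m (ℕ.+-cancelˡ-≡ r _ _ (trans e (cong (ℕ._+ m ℕ.* k′) (sym r≡))))
      where
      low : ∀ {r} k → r ℕ.< m → (r ℕ.+ m ℕ.* k) ℕ.% m ≡ r
      low {r} k lt = trans (cong (λ w → (r ℕ.+ w) ℕ.% m) (ℕ.*-comm m k)) (trans (ℕ.[m+kn]%n≡m%n r k m) (ℕ.m<n⇒m%n≡m lt))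
      r≡ = trans (sym (low k lt)) (trans (cong (ℕ._% m) e) (low k′ lt′))

    %ℕ-≡⇒∣ : ∀ {a b} m .{{_ : NonZero m}} → a %ℕ m ≡ b %ℕ m → + m ∣ a - b
    %ℕ-≡⇒∣ {a} {b} m e = divides (a /ℕ m - b /ℕ m) (begin
      a - b ≡⟨ cong₂ _-_ (a≡a%ℕn+[a/ℕn]*n a m) (a≡a%ℕn+[a/ℕn]*n b m) ⟩
      (+ (a %ℕ m) + a /ℕ m * + m) - (+ (b %ℕ m) + b /ℕ m * + m) ≡⟨ cong (λ w → (+ w + a /ℕ m * + m) - (+ (b %ℕ m) + b /ℕ m * + m)) e ⟩
      (+ (b %ℕ m) + a /ℕ m * + m) - (+ (b %ℕ m) + b /ℕ m * + m) ≡⟨ lem (+ (b %ℕ m)) (a /ℕ m) (b /ℕ m) (+ m) ⟩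
      (a /ℕ m - b /ℕ m) * + m ∎)
      where
      open ≡-Reasoning
      lem : ∀ r p q m → (r + p * m) - (r + q * m) ≡ (p - q) * m
      lem = solve-∀

    val-diff : ∀ N (x y : ℕ → ℕ) c → val N x c - val N y c ≡ Σ< N (λ j → (+ x j - + y j) * c j)
    val-diff zero    x y c = refl
    val-diff (suc N) x y c = trans (lem (val N x c) (+ x N) (val N y c) (+ y N) (c N)) (cong (_+ (+ x N - + y N) * c N) (val-diff N x y c))
      where
      lem : ∀ a x b y c → (a + x * c) - (b + y * c) ≡ (a - b) + (x - y) * c
      lem = solve-∀

    code-≡ : ∀ N x y φs → code N x φs ≡ code N y φs →
      All (λ φ → + modulus φ ∣ Σ< N (λ j → (+ x j - + y j) * coef φ j)) φs
    code-≡ N x y []       e = []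
    code-≡ N x y (φ ∷ φs) e with mixed-radix (n%ℕd<d (val N x (coef φ)) (modulus φ)) (n%ℕd<d (val N y (coef φ)) (modulus φ)) e
    ... | p , q = subst (+ modulus φ ∣_) (val-diff N x y (coef φ)) (%ℕ-≡⇒∣ {val N x (coef φ)} {val N y (coef φ)} (modulus φ) p) ∷ code-≡ N x y φs q

    ∣-∣< : ∀ {x y H} → x ℕ.< H → y ℕ.< H → ∣ + x - + y ∣ ℕ.< H
    ∣-∣< {x} {y} {H} p q rewrite m-n≡m⊖n x y with ℕ.≤-total x y
    ... | inj₁ le rewrite ∣⊖∣-≤ le = ℕ.≤-<-trans (ℕ.m∸n≤m y x) q
    ... | inj₂ ge rewrite ⊖-≥ ge = ℕ.≤-<-trans (ℕ.m∸n≤m x y) p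

    differ : ∀ N H .{{_ : NonZero H}} {t t′} → t ≢ t′ → t ℕ.< H ℕ.^ N → t′ ℕ.< H ℕ.^ N →
      ∃[ j ] (j ℕ.< N × digit H t j ≢ digit H t′ j)
    differ N H {t} {t′} ne lt lt′ with Fin.any? {n = N} (λ j → ¬? (digit H t (toℕ j) ℕ.≟ digit H t′ (toℕ j)))
      where open import Relation.Nullary using (¬?)
    ... | yes (j , p) = toℕ j , Fin.toℕ<n j , p
    ... | no none = ⊥-elim (ne (digit-inj N H lt lt′ λ j p →
            decidable-stable (digit H t j ℕ.≟ digit H t′ j) λ q → none (fromℕ< p , λ r → q (subst (λ w → digit H t w ≡ digit H t′ w) (Fin.toℕ-fromℕ< p) r))))
      where open import Relation.Nullary.Decidable using (decidable-stable)

  -- There are H^N vectors with entries in [0, H) and fewer residue patterns; two vectors share a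
  -- pattern, and their difference is the solution.
  siegel : ∀ N H .{{_ : NonZero H}} φs → moduli φs ℕ.< H ℕ.^ N →
    Σ[ p ∈ (ℕ → ℤ) ] ((∀ j → ∣ p j ∣ ℕ.< H) × (∃[ j ] (j ℕ.< N × p j ≢ 0ℤ)) ×
      All (λ φ → + modulus φ ∣ Σ< N (λ j → p j * coef φ j)) φs)
  siegel N H φs lt with Fin.pigeonhole lt (λ t → fromℕ< (code< N (digit H (toℕ t)) φs))
  ... | t , t′ , t<t′ , e with differ N H (λ q → ℕ.<⇒≢ t<t′ q) (Fin.toℕ<n t) (Fin.toℕ<n t′)
  ... | j , j<N , ne =
    (λ j → + x j - + y j) , (λ j → ∣-∣< (digit< H (toℕ t) j) (digit< H (toℕ t′) j))
    , (j , j<N , λ q → ne (+-injective (i-j≡0⇒i≡j (+ x j) (+ y j) q)))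
    , code-≡ N x y φs (trans (sym (Fin.toℕ-fromℕ< (code< N x φs))) (trans (cong toℕ e) (Fin.toℕ-fromℕ< (code< N y φs))))
    where
    x = digit H (toℕ t)
    y = digit H (toℕ t′)

  private
    size : ℕ → (ℕ → ℤ) → ℕ
    size zero    c = 0
    size (suc N) c = size N c ℕ.+ ∣ c N ∣

    value-bound : ∀ N H (p c : ℕ → ℤ) → (∀ j → ∣ p j ∣ ℕ.< H) → ∣ Σ< N (λ j → p j * c j) ∣ ℕ.≤ H ℕ.* size N c
    value-bound zero    H p c b = z≤n
    value-bound (suc N) H p c b = begin
      ∣ Σ< N _ + p N * c N ∣                ≤⟨ ∣i+j∣≤∣i∣+∣j∣ (Σ< N _) (p N * c N) ⟩
      ∣ Σ< N (λ j → p j * c j) ∣ ℕ.+ ∣ p N * c N ∣ ≤⟨ ℕ.+-mono-≤ (value-bound N H p c b)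
          (ℕ.≤-trans (ℕ.≤-reflexive (abs-* (p N) (c N))) (ℕ.*-monoˡ-≤ ∣ c N ∣ (ℕ.<⇒≤ (b N)))) ⟩
      H ℕ.* size N c ℕ.+ H ℕ.* ∣ c N ∣       ≡⟨ sym (ℕ.*-distribˡ-+ H (size N c) ∣ c N ∣) ⟩
      H ℕ.* size (suc N) c ∎
      where open ℕ.≤-Reasoning

    total : ℕ → List (ℕ → ℤ) → ℕ
    total N []       = 0
    total N (c ∷ cs) = size N c ℕ.+ total N cs

    total-≤ : ∀ N cs → All (λ c → size N c ℕ.≤ total N cs) cs
    total-≤ N []       = []
    total-≤ N (c ∷ cs) = ℕ.m≤m+n _ _ ∷ All.map (λ p → ℕ.≤-trans p (ℕ.m≤n+m _ (size N c))) (total-≤ N cs)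

  -- The equations are solved as congruences modulo an M that exceeds every value the forms can
  -- take, so that divisibility by M means vanishing.
  linear-system : ∀ N cs → length cs ℕ.< N →
    Σ[ p ∈ (ℕ → ℤ) ] ((∃[ j ] (j ℕ.< N × p j ≢ 0ℤ)) × All (λ c → Σ< N (λ j → p j * c j) ≡ 0ℤ) cs)
  linear-system N cs lt with siegel N H φs small
    where
    a = total N cs
    -- For k equations M^k = H^k (a + 1)^k, and H exceeds (a + 1)^k, so M^k < H^(k+1) ≤ H^N. Values
    -- of the forms are at most H a < M.
    H = suc (suc a ℕ.^ length cs)
    M = H ℕ.* suc a
    φs = map (form M) cs
    moduli-φs : ∀ cs → moduli (map (form M) cs) ≡ M ℕ.^ length cs
    moduli-φs []       = refl
    moduli-φs (c ∷ cs) = cong (M ℕ.*_) (moduli-φs cs)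
    *-^ : ∀ x y n → (x ℕ.* y) ℕ.^ n ≡ x ℕ.^ n ℕ.* y ℕ.^ n
    *-^ = ^-distribʳ-*
    small : moduli φs ℕ.< H ℕ.^ N
    small = begin-strict
      moduli φs                                     ≡⟨ moduli-φs cs ⟩
      M ℕ.^ length cs                               ≡⟨ *-^ H (suc a) (length cs) ⟩
      H ℕ.^ length cs ℕ.* suc a ℕ.^ length cs       <⟨ ℕ.*-monoʳ-< (H ℕ.^ length cs) {{ℕ.m^n≢0 H (length cs)}} (ℕ.n<1+n _) ⟩
      H ℕ.^ length cs ℕ.* H                         ≡⟨ ℕ.*-comm _ H ⟩
      H ℕ.^ suc (length cs)                         ≤⟨ ℕ.^-monoʳ-≤ H lt ⟩
      H ℕ.^ N ∎
      where open ℕ.≤-Reasoning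
  ... | p , bound , ne , div = p , ne , All.zipWith (λ {c} (d , le) → ∣∧<⇒≡0 d
        (ℕ.≤-<-trans (value-bound N (suc (suc (total N cs) ℕ.^ length cs)) p c bound)
          (ℕ.*-monoʳ-< (suc (suc (total N cs) ℕ.^ length cs)) (s≤s le)))) (All.map⁻ div , total-≤ N cs)

-- Binomial polynomials, Vandermonde systems, support of a family

module Vandermonde where
  open import Data.Nat.Base using (_!)
  open import Data.Integer.Base hiding (suc; NonZero)
  open import Data.Integer.Properties
  open import Data.Integer.Tactic.RingSolver using (solve-∀)
  open import Data.List.Base using (List; []; _∷_; length; map)
  open import Data.List.Relation.Unary.All as All using (All; []; _∷_)
  import Data.List.Relation.Unary.All.Properties as All
  open import Data.List.Relation.Unary.AllPairs as AllPairs using (AllPairs; []; _∷_)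
  open Powers
  open TopDegree
  open Siegel

  bin : ℕ → ℕ → ℕ
  bin n       zero    = 1
  bin zero    (suc k) = 0
  bin (suc n) (suc k) = bin n k ℕ.+ bin n (suc k)

  -- Subtraction-free form of (k + 1) C(n, k+1) = (n - k) C(n, k), valid for n < k as well.
  bin-rec : ∀ n k → suc k ℕ.* bin n (suc k) ℕ.+ k ℕ.* bin n k ≡ n ℕ.* bin n k
  bin-rec zero    zero    = refl
  bin-rec zero    (suc k) = trans (cong₂ ℕ._+_ (ℕ.*-zeroʳ (suc (suc k))) (ℕ.*-zeroʳ (suc k))) refl
  bin-rec (suc n) zero    = trans (cong (λ w → 1 ℕ.* (1 ℕ.+ w) ℕ.+ 0) bin1) (lem n)
    where
    bin1 : bin n 1 ≡ n
    bin1 = trans (lem₀ (bin n 1)) (trans (bin-rec n 0) (ℕ.*-identityʳ n))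
      where
      lem₀ : ∀ x → x ≡ 1 ℕ.* x ℕ.+ 0
      lem₀ = ℕ-Ring.solve-∀
    lem : ∀ n → 1 ℕ.* (1 ℕ.+ n) ℕ.+ 0 ≡ (1 ℕ.+ n) ℕ.* 1
    lem = ℕ-Ring.solve-∀
  bin-rec (suc n) (suc k) = begin
    (2 ℕ.+ k) ℕ.* (X ℕ.+ Z) ℕ.+ (1 ℕ.+ k) ℕ.* (Y ℕ.+ X)
      ≡⟨ lem k X Y Z ⟩
    ((2 ℕ.+ k) ℕ.* Z ℕ.+ (1 ℕ.+ k) ℕ.* X) ℕ.+ ((1 ℕ.+ k) ℕ.* X ℕ.+ k ℕ.* Y) ℕ.+ (X ℕ.+ Y)
      ≡⟨ cong₂ (λ u v → u ℕ.+ v ℕ.+ (X ℕ.+ Y)) (bin-rec n (suc k)) (bin-rec n k) ⟩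
    n ℕ.* X ℕ.+ n ℕ.* Y ℕ.+ (X ℕ.+ Y) ≡⟨ lem′ n X Y ⟩
    (1 ℕ.+ n) ℕ.* (Y ℕ.+ X) ∎
    where
    open ≡-Reasoning
    X = bin n (suc k)
    Y = bin n k
    Z = bin n (suc (suc k))
    lem : ∀ k X Y Z → (2 ℕ.+ k) ℕ.* (X ℕ.+ Z) ℕ.+ (1 ℕ.+ k) ℕ.* (Y ℕ.+ X) ≡
          ((2 ℕ.+ k) ℕ.* Z ℕ.+ (1 ℕ.+ k) ℕ.* X) ℕ.+ ((1 ℕ.+ k) ℕ.* X ℕ.+ k ℕ.* Y) ℕ.+ (X ℕ.+ Y)
    lem = ℕ-Ring.solve-∀
    lem′ : ∀ n X Y → n ℕ.* X ℕ.+ n ℕ.* Y ℕ.+ (X ℕ.+ Y) ≡ (1 ℕ.+ n) ℕ.* (Y ℕ.+ X)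
    lem′ = ℕ-Ring.solve-∀

  pos-^ : ∀ x n → + (x ℕ.^ n) ≡ (+ x) ^ n
  pos-^ x zero    = refl
  pos-^ x (suc n) = trans (pos-* x (x ℕ.^ n)) (cong (+ x *_) (pos-^ x n))

  ^ℤ-* : ∀ (x y : ℤ) n → (x * y) ^ n ≡ x ^ n * y ^ n
  ^ℤ-* x y zero    = refl
  ^ℤ-* x y (suc n) = trans (cong (x * y *_) (^ℤ-* x y n)) (lem x y (x ^ n) (y ^ n))
    where
    lem : ∀ x y p q → x * y * (p * q) ≡ x * p * (y * q)
    lem = solve-∀

  ^ℤ-swap : ∀ (x : ℤ) m n → (x ^ m) ^ n ≡ (x ^ n) ^ m
  ^ℤ-swap x m n = trans (^-*-assoc x m n) (trans (cong (x ^_) (ℕ.*-comm m n)) (sym (^-*-assoc x n m)))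

  *≢0 : ∀ {x y : ℤ} → x ≢ 0ℤ → y ≢ 0ℤ → x * y ≢ 0ℤ
  *≢0 nx ny e = ny (cancel e nx)

  ^≢0 : ∀ {x : ℤ} n → x ≢ 0ℤ → x ^ n ≢ 0ℤ
  ^≢0 zero    nx ()
  ^≢0 (suc n) nx = *≢0 nx (^≢0 n nx)

  -- k! C(z, k) is the falling factorial z (z - 1) ... (z - k + 1), a monic integer polynomial.
  top-bin : ∀ k → Top k (λ z → + (k !) * + bin z k) 1ℤ
  top-bin zero    z = refl
  top-bin (suc k) = top-cong (suc k) step refl
    (top-add (suc k) (top-z k (top-bin k)) (top-raise k (top-scale k (- + k) (top-bin k))))
    where
    step : ∀ z → + z * (+ (k !) * + bin z k) + - + k * (+ (k !) * + bin z k) ≡ + (suc k !) * + bin z (suc k)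
    step z = begin
      + z * (+ (k !) * + bin z k) + - + k * (+ (k !) * + bin z k) ≡⟨ lem (+ z) (+ k) (+ (k !)) (+ bin z k) ⟩
      + (k !) * (+ z * + bin z k - + k * + bin z k) ≡⟨ cong (λ w → + (k !) * (w - + k * + bin z k)) rec ⟩
      + (k !) * ((+ suc k * + bin z (suc k) + + k * + bin z k) - + k * + bin z k) ≡⟨ lem′ (+ (k !)) (+ suc k) (+ bin z (suc k)) (+ k * + bin z k) ⟩
      (+ suc k * + (k !)) * + bin z (suc k) ≡⟨ cong (_* + bin z (suc k)) (sym (pos-* (suc k) (k !))) ⟩
      + (suc k !) * + bin z (suc k) ∎
      where
      open ≡-Reasoning
      rec : + z * + bin z k ≡ + suc k * + bin z (suc k) + + k * + bin z k
      rec = trans (sym (pos-* z (bin z k))) (trans (cong +_ (sym (bin-rec z k)))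
        (trans (pos-+ (suc k ℕ.* bin z (suc k)) (k ℕ.* bin z k)) (cong₂ _+_ (pos-* (suc k) (bin z (suc k))) (pos-* k (bin z k)))))
      lem : ∀ z k f b → z * (f * b) + - k * (f * b) ≡ f * (z * b - k * b)
      lem = solve-∀
      lem′ : ∀ f s b t → f * ((s * b + t) - t) ≡ (s * f) * b
      lem′ = solve-∀

  !-quot : ∀ k j → ∃[ u ] (u ≢ 0 × (j ℕ.+ k) ! ≡ u ℕ.* k !)
  !-quot k zero    = 1 , (λ ()) , sym (ℕ.*-identityˡ (k !))
  !-quot k (suc j) with !-quot k j
  ... | u , ne , e = suc (j ℕ.+ k) ℕ.* u , (λ q → ne (ℕ.m+n≡0⇒m≡0 u q)) ,
    trans (cong (suc (j ℕ.+ k) ℕ.*_) e) (sym (ℕ.*-assoc (suc (j ℕ.+ k)) u (k !)))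

  -- `Top` admits only integer coefficients, so all binomials of order at most κ are scaled by the
  -- common factor κ!.
  top-bin≤ : ∀ {k κ} → k ℕ.≤ κ → ∃[ u ] (u ≢ 0ℤ × Top k (λ z → + (κ !) * + bin z k) u)
  top-bin≤ {k} {κ} le with !-quot k (κ ℕ.∸ k)
  ... | u , ne , e = + u * 1ℤ , (λ q → ne (+-injective (trans (sym (*-identityʳ (+ u))) q))) , top-cong k step refl (top-scale k (+ u) (top-bin k))
    where
    step : ∀ z → + u * (+ (k !) * + bin z k) ≡ + (κ !) * + bin z k
    step z = trans (sym (*-assoc (+ u) (+ (k !)) (+ bin z k))) (cong (_* + bin z k)
      (trans (sym (pos-* u (k !))) (cong +_ (trans (sym e) (cong _! (ℕ.m∸n+n≡m le))))))

  poly-lower : ∀ n {κ} (p : ℕ → ℤ) → n ℕ.≤ suc κ → Top n (λ z → Σ< n (λ k → p k * (+ (κ !) * + bin z k))) 0ℤ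
  poly-lower zero    p _  z = refl
  poly-lower (suc n) {κ} p (s≤s le) with top-bin≤ {n} {κ} le
  ... | u , _ , t = top-add (suc n) (top-raise n (poly-lower n p (ℕ.m≤n⇒m≤1+n le))) (top-raise n (top-scale n (p n) t))

  Good : ℕ → (ℕ → ℤ) → Set
  Good κ f = ∃[ d ] ∃[ t ] (d ℕ.≤ κ × t ≢ 0ℤ × Top d f t)

  -- The highest k with `p k` non-zero decides: binomial polynomials of different order have
  -- different degrees, so the leading term cannot cancel.
  classify : ∀ n {κ} (p : ℕ → ℤ) → n ℕ.≤ suc κ →
    (∀ {k} → k ℕ.< n → p k ≡ 0ℤ) ⊎ Good κ (λ z → Σ< n (λ k → p k * (+ (κ !) * + bin z k)))
  classify zero    p _  = inj₁ λ ()
  classify (suc n) {κ} p (s≤s le) with p n ≟ 0ℤ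
  ... | no ne with top-bin≤ {n} {κ} le
  ... | u , une , t = inj₂ (n , 0ℤ + p n * u , le , (λ q → *≢0 ne une (trans (sym (+-identityˡ _)) q)) ,
          top-add n (poly-lower n p (ℕ.m≤n⇒m≤1+n le)) (top-scale n (p n) t))
  classify (suc n) {κ} p (s≤s le) | yes e with classify n p (ℕ.m≤n⇒m≤1+n le)
  ... | inj₁ z = inj₁ λ {k} lt → case k (ℕ.m≤n⇒m<n∨m≡n (ℕ.s≤s⁻¹ lt))
    where
    case : ∀ k → k ℕ.< n ⊎ k ≡ n → p k ≡ 0ℤ
    case k (inj₁ lt)   = z lt
    case k (inj₂ refl) = e
  ... | inj₂ (d , t , d≤ , t≢ , top) = inj₂ (d , t , d≤ , t≢ , top-cong d (λ z → sym (trans (cong (λ w → Σ< n (λ k → p k * (+ (κ !) * + bin z k)) + w * (+ (κ !) * + bin z n)) e) (+-identityʳ _))) refl top)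

  poly : ℕ → (ℕ → ℤ) → ℕ → ℤ
  poly n c z = Σ< n (λ i → c i * (+ z) ^ i)

  top-^ : ∀ m → Top m (λ z → (+ z) ^ m) 1ℤ
  top-^ zero    z = refl
  top-^ (suc m) = top-z m (top-^ m)

  top-poly< : ∀ n c → Top n (poly n c) 0ℤ
  top-poly< zero    c z = refl
  top-poly< (suc n) c = top-add (suc n) (top-raise n (top-poly< n c)) (top-raise n (top-scale n (c n) (top-^ n)))

  top-poly : ∀ m c → Top m (poly (suc m) c) (c m)
  top-poly m c = top-cong m (λ _ → refl) (trans (+-identityˡ _) (*-identityʳ (c m)))
    (top-add m (top-poly< m c) (top-scale m (c m) (top-^ m)))

  -- Invertibility of the Vandermonde matrix without determinants: n coefficients and n roots force
  -- the top coefficient to vanish, and the induction descends in the degree.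
  vandermonde : ∀ n c xs → length xs ≡ n → AllPairs _≢_ xs → All (λ x → poly n c x ≡ 0ℤ) xs →
    ∀ {i} → i ℕ.< n → c i ≡ 0ℤ
  vandermonde (suc n) c (x ∷ xs) len (ne ∷ ap) (e ∷ es) {i} lt with ℕ.m≤n⇒m<n∨m≡n (ℕ.s≤s⁻¹ lt)
  ... | inj₂ refl = proj₁ (top-roots n (x ∷ xs) (top-poly n c) len (ne ∷ ap) (e ∷ es))
  ... | inj₁ lt′  = vandermonde n c xs (ℕ.suc-injective len) ap (All.map (λ {y} e′ → trans (sym (lower y)) e′) es) lt′
    where
    lower : ∀ y → poly (suc n) c y ≡ poly n c y
    lower y = trans (cong (λ w → poly n c y + w * (+ y) ^ n) (proj₁ (top-roots n (x ∷ xs) (top-poly n c) len (ne ∷ ap) (e ∷ es))))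
      (+-identityʳ _)

  ΣL : List ℕ → (ℕ → ℤ) → ℤ
  ΣL []       g = 0ℤ
  ΣL (l ∷ ls) g = g l + ΣL ls g

  ΣL-zero : ∀ {ls g} → All (λ l → g l ≡ 0ℤ) ls → ΣL ls g ≡ 0ℤ
  ΣL-zero []       = refl
  ΣL-zero (e ∷ es) = cong₂ _+_ e (ΣL-zero es)

  ΣL-cong : ∀ ls {f g} → (∀ l → f l ≡ g l) → ΣL ls f ≡ ΣL ls g
  ΣL-cong []       e = refl
  ΣL-cong (l ∷ ls) e = cong₂ _+_ (e l) (ΣL-cong ls e)

  ΣL-* : ∀ ls a f → ΣL ls (λ l → a * f l) ≡ a * ΣL ls f
  ΣL-* []       a f = sym (*-zeroʳ a)
  ΣL-* (l ∷ ls) a f = trans (cong (λ w → a * f l + w) (ΣL-* ls a f)) (sym (*-distribˡ-+ a (f l) (ΣL ls f)))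

  ΣL-Σ< : ∀ ls n (f : ℕ → ℕ → ℤ) → Σ< n (λ i → ΣL ls (λ l → f i l)) ≡ ΣL ls (λ l → Σ< n (λ i → f i l))
  ΣL-Σ< []       n f = Σ<-zero n (λ _ → refl)
  ΣL-Σ< (l ∷ ls) n f = trans (Σ<-+ n (λ i → f i l) (λ i → ΣL ls (f i))) (cong (λ w → Σ< n (λ i → f i l) + w) (ΣL-Σ< ls n f))

  -- The list collects the exponents l whose polynomial does not vanish; `Z` and `Y` are the two
  -- outcomes of `classify`, and `sum` drops the vanishing terms from a sum over all l < L.
  record Support (Z : ℕ → Set) (Y : ℕ → Set) (L : ℕ) : Set where
    field
      list     : List ℕ
      short    : length list ℕ.≤ L
      distinct : AllPairs _≢_ list
      below    : All (ℕ._< L) list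
      good     : All Y list
      sum      : ∀ g → (∀ {l} → l ℕ.< L → Z l → g l ≡ 0ℤ) → Σ< L g ≡ ΣL list g
      empty    : list ≡ [] → ∀ {l} → l ℕ.< L → Z l

  support : ∀ {Z Y : ℕ → Set} L → (∀ l → Z l ⊎ Y l) → Support Z Y L
  support zero dec = record
    { list = [] ; short = z≤n ; distinct = [] ; below = [] ; good = [] ; sum = λ _ _ → refl ; empty = λ _ () }
  support {Z} (suc L) dec with support L dec | dec L
  ... | S | inj₁ z = record
    { list = list ; short = ℕ.m≤n⇒m≤1+n short ; distinct = distinct ; below = All.map ℕ.m<n⇒m<1+n below ; good = good
    ; sum = λ g h → trans (cong₂ _+_ (sum g (λ lt → h (ℕ.m<n⇒m<1+n lt))) (h (ℕ.n<1+n L) z)) (+-identityʳ _)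
    ; empty = λ e {l} lt → case l e (ℕ.m≤n⇒m<n∨m≡n (ℕ.s≤s⁻¹ lt)) }
    where
    open Support S
    case : ∀ l → list ≡ [] → l ℕ.< L ⊎ l ≡ L → Z l
    case l e (inj₁ lt)   = empty e lt
    case l e (inj₂ refl) = z
  ... | S | inj₂ y = record
    { list = L ∷ list ; short = s≤s short ; distinct = All.map (λ lt e → ℕ.<⇒≢ lt (sym e)) below ∷ distinct
    ; below = ℕ.n<1+n L ∷ All.map ℕ.m<n⇒m<1+n below ; good = y ∷ good
    ; sum = λ g h → trans (+-comm (Σ< L g) (g L)) (cong (λ w → g L + w) (sum g (λ lt → h (ℕ.m<n⇒m<1+n lt))))
    ; empty = λ () }
    where open Support S

-- Zero estimate for exponential polynomials on a grid

module ZeroEstimate where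
  open import Data.Nat.Base using (_!)
  open import Data.Integer.Base hiding (suc; NonZero)
  open import Data.Integer.Properties
  open import Data.Integer.Tactic.RingSolver using (solve-∀)
  open import Data.List.Base using (List; []; _∷_; length; map; applyUpTo; upTo; _++_)
  open import Data.List.Properties using (length-applyUpTo; length-map; length-++)
  open import Data.List.Relation.Unary.All as All using (All; []; _∷_)
  import Data.List.Relation.Unary.All.Properties as All
  open import Data.List.Relation.Unary.AllPairs as AllPairs using (AllPairs; []; _∷_)
  import Data.List.Relation.Unary.AllPairs.Properties as AllPairs
  open import Relation.Binary.Definitions using (tri<; tri≈; tri>)
  open Powers
  open TopDegree
  open Siegel
  open Vandermonde

  top-0 : ∀ d → Top d (λ _ → 0ℤ) 0ℤ
  top-0 zero    z = refl
  top-0 (suc d) = top-raise d (top-0 d)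

  top-Σ : ∀ d n {f : ℕ → ℕ → ℤ} {t : ℕ → ℤ} → (∀ i → Top d (f i) (t i)) → Top d (λ z → Σ< n (λ i → f i z)) (Σ< n t)
  top-Σ d zero    p = top-0 d
  top-Σ d (suc n) p = top-add d (top-Σ d n p) (p n)

  upTo-distinct : ∀ n → AllPairs _≢_ (upTo n)
  upTo-distinct n = AllPairs.applyUpTo⁺₁ _ n (λ i<j _ → ℕ.<⇒≢ i<j)

  quot-rem : ∀ {M} .{{_ : NonZero M}} i {j} → j ℕ.< M → (i ℕ.* M ℕ.+ j) ℕ./ M ≡ i × (i ℕ.* M ℕ.+ j) ℕ.% M ≡ j
  quot-rem {M} i {j} lt = ℕ.*-cancelʳ-≡ _ i M (ℕ.+-cancelˡ-≡ j _ _ (trans (cong (ℕ._+ q ℕ.* M) (sym r≡)) (trans (sym (ℕ.m≡m%n+[m/n]*n x M)) (ℕ.+-comm (i ℕ.* M) j)))) , r≡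
    where
    x = i ℕ.* M ℕ.+ j
    q = x ℕ./ M
    r≡ : x ℕ.% M ≡ j
    r≡ = trans (cong (ℕ._% M) (ℕ.+-comm (i ℕ.* M) j)) (trans (ℕ.[m+kn]%n≡m%n j i M) (ℕ.m<n⇒m%n≡m lt))

  ^-injective : ∀ {ξ} → 2 ℕ.≤ ξ → ∀ {m n} → ξ ℕ.^ m ≡ ξ ℕ.^ n → m ≡ n
  ^-injective {ξ} 2≤ξ {m} {n} e with ℕ.<-cmp m n
  ... | tri< lt _ _ = ⊥-elim (ℕ.<⇒≢ (ℕ.^-monoʳ-< ξ 2≤ξ lt) e)
  ... | tri≈ _ p _ = p
  ... | tri> _ _ gt = ⊥-elim (ℕ.<⇒≢ (ℕ.^-monoʳ-< ξ 2≤ξ gt) (sym e))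

  module _ (κ L R₂ S δ ξ : ℕ) (p : ℕ → ℕ → ℤ) (w : ℕ → ℕ → ℤ)
    (2≤ξ : 2 ℕ.≤ ξ) .{{_ : NonZero R₂}} (R₂≤δ : R₂ ℕ.≤ δ) (room : L ℕ.* κ ℕ.< R₂ ℕ.* suc S)
    (w≢0 : ∀ r s → w r s ≢ 0ℤ) (w-step : ∀ r s → w (suc r) s ≡ + ξ * w r s)
    (vanish : ∀ r s → r ℕ.< R₂ ℕ.+ L → s ℕ.≤ S →
      Σ< L (λ l → Σ< (suc κ) (λ k → p l k * + bin (r ℕ.+ s ℕ.* δ) k) * w r s ^ l) ≡ 0ℤ) where

    private
      P : ℕ → ℕ → ℤ
      P l z = Σ< (suc κ) (λ k → p l k * (+ (κ !) * + bin z k))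

      ω : ℕ → ℤ
      ω l = (+ ξ) ^ l

      P-scaled : ∀ l z → P l z ≡ + (κ !) * Σ< (suc κ) (λ k → p l k * + bin z k)
      P-scaled l z = trans (Σ<-cong (suc κ) (λ {k} _ → lem (p l k) (+ (κ !)) (+ bin z k))) (Σ<-* (suc κ) (+ (κ !)) (λ k → p l k * + bin z k))
        where
        lem : ∀ p f b → p * (f * b) ≡ f * (p * b)
        lem = solve-∀

      P-zero : ∀ {l} → (∀ {k} → k ℕ.< suc κ → p l k ≡ 0ℤ) → ∀ z → P l z ≡ 0ℤ
      P-zero e z = Σ<-zero (suc κ) (λ {k} lt → cong (_* (+ (κ !) * + bin z k)) (e lt))

      w-shift : ∀ i r s → w (r ℕ.+ i) s ≡ (+ ξ) ^ i * w r s
      w-shift zero    r s = trans (cong (λ r → w r s) (ℕ.+-identityʳ r)) (sym (*-identityˡ (w r s)))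
      w-shift (suc i) r s = trans (cong (λ r → w r s) (ℕ.+-suc r i)) (trans (w-step (r ℕ.+ i) s)
        (trans (cong (+ ξ *_) (w-shift i r s)) (sym (*-assoc (+ ξ) ((+ ξ) ^ i) (w r s)))))

      module Elim (Sup : Support (λ l → ∀ {k} → k ℕ.< suc κ → p l k ≡ 0ℤ) (λ l → Good κ (P l)) L)
        (l₀ : ℕ) (ls′ : List ℕ) (split : Support.list Sup ≡ l₀ ∷ ls′) where
        open Support Sup renaming (list to ls)

        -- Vanishing at z, z + 1, ..., z + L - 1 with the factor w^l of the base point z extracted.
        -- These shifts are why the hypothesis reaches up to R₂ + L while zeros are counted for r <
        -- R₂ only.
        F : ∀ i r s → r ℕ.< R₂ → i ℕ.< L → s ℕ.≤ S → ΣL ls (λ l → w r s ^ l * (P l (r ℕ.+ s ℕ.* δ ℕ.+ i) * ω l ^ i)) ≡ 0ℤ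
        F i r s r< i< s≤ = begin
          ΣL ls (λ l → w r s ^ l * (P l (z ℕ.+ i) * ω l ^ i))
            ≡⟨ sym (sum (λ l → w r s ^ l * (P l (z ℕ.+ i) * ω l ^ i)) (λ {l} _ e → trans (cong (λ u → w r s ^ l * (u * ω l ^ i)) (P-zero e (z ℕ.+ i))) (*-zeroʳ (w r s ^ l)))) ⟩
          Σ< L (λ l → w r s ^ l * (P l (z ℕ.+ i) * ω l ^ i))
            ≡⟨ Σ<-cong L (λ {l} _ → step l) ⟩
          Σ< L (λ l → + (κ !) * (Σ< (suc κ) (λ k → p l k * + bin (r ℕ.+ i ℕ.+ s ℕ.* δ) k) * w (r ℕ.+ i) s ^ l))
            ≡⟨ Σ<-* L (+ (κ !)) _ ⟩
          + (κ !) * Σ< L (λ l → Σ< (suc κ) (λ k → p l k * + bin (r ℕ.+ i ℕ.+ s ℕ.* δ) k) * w (r ℕ.+ i) s ^ l)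
            ≡⟨ cong (+ (κ !) *_) (vanish (r ℕ.+ i) s (ℕ.+-mono-<-≤ r< (ℕ.<⇒≤ i<)) s≤) ⟩
          + (κ !) * 0ℤ ≡⟨ *-zeroʳ (+ (κ !)) ⟩
          0ℤ ∎
          where
          open ≡-Reasoning
          z = r ℕ.+ s ℕ.* δ
          z≡ : ∀ r i t → r ℕ.+ t ℕ.+ i ≡ r ℕ.+ i ℕ.+ t
          z≡ = ℕ-Ring.solve-∀
          lem : ∀ a f b c → a * ((f * b) * c) ≡ f * (b * (c * a))
          lem = solve-∀
          step : ∀ l → w r s ^ l * (P l (z ℕ.+ i) * ω l ^ i) ≡ + (κ !) * (Σ< (suc κ) (λ k → p l k * + bin (r ℕ.+ i ℕ.+ s ℕ.* δ) k) * w (r ℕ.+ i) s ^ l)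
          step l = begin
            w r s ^ l * (P l (z ℕ.+ i) * ω l ^ i) ≡⟨ cong (λ u → w r s ^ l * (u * ω l ^ i)) (P-scaled l (z ℕ.+ i)) ⟩
            w r s ^ l * ((+ (κ !) * Σ< (suc κ) (λ k → p l k * + bin (z ℕ.+ i) k)) * ω l ^ i) ≡⟨ lem (w r s ^ l) (+ (κ !)) _ (ω l ^ i) ⟩
            + (κ !) * (Σ< (suc κ) (λ k → p l k * + bin (z ℕ.+ i) k) * (ω l ^ i * w r s ^ l))
              ≡⟨ cong₂ (λ u v → + (κ !) * (Σ< (suc κ) (λ k → p l k * + bin u k) * v)) (z≡ r i (s ℕ.* δ))
                   (trans (cong (_* w r s ^ l) (^ℤ-swap (+ ξ) l i)) (trans (sym (^ℤ-* ((+ ξ) ^ i) (w r s) l)) (cong (_^ l) (sym (w-shift i r s))))) ⟩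
            + (κ !) * (Σ< (suc κ) (λ k → p l k * + bin (r ℕ.+ i ℕ.+ s ℕ.* δ) k) * w (r ℕ.+ i) s ^ l) ∎

        n′ = length ls′
        n = suc n′
        -- Degree bound for the unknown polynomials q_i. Killing n′ terms costs n′ (m + 1 + κ)
        -- linear conditions on n (m + 1) coefficients, exactly one condition fewer than unknowns.
        m = n′ ℕ.* κ
        M = suc m

        n≤L : n ℕ.≤ L
        n≤L = subst (ℕ._≤ L) (cong length split) short

        -- Coefficient of the unknown with index i M + j, which is the coefficient of z^j in q_i, in
        -- the condition that term l be killed at the point z.
        eq : ℕ → ℕ → ℕ → ℤ
        eq l z idx = (+ z) ^ (idx ℕ.% M) * (P l (z ℕ.+ idx ℕ./ M) * ω l ^ (idx ℕ./ M))

        eqs : List ℕ → List (ℕ → ℤ)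
        eqs []       = []
        eqs (l ∷ ls) = map (eq l) (upTo (M ℕ.+ κ)) ++ eqs ls

        length-eqs : ∀ ls → length (eqs ls) ≡ length ls ℕ.* (M ℕ.+ κ)
        length-eqs []       = refl
        length-eqs (l ∷ ls) = trans (length-++ (map (eq l) (upTo (M ℕ.+ κ))))
          (cong₂ ℕ._+_ (trans (length-map (eq l) (upTo (M ℕ.+ κ))) (length-applyUpTo (λ z → z) (M ℕ.+ κ))) (length-eqs ls))

        fewer : length (eqs ls′) ℕ.< n ℕ.* M
        fewer = ℕ.≤-reflexive (trans (cong suc (length-eqs ls′)) (lem n′ κ))
          where
          lem : ∀ n k → 1 ℕ.+ n ℕ.* (1 ℕ.+ n ℕ.* k ℕ.+ k) ≡ (1 ℕ.+ n) ℕ.* (1 ℕ.+ n ℕ.* k)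
          lem = ℕ-Ring.solve-∀

        module Solved (sol : ℕ → ℤ) (solves : All (λ c → Σ< (n ℕ.* M) (λ idx → sol idx * c idx) ≡ 0ℤ) (eqs ls′)) where
          q : ℕ → ℕ → ℤ
          q i j = sol (i ℕ.* M ℕ.+ j)

          -- The difference operator Σ q_i(z) E^i, with E the shift by one, applied to P_l(z) ξ^(lz)
          -- and divided by ξ^(lz). The first argument truncates each q_i to its coefficients below
          -- h.
          G : ℕ → ℕ → ℕ → ℤ
          G h l z = Σ< n (λ i → poly h (q i) z * (P l (z ℕ.+ i) * ω l ^ i))

          eq-G : ∀ l z → Σ< (n ℕ.* M) (λ idx → sol idx * eq l z idx) ≡ G M l z
          eq-G l z = trans (Σ<-flatten n M _) (Σ<-cong n (λ {i} _ → trans (Σ<-cong M (λ {j} lt → step i j lt)) (Σ<-*ʳ M (P l (z ℕ.+ i) * ω l ^ i) (λ j → q i j * (+ z) ^ j))))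
            where
            step : ∀ i j → j ℕ.< M → q i j * eq l z (i ℕ.* M ℕ.+ j) ≡ q i j * (+ z) ^ j * (P l (z ℕ.+ i) * ω l ^ i)
            step i j lt = trans (cong₂ (λ u v → q i j * ((+ z) ^ u * (P l (z ℕ.+ v) * ω l ^ v))) (proj₂ (quot-rem i lt)) (proj₁ (quot-rem i lt)))
              (sym (*-assoc (q i j) ((+ z) ^ j) _))

          G-vanish-at : ∀ ls → All (λ c → Σ< (n ℕ.* M) (λ idx → sol idx * c idx) ≡ 0ℤ) (eqs ls) →
            All (λ l → ∀ {z} → z ℕ.< M ℕ.+ κ → G M l z ≡ 0ℤ) ls
          G-vanish-at []       _ = []
          G-vanish-at (l ∷ ls) h = (λ {z} lt → trans (sym (eq-G l z)) (All.applyUpTo⁻ (λ z → z) (M ℕ.+ κ) (All.map⁻ (All.++⁻ˡ _ h)) lt))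
            ∷ G-vanish-at ls (All.++⁻ʳ (map (eq l) (upTo (M ℕ.+ κ))) h)

          top-G : ∀ h l {d t} → Top d (P l) t → Top (h ℕ.+ d) (G (suc h) l) (t * Σ< n (λ i → q i h * ω l ^ i))
          top-G h l {d} {t} top = top-cong (h ℕ.+ d) (λ _ → refl)
            (trans (Σ<-cong n (λ {i} _ → lem (q i h) t (ω l ^ i))) (Σ<-* n t (λ i → q i h * ω l ^ i)))
            (top-Σ (h ℕ.+ d) n (λ i → top-mul h d (top-poly h (q i)) (top-cong d (λ z → *-comm (ω l ^ i) _) refl (top-scale d (ω l ^ i) (top-shift d i top)))))
            where
            lem : ∀ a t o → a * (o * t) ≡ t * (a * o)
            lem = solve-∀

          -- The degree is at most m + κ, and there are m + 1 + κ zeros by construction.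
          G-others : All (λ l → ∀ z → G M l z ≡ 0ℤ) ls′
          G-others = All.zipWith (λ {l} (v , (d , t , d≤ , _ , top)) → proj₂ (top-roots (m ℕ.+ d) (upTo (suc (m ℕ.+ d))) (top-G m l top) (length-applyUpTo (λ z → z) (suc (m ℕ.+ d)))
                (upTo-distinct (suc (m ℕ.+ d))) (All.applyUpTo⁺₁ (λ z → z) (suc (m ℕ.+ d)) (λ lt → v (ℕ.<-≤-trans lt (s≤s (ℕ.+-monoʳ-≤ m d≤)))))))
            (G-vanish-at ls′ (solves) , All.tail (subst (All (λ l → Good κ (P l))) split good))

          -- At a grid point the sum over all l vanishes by `F`, the killed terms contribute
          -- nothing, and w is non-zero; so the remaining term vanishes too.
          G-on-grid : ∀ r s → r ℕ.< R₂ → s ℕ.≤ S → G M l₀ (r ℕ.+ s ℕ.* δ) ≡ 0ℤ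
          G-on-grid r s r< s≤ = cancel (trans (sym (+-identityʳ _)) (trans (cong (λ u → w r s ^ l₀ * G M l₀ z + u) (sym others)) total)) (^≢0 l₀ (w≢0 r s))
            where
            open ≡-Reasoning
            z = r ℕ.+ s ℕ.* δ
            others : ΣL ls′ (λ l → w r s ^ l * G M l z) ≡ 0ℤ
            others = ΣL-zero (All.map (λ {l} g → trans (cong (w r s ^ l *_) (g z)) (*-zeroʳ (w r s ^ l))) G-others)
            lem : ∀ a b c → a * (b * c) ≡ b * (a * c)
            lem = solve-∀
            total : w r s ^ l₀ * G M l₀ z + ΣL ls′ (λ l → w r s ^ l * G M l z) ≡ 0ℤ
            total = begin
              ΣL (l₀ ∷ ls′) (λ l → w r s ^ l * G M l z) ≡⟨ cong (λ ls → ΣL ls (λ l → w r s ^ l * G M l z)) (sym split) ⟩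
              ΣL ls (λ l → w r s ^ l * G M l z) ≡⟨ ΣL-cong ls (λ l → trans (sym (Σ<-* n (w r s ^ l) _)) (Σ<-cong n (λ {i} _ → lem (w r s ^ l) (poly M (q i) z) _))) ⟩
              ΣL ls (λ l → Σ< n (λ i → poly M (q i) z * (w r s ^ l * (P l (z ℕ.+ i) * ω l ^ i)))) ≡⟨ sym (ΣL-Σ< ls n _) ⟩
              Σ< n (λ i → ΣL ls (λ l → poly M (q i) z * (w r s ^ l * (P l (z ℕ.+ i) * ω l ^ i)))) ≡⟨ Σ<-zero n (λ {i} lt → trans (ΣL-* ls (poly M (q i) z) _)
                   (trans (cong (poly M (q i) z *_) (F i r s r< (ℕ.<-≤-trans lt n≤L) s≤)) (*-zeroʳ (poly M (q i) z)))) ⟩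
              0ℤ ∎

          point : ℕ → ℕ
          point i = i ℕ.% R₂ ℕ.+ i ℕ./ R₂ ℕ.* δ

          -- R₂ ≤ δ makes r and s the remainder and the quotient of r + s δ by δ.
          point-injective : ∀ {i j} → i ℕ.< j → point i ≢ point j
          point-injective {i} {j} i<j e = ℕ.<⇒≢ i<j (trans (ℕ.m≡m%n+[m/n]*n i R₂) (trans (cong₂ (λ u v → u ℕ.+ v ℕ.* R₂) (proj₁ same) (proj₂ same)) (sym (ℕ.m≡m%n+[m/n]*n j R₂))))
            where
            instance δ≢0 : NonZero δ
                     δ≢0 = ℕ.>-nonZero (ℕ.<-≤-trans (ℕ.>-nonZero⁻¹ R₂) R₂≤δ)
            r< : ∀ i → i ℕ.% R₂ ℕ.< δ
            r< i = ℕ.<-≤-trans (ℕ.m%n<n i R₂) R₂≤δ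
            low : ∀ i → point i ℕ.% δ ≡ i ℕ.% R₂
            low i = trans (ℕ.[m+kn]%n≡m%n (i ℕ.% R₂) (i ℕ./ R₂) δ) (ℕ.m<n⇒m%n≡m (r< i))
            r≡ = trans (sym (low i)) (trans (cong (ℕ._% δ) e) (low j))
            same : i ℕ.% R₂ ≡ j ℕ.% R₂ × i ℕ./ R₂ ≡ j ℕ./ R₂
            same = r≡ , ℕ.*-cancelʳ-≡ _ _ δ (ℕ.+-cancelˡ-≡ (i ℕ.% R₂) _ _ (trans e (cong (ℕ._+ j ℕ./ R₂ ℕ.* δ) (sym r≡))))

          -- The degree is at most n κ ≤ L κ < R₂ (S + 1), the number of grid points.
          G-first : ∀ z → G M l₀ z ≡ 0ℤ
          G-first = from (All.head (subst (All (λ l → Good κ (P l))) split good))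
            where
            in-grid : ∀ {d i} → d ℕ.≤ κ → i ℕ.< suc (m ℕ.+ d) → i ℕ.< suc S ℕ.* R₂
            in-grid {d} {i} d≤ lt = begin-strict
              i              ≤⟨ ℕ.s≤s⁻¹ lt ⟩
              m ℕ.+ d        ≤⟨ ℕ.+-monoʳ-≤ m d≤ ⟩
              m ℕ.+ κ        ≡⟨ ℕ.+-comm m κ ⟩
              n ℕ.* κ        ≤⟨ ℕ.*-monoˡ-≤ κ n≤L ⟩
              L ℕ.* κ        <⟨ room ⟩
              R₂ ℕ.* suc S   ≡⟨ ℕ.*-comm R₂ (suc S) ⟩
              suc S ℕ.* R₂   ∎
              where open ℕ.≤-Reasoning
            from : Good κ (P l₀) → ∀ z → G M l₀ z ≡ 0ℤ
            from (d , t , d≤ , _ , top) = proj₂ (top-roots (m ℕ.+ d) (applyUpTo point N) (top-G m l₀ top) (length-applyUpTo point N)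
                (AllPairs.applyUpTo⁺₁ point N (λ i<j _ → point-injective i<j))
                (All.applyUpTo⁺₁ point N (λ {i} lt → G-on-grid (i ℕ.% R₂) (i ℕ./ R₂) (ℕ.m%n<n i R₂) (ℕ.s≤s⁻¹ (ℕ.m<n*o⇒m/o<n (in-grid d≤ lt))))))
              where N = suc (m ℕ.+ d)

          module Leading (h : ℕ) (Gs : All (λ l → ∀ z → G (suc h) l z ≡ 0ℤ) ls) where
            leading : ∀ {l} → (∀ z → G (suc h) l z ≡ 0ℤ) → Good κ (P l) → poly n (λ i → q i h) (ξ ℕ.^ l) ≡ 0ℤ
            leading {l} g (d , t , _ , t≢0 , top) = trans (Σ<-cong n (λ {i} _ → cong (λ u → q i h * u ^ i) (pos-^ ξ l))) (cancel {t} {c} product t≢0)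
              where
              c = Σ< n (λ i → q i h * ω l ^ i)
              N = suc (h ℕ.+ d)
              product : t * c ≡ 0ℤ
              product = proj₁ (top-roots (h ℕ.+ d) {G (suc h) l} {t * c} (upTo N) (top-G h l top) (length-applyUpTo (λ z → z) N) (upTo-distinct N)
                (All.applyUpTo⁺₁ (λ z → z) N (λ {z} _ → g z)))

            roots-distinct : AllPairs _≢_ (map (ξ ℕ.^_) ls)
            roots-distinct = AllPairs.map⁺ {f = ξ ℕ.^_} (AllPairs.map (λ ne e → ne (^-injective 2≤ξ e)) distinct)

            roots : All (λ x → poly n (λ i → q i h) x ≡ 0ℤ) (map (ξ ℕ.^_) ls)
            roots = All.map⁺ {f = ξ ℕ.^_} (All.zipWith (λ {l} (g , ok) → leading {l} g ok) (Gs , good))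

            -- Leading coefficients: Σ q_{i,h} (ξ^l)^i = 0 for the n distinct values ξ^l, a
            -- Vandermonde system in n unknowns.
            top-zero : ∀ {i} → i ℕ.< n → q i h ≡ 0ℤ
            top-zero = vandermonde n (λ i → q i h) (map (ξ ℕ.^_) ls) (trans (length-map (ξ ℕ.^_) ls) (cong length split)) roots-distinct roots

            lower : ∀ l z → G h l z ≡ G (suc h) l z
            lower l z = Σ<-cong n {λ i → poly h (q i) z * (P l (z ℕ.+ i) * ω l ^ i)} {λ i → poly (suc h) (q i) z * (P l (z ℕ.+ i) * ω l ^ i)} (λ {i} i< → cong (_* (P l (z ℕ.+ i) * ω l ^ i))
              (sym (trans (cong (λ u → poly h (q i) z + u * (+ z) ^ h) (top-zero i<)) (+-identityʳ (poly h (q i) z)))))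

          descend : ∀ h → All (λ l → ∀ z → G h l z ≡ 0ℤ) ls → ∀ {i j} → i ℕ.< n → j ℕ.< h → q i j ≡ 0ℤ
          descend (suc h) Gs {i} {j} i< j< with ℕ.m≤n⇒m<n∨m≡n (ℕ.s≤s⁻¹ j<)
          ... | inj₂ refl = Leading.top-zero h Gs i<
          ... | inj₁ lt   = descend h (All.map (λ {l} g z → trans (Leading.lower h Gs l z) (g z)) Gs) i< lt

        no-solution : ∀ sol → ∃[ j ] (j ℕ.< n ℕ.* M × sol j ≢ 0ℤ) → All (λ c → Σ< (n ℕ.* M) (λ idx → sol idx * c idx) ≡ 0ℤ) (eqs ls′) → ⊥
        no-solution sol (idx , lt , ne) solves = ne (trans (cong sol idx≡) (descend M (subst (All (λ l → ∀ z → G M l z ≡ 0ℤ)) (sym split) (G-first ∷ G-others))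
            {idx ℕ./ M} {idx ℕ.% M} (ℕ.m<n*o⇒m/o<n lt) (ℕ.m%n<n idx M)))
          where
          open Solved sol solves
          idx≡ : idx ≡ idx ℕ./ M ℕ.* M ℕ.+ idx ℕ.% M
          idx≡ = trans (ℕ.m≡m%n+[m/n]*n idx M) (ℕ.+-comm (idx ℕ.% M) _)

        contradiction : ⊥
        contradiction = let (sol , ne , solves) = linear-system (n ℕ.* M) (eqs ls′) fewer in no-solution sol ne solves

    -- If n of the polynomials P_l were non-zero, a non-trivial difference operator could be chosen
    -- to kill n - 1 of the terms P_l(z) ξ^(lz). It would kill the last term on the grid, hence
    -- identically by counting zeros, and the leading coefficients then force the operator itself to
    -- be zero.
    zero-estimate : ∀ {l k} → l ℕ.< L → k ℕ.≤ κ → p l k ≡ 0ℤ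
    zero-estimate l< k≤ = conclude (support L (λ l → classify (suc κ) (p l) ℕ.≤-refl))
      where
      conclude : Support (λ l → ∀ {k} → k ℕ.< suc κ → p l k ≡ 0ℤ) (λ l → Good κ (P l)) L → _
      conclude Sup with Support.list Sup in e
      ... | []       = Support.empty Sup e l< (s≤s k≤)
      ... | l₀ ∷ ls′ = ⊥-elim (Elim.contradiction Sup l₀ ls′ e)

-- Auxiliary function: divisibility from differences, smallness, contradiction

module Criterion where
  open import Data.Integer.Base hiding (suc; NonZero)
  open import Data.Integer.Properties
  open import Data.Integer.Divisibility.Signed
  open import Data.Integer.Tactic.RingSolver using (solve-∀)
  open import Data.List.Base using (List; []; _∷_)
  open import Data.List.Relation.Unary.All as All using (All; []; _∷_)
  open Powers
  open Siegel
  open Vandermonde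
  open ZeroEstimate

  Δ : (ℕ → ℤ) → ℕ → ℤ
  Δ f z = f (suc z) - f z

  Δ^ : ℕ → (ℕ → ℤ) → ℕ → ℤ
  Δ^ zero    f = f
  Δ^ (suc i) f = Δ^ i (Δ f)

  Δ^-cong : ∀ i {f g} → (∀ z → f z ≡ g z) → ∀ z → Δ^ i f z ≡ Δ^ i g z
  Δ^-cong zero    e z = e z
  Δ^-cong (suc i) e z = Δ^-cong i (λ z → cong₂ _-_ (e (suc z)) (e z)) z

  Δ^-linear : ∀ i a b (f g : ℕ → ℤ) z → Δ^ i (λ z → a * f z + b * g z) z ≡ a * Δ^ i f z + b * Δ^ i g z
  Δ^-linear zero    a b f g z = refl
  Δ^-linear (suc i) a b f g z = trans (Δ^-cong i (λ z → lem a b (f (suc z)) (f z) (g (suc z)) (g z)) z) (Δ^-linear i a b (Δ f) (Δ g) z)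
    where
    lem : ∀ a b f′ f g′ g → (a * f′ + b * g′) - (a * f + b * g) ≡ a * (f′ - f) + b * (g′ - g)
    lem = solve-∀

  Δ^-+ : ∀ i (f g : ℕ → ℤ) z → Δ^ i (λ z → f z + g z) z ≡ Δ^ i f z + Δ^ i g z
  Δ^-+ i f g z = trans (Δ^-cong i (λ z → sym (cong₂ _+_ (*-identityˡ (f z)) (*-identityˡ (g z)))) z)
    (trans (Δ^-linear i 1ℤ 1ℤ f g z) (cong₂ _+_ (*-identityˡ (Δ^ i f z)) (*-identityˡ (Δ^ i g z))))

  Δ^-* : ∀ i a (f : ℕ → ℤ) z → Δ^ i (λ z → a * f z) z ≡ a * Δ^ i f z
  Δ^-* i a f z = trans (Δ^-cong i (λ z → lem a (f z)) z) (trans (Δ^-linear i a 0ℤ f f z) (sym (lem a (Δ^ i f z))))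
    where
    lem : ∀ a x → a * x ≡ a * x + 0ℤ * x
    lem = solve-∀

  Δ^-0 : ∀ i z → Δ^ i (λ _ → 0ℤ) z ≡ 0ℤ
  Δ^-0 zero    z = refl
  Δ^-0 (suc i) z = Δ^-0 i z

  Δ^-Σ : ∀ i n (f : ℕ → ℕ → ℤ) z → Δ^ i (λ z → Σ< n (λ j → f j z)) z ≡ Σ< n (λ j → Δ^ i (f j) z)
  Δ^-Σ i zero    f z = Δ^-0 i z
  Δ^-Σ i (suc n) f z = trans (Δ^-+ i (λ z → Σ< n (λ j → f j z)) (f n) z) (cong (λ w → w + Δ^ i (f n) z) (Δ^-Σ i n f z))

  -- Newton's forward difference formula, modulo N.
  ∣-from-differences : ∀ {N} z f → (∀ i → N ∣ Δ^ i f 0) → N ∣ f z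
  ∣-from-differences zero    f d = d 0
  ∣-from-differences {N} (suc z) f d = ∣-from-differences z (λ z → f (suc z)) λ i → subst (N ∣_) (sym (shift i)) (∣m∣n⇒∣m+n (d i) (d (suc i)))
    where
    lem : ∀ x y → x ≡ y + (x - y)
    lem = solve-∀
    shift : ∀ i → Δ^ i (λ z → f (suc z)) 0 ≡ Δ^ i f 0 + Δ^ (suc i) f 0
    shift i = trans (Δ^-cong i (λ z → lem (f (suc z)) (f z)) 0) (Δ^-+ i f (Δ f) 0)

  ^ℤ-∣ : ∀ (g : ℤ) {m n} → m ℕ.≤ n → g ^ m ∣ g ^ n
  ^ℤ-∣ g {m} {n} le = divides (g ^ (n ℕ.∸ m)) (trans (cong (g ^_) (sym (ℕ.m∸n+n≡m le))) (^-distribˡ-+-* g (n ℕ.∸ m) m))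

  -- Δ(ω^z) = (ω - 1) ω^z, so every difference gains a factor g, except for at most k of them that
  -- are spent on lowering the binomial.
  Δ^-bin : ∀ {g ω} → g ∣ ω - 1ℤ → ∀ i k z → g ^ (i ℕ.∸ k) ∣ Δ^ i (λ z → + bin z k * ω ^ z) z
  Δ^-bin {g} {ω} d zero k z = subst (λ e → g ^ e ∣ + bin z k * ω ^ z) (sym (ℕ.0∸n≡0 k)) (divides (+ bin z k * ω ^ z) (sym (*-identityʳ _)))
  Δ^-bin {g} {ω} d (suc i) zero z = subst (g ^ suc i ∣_)
      (sym (trans (Δ^-cong i (λ z → lem ω (ω ^ z)) z) (Δ^-* i (ω - 1ℤ) (λ z → 1ℤ * ω ^ z) z)))
      (mul d (Δ^-bin d i zero z))
    where
    lem : ∀ ω p → 1ℤ * (ω * p) - 1ℤ * p ≡ (ω - 1ℤ) * (1ℤ * p)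
    lem = solve-∀
    mul : ∀ {a b x y} → a ∣ x → b ∣ y → a * b ∣ x * y
    mul {a} {b} (divides p refl) (divides q refl) = divides (p * q) (lem′ p a q b)
      where
      lem′ : ∀ p a q b → (p * a) * (q * b) ≡ (p * q) * (a * b)
      lem′ = solve-∀
  Δ^-bin {g} {ω} d (suc i) (suc k) z = subst (g ^ (i ℕ.∸ k) ∣_)
      (sym (trans (Δ^-cong i step z) (Δ^-linear i ω (ω - 1ℤ) (λ z → + bin z k * ω ^ z) (λ z → + bin z (suc k) * ω ^ z) z)))
      (∣m∣n⇒∣m+n (∣n⇒∣m*n ω (Δ^-bin d i k z)) (∣-trans (^ℤ-∣ g exps) (mul d (Δ^-bin d i (suc k) z))))
    where
    mul : ∀ {a b x y} → a ∣ x → b ∣ y → a * b ∣ x * y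
    mul {a} {b} (divides p refl) (divides q refl) = divides (p * q) (lem′ p a q b)
      where
      lem′ : ∀ p a q b → (p * a) * (q * b) ≡ (p * q) * (a * b)
      lem′ = solve-∀
    exps : i ℕ.∸ k ℕ.≤ suc (i ℕ.∸ suc k)
    exps = go i k
      where
      go : ∀ i k → i ℕ.∸ k ℕ.≤ suc (i ℕ.∸ suc k)
      go zero    zero    = z≤n
      go zero    (suc k) = z≤n
      go (suc i) zero    = ℕ.≤-refl
      go (suc i) (suc k) = go i k
    lem : ∀ ω p a b → (a + b) * (ω * p) - b * p ≡ ω * (a * p) + (ω - 1ℤ) * (b * p)
    lem = solve-∀
    step : ∀ z → + bin (suc z) (suc k) * ω ^ suc z - + bin z (suc k) * ω ^ z ≡ ω * (+ bin z k * ω ^ z) + (ω - 1ℤ) * (+ bin z (suc k) * ω ^ z)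
    step z = trans (cong (λ u → u * (ω * ω ^ z) - + bin z (suc k) * ω ^ z) (pos-+ (bin z k) (bin z (suc k)))) (lem ω (ω ^ z) (+ bin z k) (+ bin z (suc k)))

  ∣-^ : ∀ {N x y} n → N ∣ x - y → N ∣ x ^ n - y ^ n
  ∣-^ {N} zero    d = divides 0ℤ refl
  ∣-^ {N} {x} {y} (suc n) d = subst (N ∣_) (lem x y (x ^ n) (y ^ n)) (∣m∣n⇒∣m+n (∣n⇒∣m*n x (∣-^ {N} {x} {y} n d)) (∣m⇒∣m*n (y ^ n) d))
    where
    lem : ∀ x y p q → x * (p - q) + (x - y) * q ≡ x * p - y * q
    lem = solve-∀

  -- Total exponent of G in the moduli of the first i conditions. Differences of order up to κ need
  -- the full G^τ; one of higher order i has i - κ factors G for free.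
  weight : ℕ → ℕ → ℕ → ℕ
  weight κ τ zero    = 0
  weight κ τ (suc i) = (τ ℕ.∸ (i ℕ.∸ κ)) ℕ.+ weight κ τ i

  module _ (G ξ δ B c τ κ L R₂ S H V : ℕ) .{{_ : NonZero G}} .{{_ : NonZero R₂}} .{{_ : NonZero H}}
    (2≤ξ : 2 ℕ.≤ ξ) (1≤B : 1 ℕ.≤ B) (1≤c : 1 ℕ.≤ c) (G∣ξ-1 : + G ∣ + ξ - 1ℤ)
    (rel : + (G ℕ.^ τ) ∣ + (B ℕ.* ξ ℕ.^ δ ℕ.+ c))
    (R₂≤δ : R₂ ℕ.≤ δ) (room : L ℕ.* κ ℕ.< R₂ ℕ.* suc S)
    (many : G ℕ.^ weight κ τ (suc κ ℕ.+ τ) ℕ.< H ℕ.^ (L ℕ.* suc κ))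
    (small : ∀ {r s l k} → r ℕ.< R₂ ℕ.+ L → s ℕ.≤ S → l ℕ.< L → k ℕ.≤ κ →
      bin (r ℕ.+ s ℕ.* δ) k ℕ.* (ξ ℕ.^ r ℕ.* c ℕ.^ s ℕ.* B ℕ.^ (S ℕ.∸ s)) ℕ.^ l ℕ.≤ V)
    (large : L ℕ.* (suc κ ℕ.* (H ℕ.* V)) ℕ.< G ℕ.^ τ) where

    private
      K = suc κ
      g = + G
      x = + ξ

      φ : ℕ → ℕ → ℕ → ℤ
      φ l k z = (+ B) ^ (S ℕ.* l) * (+ bin z k * (x ^ l) ^ z)

      φ-divisible : ∀ i l {k} → k ℕ.≤ κ → g ^ (i ℕ.∸ κ) ∣ Δ^ i (φ l k) 0
      φ-divisible i l {k} k≤ = subst (g ^ (i ℕ.∸ κ) ∣_) (sym (Δ^-* i ((+ B) ^ (S ℕ.* l)) (λ z → + bin z k * (x ^ l) ^ z) 0))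
        (∣n⇒∣m*n ((+ B) ^ (S ℕ.* l)) (∣-trans (^ℤ-∣ g (ℕ.∸-monoʳ-≤ i k≤)) (Δ^-bin (subst (λ u → g ∣ x ^ l - u) (1^ l) (∣-^ {g} {x} {1ℤ} l G∣ξ-1)) i k 0)))
        where
        1^ : ∀ l → 1ℤ ^ l ≡ 1ℤ
        1^ zero    = refl
        1^ (suc l) = trans (*-identityˡ (1ℤ ^ l)) (1^ l)

      κ≥ : ∀ idx → idx ℕ.% K ℕ.≤ κ
      κ≥ idx = ℕ.s≤s⁻¹ (ℕ.m%n<n idx K)

      -- From order κ + τ on the differences are divisible by G^τ unconditionally, so finitely many
      -- conditions suffice.
      I = K ℕ.+ τ

      -- What becomes of B^S ξ^(r + s δ) modulo G^τ when each B ξ^δ is replaced by -c. The factor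
      -- B^S supplies the needed B for every s ≤ S.
      w : ℕ → ℕ → ℤ
      w r s = x ^ r * (- + c) ^ s * (+ B) ^ (S ℕ.∸ s)

      ∣-c∣ : ∀ s → ∣ (- + c) ^ s ∣ ≡ c ℕ.^ s
      ∣-c∣ zero    = refl
      ∣-c∣ (suc s) = trans (abs-* (- + c) ((- + c) ^ s)) (cong₂ ℕ._*_ (∣-i∣≡∣i∣ (+ c)) (∣-c∣ s))

      ∣pos^∣ : ∀ n e → ∣ (+ n) ^ e ∣ ≡ n ℕ.^ e
      ∣pos^∣ n e = cong ∣_∣ (sym (pos-^ n e))

      ∣w∣ : ∀ r s → ∣ w r s ∣ ≡ ξ ℕ.^ r ℕ.* c ℕ.^ s ℕ.* B ℕ.^ (S ℕ.∸ s)
      ∣w∣ r s = trans (abs-* (x ^ r * (- + c) ^ s) _) (cong₂ ℕ._*_ (trans (abs-* (x ^ r) _) (cong₂ ℕ._*_ (∣pos^∣ ξ r) (∣-c∣ s))) (∣pos^∣ B (S ℕ.∸ s)))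

      ∣^∣ : ∀ (a : ℤ) e → ∣ a ^ e ∣ ≡ ∣ a ∣ ℕ.^ e
      ∣^∣ a zero    = refl
      ∣^∣ a (suc e) = trans (abs-* a (a ^ e)) (cong (∣ a ∣ ℕ.*_) (∣^∣ a e))

      pos≢0 : ∀ {n} → 1 ℕ.≤ n → + n ≢ 0ℤ
      pos≢0 (s≤s _) ()

      w≢0 : ∀ r s → w r s ≢ 0ℤ
      w≢0 r s = *≢0 (*≢0 (^≢0 r (pos≢0 (ℕ.≤-trans (s≤s z≤n) 2≤ξ))) (^≢0 s (λ e → pos≢0 1≤c (neg-injective e)))) (^≢0 (S ℕ.∸ s) (pos≢0 1≤B))

      w-step : ∀ r s → w (suc r) s ≡ x * w r s
      w-step r s = lem x (x ^ r) ((- + c) ^ s) ((+ B) ^ (S ℕ.∸ s))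
        where
        lem : ∀ x p q r → x * p * q * r ≡ x * (p * q * r)
        lem = solve-∀

      N = + (G ℕ.^ τ)

      w-congruent : ∀ r {s} → s ℕ.≤ S → N ∣ (+ B) ^ S * x ^ (r ℕ.+ s ℕ.* δ) - w r s
      w-congruent r {s} s≤ = subst (N ∣_) (trans (lem (x ^ r) ((+ B) ^ (S ℕ.∸ s)) (((+ B) * x ^ δ) ^ s) ((- + c) ^ s)) (cong (_- w r s) main))
        (∣n⇒∣m*n (x ^ r * (+ B) ^ (S ℕ.∸ s)) (∣-^ {N} {(+ B) * x ^ δ} { - + c} s (subst (N ∣_) rel′ rel)))
        where
        open ≡-Reasoning
        rel′ : + (B ℕ.* ξ ℕ.^ δ ℕ.+ c) ≡ (+ B) * x ^ δ - (- + c)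
        rel′ = trans (pos-+ (B ℕ.* ξ ℕ.^ δ) c) (cong₂ _+_ (trans (pos-* B (ξ ℕ.^ δ)) (cong (+ B *_) (pos-^ ξ δ))) (sym (neg-involutive (+ c))))
        lem : ∀ p b y z → p * b * (y - z) ≡ p * b * y - p * z * b
        lem = solve-∀
        lem′ : ∀ p b y d → p * b * (y * d) ≡ (b * y) * (p * d)
        lem′ = solve-∀
        main : x ^ r * (+ B) ^ (S ℕ.∸ s) * ((+ B) * x ^ δ) ^ s ≡ (+ B) ^ S * x ^ (r ℕ.+ s ℕ.* δ)
        main = begin
          x ^ r * (+ B) ^ (S ℕ.∸ s) * ((+ B) * x ^ δ) ^ s ≡⟨ cong (x ^ r * (+ B) ^ (S ℕ.∸ s) *_) (^ℤ-* (+ B) (x ^ δ) s) ⟩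
          x ^ r * (+ B) ^ (S ℕ.∸ s) * ((+ B) ^ s * (x ^ δ) ^ s) ≡⟨ lem′ (x ^ r) ((+ B) ^ (S ℕ.∸ s)) ((+ B) ^ s) ((x ^ δ) ^ s) ⟩
          ((+ B) ^ (S ℕ.∸ s) * (+ B) ^ s) * (x ^ r * (x ^ δ) ^ s) ≡⟨ cong₂ _*_ (trans (sym (^-distribˡ-+-* (+ B) (S ℕ.∸ s) s)) (cong ((+ B) ^_) (ℕ.m∸n+n≡m s≤)))
              (trans (cong (x ^ r *_) (trans (^-*-assoc x δ s) (cong (x ^_) (ℕ.*-comm δ s)))) (sym (^-distribˡ-+-* x r (s ℕ.* δ)))) ⟩
          (+ B) ^ S * x ^ (r ℕ.+ s ℕ.* δ) ∎

      -- The coefficients are the quotients of the differences by G^(i - κ); they enter as variables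
      -- because only the equation `coef-eq` matters.
      module WithCoef (coef : ℕ → ℕ → ℤ)
        (coef-eq : ∀ i idx → Δ^ i (φ (idx ℕ./ K) (idx ℕ.% K)) 0 ≡ coef i idx * g ^ (i ℕ.∸ κ)) where

        forms : ℕ → List Form
        forms zero    = []
        forms (suc i) = form (G ℕ.^ (τ ℕ.∸ (i ℕ.∸ κ))) {{ℕ.m^n≢0 G (τ ℕ.∸ (i ℕ.∸ κ))}} (coef i) ∷ forms i

        moduli-forms : ∀ i → moduli (forms i) ≡ G ℕ.^ weight κ τ i
        moduli-forms zero    = refl
        moduli-forms (suc i) = trans (cong (G ℕ.^ (τ ℕ.∸ (i ℕ.∸ κ)) ℕ.*_) (moduli-forms i)) (sym (ℕ.^-distribˡ-+-* G (τ ℕ.∸ (i ℕ.∸ κ)) (weight κ τ i)))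

        module Auxiliary (sol : ℕ → ℤ) (bounded : ∀ j → ∣ sol j ∣ ℕ.< H)
          (solves : All (λ φ → + Form.modulus φ ∣ Σ< (L ℕ.* K) (λ j → sol j * Form.coef φ j)) (forms I)) where

          f : ℕ → ℤ
          f z = Σ< (L ℕ.* K) (λ j → sol j * φ (j ℕ./ K) (j ℕ.% K) z)

          Δf : ∀ i → Δ^ i f 0 ≡ Σ< (L ℕ.* K) (λ j → sol j * coef i j) * g ^ (i ℕ.∸ κ)
          Δf i = trans (Δ^-Σ i (L ℕ.* K) (λ j z → sol j * φ (j ℕ./ K) (j ℕ.% K) z) 0)
            (trans (Σ<-cong (L ℕ.* K) (λ {j} _ → trans (Δ^-* i (sol j) (φ (j ℕ./ K) (j ℕ.% K)) 0) (trans (cong (sol j *_) (coef-eq i j)) (sym (*-assoc (sol j) (coef i j) (g ^ (i ℕ.∸ κ)))))))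
              (Σ<-*ʳ (L ℕ.* K) (g ^ (i ℕ.∸ κ)) (λ j → sol j * coef i j)))

          pick : ∀ n → All (λ φ → + Form.modulus φ ∣ Σ< (L ℕ.* K) (λ j → sol j * Form.coef φ j)) (forms n) →
            ∀ {i} → i ℕ.< n → + (G ℕ.^ (τ ℕ.∸ (i ℕ.∸ κ))) ∣ Σ< (L ℕ.* K) (λ j → sol j * coef i j)
          pick (suc n) (d ∷ ds) {i} lt with ℕ.m≤n⇒m<n∨m≡n (ℕ.s≤s⁻¹ lt)
          ... | inj₁ lt′  = pick n ds lt′
          ... | inj₂ refl = d

          g^ : ∀ e → + (G ℕ.^ e) ≡ g ^ e
          g^ = pos-^ G

          N∣Δf : ∀ i → N ∣ Δ^ i f 0
          N∣Δf i = subst₂ _∣_ (sym (g^ τ)) (sym (Δf i)) (case (ℕ.<-≤-connex i I))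
            where
            e = i ℕ.∸ κ
            a = Σ< (L ℕ.* K) (λ j → sol j * coef i j)
            case : i ℕ.< I ⊎ I ℕ.≤ i → g ^ τ ∣ a * g ^ e
            case (inj₁ lt) = ∣-trans (^ℤ-∣ g {τ} {(τ ℕ.∸ e) ℕ.+ e} (ℕ.≤-trans (ℕ.m≤n+m∸n τ e) (ℕ.≤-reflexive (ℕ.+-comm e (τ ℕ.∸ e)))))
              (subst (_∣ a * g ^ e) (sym (^-distribˡ-+-* g (τ ℕ.∸ e) e)) (*-monoˡ-∣ (g ^ e) (subst (_∣ a) (g^ (τ ℕ.∸ e)) (pick I solves lt))))
            case (inj₂ ge) = ∣n⇒∣m*n a (^ℤ-∣ g {τ} {e} (ℕ.≤-trans (ℕ.≤-reflexive (sym (ℕ.m+n∸m≡n κ τ))) (ℕ.∸-monoˡ-≤ κ (ℕ.≤-trans (ℕ.n≤1+n (κ ℕ.+ τ)) ge))))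

          p : ℕ → ℕ → ℤ
          p l k = sol (l ℕ.* K ℕ.+ k)

          F : ℕ → ℕ → ℤ
          F r s = Σ< L (λ l → Σ< K (λ k → p l k * + bin (r ℕ.+ s ℕ.* δ) k) * w r s ^ l)

          f≡ : ∀ z → f z ≡ Σ< L (λ l → Σ< K (λ k → p l k * + bin z k) * ((+ B) ^ S * x ^ z) ^ l)
          f≡ z = trans (Σ<-flatten L K _) (Σ<-cong L (λ {l} _ → trans (Σ<-cong K (λ {k} k< → step l k k<)) (Σ<-*ʳ K (((+ B) ^ S * x ^ z) ^ l) (λ k → p l k * + bin z k))))
            where
            step : ∀ l k → k ℕ.< K → p l k * φ ((l ℕ.* K ℕ.+ k) ℕ./ K) ((l ℕ.* K ℕ.+ k) ℕ.% K) z ≡ p l k * + bin z k * ((+ B) ^ S * x ^ z) ^ l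
            step l k k< = trans (cong₂ (λ u v → p l k * φ u v z) (proj₁ (quot-rem l k<)) (proj₂ (quot-rem l k<)))
              (trans (cong₂ (λ u v → p l k * (u * (+ bin z k * v))) (sym (^-*-assoc (+ B) S l)) (^ℤ-swap x l z))
                (trans (lem (p l k) (((+ B) ^ S) ^ l) (+ bin z k) ((x ^ z) ^ l)) (cong (p l k * + bin z k *_) (sym (^ℤ-* ((+ B) ^ S) (x ^ z) l)))))
              where
              lem : ∀ p b n y → p * (b * (n * y)) ≡ p * n * (b * y)
              lem = solve-∀

          N∣F : ∀ r {s} → s ℕ.≤ S → N ∣ F r s
          N∣F r {s} s≤ = subst (N ∣_) (lem (f z) (F r s)) (∣m∣n⇒∣m-n (∣-from-differences z f N∣Δf) f-F)
            where
            z = r ℕ.+ s ℕ.* δ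
            y = (+ B) ^ S * x ^ z
            lem : ∀ a b → a - (a - b) ≡ b
            lem = solve-∀
            c′ : ℕ → ℤ
            c′ l = Σ< K (λ k → p l k * + bin z k)
            term : ∀ a u v → a * u + - 1ℤ * (a * v) ≡ a * (u - v)
            term = solve-∀
            minus : ∀ a b → a + - 1ℤ * b ≡ a - b
            minus = solve-∀
            f-F : N ∣ f z - F r s
            f-F = subst (N ∣_) (trans (Σ<-+ L (λ l → c′ l * y ^ l) (λ l → - 1ℤ * (c′ l * w r s ^ l)))
                    (trans (cong₂ _+_ (sym (f≡ z)) (Σ<-* L (- 1ℤ) (λ l → c′ l * w r s ^ l))) (minus (f z) (F r s))))
              (Σ<-∣ L {N} {λ l → c′ l * y ^ l + - 1ℤ * (c′ l * w r s ^ l)} (λ {l} _ → subst (N ∣_) (sym (term (c′ l) (y ^ l) (w r s ^ l))) (∣n⇒∣m*n (c′ l) (∣-^ {N} {y} {w r s} l (w-congruent r s≤)))))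

          ∣F∣ : ∀ {r s} → r ℕ.< R₂ ℕ.+ L → s ℕ.≤ S → ∣ F r s ∣ ℕ.≤ L ℕ.* (K ℕ.* (H ℕ.* V))
          ∣F∣ {r} {s} r< s≤ = Σ<-bound L _ λ {l} l< → subst (λ u → ∣ u ∣ ℕ.≤ K ℕ.* (H ℕ.* V)) (Σ<-*ʳ K (w r s ^ l) (λ k → p l k * + bin (r ℕ.+ s ℕ.* δ) k))
            (Σ<-bound K (H ℕ.* V) λ {k} k< → begin
              ∣ p l k * + bin (r ℕ.+ s ℕ.* δ) k * w r s ^ l ∣ ≡⟨ cong ∣_∣ (*-assoc (p l k) (+ bin (r ℕ.+ s ℕ.* δ) k) (w r s ^ l)) ⟩
              ∣ p l k * (+ bin (r ℕ.+ s ℕ.* δ) k * w r s ^ l) ∣ ≡⟨ trans (abs-* (p l k) _) (cong (∣ p l k ∣ ℕ.*_) (trans (abs-* (+ bin (r ℕ.+ s ℕ.* δ) k) _)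
                  (cong (bin (r ℕ.+ s ℕ.* δ) k ℕ.*_) (trans (∣^∣ (w r s) l) (cong (ℕ._^ l) (∣w∣ r s)))))) ⟩
              ∣ p l k ∣ ℕ.* (bin (r ℕ.+ s ℕ.* δ) k ℕ.* (ξ ℕ.^ r ℕ.* c ℕ.^ s ℕ.* B ℕ.^ (S ℕ.∸ s)) ℕ.^ l) ≤⟨ ℕ.*-mono-≤ (ℕ.<⇒≤ (bounded (l ℕ.* K ℕ.+ k))) (small r< s≤ l< (ℕ.s≤s⁻¹ k<)) ⟩
              H ℕ.* V ∎)
            where open ℕ.≤-Reasoning

          vanish : ∀ r s → r ℕ.< R₂ ℕ.+ L → s ℕ.≤ S → F r s ≡ 0ℤ
          vanish r s r< s≤ = ∣∧<⇒≡0 (N∣F r s≤) (ℕ.≤-<-trans (∣F∣ r< s≤) large)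

          all-zero : ∀ {j} → j ℕ.< L ℕ.* K → sol j ≡ 0ℤ
          all-zero {j} lt = trans (cong sol (trans (ℕ.m≡m%n+[m/n]*n j K) (ℕ.+-comm (j ℕ.% K) _)))
            (zero-estimate κ L R₂ S δ ξ p w 2≤ξ R₂≤δ room w≢0 w-step vanish {j ℕ./ K} {j ℕ.% K} (ℕ.m<n*o⇒m/o<n lt) (κ≥ j))

        impossible : ⊥
        impossible = let (sol , bounded , (j , j< , ne) , solves) = siegel (L ℕ.* K) H (forms I) (subst (ℕ._< H ℕ.^ (L ℕ.* K)) (sym (moduli-forms I)) many)
          in ne (Auxiliary.all-zero sol bounded solves j<)

    -- The function f(z) = Σ p_{lk} B^(Sl) C(z, k) ξ^(lz) is made divisible by G^τ for all z. At z =
    -- r + s δ it is congruent to F r s, in which the huge power of ξ has become (-c)^s B^(S-s). By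
    -- `large` F is below G^τ, hence zero, and the zero estimate annihilates every p_{lk}.
    criterion : ⊥
    criterion = WithCoef.impossible
      (λ i idx → _∣_.quotient (φ-divisible i (idx ℕ./ K) (κ≥ idx)))
      (λ i idx → _∣_.equality (φ-divisible i (idx ℕ./ K) (κ≥ idx)))

-- Choice of parameters: an explicit bound for δ

module Baker where
  open import Data.Nat.Base
  open import Data.Nat.Properties
  open import Data.Nat.Tactic.RingSolver using (solve-∀)
  import Data.Integer.Base as ℤ
  open import Data.Integer.Divisibility.Signed using (_∣_)
  open Powers
  open Vandermonde using (bin; bin-rec)
  open Criterion

  !-bin : ∀ z k → k ! * bin z k ≤ z ^ k
  !-bin z       zero    = s≤s z≤n
  !-bin zero    (suc k) = ≤-reflexive (*-zeroʳ (suc k !))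
  !-bin (suc z) (suc k) = begin
    suc k ! * (bin z k + bin z (suc k))               ≡⟨ lem (k !) k (bin z k) (bin z (suc k)) ⟩
    k ! * ((suc k * bin z (suc k) + k * bin z k) + bin z k) ≡⟨ cong (λ w → k ! * (w + bin z k)) (bin-rec z k) ⟩
    k ! * (z * bin z k + bin z k)                     ≡⟨ lem′ (k !) z (bin z k) ⟩
    suc z * (k ! * bin z k)                           ≤⟨ *-monoʳ-≤ (suc z) (!-bin z k) ⟩
    suc z * z ^ k                                     ≤⟨ *-monoʳ-≤ (suc z) (^-monoˡ-≤ k (n≤1+n z)) ⟩
    suc z ^ suc k                                     ∎
    where
    open ≤-Reasoning
    lem : ∀ f k a b → (1 + k) * f * (a + b) ≡ f * (((1 + k) * b + k * a) + a)
    lem = solve-∀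
    lem′ : ∀ f z b → f * (z * b + b) ≡ (1 + z) * (f * b)
    lem′ = solve-∀

  ^≤!-bin : ∀ n k → n ^ k ≤ k ! * bin (n + k) k
  ^≤!-bin n zero    = s≤s z≤n
  ^≤!-bin n (suc k) = begin
    n * n ^ k                                          ≤⟨ *-mono-≤ (≤-trans (m≤m+n n k) (n≤1+n (n + k))) (^≤!-bin n k) ⟩
    suc (n + k) * (k ! * bin (n + k) k)                ≡⟨ lem (k !) (n + k) (bin (n + k) k) ⟩
    k ! * ((n + k) * bin (n + k) k + bin (n + k) k)    ≡⟨ cong (λ w → k ! * (w + bin (n + k) k)) (sym (bin-rec (n + k) k)) ⟩
    k ! * ((suc k * bin (n + k) (suc k) + k * bin (n + k) k) + bin (n + k) k) ≡⟨ lem′ (k !) k (bin (n + k) k) (bin (n + k) (suc k)) ⟩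
    suc k ! * bin (suc (n + k)) (suc k)                ≡⟨ cong (λ w → suc k ! * bin w (suc k)) (sym (+-suc n k)) ⟩
    suc k ! * bin (n + suc k) (suc k)                  ∎
    where
    open ≤-Reasoning
    lem : ∀ f z b → (1 + z) * (f * b) ≡ f * (z * b + b)
    lem = solve-∀
    lem′ : ∀ f k a b → f * (((1 + k) * b + k * a) + a) ≡ (1 + k) * f * (a + b)
    lem′ = solve-∀

  bin≤2^ : ∀ n k → bin n k ≤ 2 ^ n
  bin≤2^ n       zero    = m^n>0 2 n
  bin≤2^ zero    (suc k) = z≤n
  bin≤2^ (suc n) (suc k) = ≤-trans (+-mono-≤ (bin≤2^ n k) (bin≤2^ n (suc k))) (≤-reflexive (cong (2 ^ n +_) (sym (+-identityʳ (2 ^ n)))))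

  -- z^k / k! ≤ n^k K^k / k!, and K^k / k! ≤ C(K + k, k) ≤ 4^K. Without the factorial the bound
  -- would contain K^K.
  bin-bound : ∀ {n K z k} .{{_ : NonZero n}} → k ≤ K → z ≤ n * K → bin z k ≤ (4 * n) ^ K
  bin-bound {n} {K} {z} {k} k≤K z≤nK = *-cancelˡ-≤ (k !) {{k !≢0}} (begin
    k ! * bin z k                   ≤⟨ !-bin z k ⟩
    z ^ k                           ≤⟨ ^-monoˡ-≤ k z≤nK ⟩
    (n * K) ^ k                     ≡⟨ ^-distribʳ-* n K k ⟩
    n ^ k * K ^ k                   ≤⟨ *-mono-≤ (^-monoʳ-≤ n k≤K) (^≤!-bin K k) ⟩
    n ^ K * (k ! * bin (K + k) k)   ≤⟨ *-monoʳ-≤ (n ^ K) (*-monoʳ-≤ (k !) (≤-trans (bin≤2^ (K + k) k) (^-monoʳ-≤ 2 (+-monoʳ-≤ K k≤K)))) ⟩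
    n ^ K * (k ! * 2 ^ (K + K))     ≡⟨ cong (λ w → n ^ K * (k ! * w)) (trans (^-distribˡ-+-* 2 K K) (sym (^-distribʳ-* 2 2 K))) ⟩
    n ^ K * (k ! * 4 ^ K)           ≡⟨ lem (n ^ K) (k !) (4 ^ K) ⟩
    k ! * (4 ^ K * n ^ K)           ≡⟨ cong (k ! *_) (sym (^-distribʳ-* 4 n K)) ⟩
    k ! * (4 * n) ^ K               ∎)
    where
    open ≤-Reasoning
    lem : ∀ a b c → a * (b * c) ≡ b * (c * a)
    lem = solve-∀

  -- κ + 1 summands τ are followed by τ - 1, ..., τ - j; the sum is doubled to avoid halving j (j +
  -- 1).
  weight-closed : ∀ κ τ j → j ≤ τ → 2 * weight κ τ (suc κ + j) + j * suc j ≡ 2 * (suc κ * τ) + 2 * (j * τ)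
  weight-closed κ τ zero _ = trans (cong (λ w → 2 * weight κ τ w + 0) (+-identityʳ (suc κ))) (cong (λ w → 2 * w + 0) (flat (suc κ) ≤-refl))
    where
    flat : ∀ i → i ≤ suc κ → weight κ τ i ≡ i * τ
    flat zero    _        = refl
    flat (suc i) (s≤s le) = cong₂ _+_ (cong (τ ∸_) (m≤n⇒m∸n≡0 le)) (flat i (m≤n⇒m≤1+n le))
  weight-closed κ τ (suc j) j<τ = begin
    2 * weight κ τ (suc κ + suc j) + suc j * suc (suc j)
      ≡⟨ cong (λ w → 2 * weight κ τ w + suc j * suc (suc j)) (+-suc (suc κ) j) ⟩
    2 * ((τ ∸ (suc κ + j ∸ κ)) + W) + suc j * suc (suc j)
      ≡⟨ cong (λ w → 2 * ((τ ∸ w) + W) + suc j * suc (suc j)) (trans (cong (_∸ κ) (sym (+-suc κ j))) (m+n∸m≡n κ (suc j))) ⟩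
    2 * (t + W) + suc j * suc (suc j)               ≡⟨ lem t W j ⟩
    (2 * W + j * suc j) + 2 * (t + suc j)           ≡⟨ cong₂ (λ u v → u + 2 * v) (weight-closed κ τ j (<⇒≤ j<τ)) (m∸n+n≡m j<τ) ⟩
    (2 * (suc κ * τ) + 2 * (j * τ)) + 2 * τ         ≡⟨ lem′ (suc κ * τ) j τ ⟩
    2 * (suc κ * τ) + 2 * (suc j * τ)               ∎
    where
    open ≡-Reasoning
    W = weight κ τ (suc κ + j)
    t = τ ∸ suc j
    lem : ∀ t w j → 2 * (t + w) + (1 + j) * (2 + j) ≡ (2 * w + j * (1 + j)) + 2 * (t + (1 + j))
    lem = solve-∀
    lem′ : ∀ a j τ → (2 * a + 2 * (j * τ)) + 2 * τ ≡ 2 * a + 2 * ((1 + j) * τ)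
    lem′ = solve-∀

  -- Integer substitute for log N / log Q.
  log-bracket : ∀ Q N → 2 ≤ Q → 2 ≤ N → ∃[ e ] (Q ^ e < N × N ≤ Q ^ suc e)
  log-bracket Q N 2≤Q 2≤N = search N (≤-trans (<⇒≤ (n<2^n N)) (^-monoˡ-≤ N 2≤Q))
    where
    n<2^n : ∀ n → n < 2 ^ n
    n<2^n zero    = s≤s z≤n
    n<2^n (suc n) = begin-strict
      suc n          ≤⟨ n<2^n n ⟩
      2 ^ n          <⟨ m<m+n (2 ^ n) (m^n>0 2 n) ⟩
      2 ^ n + 2 ^ n  ≡⟨ cong (2 ^ n +_) (sym (+-identityʳ (2 ^ n))) ⟩
      2 ^ suc n      ∎
      where open ≤-Reasoning
    search : ∀ f → N ≤ Q ^ f → ∃[ e ] (Q ^ e < N × N ≤ Q ^ suc e)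
    search zero    le with ≤-trans 2≤N le
    ... | s≤s ()
    search (suc f) le with N ≤? Q ^ f
    ... | yes le′ = search f le′
    ... | no  gt  = f , ≰⇒> gt , le

  ^-cancel-≤ : ∀ {G i j} → 2 ≤ G → G ^ i ≤ G ^ j → i ≤ j
  ^-cancel-≤ {G} {i} {j} 2≤G le with i ≤? j
  ... | yes p = p
  ... | no  p with <⇒≱ (^-monoʳ-< G 2≤G (≰⇒> p)) le
  ... | ()

  square≤2^ : ∀ j → (4 + j) * (4 + j) ≤ 2 ^ (4 + j)
  square≤2^ zero    = ≤-refl
  square≤2^ (suc j) = begin
    (5 + j) * (5 + j)                                ≤⟨ m≤m+n _ (7 + 6 * j + j * j) ⟩
    (5 + j) * (5 + j) + (7 + 6 * j + j * j)          ≡⟨ lem j ⟩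
    2 * ((4 + j) * (4 + j))                          ≤⟨ *-monoʳ-≤ 2 (square≤2^ j) ⟩
    2 ^ (5 + j)                                      ∎
    where
    open ≤-Reasoning
    lem : ∀ j → (5 + j) * (5 + j) + (7 + 6 * j + j * j) ≡ 2 * ((4 + j) * (4 + j))
    lem = solve-∀

  module _ (G ξ δ B c u m n : ℕ) .{{_ : NonZero u}} .{{_ : NonZero m}} .{{_ : NonZero n}}
    (2≤G : 2 ≤ G) (G<ξ : G < ξ) (G∣ξ-1 : ℤ.+ G ∣ ℤ.+ ξ ℤ.- ℤ.1ℤ) (1≤B : 1 ≤ B) (1≤c : 1 ≤ c) (A≤ : B + c ≤ G ^ u)
    (rel : ∀ τ → G ^ τ ≤ ξ ^ δ → ℤ.+ (G ^ τ) ∣ ℤ.+ (B * ξ ^ δ + c))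
    (n-large : δ + u ≤ 8 * u * n) (m-large : 2 * (4 * n) ^ 8 * G ^ 6 ≤ G ^ (7 * m))
    (δ-large : 768 * (m * m * u) + 96 * (m * m) + 48 * (m * u) ≤ δ) where

    private
      instance
        G≢0 : NonZero G
        G≢0 = >-nonZero (<⇒≤ 2≤G)
        ξ≢0 : NonZero ξ
        ξ≢0 = >-nonZero (≤-<-trans z≤n G<ξ)

      Q L R₂ R : ℕ
      Q = G ^ u
      L = 4 * m
      R₂ = 32 * (m * u)
      R = R₂ + L

      1≤m : 1 ≤ m
      1≤m = >-nonZero⁻¹ m
      1≤u : 1 ≤ u
      1≤u = >-nonZero⁻¹ u

      2≤ξ : 2 ≤ ξ
      2≤ξ = ≤-trans 2≤G (<⇒≤ G<ξ)

      1≤mu : 1 ≤ m * u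
      1≤mu = *-mono-≤ 1≤m 1≤u

      2≤Q : 2 ≤ Q
      2≤Q = ≤-trans 2≤G (≤-trans (≤-reflexive (sym (^-identityʳ G))) (^-monoʳ-≤ G 1≤u))

      2≤ξ^R : 2 ≤ ξ ^ R
      2≤ξ^R = ≤-trans 2≤ξ (≤-trans (≤-reflexive (sym (^-identityʳ ξ))) (^-monoʳ-≤ ξ {1} {R} (≤-trans (*-mono-≤ {1} {32} (s≤s z≤n) 1≤mu) (m≤m+n R₂ L))))

      bracket = log-bracket Q (ξ ^ R) 2≤Q 2≤ξ^R

    -- S is the least exponent with ξ^R ≤ Q^S. It balances the two parts of the values: ξ^r and c^s
    -- B^(S-s) are both at most Q^S.
    module Parameters (S′ : ℕ) (low : Q ^ S′ < ξ ^ R) (high : ξ ^ R ≤ Q ^ suc S′) where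
      S k₀ K κ τ h H V : ℕ
      S = suc S′
      k₀ = u * suc S
      -- Then L K = R₂ (S + 1) exactly, and `room` is strict because κ is K - 1.
      K = 8 * k₀
      κ = pred K
      -- In `large` the exponent 24 m k₀ splits into 7 m k₀ for the binomials, granted by `m-large`,
      -- 9 m k₀ from H and 8 m k₀ for the heights. The other 6 k₀ in h is paid by the factor `G ^ 6`
      -- of `m-large`.
      τ = 24 * (m * k₀)
      -- Solves 2 h L K = 2 K τ + τ², so that the two sides of `many`, with exponents doubled,
      -- differ by exactly τ.
      h = 3 * (k₀ * (2 + 3 * m))
      H = G ^ h
      V = (4 * n) ^ K * (Q ^ (2 * S)) ^ L

      1≤k₀ : 1 ≤ k₀
      1≤k₀ = *-mono-≤ 1≤u (s≤s z≤n)

      sκ≡K : suc κ ≡ K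
      sκ≡K = suc-pred K {{>-nonZero (*-mono-≤ {1} {8} (s≤s z≤n) 1≤k₀)}}

      R≤uS : R ≤ u * S
      R≤uS = ^-cancel-≤ 2≤G (begin
        G ^ R       ≤⟨ ^-monoˡ-≤ R (<⇒≤ G<ξ) ⟩
        ξ ^ R       ≤⟨ high ⟩
        Q ^ S       ≡⟨ ^-*-assoc G u S ⟩
        G ^ (u * S) ∎)
        where open ≤-Reasoning

      32m≤k₀ : 32 * m ≤ k₀
      32m≤k₀ = begin
        32 * m        ≤⟨ *-monoʳ-≤ 32 (m≤m*n m u) ⟩
        R₂            ≤⟨ m≤m+n R₂ L ⟩
        R             ≤⟨ R≤uS ⟩
        u * S         ≤⟨ *-monoʳ-≤ u (n≤1+n S) ⟩
        k₀            ∎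
        where open ≤-Reasoning

      R₂≤δ : R₂ ≤ δ
      R₂≤δ = ≤-trans (*-monoˡ-≤ (m * u) {32} {48} (m≤m+n 32 16)) (≤-trans (m≤n+m (48 * (m * u)) (768 * (m * m * u) + 96 * (m * m))) δ-large)

      room : L * κ < R₂ * suc S
      room = begin-strict
        L * κ           <⟨ *-monoʳ-< L {{m*n≢0 4 m}} (n<1+n κ) ⟩
        L * suc κ       ≡⟨ cong (L *_) sκ≡K ⟩
        L * K           ≡⟨ lem m u S ⟩
        R₂ * suc S      ∎
        where
        open ≤-Reasoning
        lem : ∀ m u S → 4 * m * (8 * (u * (1 + S))) ≡ 32 * (m * u) * (1 + S)
        lem = solve-∀

      many : G ^ weight κ τ (suc κ + τ) < H ^ (L * suc κ)
      many = begin-strict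
        G ^ W                 <⟨ ^-monoʳ-< G 2≤G (*-cancelˡ-< 2 W E (begin-strict
            2 * W             <⟨ m<m+n (2 * W) {τ} (*-mono-≤ {1} {24} (s≤s z≤n) (*-mono-≤ 1≤m 1≤k₀)) ⟩
            2 * W + τ         ≡⟨ +-cancelʳ-≡ (τ * τ) _ _ (trans (lem₁ W τ) (trans (weight-closed κ τ τ ≤-refl) (trans (cong (λ w → 2 * (w * τ) + 2 * (τ * τ)) sκ≡K) (lem₂ m k₀)))) ⟩
            2 * E ∎)) ⟩
        G ^ E                 ≡⟨ cong (λ w → G ^ (h * (L * w))) (sym sκ≡K) ⟩
        G ^ (h * (L * suc κ)) ≡⟨ sym (^-*-assoc G h (L * suc κ)) ⟩
        H ^ (L * suc κ)       ∎
        where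
        open ≤-Reasoning
        W = weight κ τ (suc κ + τ)
        E = h * (L * K)
        lem₁ : ∀ W τ → (2 * W + τ) + τ * τ ≡ 2 * W + τ * (1 + τ)
        lem₁ = solve-∀
        lem₂ : ∀ m k → 2 * (8 * k * (24 * (m * k))) + 2 * ((24 * (m * k)) * (24 * (m * k))) ≡ 2 * (3 * (k * (2 + 3 * m)) * (4 * m * (8 * k))) + (24 * (m * k)) * (24 * (m * k))
        lem₂ = solve-∀

      small : ∀ {r s l k} → r < R → s ≤ S → l < L → k ≤ κ →
        bin (r + s * δ) k * (ξ ^ r * c ^ s * B ^ (S ∸ s)) ^ l ≤ V
      small {r} {s} {l} {k} r< s≤ l< k≤ = *-mono-≤ (bin-bound {n} {K} (≤-trans k≤ (≤-trans (n≤1+n κ) (≤-reflexive sκ≡K))) point) power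
        where
        open ≤-Reasoning
        point : r + s * δ ≤ n * K
        point = begin
          r + s * δ           ≤⟨ +-mono-≤ (≤-trans (<⇒≤ r<) R≤uS) (*-monoˡ-≤ δ s≤) ⟩
          u * S + S * δ       ≡⟨ lem u S δ ⟩
          S * (δ + u)         ≤⟨ *-mono-≤ (n≤1+n S) n-large ⟩
          suc S * (8 * u * n) ≡⟨ lem′ S u n ⟩
          n * K ∎
          where
          lem : ∀ u S δ → u * S + S * δ ≡ S * (δ + u)
          lem = solve-∀
          lem′ : ∀ S u n → (1 + S) * (8 * u * n) ≡ n * (8 * (u * (1 + S)))
          lem′ = solve-∀
        base : ξ ^ r * c ^ s * B ^ (S ∸ s) ≤ Q ^ (2 * S)
        base = begin
          ξ ^ r * c ^ s * B ^ (S ∸ s)   ≡⟨ *-assoc (ξ ^ r) (c ^ s) (B ^ (S ∸ s)) ⟩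
          ξ ^ r * (c ^ s * B ^ (S ∸ s)) ≤⟨ *-mono-≤ (≤-trans (^-monoʳ-≤ ξ (<⇒≤ r<)) high)
               (*-mono-≤ (^-monoˡ-≤ s (≤-trans (m≤n+m c B) A≤)) (^-monoˡ-≤ (S ∸ s) (≤-trans (m≤m+n B c) A≤))) ⟩
          Q ^ S * (Q ^ s * Q ^ (S ∸ s)) ≡⟨ cong (Q ^ S *_) (trans (sym (^-distribˡ-+-* Q s (S ∸ s))) (cong (Q ^_) (m+[n∸m]≡n s≤))) ⟩
          Q ^ S * Q ^ S                 ≡⟨ sym (^-distribˡ-+-* Q S S) ⟩
          Q ^ (S + S)                   ≡⟨ cong (λ w → Q ^ (S + w)) (sym (+-identityʳ S)) ⟩
          Q ^ (2 * S) ∎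
        power : (ξ ^ r * c ^ s * B ^ (S ∸ s)) ^ l ≤ (Q ^ (2 * S)) ^ L
        power = ≤-trans (^-monoˡ-≤ l base) (^-monoʳ-≤ (Q ^ (2 * S)) {{m^n≢0 Q (2 * S) {{m^n≢0 G u}}}} (<⇒≤ l<))

      32mk₀≤ : L * K ≤ 2 ^ k₀
      32mk₀≤ = begin
        L * K         ≡⟨ lem m k₀ ⟩
        32 * m * k₀   ≤⟨ *-monoˡ-≤ k₀ 32m≤k₀ ⟩
        k₀ * k₀       ≡⟨ cong (λ w → w * w) (sym 4+) ⟩
        (4 + (k₀ ∸ 4)) * (4 + (k₀ ∸ 4)) ≤⟨ square≤2^ (k₀ ∸ 4) ⟩
        2 ^ (4 + (k₀ ∸ 4)) ≡⟨ cong (2 ^_) 4+ ⟩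
        2 ^ k₀ ∎
        where
        open ≤-Reasoning
        lem : ∀ m k → 4 * m * (8 * k) ≡ 32 * m * k
        lem = solve-∀
        4+ : 4 + (k₀ ∸ 4) ≡ k₀
        4+ = m+[n∸m]≡n (≤-trans (≤-trans (m≤m+n 4 28) (*-monoʳ-≤ 32 1≤m)) 32m≤k₀)

      large : L * (suc κ * (H * V)) < G ^ τ
      large = *-cancelʳ-< _ _ _ (begin-strict
        L * (suc κ * (H * V)) * G ^ (6 * k₀)            ≡⟨ cong (λ w → L * (w * (H * V)) * G ^ (6 * k₀)) sκ≡K ⟩
        L * (K * (H * V)) * G ^ (6 * k₀)                ≡⟨ lem₁ L K H ((4 * n) ^ K) X (G ^ (6 * k₀)) ⟩
        L * K * (4 * n) ^ K * G ^ (6 * k₀) * (H * X)    ≤⟨ *-monoˡ-≤ (H * X) (*-monoˡ-≤ (G ^ (6 * k₀)) (*-monoˡ-≤ ((4 * n) ^ K) 32mk₀≤)) ⟩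
        2 ^ k₀ * (4 * n) ^ K * G ^ (6 * k₀) * (H * X)   ≡⟨ cong (_* (H * X)) (trans (cong₂ (λ a b → 2 ^ k₀ * a * b) (sym (^-*-assoc (4 * n) 8 k₀)) (sym (^-*-assoc G 6 k₀)))
              (sym (trans (^-distribʳ-* (2 * (4 * n) ^ 8) (G ^ 6) k₀) (cong (_* (G ^ 6) ^ k₀) (^-distribʳ-* 2 ((4 * n) ^ 8) k₀))))) ⟩
        (2 * (4 * n) ^ 8 * G ^ 6) ^ k₀ * (H * X)        ≤⟨ *-monoˡ-≤ (H * X) (^-monoˡ-≤ k₀ m-large) ⟩
        (G ^ (7 * m)) ^ k₀ * (H * X)                    ≡⟨ cong₂ (λ a b → a * (H * b)) (^-*-assoc G (7 * m) k₀) (trans (^-*-assoc Q (2 * S) L) (^-*-assoc G u (2 * S * L))) ⟩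
        G ^ (7 * m * k₀) * (H * G ^ (u * (2 * S * L)))  ≡⟨ trans (cong (G ^ (7 * m * k₀) *_) (sym (^-distribˡ-+-* G h _))) (sym (^-distribˡ-+-* G (7 * m * k₀) _)) ⟩
        G ^ (7 * m * k₀ + (h + u * (2 * S * L)))        <⟨ ^-monoʳ-< G 2≤G (≤-trans (m<m+n (7 * m * k₀ + (h + u * (2 * S * L))) {8 * (m * u)} (*-mono-≤ {1} {8} (s≤s z≤n) 1≤mu)) (≤-reflexive (lem₂ m u S))) ⟩
        G ^ (τ + 6 * k₀)                                ≡⟨ ^-distribˡ-+-* G τ (6 * k₀) ⟩
        G ^ τ * G ^ (6 * k₀) ∎)
        where
        open ≤-Reasoning
        X = (Q ^ (2 * S)) ^ L
        lem₁ : ∀ l k h p x g → l * (k * (h * (p * x))) * g ≡ l * k * p * g * (h * x)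
        lem₁ = solve-∀
        lem₂ : ∀ m u S → 7 * m * (u * (1 + S)) + (3 * (u * (1 + S) * (2 + 3 * m)) + u * (2 * S * (4 * m))) + 8 * (m * u) ≡ 24 * (m * (u * (1 + S))) + 6 * (u * (1 + S))
        lem₂ = solve-∀

      -- τ = 24 m u S′ + 48 m u, and Q^S′ < ξ^R turns this into the exponent 24 m R + 48 m u of ξ,
      -- which is the left-hand side of `δ-large`.
      precise : G ^ τ ≤ ξ ^ δ
      precise = begin
        G ^ τ                                        ≡⟨ cong (G ^_) (lem m u S′) ⟩
        G ^ (u * S′ * (24 * m) + 48 * (m * u))       ≡⟨ ^-distribˡ-+-* G (u * S′ * (24 * m)) (48 * (m * u)) ⟩
        G ^ (u * S′ * (24 * m)) * G ^ (48 * (m * u)) ≡⟨ cong (_* G ^ (48 * (m * u))) (trans (sym (^-*-assoc G (u * S′) (24 * m))) (cong (_^ (24 * m)) (sym (^-*-assoc G u S′)))) ⟩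
        (Q ^ S′) ^ (24 * m) * G ^ (48 * (m * u))     ≤⟨ *-mono-≤ (^-monoˡ-≤ (24 * m) (<⇒≤ low)) (^-monoˡ-≤ (48 * (m * u)) (<⇒≤ G<ξ)) ⟩
        (ξ ^ R) ^ (24 * m) * ξ ^ (48 * (m * u))      ≡⟨ cong (_* ξ ^ (48 * (m * u))) (^-*-assoc ξ R (24 * m)) ⟩
        ξ ^ (R * (24 * m)) * ξ ^ (48 * (m * u))      ≡⟨ sym (^-distribˡ-+-* ξ (R * (24 * m)) (48 * (m * u))) ⟩
        ξ ^ (R * (24 * m) + 48 * (m * u))            ≤⟨ ^-monoʳ-≤ ξ (≤-trans (≤-reflexive (lem′ m u)) δ-large) ⟩
        ξ ^ δ ∎
        where
        open ≤-Reasoning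
        lem : ∀ m u S → 24 * (m * (u * (2 + S))) ≡ u * S * (24 * m) + 48 * (m * u)
        lem = solve-∀
        lem′ : ∀ m u → (32 * (m * u) + 4 * m) * (24 * m) + 48 * (m * u) ≡ 768 * (m * m * u) + 96 * (m * m) + 48 * (m * u)
        lem′ = solve-∀

      impossible : ⊥
      impossible = criterion G ξ δ B c τ κ L R₂ S H V {{G≢0}} {{>-nonZero (*-mono-≤ {1} {32} (s≤s z≤n) 1≤mu)}} {{m^n≢0 G h}}
        2≤ξ 1≤B 1≤c G∣ξ-1 (rel τ precise) R₂≤δ room many small large

    -- u measures B + c in powers of G, n measures the grid points against K, and m is free: a
    -- larger m relaxes `m-large` and tightens `δ-large`.
    baker : ⊥
    baker = let (S′ , low , high) = bracket in Parameters.impossible S′ low high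

-- Divisibility by primes and prime powers in ℤ

module SignedDivisibility where
  open import Data.Nat.Primality using (euclidsLemma; prime⇒nonTrivial)
  open import Data.Integer.Base hiding (suc; NonZero)
  open import Data.Integer.Properties
  open import Data.Integer.Divisibility.Signed
  open import Data.Integer.Tactic.RingSolver using (solve-∀)
  open Vandermonde using (pos-^)

  ℕ∣⇒ℤ∣ : ∀ {m n} → m ℕ.∣ n → + m ∣ + n
  ℕ∣⇒ℤ∣ = ∣ᵤ⇒∣

  ℤ∣⇒ℕ∣ : ∀ {m n} → + m ∣ + n → m ℕ.∣ n
  ℤ∣⇒ℕ∣ = ∣⇒∣ᵤ

  euclidℤ : ∀ {p} → Prime p → ∀ x y → + p ∣ x * y → (+ p ∣ x) ⊎ (+ p ∣ y)
  euclidℤ {p} pr x y d = Sum.map ∣ᵤ⇒∣ ∣ᵤ⇒∣ (euclidsLemma ∣ x ∣ ∣ y ∣ pr (subst (p ℕ.∣_) (abs-* x y) (∣⇒∣ᵤ d)))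

  prime∣^ : ∀ {p} → Prime p → ∀ x n → + p ∣ x ^ n → + p ∣ x
  prime∣^ pr x zero    d = ⊥-elim (ℕ.>⇒∤ (ℕ.nonTrivial⇒n>1 _ {{prime⇒nonTrivial pr}}) (∣⇒∣ᵤ d))
  prime∣^ pr x (suc n) d with euclidℤ pr x (x ^ n) d
  ... | inj₁ e = e
  ... | inj₂ e = prime∣^ pr x n e

  prime∣^ℕ : ∀ {p} → Prime p → ∀ x n → p ℕ.∣ x ℕ.^ n → p ℕ.∣ x
  prime∣^ℕ pr x n d = ℤ∣⇒ℕ∣ (prime∣^ pr (+ x) n (subst (_ ∣_) (pos-^ x n) (ℕ∣⇒ℤ∣ d)))

  ∣*-cancel : ∀ {k x y} → k ≢ 0ℤ → k * x ∣ k * y → x ∣ y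
  ∣*-cancel {k} ne d = *-cancelˡ-∣ k {{≢-nonZero ne}} d

  prime≢0 : ∀ {p} → Prime p → + p ≢ 0ℤ
  prime≢0 pr e = ℕ.<⇒≢ (ℕ.<-trans (s≤s z≤n) (ℕ.nonTrivial⇒n>1 _ {{prime⇒nonTrivial pr}})) (sym (+-injective e))

  prime^∣* : ∀ {p} → Prime p → ∀ {u} → ¬ (+ p ∣ u) → ∀ n {v} → (+ p) ^ n ∣ u * v → (+ p) ^ n ∣ v
  prime^∣* pr ¬d zero    {v} d = divides v (sym (*-identityʳ v))
  prime^∣* {p} pr {u} ¬d (suc n) {v} d with euclidℤ pr u v (∣-trans (divides ((+ p) ^ n) (*-comm (+ p) _)) d)
  ... | inj₁ e = ⊥-elim (¬d e)
  ... | inj₂ (divides w refl) = subst ((+ p) ^ suc n ∣_) (*-comm (+ p) w) (*-monoʳ-∣ (+ p)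
      (prime^∣* pr ¬d n (∣*-cancel (prime≢0 pr) (subst (+ p * (+ p) ^ n ∣_) (lem u w (+ p)) d))))
    where
    lem : ∀ u w p → u * (w * p) ≡ p * (u * w)
    lem = solve-∀

  ∤1 : ∀ {p} → Prime p → ¬ (+ p ∣ 1ℤ)
  ∤1 pr d = ℕ.>⇒∤ (ℕ.nonTrivial⇒n>1 _ {{prime⇒nonTrivial pr}}) (∣⇒∣ᵤ d)

-- Elements of norm a^n are odd powers of √B + √-c

module Descent where
  open import Data.Integer.Base hiding (suc; NonZero)
  open import Data.Integer.Properties
  open import Data.Integer.Divisibility.Signed
  open import Data.Integer.Tactic.RingSolver using (solve-∀)
  open Vandermonde using (pos-^; ^≢0)
  open SignedDivisibility

  sq-abs : ∀ p → p * p ≡ + (∣ p ∣ ℕ.* ∣ p ∣)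
  sq-abs (+ n)    = sym (pos-* n n)
  sq-abs -[1+ n ] = refl

  -- (P m √B + Q m √-c) = (√B + √-c)^(2m+1)
  P Q : ℤ → ℤ → ℕ → ℤ
  P B c zero    = 1ℤ
  P B c (suc m) = (B - c) * P B c m - + 2 * c * Q B c m
  Q B c zero    = 1ℤ
  Q B c (suc m) = (B - c) * Q B c m + + 2 * B * P B c m

  ±_≈_ : ℤ → ℤ → Set
  ± p ≈ q = p ≡ q ⊎ p ≡ - q

  square-1 : ∀ q → ∣ q ∣ ℕ.* ∣ q ∣ ≡ 1 → ± q ≈ 1ℤ
  square-1 q e with q | ℕ.m*n≡1⇒m≡1 ∣ q ∣ ∣ q ∣ e
  ... | + .1       | refl = inj₁ refl
  ... | -[1+ .0 ]  | refl = inj₂ refl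

  -- This is (b - 1)(c - 1) ≥ 0. It gives the even norm form p² + B c q² the same lower bound B + c
  -- that the odd form B p² + c q² has.
  sum≤1+product : ∀ {b c} → 1 ℕ.≤ b → 1 ℕ.≤ c → b ℕ.+ c ℕ.≤ 1 ℕ.+ b ℕ.* c
  sum≤1+product {suc b} {suc c} _ _ = ℕ.≤-trans (ℕ.≤-trans (ℕ.≤-reflexive (lem b c)) (ℕ.m≤m+n (2 ℕ.+ b ℕ.+ c) (b ℕ.* c))) (ℕ.≤-reflexive (lem′ b c))
    where
    lem : ∀ b c → suc b ℕ.+ suc c ≡ 2 ℕ.+ b ℕ.+ c
    lem = ℕ-Ring.solve-∀
    lem′ : ∀ b c → 2 ℕ.+ b ℕ.+ c ℕ.+ b ℕ.* c ≡ 1 ℕ.+ suc b ℕ.* suc c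
    lem′ = ℕ-Ring.solve-∀

  module _ {a} (pr : Prime a) (3≤a : 3 ℕ.≤ a) (x : ℕ) (1≤x : 1 ℕ.≤ x) (Bₙ cₙ : ℕ)
    (2≤B : 2 ℕ.≤ Bₙ) (2≤c : 2 ℕ.≤ cₙ) (sum : Bₙ ℕ.+ cₙ ≡ a ℕ.^ x)
    (a∤B : ¬ (+ a ∣ + Bₙ)) (a∤c : ¬ (+ a ∣ + cₙ)) where

    private
      α = + a
      B = + Bₙ
      c = + cₙ
      A = α ^ x

      A≡ : A ≡ B + c
      A≡ = trans (sym (pos-^ a x)) (trans (cong +_ (sym sum)) (pos-+ Bₙ cₙ))

      A≢0 : A ≢ 0ℤ
      A≢0 = ^≢0 x (prime≢0 pr)

      a∣^ : ∀ {n} → 1 ℕ.≤ n → α ∣ α ^ n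
      a∣^ {suc n} _ = divides (α ^ n) (*-comm α (α ^ n))

      a∣A : α ∣ A
      a∣A = a∣^ 1≤x

      a∤2 : ¬ (α ∣ + 2)
      a∤2 d = ℕ.>⇒∤ {n = 2} 3≤a (∣⇒∣ᵤ d)

      split : ∀ {n} → x ℕ.≤ n → α ^ n ≡ A * α ^ (n ℕ.∸ x)
      split {n} le = trans (cong (α ^_) (sym (ℕ.m+[n∸m]≡n le))) (^-distribˡ-+-* α x (n ℕ.∸ x))

      one-of : ∀ {u v} → A ∣ u * v → ¬ ((α ∣ u) × (α ∣ v)) → (A ∣ u) ⊎ (A ∣ v)
      one-of {u} {v} d ¬both with α ∣? u
      ... | no ¬u = inj₂ (prime^∣* pr ¬u x d)
      ... | yes u′ = inj₁ (prime^∣* pr (λ v′ → ¬both (u′ , v′)) x (subst (A ∣_) (*-comm u v) d))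

      not-both : ∀ {p u v} → u + v ≡ + 2 * p → ¬ (α ∣ p) → ¬ ((α ∣ u) × (α ∣ v))
      not-both {p} e ¬p (d , d′) with euclidℤ pr (+ 2) p (subst (α ∣_) e (∣m∣n⇒∣m+n d d′))
      ... | inj₁ two = a∤2 two
      ... | inj₂ d″  = ¬p d″

      nat-form : ∀ k k′ p q n → + k * (p * p) + + k′ * (q * q) ≡ α ^ n → k ℕ.* (∣ p ∣ ℕ.* ∣ p ∣) ℕ.+ k′ ℕ.* (∣ q ∣ ℕ.* ∣ q ∣) ≡ a ℕ.^ n
      nat-form k k′ p q n e = +-injective (trans (pos-+ (k ℕ.* _) (k′ ℕ.* _)) (trans (cong₂ _+_
          (trans (pos-* k _) (cong (+ k *_) (sym (sq-abs p)))) (trans (pos-* k′ _) (cong (+ k′ *_) (sym (sq-abs q))))) (trans e (sym (pos-^ a n)))))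

      1≤sq : ∀ p → p ≢ 0ℤ → 1 ℕ.≤ ∣ p ∣ ℕ.* ∣ p ∣
      1≤sq p ne = ℕ.*-mono-≤ {1} {∣ p ∣} {1} {∣ p ∣} 1≤p 1≤p
        where 1≤p = ℕ.n≢0⇒n>0 (λ e → ne (∣i∣≡0⇒i≡0 e))

      ^-lt : ∀ {n} → n ℕ.< x → a ℕ.^ n ℕ.< a ℕ.^ x
      ^-lt = ℕ.^-monoʳ-< a (ℕ.≤-trans (ℕ.n≤1+n 2) 3≤a)

      -- With both coordinates non-zero the norm is at least the sum of the two coefficients, so it
      -- is no power of a below a^x.
      big : ∀ {k k′ p q n} → p ≢ 0ℤ → q ≢ 0ℤ → a ℕ.^ x ℕ.≤ k ℕ.+ k′ → + k * (p * p) + + k′ * (q * q) ≡ α ^ n → x ℕ.≤ n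
      big {k} {k′} {p} {q} {n} p≢ q≢ le e = ℕ.≮⇒≥ λ n<x → ℕ.<⇒≱ (^-lt n<x) (begin
        a ℕ.^ x        ≤⟨ le ⟩
        k ℕ.+ k′       ≡⟨ sym (cong₂ ℕ._+_ (ℕ.*-identityʳ k) (ℕ.*-identityʳ k′)) ⟩
        k ℕ.* 1 ℕ.+ k′ ℕ.* 1 ≤⟨ ℕ.+-mono-≤ (ℕ.*-monoʳ-≤ k (1≤sq p p≢)) (ℕ.*-monoʳ-≤ k′ (1≤sq q q≢)) ⟩
        k ℕ.* (∣ p ∣ ℕ.* ∣ p ∣) ℕ.+ k′ ℕ.* (∣ q ∣ ℕ.* ∣ q ∣) ≡⟨ nat-form k k′ p q n e ⟩
        a ℕ.^ n ∎)
        where open ℕ.≤-Reasoning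

      ∤⇒≢0 : ∀ {p} → ¬ (α ∣ p) → p ≢ 0ℤ
      ∤⇒≢0 ¬d refl = ¬d (divides 0ℤ refl)

      ∣sq : ∀ {k p} → ¬ (α ∣ k) → α ∣ k * (p * p) → α ∣ p
      ∣sq {k} {p} ¬k d with euclidℤ pr k (p * p) d
      ... | inj₁ d′ = ⊥-elim (¬k d′)
      ... | inj₂ d′ with euclidℤ pr p p d′
      ... | inj₁ e = e
      ... | inj₂ e = e

      1<B*n : ∀ {n} → n ≢ 0 → 1 ℕ.< Bₙ ℕ.* n
      1<B*n {n} ne = ℕ.≤-trans 2≤B (ℕ.m≤m*n Bₙ n {{ℕ.≢-nonZero ne}})

      odd-size : ∀ n p q → B * (p * p) + c * (q * q) ≡ α ^ n → ¬ (α ∣ p) → x ℕ.≤ n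
      odd-size n p q e ¬p with q ≟ 0ℤ
      ... | no q≢ = big {Bₙ} {cₙ} {p} {q} (∤⇒≢0 ¬p) q≢ (ℕ.≤-reflexive (sym sum)) e
      ... | yes refl with n
      ... | zero  = ⊥-elim (ℕ.<⇒≢ (ℕ.<-≤-trans (1<B*n λ z → ℕ.<⇒≢ (1≤sq p (∤⇒≢0 ¬p)) (sym z)) (ℕ.m≤m+n _ (cₙ ℕ.* 0))) (sym (nat-form Bₙ cₙ p 0ℤ 0 e)))
      ... | suc n = ⊥-elim (¬p (∣sq a∤B (subst (α ∣_) (trans (sym e) (trans (cong (λ w → B * (p * p) + w) (*-zeroʳ c)) (+-identityʳ _))) (a∣^ {suc n} (s≤s z≤n)))))

      even-size : ∀ n p q → 1ℤ * (p * p) + (B * c) * (q * q) ≡ α ^ n → 1 ℕ.≤ n → ¬ (α ∣ p) → x ℕ.≤ n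
      even-size n p q e 1≤n ¬p with q ≟ 0ℤ
      ... | yes refl = ⊥-elim (¬p (∣sq (∤1 pr) (subst (α ∣_) (trans (sym e) (trans (cong (λ w → 1ℤ * (p * p) + w) (*-zeroʳ (B * c))) (+-identityʳ _))) (a∣^ 1≤n))))
      ... | no q≢ = big {1} {Bₙ ℕ.* cₙ} {p} {q} (∤⇒≢0 ¬p) q≢ (ℕ.≤-trans (ℕ.≤-reflexive (sym sum)) le)
            (trans (cong (λ w → 1ℤ * (p * p) + w * (q * q)) (pos-* Bₙ cₙ)) e)
        where
        le : Bₙ ℕ.+ cₙ ℕ.≤ 1 ℕ.+ Bₙ ℕ.* cₙ
        le = sum≤1+product (ℕ.≤-trans (s≤s z≤n) 2≤B) (ℕ.≤-trans (s≤s z≤n) 2≤c)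

      Match : ℤ → ℤ → Set
      Match p q = ∃[ m ] ((± p ≈ P B c m) × (± q ≈ Q B c m))

      flip : ∀ {p q} → Match p (- q) → Match p q
      flip (m , sp , inj₁ e) = m , sp , inj₂ (trans (sym (neg-involutive _)) (cong -_ e))
      flip (m , sp , inj₂ e) = m , sp , inj₁ (trans (sym (neg-involutive _)) (trans (cong -_ e) (neg-involutive _)))

      -- (√B + √-c)² times the conjugate of (√B + √-c)^(2m+1) is divisible by a.
      conjugate : ∀ m → α ∣ (B - c) * P B c m - + 2 * c * (- Q B c m)
      conjugate zero = subst (α ∣_) (trans A≡ (lem B c)) a∣A
        where
        lem : ∀ B c → B + c ≡ (B - c) * 1ℤ - + 2 * c * (- 1ℤ)
        lem = solve-∀
      conjugate (suc m) = subst (α ∣_) (lem B c (P B c m) (Q B c m)) (∣m⇒∣m*n _ (subst (α ∣_) A≡ a∣A))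
        where
        lem : ∀ B c p q → (B + c) * ((B + c) * p) ≡ (B - c) * ((B - c) * p - + 2 * c * q) - + 2 * c * (- ((B - c) * q + + 2 * B * p))
        lem = solve-∀

      -- Multiplication by (√B + √-c)². If the signs of the match disagreed, the element would be
      -- this square times the conjugate of an odd power, and a would divide p.
      advance : ∀ {p q p₂ q₂} → ¬ (α ∣ p) → p ≡ (B - c) * p₂ - + 2 * c * q₂ → q ≡ (B - c) * q₂ + + 2 * B * p₂ → Match p₂ q₂ → Match p q
      advance ¬p e f (m , inj₁ refl , inj₁ refl) = suc m , inj₁ e , inj₁ f
      advance ¬p e f (m , inj₂ refl , inj₂ refl) = suc m , inj₂ (trans e (lem B c (P B c m) (Q B c m))) , inj₂ (trans f (lem′ B c (P B c m) (Q B c m)))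
        where
        lem : ∀ B c p q → (B - c) * (- p) - + 2 * c * (- q) ≡ - ((B - c) * p - + 2 * c * q)
        lem = solve-∀
        lem′ : ∀ B c p q → (B - c) * (- q) + + 2 * B * (- p) ≡ - ((B - c) * q + + 2 * B * p)
        lem′ = solve-∀
      advance ¬p e f (m , inj₁ refl , inj₂ refl) = ⊥-elim (¬p (subst (α ∣_) (sym e) (conjugate m)))
      advance ¬p e f (m , inj₂ refl , inj₁ refl) = ⊥-elim (¬p (subst (α ∣_) (trans (lem B c (P B c m) (Q B c m)) (sym e)) (∣m⇒∣-m (conjugate m))))
        where
        lem : ∀ B c p q → - ((B - c) * p - + 2 * c * (- q)) ≡ (B - c) * (- p) - + 2 * c * q
        lem = solve-∀

      mutual
        -- B (p - q)(p + q) = a^n - A q² is divisible by A, so √B + √-c or its conjugate can be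
        -- divided out; conjugation changes the sign of q.
        descent : ∀ f n p q → n ℕ.≤ f → B * (p * p) + c * (q * q) ≡ α ^ n → ¬ (α ∣ p) → Match p q
        descent f n p q n≤f e ¬p = orient (one-of {p - q} {p + q} (prime^∣* pr a∤B x A∣) (not-both (lem p q) ¬p))
          where
          x≤n = odd-size n p q e ¬p
          lem : ∀ p q → (p - q) + (p + q) ≡ + 2 * p
          lem = solve-∀
          lem′ : ∀ B c p q → (B * (p * p) + c * (q * q)) - (B + c) * (q * q) ≡ B * ((p - q) * (p + q))
          lem′ = solve-∀
          A∣ : A ∣ B * ((p - q) * (p + q))
          A∣ = subst (A ∣_) (trans (cong₂ (λ u v → u - v * (q * q)) (sym e) A≡) (lem′ B c p q))
            (∣m∣n⇒∣m-n (divides (α ^ (n ℕ.∸ x)) (trans (split x≤n) (*-comm A _))) (∣m⇒∣m*n (q * q) ∣-refl))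
          orient : (A ∣ p - q) ⊎ (A ∣ p + q) → Match p q
          orient (inj₁ (divides t eq)) = first f n p q t n≤f x≤n (trans (sym (lem₁ p q)) (cong (_+ q) eq)) e ¬p
            where
            lem₁ : ∀ p q → (p - q) + q ≡ p
            lem₁ = solve-∀
          orient (inj₂ (divides t eq)) = flip (first f n p (- q) t n≤f x≤n (trans (sym (lem₁ p q)) (cong (λ w → w + - q) eq)) (trans (lem₂ B c p q) e) ¬p)
            where
            lem₁ : ∀ p q → (p + q) + - q ≡ p
            lem₁ = solve-∀
            lem₂ : ∀ B c p q → B * (p * p) + c * ((- q) * (- q)) ≡ B * (p * p) + c * (q * q)
            lem₂ = solve-∀

        -- Division by √B + √-c: p √B + q √-c = (√B + √-c)(p₁ + q₁ √(-Bc)), where the second factor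
        -- has norm a^(n-x).
        first : ∀ f n p q t → n ℕ.≤ f → x ℕ.≤ n → p ≡ t * A + q → B * (p * p) + c * (q * q) ≡ α ^ n → ¬ (α ∣ p) → Match p q
        first f n p q t n≤f x≤n p≡ e ¬p = by-size (n ℕ.∸ x) refl
          where
          p₁ = B * t + q
          q₁ = - t
          lem : ∀ B c t q → (B + c) * (1ℤ * ((B * t + q) * (B * t + q)) + (B * c) * ((- t) * (- t))) ≡ B * ((t * (B + c) + q) * (t * (B + c) + q)) + c * (q * q)
          lem = solve-∀
          p≡′ : p ≡ t * (B + c) + q
          p≡′ = trans p≡ (cong (λ w → t * w + q) A≡)
          norm : 1ℤ * (p₁ * p₁) + (B * c) * (q₁ * q₁) ≡ α ^ (n ℕ.∸ x)
          norm = *-cancelˡ-≡ A _ _ {{≢-nonZero A≢0}} (trans (cong (_* (1ℤ * (p₁ * p₁) + (B * c) * (q₁ * q₁))) A≡)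
            (trans (lem B c t q) (trans (cong (λ w → B * (w * w) + c * (q * q)) (sym p≡′)) (trans e (split x≤n)))))
          p-from : p ≡ p₁ - c * q₁
          p-from = trans p≡′ (lem′ B c t q)
            where
            lem′ : ∀ B c t q → t * (B + c) + q ≡ (B * t + q) - c * (- t)
            lem′ = solve-∀
          q-from : q ≡ p₁ + B * q₁
          q-from = lem′ B t q
            where
            lem′ : ∀ B t q → q ≡ (B * t + q) + B * (- t)
            lem′ = solve-∀
          by-size : ∀ M → n ℕ.∸ x ≡ M → Match p q
          by-size zero M≡ with t ≟ 0ℤ
          -- The descent ends at ±(√B + √-c) itself, the case m = 0.
          ... | yes refl = 0 , subst (λ w → ± w ≈ 1ℤ) (sym p≡q) unit , unit
            where
            p≡q : p ≡ q
            p≡q = trans p≡ (+-identityˡ q)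
            sq1 : ∣ q ∣ ℕ.* ∣ q ∣ ≡ 1
            sq1 = +-injective (trans (sym (sq-abs q)) (trans (lem₀ B c q) (trans norm (cong (α ^_) M≡))))
              where
              lem₀ : ∀ B c q → q * q ≡ 1ℤ * ((B * 0ℤ + q) * (B * 0ℤ + q)) + (B * c) * ((- 0ℤ) * (- 0ℤ))
              lem₀ = solve-∀
            unit : ± q ≈ 1ℤ
            unit = square-1 q sq1
          ... | no t≢ = ⊥-elim (ℕ.<⇒≢ small (sym (nat-form 1 (Bₙ ℕ.* cₙ) p₁ q₁ 0 (trans (cong (λ w → 1ℤ * (p₁ * p₁) + w * (q₁ * q₁)) (pos-* Bₙ cₙ)) (trans norm (cong (α ^_) M≡))))))
            where
            small : 1 ℕ.< 1 ℕ.* (∣ p₁ ∣ ℕ.* ∣ p₁ ∣) ℕ.+ Bₙ ℕ.* cₙ ℕ.* (∣ q₁ ∣ ℕ.* ∣ q₁ ∣)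
            small = ℕ.<-≤-trans (subst (1 ℕ.<_) (sym (ℕ.*-assoc Bₙ cₙ _)) (1<B*n (λ z → ℕ.<⇒≢ (ℕ.*-mono-≤ {1} {cₙ} (ℕ.≤-trans (s≤s z≤n) 2≤c) (1≤sq q₁ (λ z → t≢ (neg-injective z)))) (sym z)))) (ℕ.m≤n+m _ _)
          by-size (suc M) M≡ = second f (n ℕ.∸ x) p q p₁ q₁ (ℕ.≤-trans (ℕ.m∸n≤m n x) n≤f) n-x<f (ℕ.≤-trans (s≤s z≤n) (ℕ.≤-reflexive (sym M≡))) p-from q-from norm ¬p
            where
            n-x<f : suc (n ℕ.∸ x) ℕ.≤ f
            n-x<f = ℕ.≤-trans (ℕ.∸-monoʳ-< 1≤x x≤n) n≤f

        -- A second division by √B + √-c returns to the shape p₂ √B + q₂ √-c. If the conjugate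
        -- divided instead, the original element would contain (√B + √-c)(√B - √-c) = a^x, against a
        -- ∤ p.
        second : ∀ f M p q p₁ q₁ → M ℕ.≤ f → M ℕ.< f → 1 ℕ.≤ M → p ≡ p₁ - c * q₁ → q ≡ p₁ + B * q₁ →
          1ℤ * (p₁ * p₁) + (B * c) * (q₁ * q₁) ≡ α ^ M → ¬ (α ∣ p) → Match p q
        second (suc f) M p q p₁ q₁ _ (s≤s M≤f) 1≤M p≡ q≡ e ¬p = orient (one-of {p₁ - B * q₁} {p₁ + B * q₁} A∣ (not-both (lem p₁ (B * q₁)) ¬p₁))
          where
          lem : ∀ p q → (p - q) + (p + q) ≡ + 2 * p
          lem = solve-∀
          ¬p₁ : ¬ (α ∣ p₁)
          ¬p₁ d = ¬p (subst (α ∣_) (sym p≡) (∣m∣n⇒∣m-n d (∣n⇒∣m*n c d′)))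
            where
            lem₀ : ∀ s k → (1ℤ * s + k) - 1ℤ * s ≡ k
            lem₀ = solve-∀
            ¬Bc : ¬ (α ∣ B * c)
            ¬Bc d with euclidℤ pr B c d
            ... | inj₁ d = a∤B d
            ... | inj₂ d = a∤c d
            d′ : α ∣ q₁
            d′ = ∣sq {B * c} {q₁} ¬Bc (subst (α ∣_) (trans (cong (λ w → w - 1ℤ * (p₁ * p₁)) (sym e)) (lem₀ (p₁ * p₁) ((B * c) * (q₁ * q₁))))
              (∣m∣n⇒∣m-n (a∣^ 1≤M) (∣n⇒∣m*n 1ℤ (∣m⇒∣m*n p₁ d))))
          x≤M = even-size M p₁ q₁ e 1≤M ¬p₁
          lem′ : ∀ B c p q → (1ℤ * (p * p) + (B * c) * (q * q)) - (B + c) * (B * (q * q)) ≡ (p - B * q) * (p + B * q)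
          lem′ = solve-∀
          A∣ : A ∣ (p₁ - B * q₁) * (p₁ + B * q₁)
          A∣ = subst (A ∣_) (trans (cong₂ (λ u v → u - v * (B * (q₁ * q₁))) (sym e) A≡) (lem′ B c p₁ q₁))
            (∣m∣n⇒∣m-n (divides (α ^ (M ℕ.∸ x)) (trans (split x≤M) (*-comm A _))) (∣m⇒∣m*n (B * (q₁ * q₁)) ∣-refl))
          orient : (A ∣ p₁ - B * q₁) ⊎ (A ∣ p₁ + B * q₁) → Match p q
          orient (inj₂ d) = ⊥-elim (¬p (subst (α ∣_) (trans (lem₀ B c p₁ q₁) (sym p≡))
              (∣m∣n⇒∣m-n (∣-trans a∣A d) (∣m⇒∣m*n q₁ (subst (α ∣_) A≡ a∣A)))))
            where
            lem₀ : ∀ B c p q → p + B * q - (B + c) * q ≡ p - c * q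
            lem₀ = solve-∀
          orient (inj₁ (divides w eq)) = advance ¬p p₂-eq q₂-eq (descent f (M ℕ.∸ x) p₂ q₂ (ℕ.≤-trans (ℕ.m∸n≤m M x) M≤f) norm ¬p₂)
            where
            p₂ = q₁ + w
            q₂ = - w
            p₁≡ : p₁ ≡ w * (B + c) + B * q₁
            p₁≡ = trans (lem₀ p₁ (B * q₁)) (cong (λ w → w + B * q₁) (trans eq (cong (w *_) A≡)))
              where
              lem₀ : ∀ p q → p ≡ (p - q) + q
              lem₀ = solve-∀
            lem₁ : ∀ B c q w → (w * (B + c) + B * q) - c * q ≡ (B - c) * (q + w) - + 2 * c * (- w)
            lem₁ = solve-∀
            lem₂ : ∀ B c q w → (w * (B + c) + B * q) + B * q ≡ (B - c) * (- w) + + 2 * B * (q + w)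
            lem₂ = solve-∀
            p₂-eq : p ≡ (B - c) * p₂ - + 2 * c * q₂
            p₂-eq = trans p≡ (trans (cong (λ w → w - c * q₁) p₁≡) (lem₁ B c q₁ w))
            q₂-eq : q ≡ (B - c) * q₂ + + 2 * B * p₂
            q₂-eq = trans q≡ (trans (cong (λ w → w + B * q₁) p₁≡) (lem₂ B c q₁ w))
            lem₃ : ∀ B c q w → (B + c) * (B * ((q + w) * (q + w)) + c * ((- w) * (- w))) ≡ 1ℤ * ((w * (B + c) + B * q) * (w * (B + c) + B * q)) + (B * c) * (q * q)
            lem₃ = solve-∀
            norm : B * (p₂ * p₂) + c * (q₂ * q₂) ≡ α ^ (M ℕ.∸ x)
            norm = *-cancelˡ-≡ A _ _ {{≢-nonZero A≢0}} (trans (cong (_* (B * (p₂ * p₂) + c * (q₂ * q₂))) A≡)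
              (trans (lem₃ B c q₁ w) (trans (cong (λ u → 1ℤ * (u * u) + (B * c) * (q₁ * q₁)) (sym p₁≡)) (trans e (split x≤M)))))
            ¬p₂ : ¬ (α ∣ p₂)
            ¬p₂ d with M ℕ.∸ x in M-x
            ... | suc k = ¬p (subst (α ∣_) (sym p₂-eq) (∣m∣n⇒∣m-n (∣n⇒∣m*n (B - c) d) (∣n⇒∣m*n (+ 2 * c) d′)))
              where
              lem₄ : ∀ s k → (s + k) - s ≡ k
              lem₄ = solve-∀
              d′ : α ∣ q₂
              d′ = ∣sq {c} {q₂} a∤c (subst (α ∣_) (trans (cong (λ w → w - B * (p₂ * p₂)) (sym norm)) (lem₄ (B * (p₂ * p₂)) (c * (q₂ * q₂))))
                (∣m∣n⇒∣m-n (subst (λ e → α ∣ α ^ e) (sym M-x) (a∣^ {suc k} (s≤s z≤n))) (∣n⇒∣m*n B (∣m⇒∣m*n p₂ d))))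
            -- B and c are at least 2, so the odd form does not represent 1.
            ... | zero = too-small (nat-form Bₙ cₙ p₂ q₂ 0 (trans norm (cong (α ^_) M-x)))
              where
              too-small : Bₙ ℕ.* (∣ p₂ ∣ ℕ.* ∣ p₂ ∣) ℕ.+ cₙ ℕ.* (∣ q₂ ∣ ℕ.* ∣ q₂ ∣) ≡ 1 → ⊥
              too-small e with ∣ p₂ ∣ ℕ.* ∣ p₂ ∣ | ∣ q₂ ∣ ℕ.* ∣ q₂ ∣
              ... | zero  | zero  = ℕ.<⇒≢ (s≤s z≤n) (trans (sym (cong₂ ℕ._+_ (ℕ.*-zeroʳ Bₙ) (ℕ.*-zeroʳ cₙ))) e)
              ... | suc s | t     = ℕ.<⇒≢ (ℕ.<-≤-trans (ℕ.≤-trans 2≤B (ℕ.m≤m*n Bₙ (suc s))) (ℕ.m≤m+n _ (cₙ ℕ.* t))) (sym e)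
              ... | zero  | suc t = ℕ.<⇒≢ (ℕ.<-≤-trans (ℕ.≤-trans 2≤c (ℕ.m≤m*n cₙ (suc t))) (ℕ.m≤n+m _ (Bₙ ℕ.* 0))) (sym e)

    odd-power : ∀ n p q → B * (p * p) + c * (q * q) ≡ α ^ n → ¬ (α ∣ p) → ∃[ m ] ((± p ≈ P B c m) × (± q ≈ Q B c m))
    odd-power n p q = descent n n p q ℕ.≤-refl

-- Prime divisors, and divisibility properties of the sequences P and Q

module LehmerSequences where
  open import Data.Nat.Primality using (prime⇒nonTrivial; prime⇒irreducible)
  open import Data.Nat.Primality.Factorisation using (factorise)
  open import Data.Integer.Base hiding (suc; NonZero)
  open import Data.Integer.Properties
  open import Data.Integer.Divisibility.Signed
  open import Data.Integer.Tactic.RingSolver using (solve-∀)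
  open import Data.List.Base using ([]; _∷_)
  open import Data.List.Relation.Unary.All using ([]; _∷_)
  open SignedDivisibility
  open Descent

  1<prime : ∀ {p} → Prime p → 1 ℕ.< p
  1<prime pr = ℕ.nonTrivial⇒n>1 _ {{prime⇒nonTrivial pr}}

  prime-divisor : ∀ {n} → 1 ℕ.< n → ∃[ p ] (Prime p × p ℕ.∣ n)
  prime-divisor {n} 1<n with factorise n {{ℕ.>-nonZero (ℕ.<-trans (s≤s z≤n) 1<n)}}
  ... | record { factors = [] ; isFactorisation = e } = ⊥-elim (ℕ.<⇒≢ 1<n (sym e))
  ... | record { factors = p ∷ ps ; isFactorisation = e ; factorsPrime = pr ∷ _ } = p , pr , subst (p ℕ.∣_) (sym e) (ℕ.m∣m*n _)

  only-prime : ∀ {r n} .{{_ : NonZero n}} → (∀ s → Prime s → s ℕ.∣ n → s ≡ r) → ¬ (r ℕ.* r ℕ.∣ n) → n ≡ 1 ⊎ n ≡ r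
  only-prime {r} {n} only ¬sq with factorise n
  ... | record { factors = [] ; isFactorisation = e } = inj₁ e
  ... | record { factors = p ∷ [] ; isFactorisation = e ; factorsPrime = pr ∷ _ } =
          inj₂ (trans e (trans (ℕ.*-identityʳ p) (only p pr (subst (p ℕ.∣_) (sym e) (ℕ.m∣m*n 1)))))
  ... | record { factors = p ∷ q ∷ ps ; isFactorisation = e ; factorsPrime = pr ∷ qr ∷ _ } =
          ⊥-elim (¬sq (subst₂ ℕ._∣_ (cong₂ ℕ._*_ p≡ q≡) (sym e′) (ℕ.m∣m*n _)))
    where
    e′ : n ≡ p ℕ.* q ℕ.* _
    e′ = trans e (sym (ℕ.*-assoc p q _))
    p≡ = only p pr (subst (p ℕ.∣_) (sym e) (ℕ.m∣m*n _))
    q≡ = only q qr (subst (q ℕ.∣_) (sym e) (ℕ.∣n⇒∣m*n p (ℕ.m∣m*n _)))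

  prime∣prime : ∀ {p q} → Prime p → Prime q → p ℕ.∣ q → p ≡ q
  prime∣prime pp pq d with prime⇒irreducible pq d
  ... | inj₁ e = ⊥-elim (ℕ.<⇒≢ (1<prime pp) (sym e))
  ... | inj₂ e = e

  parity : ∀ n → ∃[ k ] (n ≡ 2 ℕ.* k ⊎ n ≡ suc (2 ℕ.* k))
  parity zero = 0 , inj₁ refl
  parity (suc n) with parity n
  ... | k , inj₁ e = k , inj₂ (cong suc e)
  ... | k , inj₂ e = suc k , inj₁ (trans (cong suc e) (sym (ℕ.*-suc 2 k)))

  odd≢even : ∀ m k → suc (2 ℕ.* m) ≢ 2 ℕ.* k
  odd≢even m k e = ℕ.1+n≢0 {0} (trans (sym (rem1 m)) (trans (cong (ℕ._% 2) e) (rem0 k)))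
    where
    rem1 : ∀ m → suc (2 ℕ.* m) ℕ.% 2 ≡ 1
    rem1 m = trans (cong (λ w → suc w ℕ.% 2) (ℕ.*-comm 2 m)) (ℕ.[m+kn]%n≡m%n 1 m 2)
    rem0 : ∀ k → 2 ℕ.* k ℕ.% 2 ≡ 0
    rem0 k = trans (cong (ℕ._% 2) (ℕ.*-comm 2 k)) (ℕ.m*n%n≡0 k 2)

  -- The factorisation 2m + 1 = (2k + 1)(2j + 1), with m in the shape that `divides-multiple`
  -- expects.
  odd-product : ∀ m r t → suc (2 ℕ.* m) ≡ r ℕ.* t → ∃[ k ] ∃[ j ] (r ≡ suc (2 ℕ.* k) × m ≡ k ℕ.+ j ℕ.* suc (2 ℕ.* k))
  odd-product m r t e with parity r | parity t
  ... | k , inj₁ refl | j , _ = ⊥-elim (odd≢even m (k ℕ.* t) (trans e (ℕ.*-assoc 2 k t)))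
  ... | k , inj₂ refl | j , inj₁ refl = ⊥-elim (odd≢even m (suc (2 ℕ.* k) ℕ.* j) (trans e (lem k j)))
    where
    lem : ∀ k j → suc (2 ℕ.* k) ℕ.* (2 ℕ.* j) ≡ 2 ℕ.* (suc (2 ℕ.* k) ℕ.* j)
    lem = ℕ-Ring.solve-∀
  ... | k , inj₂ refl | j , inj₂ refl = k , j , refl , ℕ.*-cancelˡ-≡ m _ 2 (ℕ.suc-injective (trans e (lem k j)))
    where
    lem : ∀ k j → suc (2 ℕ.* k) ℕ.* suc (2 ℕ.* j) ≡ suc (2 ℕ.* (k ℕ.+ j ℕ.* suc (2 ℕ.* k)))
    lem = ℕ-Ring.solve-∀

  module Lehmer (B c : ℤ) where
    private
      P′ = P B c
      Q′ = Q B c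

    norm : ∀ m → B * (P′ m * P′ m) + c * (Q′ m * Q′ m) ≡ (B + c) ^ suc (2 ℕ.* m)
    norm zero = lem B c
      where
      lem : ∀ B c → B * (1ℤ * 1ℤ) + c * (1ℤ * 1ℤ) ≡ (B + c) * 1ℤ
      lem = solve-∀
    norm (suc m) = trans (lem B c (P′ m) (Q′ m)) (trans (cong ((B + c) * ((B + c)) *_) (norm m))
        (trans (*-assoc (B + c) (B + c) _) (cong (λ e → (B + c) ^ suc e) (sym (ℕ.*-suc 2 m)))))
      where
      lem : ∀ B c p q → B * (((B - c) * p - + 2 * c * q) * ((B - c) * p - + 2 * c * q)) + c * (((B - c) * q + + 2 * B * p) * ((B - c) * q + + 2 * B * p))
        ≡ (B + c) * (B + c) * (B * (p * p) + c * (q * q))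
      lem = solve-∀

    -- Lowest terms in the binomial expansion of (√B + √-c)^(2m+1).
    mod-B : ∀ m → ∃[ k ] ∃[ l ] (P′ m ≡ (+ 2 * + m + 1ℤ) * (- c) ^ m + B * k × Q′ m ≡ (- c) ^ m + B * l)
    mod-B zero = 0ℤ , 0ℤ , lem B , lem′ B
      where
      lem : ∀ B → 1ℤ ≡ (+ 2 * 0ℤ + 1ℤ) * 1ℤ + B * 0ℤ
      lem = solve-∀
      lem′ : ∀ B → 1ℤ ≡ 1ℤ + B * 0ℤ
      lem′ = solve-∀
    mod-B (suc m) with mod-B m
    ... | k , l , e , f = P′ m - c * k - + 2 * c * l , Q′ m - c * l + + 2 * P′ m ,
      trans (lem B c (P′ m) (Q′ m)) (trans (cong₂ (λ p q → B * P′ m + - c * p - + 2 * c * q) e f) (lem₁ B c (P′ m) ((- c) ^ m) k l (+ m))) ,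
      trans (lem₂ B c (P′ m) (Q′ m)) (trans (cong (λ q → B * (Q′ m + + 2 * P′ m) + - c * q) f) (lem₃ B c (P′ m) (Q′ m) ((- c) ^ m) l))
      where
      lem : ∀ B c p q → (B - c) * p - + 2 * c * q ≡ B * p + - c * p - + 2 * c * q
      lem = solve-∀
      lem₁ : ∀ B c p u k l M → B * p + - c * ((+ 2 * M + 1ℤ) * u + B * k) - + 2 * c * (u + B * l) ≡ (+ 2 * (1ℤ + M) + 1ℤ) * (- c * u) + B * (p - c * k - + 2 * c * l)
      lem₁ = solve-∀
      lem₂ : ∀ B c p q → (B - c) * q + + 2 * B * p ≡ B * (q + + 2 * p) + - c * q
      lem₂ = solve-∀
      lem₃ : ∀ B c p q u l → B * (q + + 2 * p) + - c * (u + B * l) ≡ - c * u + B * (q - c * l + + 2 * p)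
      lem₃ = solve-∀

    -- The next coefficients are C(2m+1, 3) = (2m+1) m (2m-1) / 3 and C(2m+1, 2) = (2m+1) m. The
    -- factor 3 clears the denominator, and -c turns the exponent m - 1 into m.
    mod-B² : ∀ m → ∃[ k ] ∃[ l ]
      ( + 3 * (- c * P′ m) ≡ + 3 * (+ 2 * + m + 1ℤ) * (- c * (- c) ^ m) + (+ 2 * + m + 1ℤ) * + m * (+ 2 * + m - 1ℤ) * (B * (- c) ^ m) + B * B * k
      × - c * Q′ m ≡ - c * (- c) ^ m + (+ 2 * + m + 1ℤ) * + m * (B * (- c) ^ m) + B * B * l)
    mod-B² zero = 0ℤ , 0ℤ , lem B c , lem′ B c
      where
      lem : ∀ B c → + 3 * (- c * 1ℤ) ≡ + 3 * (+ 2 * 0ℤ + 1ℤ) * (- c * 1ℤ) + (+ 2 * 0ℤ + 1ℤ) * 0ℤ * (+ 2 * 0ℤ - 1ℤ) * (B * 1ℤ) + B * B * 0ℤ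
      lem = solve-∀
      lem′ : ∀ B c → - c * 1ℤ ≡ - c * 1ℤ + (+ 2 * 0ℤ + 1ℤ) * 0ℤ * (B * 1ℤ) + B * B * 0ℤ
      lem′ = solve-∀
    mod-B² (suc m) with mod-B² m | mod-B m
    ... | k , l , e , f | k₁ , _ , e₁ , _ =
        + 3 * - c * k₁ - c * k - + 6 * c * l , (+ 2 * + m + 1ℤ) * + m * (- c) ^ m + B * l - c * l - + 2 * c * k₁ ,
        trans (lem B c (P′ m) (Q′ m)) (trans (cong (λ p → B * (+ 3 * - c * p) + - c * (+ 3 * (- c * P′ m)) - + 6 * c * (- c * Q′ m)) e₁)
          (trans (cong₂ (λ s t → B * (+ 3 * - c * ((+ 2 * + m + 1ℤ) * (- c) ^ m + B * k₁)) + - c * s - + 6 * c * t) e f) (lem₁ B c ((- c) ^ m) (+ m) k l k₁))) ,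
        trans (lem₂ B c (P′ m) (Q′ m)) (trans (cong₂ (λ p t → B * t + - c * t + + 2 * B * (- c * p)) e₁ f) (lem₃ B c ((- c) ^ m) (+ m) k₁ l))
      where
      lem : ∀ B c p q → + 3 * (- c * ((B - c) * p - + 2 * c * q)) ≡ B * (+ 3 * - c * p) + - c * (+ 3 * (- c * p)) - + 6 * c * (- c * q)
      lem = solve-∀
      lem₁ : ∀ B c u M k l k₁ → B * (+ 3 * - c * ((+ 2 * M + 1ℤ) * u + B * k₁))
          + - c * (+ 3 * (+ 2 * M + 1ℤ) * (- c * u) + (+ 2 * M + 1ℤ) * M * (+ 2 * M - 1ℤ) * (B * u) + B * B * k)
          - + 6 * c * (- c * u + (+ 2 * M + 1ℤ) * M * (B * u) + B * B * l)
        ≡ + 3 * (+ 2 * (1ℤ + M) + 1ℤ) * (- c * (- c * u)) + (+ 2 * (1ℤ + M) + 1ℤ) * (1ℤ + M) * (+ 2 * (1ℤ + M) - 1ℤ) * (B * (- c * u)) + B * B * (+ 3 * - c * k₁ - c * k - + 6 * c * l)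
      lem₁ = solve-∀
      lem₂ : ∀ B c p q → - c * ((B - c) * q + + 2 * B * p) ≡ B * (- c * q) + - c * (- c * q) + + 2 * B * (- c * p)
      lem₂ = solve-∀
      lem₃ : ∀ B c u M k₁ l → B * (- c * u + (+ 2 * M + 1ℤ) * M * (B * u) + B * B * l) + - c * (- c * u + (+ 2 * M + 1ℤ) * M * (B * u) + B * B * l) + + 2 * B * (- c * ((+ 2 * M + 1ℤ) * u + B * k₁))
        ≡ - c * (- c * u) + (+ 2 * (1ℤ + M) + 1ℤ) * (1ℤ + M) * (B * (- c * u)) + B * B * ((+ 2 * M + 1ℤ) * M * u + B * l - c * l - + 2 * c * k₁)
      lem₃ = solve-∀

    -- E t + F t √(-Bc) = (√B + √-c)^(2t).
    E F : ℕ → ℤ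
    E zero    = 1ℤ
    E (suc t) = (B - c) * E t - + 2 * (B * c) * F t
    F zero    = 0ℤ
    F (suc t) = (B - c) * F t + + 2 * E t

    add : ∀ t m → P′ (t ℕ.+ m) ≡ E t * P′ m - c * F t * Q′ m × Q′ (t ℕ.+ m) ≡ E t * Q′ m + B * F t * P′ m
    add zero m = lem c (P′ m) (Q′ m) , lem′ B (P′ m) (Q′ m)
      where
      lem : ∀ c p q → p ≡ 1ℤ * p - c * 0ℤ * q
      lem = solve-∀
      lem′ : ∀ B p q → q ≡ 1ℤ * q + B * 0ℤ * p
      lem′ = solve-∀
    add (suc t) m with add t m
    ... | e , f = trans (cong₂ (λ p q → (B - c) * p - + 2 * c * q) e f) (lem B c (E t) (F t) (P′ m) (Q′ m))
                , trans (cong₂ (λ p q → (B - c) * q + + 2 * B * p) e f) (lem′ B c (E t) (F t) (P′ m) (Q′ m))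
      where
      lem : ∀ B c E F p q → (B - c) * (E * p - c * F * q) - + 2 * c * (E * q + B * F * p) ≡ ((B - c) * E - + 2 * (B * c) * F) * p - c * ((B - c) * F + + 2 * E) * q
      lem = solve-∀
      lem′ : ∀ B c E F p q → (B - c) * (E * q + B * F * p) + + 2 * B * (E * p - c * F * q) ≡ ((B - c) * E - + 2 * (B * c) * F) * q + B * ((B - c) * F + + 2 * E) * p
      lem′ = solve-∀

    -- (√B + √-c)^(2(2k+1)) is the square of P √B + Q √-c. What matters is that both P and Q divide
    -- F (2k+1).
    F-square : ∀ k → E (suc (2 ℕ.* k)) ≡ B * (P′ k * P′ k) - c * (Q′ k * Q′ k) × F (suc (2 ℕ.* k)) ≡ + 2 * (P′ k * Q′ k)
    F-square zero = lem B c , lem′ B c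
      where
      lem : ∀ B c → (B - c) * 1ℤ - + 2 * (B * c) * 0ℤ ≡ B * (1ℤ * 1ℤ) - c * (1ℤ * 1ℤ)
      lem = solve-∀
      lem′ : ∀ B c → (B - c) * 0ℤ + + 2 * 1ℤ ≡ + 2 * (1ℤ * 1ℤ)
      lem′ = solve-∀
    F-square (suc k) with F-square k
    ... | e , f = trans (cong (λ t → E (suc t)) (ℕ.*-suc 2 k)) (trans (cong₂ (λ e f → (B - c) * ((B - c) * e - + 2 * (B * c) * f) - + 2 * (B * c) * ((B - c) * f + + 2 * e)) e f) (lem B c (P′ k) (Q′ k)))
                , trans (cong (λ t → F (suc t)) (ℕ.*-suc 2 k)) (trans (cong₂ (λ e f → (B - c) * ((B - c) * f + + 2 * e) + + 2 * ((B - c) * e - + 2 * (B * c) * f)) e f) (lem′ B c (P′ k) (Q′ k)))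
      where
      lem : ∀ B c p q → (B - c) * ((B - c) * (B * (p * p) - c * (q * q)) - + 2 * (B * c) * (+ 2 * (p * q))) - + 2 * (B * c) * ((B - c) * (+ 2 * (p * q)) + + 2 * (B * (p * p) - c * (q * q)))
        ≡ B * (((B - c) * p - + 2 * c * q) * ((B - c) * p - + 2 * c * q)) - c * (((B - c) * q + + 2 * B * p) * ((B - c) * q + + 2 * B * p))
      lem = solve-∀
      lem′ : ∀ B c p q → (B - c) * ((B - c) * (+ 2 * (p * q)) + + 2 * (B * (p * p) - c * (q * q))) + + 2 * ((B - c) * (B * (p * p) - c * (q * q)) - + 2 * (B * c) * (+ 2 * (p * q)))
        ≡ + 2 * (((B - c) * p - + 2 * c * q) * ((B - c) * q + + 2 * B * p))
      lem′ = solve-∀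

    -- The index k + j (2k + 1) belongs to the exponent (2k + 1)(2j + 1), and an odd power of P √B +
    -- Q √-c has coordinates divisible by P and by Q.
    divides-multiple : ∀ k j → (P′ k ∣ P′ (k ℕ.+ j ℕ.* suc (2 ℕ.* k))) × (Q′ k ∣ Q′ (k ℕ.+ j ℕ.* suc (2 ℕ.* k)))
    divides-multiple k zero = subst (λ w → P′ k ∣ P′ w) (sym (ℕ.+-identityʳ k)) ∣-refl , subst (λ w → Q′ k ∣ Q′ w) (sym (ℕ.+-identityʳ k)) ∣-refl
    divides-multiple k (suc j) with divides-multiple k j
    ... | d , d′ = subst (P′ k ∣_) (trans (sym (proj₁ (add t m))) (cong P′ idx)) (∣m∣n⇒∣m-n (∣n⇒∣m*n (E t) d) (∣m⇒∣m*n (Q′ m) (∣n⇒∣m*n c (subst (P′ k ∣_) (sym (proj₂ (F-square k))) (∣n⇒∣m*n (+ 2) (∣m⇒∣m*n (Q′ k) ∣-refl))))))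
                 , subst (Q′ k ∣_) (trans (sym (proj₂ (add t m))) (cong Q′ idx)) (∣m∣n⇒∣m+n (∣n⇒∣m*n (E t) d′) (∣m⇒∣m*n (P′ m) (∣n⇒∣m*n B (subst (Q′ k ∣_) (sym (proj₂ (F-square k))) (∣n⇒∣m*n (+ 2) (∣n⇒∣m*n (P′ k) ∣-refl))))))
      where
      t = suc (2 ℕ.* k)
      m = k ℕ.+ j ℕ.* t
      idx : t ℕ.+ m ≡ k ℕ.+ suc j ℕ.* t
      idx = lem t k (j ℕ.* t)
        where
        lem : ∀ t k u → t ℕ.+ (k ℕ.+ u) ≡ k ℕ.+ (t ℕ.+ u)
        lem = ℕ-Ring.solve-∀

-- Even difference of the exponents of b

module EvenGap where
  open import Data.Nat.Primality using (prime?)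
  open import Data.Integer.Base hiding (suc; NonZero)
  open import Data.Integer.Properties
  open import Data.Integer.Divisibility.Signed
  open import Data.Integer.Tactic.RingSolver using (solve-∀)
  open import Relation.Nullary.Decidable using (from-yes)
  open Vandermonde using (pos-^)
  open ZeroEstimate using (^-injective)
  open SignedDivisibility
  open Descent
  open LehmerSequences

  prime3 : Prime 3
  prime3 = from-yes (prime? 3)

  prime7 : Prime 7
  prime7 = from-yes (prime? 7)

  prime13 : Prime 13
  prime13 = from-yes (prime? 13)

  ±-∣ : ∀ {p q} → ± p ≈ q → (q ∣ p) × (p ∣ q)
  ±-∣ {p} {q} (inj₁ refl) = ∣-refl , ∣-refl
  ±-∣ {p} {q} (inj₂ refl) = ∣m⇒∣-m ∣-refl , subst (- q ∣_) (neg-involutive q) (∣m⇒∣-m ∣-refl)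

  ∣1⇒square : ∀ {q} → q ∣ 1ℤ → ± q ≈ 1ℤ
  ∣1⇒square {q} d with q | ℕ.∣1⇒≡1 (∣⇒∣ᵤ d)
  ... | + .1      | refl = inj₁ refl
  ... | -[1+ .0 ] | refl = inj₂ refl

  module _ {a} (pr : Prime a) (3≤a : 3 ℕ.≤ a) {b c x y X e : ℕ}
    (1<b : 1 ℕ.< b) (2≤c : 2 ℕ.≤ c) (1≤x : 1 ℕ.≤ x) (1≤y : 1 ℕ.≤ y) (1≤e : 1 ℕ.≤ e)
    (a∤b : ¬ (a ℕ.∣ b)) (a∤c : ¬ (a ℕ.∣ c)) (b⊥c : Coprime b c)
    (eq : a ℕ.^ x ≡ b ℕ.^ y ℕ.+ c) (Eq : a ℕ.^ X ≡ b ℕ.^ (y ℕ.+ 2 ℕ.* e) ℕ.+ c) where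

    private
      Bₙ = b ℕ.^ y
      B = + Bₙ
      γ = + c
      v = b ℕ.^ e
      instance
        b≢0 : NonZero b
        b≢0 = ℕ.>-nonZero (ℕ.<-trans (s≤s z≤n) 1<b)
      open Lehmer B γ

      b≤B : b ℕ.≤ Bₙ
      b≤B = ℕ.≤-trans (ℕ.≤-reflexive (sym (ℕ.^-identityʳ b))) (ℕ.^-monoʳ-≤ b 1≤y)

      b≤v : b ℕ.≤ v
      b≤v = ℕ.≤-trans (ℕ.≤-reflexive (sym (ℕ.^-identityʳ b))) (ℕ.^-monoʳ-≤ b 1≤e)

      b∣^ : ∀ {n} → 1 ℕ.≤ n → b ℕ.∣ b ℕ.^ n
      b∣^ {suc n} _ = ℕ.m∣m*n (b ℕ.^ n)

      norm-v : B * (+ v * + v) + γ * (1ℤ * 1ℤ) ≡ (+ a) ^ X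
      norm-v = trans (cong₂ _+_ (trans (cong (B *_) (sym (pos-* v v))) (sym (pos-* Bₙ (v ℕ.* v)))) (*-identityʳ γ))
        (trans (sym (pos-+ (Bₙ ℕ.* (v ℕ.* v)) c)) (trans (cong (λ w → + (w ℕ.+ c)) exps) (trans (cong +_ (sym Eq)) (pos-^ a X))))
        where
        exps : Bₙ ℕ.* (v ℕ.* v) ≡ b ℕ.^ (y ℕ.+ 2 ℕ.* e)
        exps = trans (cong (Bₙ ℕ.*_) (trans (sym (ℕ.^-distribˡ-+-* b e e)) (cong (λ w → b ℕ.^ (e ℕ.+ w)) (sym (ℕ.+-identityʳ e))))) (sym (ℕ.^-distribˡ-+-* b y (2 ℕ.* e)))

      a∤ : ∀ n → ¬ (+ a ∣ + (b ℕ.^ n))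
      a∤ n d = a∤b (prime∣^ℕ pr b n (ℤ∣⇒ℕ∣ d))

      found = odd-power pr 3≤a x 1≤x Bₙ c (ℕ.≤-trans 1<b b≤B) 2≤c (sym eq) (a∤ y) (λ d → a∤c (ℤ∣⇒ℕ∣ d)) X (+ v) 1ℤ norm-v (a∤ e)

      prime∤c : ∀ {s} → Prime s → s ℕ.∣ b → ¬ (+ s ∣ γ)
      prime∤c sp d d′ = ℕ.<⇒≢ (1<prime sp) (sym (b⊥c (d , ℤ∣⇒ℕ∣ d′)))

      prime∤-c^ : ∀ {s} → Prime s → s ℕ.∣ b → ∀ n → ¬ (+ s ∣ (- γ) ^ n)
      prime∤-c^ sp d n d′ = prime∤c sp d (subst (_ ∣_) (neg-involutive γ) (∣m⇒∣-m (prime∣^ sp (- γ) n d′)))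

      s∣B : ∀ {s} → s ℕ.∣ b → + s ∣ B
      s∣B d = ℕ∣⇒ℤ∣ (ℕ.∣-trans d (b∣^ 1≤y))

      index : ∀ m → + 2 * + m + 1ℤ ≡ + suc (2 ℕ.* m)
      index m = trans (cong (λ w → w + 1ℤ) (sym (pos-* 2 m))) (cong +_ (ℕ.+-comm (2 ℕ.* m) 1))

      -- The component P of the (2m+1)-st power is (2m+1)(-c)^m modulo any prime divisor of b.
      rank : ∀ {s} m → Prime s → s ℕ.∣ b → + s ∣ P B γ m → s ℕ.∣ suc (2 ℕ.* m)
      rank {s} m sp d d′ with mod-B m
      ... | k , _ , e₁ , _ with euclidℤ sp _ _ (subst (+ s ∣_) (trans (cong (λ w → w - B * k) e₁) (lem _ (B * k))) (∣m∣n⇒∣m-n d′ (∣m⇒∣m*n k (s∣B d))))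
        where
        lem : ∀ u w → (u + w) - w ≡ u
        lem = solve-∀
      ... | inj₁ d″ = ℤ∣⇒ℕ∣ (subst (+ s ∣_) (index m) d″)
      ... | inj₂ d″ = ⊥-elim (prime∤-c^ sp d m d″)

      module Found (m : ℕ) (v≈P : ± + v ≈ P B γ m) (1≈Q : ± 1ℤ ≈ Q B γ m) where
        -- A prime r = 2k + 1 dividing b divides the exponent 2m + 1, so already the r-th power of
        -- √B + √-c has coordinates that divide b^e and 1.
        record Root (r : ℕ) : Set where
          field
            k      : ℕ
            r≡     : r ≡ suc (2 ℕ.* k)
            P∣v    : P B γ k ∣ + v
            Q±1    : ± Q B γ k ≈ 1ℤ

        root : ∀ {r} → Prime r → r ℕ.∣ b → Root r
        root {r} rp d with rank m rp d (∣-trans (ℕ∣⇒ℤ∣ (ℕ.∣-trans d (b∣^ 1≤e))) (proj₂ (±-∣ v≈P)))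
        ... | ℕ.divides t e₁ with odd-product m r t (trans e₁ (ℕ.*-comm t r))
        ... | k , j , refl , m≡ = record
          { k = k ; r≡ = refl
          ; P∣v = ∣-trans (subst (λ w → P B γ k ∣ P B γ w) (sym m≡) (proj₁ (divides-multiple k j))) (proj₁ (±-∣ v≈P))
          ; Q±1 = ∣1⇒square (∣-trans (subst (λ w → Q B γ k ∣ Q B γ w) (sym m≡) (proj₂ (divides-multiple k j))) (proj₁ (±-∣ 1≈Q))) }

        module _ {r} (rp : Prime r) (r∣b : r ℕ.∣ b) (R : Root r) where
          open Root R
          Pₙ = ∣ P B γ k ∣

          Pₙ≢0 : NonZero Pₙ
          Pₙ≢0 = ℕ.≢-nonZero λ e → ℕ.<⇒≢ (ℕ.<-≤-trans (ℕ.<-trans (s≤s z≤n) 1<b) b≤v)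
            (sym (ℕ.0∣⇒≡0 (subst (ℕ._∣ v) e (∣⇒∣ᵤ P∣v))))

          ∣b : ∀ s → Prime s → s ℕ.∣ Pₙ → s ℕ.∣ b
          ∣b s sp d = prime∣^ℕ sp b e (ℕ.∣-trans d (∣⇒∣ᵤ P∣v))

          only-r : ∀ s → Prime s → s ℕ.∣ Pₙ → s ≡ r
          only-r s sp d = prime∣prime sp rp (subst (s ℕ.∣_) (sym r≡) (rank k sp (∣b s sp d) (∣ᵤ⇒∣ d)))

          r∣P : r ℕ.∣ Pₙ
          r∣P with mod-B k
          ... | k₁ , _ , e₁ , _ = ∣⇒∣ᵤ (subst (+ r ∣_) (sym e₁) (∣m∣n⇒∣m+n (∣m⇒∣m*n _ (subst (+ r ∣_) (trans (cong +_ r≡) (sym (index k))) ∣-refl)) (∣m⇒∣m*n k₁ (s∣B r∣b))))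

          -- In `mod-B²` the second term has a factor r from 2k + 1 and another from B, so modulo r²
          -- only a multiple 3 r (-c)^(k+1) survives; r ≥ 5 makes 3 a unit.
          r²∤P : 5 ℕ.≤ r → ¬ (r ℕ.* r ℕ.∣ Pₙ)
          r²∤P 5≤r d with mod-B² k
          ... | k₁ , _ , e₁ , _ = contra (euclidℤ rp (+ 3) _ r∣3w)
            where
            ρ = + r
            w = - γ * (- γ) ^ k
            ρ² : ρ * ρ ∣ P B γ k
            ρ² = subst (_∣ P B γ k) (pos-* r r) (∣ᵤ⇒∣ d)
            ρ≡ : + 2 * + k + 1ℤ ≡ ρ
            ρ≡ = trans (index k) (cong +_ (sym r≡))
            isolate : ∀ n u z t → (+ 3 * n * u + z + t) - t - z ≡ n * (+ 3 * u)
            isolate = solve-∀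
            square : ∀ {s t} → ρ ∣ s → ρ ∣ t → ρ * ρ ∣ s * t
            square (divides p refl) (divides q refl) = divides (p * q) (lem p q ρ)
              where
              lem : ∀ p q r → (p * r) * (q * r) ≡ (p * q) * (r * r)
              lem = solve-∀
            r∣3w : ρ ∣ + 3 * w
            r∣3w = ∣*-cancel {ρ} (prime≢0 rp) (subst (ρ * ρ ∣_) (trans (cong (λ u → u - B * B * k₁ - (+ 2 * + k + 1ℤ) * + k * (+ 2 * + k - 1ℤ) * (B * (- γ) ^ k)) e₁)
                (trans (isolate (+ 2 * + k + 1ℤ) w _ (B * B * k₁)) (cong (_* (+ 3 * w)) ρ≡)))
              (∣m∣n⇒∣m-n (∣m∣n⇒∣m-n (∣n⇒∣m*n (+ 3) (∣n⇒∣m*n (- γ) ρ²)) (∣m⇒∣m*n k₁ (square (s∣B r∣b) (s∣B r∣b))))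
                (subst (ρ * ρ ∣_) (lem (+ 2 * + k + 1ℤ) (+ k) (+ 2 * + k - 1ℤ) (B * (- γ) ^ k)) (square (subst (ρ ∣_) (sym ρ≡) ∣-refl)
                  (∣n⇒∣m*n (+ k * (+ 2 * + k - 1ℤ)) (∣m⇒∣m*n ((- γ) ^ k) (s∣B r∣b)))))))
              where
              lem : ∀ n k h u → n * (k * h * u) ≡ n * k * h * u
              lem = solve-∀
            contra : (ρ ∣ + 3) ⊎ (ρ ∣ w) → ⊥
            contra (inj₁ d) = ℕ.>⇒∤ {n = 3} (ℕ.≤-trans (ℕ.n≤1+n 4) 5≤r) (∣⇒∣ᵤ d)
            contra (inj₂ d) = prime∤-c^ rp r∣b (suc k) d

          P≡r : ¬ (r ℕ.* r ℕ.∣ Pₙ) → Pₙ ≡ r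
          P≡r ¬sq = case (only-prime {r} {Pₙ} {{Pₙ≢0}} only-r ¬sq)
            where
            case : Pₙ ≡ 1 ⊎ Pₙ ≡ r → Pₙ ≡ r
            case (inj₁ e) = ⊥-elim (ℕ.<⇒≢ (1<prime rp) (sym (ℕ.∣1⇒≡1 (subst (r ℕ.∣_) e r∣P))))
            case (inj₂ e) = e

          Q²≡1 : Q B γ k * Q B γ k ≡ 1ℤ
          Q²≡1 with Q±1
          ... | inj₁ e = cong₂ _*_ e e
          ... | inj₂ e = cong₂ _*_ e e

          r≤B : r ℕ.≤ Bₙ
          r≤B = ℕ.≤-trans (ℕ.∣⇒≤ r∣b) b≤B

          -- With |P| = r and Q = ±1 the norm reads B r² + c = (B + c)^r, which is too large since r
          -- ≤ b ≤ B.
          not-large : 5 ℕ.≤ r → ⊥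
          not-large 5≤r = ℕ.<⇒≢ (begin-strict
              Bₙ ℕ.* (r ℕ.* r) ℕ.+ c             <⟨ ℕ.+-monoʳ-< (Bₙ ℕ.* (r ℕ.* r)) (ℕ.m<m*n c (r ℕ.* r) {{ℕ.>-nonZero (ℕ.<-trans (s≤s z≤n) 2≤c)}} (ℕ.*-mono-≤ {1} {r} {2} {r} (ℕ.<⇒≤ (1<prime rp)) (1<prime rp))) ⟩
              Bₙ ℕ.* (r ℕ.* r) ℕ.+ c ℕ.* (r ℕ.* r) ≡⟨ lem Bₙ c r ⟩
              (Bₙ ℕ.+ c) ℕ.* (r ℕ.* r)           ≤⟨ ℕ.*-monoʳ-≤ (Bₙ ℕ.+ c) (ℕ.*-mono-≤ r≤ (ℕ.≤-trans r≤ (ℕ.≤-reflexive (sym (ℕ.*-identityʳ (Bₙ ℕ.+ c)))))) ⟩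
              (Bₙ ℕ.+ c) ℕ.^ 3                   ≤⟨ ℕ.^-monoʳ-≤ (Bₙ ℕ.+ c) {{ℕ.>-nonZero (ℕ.≤-trans (s≤s z≤n) r≤′)}} (ℕ.≤-trans (ℕ.m≤m+n 3 2) 5≤r) ⟩
              (Bₙ ℕ.+ c) ℕ.^ r ∎)
              (+-injective (trans (pos-+ (Bₙ ℕ.* (r ℕ.* r)) c) (trans (cong₂ _+_ (trans (pos-* Bₙ (r ℕ.* r)) (cong (B *_) (trans (cong (λ w → + (w ℕ.* w)) (sym (P≡r (r²∤P 5≤r)))) (sym (sq-abs (P B γ k))))))
                  (trans (sym (*-identityʳ γ)) (cong (γ *_) (sym Q²≡1)))) (trans (norm k) (trans (cong₂ _^_ (sym (pos-+ Bₙ c)) (sym r≡)) (sym (pos-^ (Bₙ ℕ.+ c) r)))))))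
            where
            open ℕ.≤-Reasoning
            r≤ : r ℕ.≤ Bₙ ℕ.+ c
            r≤ = ℕ.≤-trans r≤B (ℕ.m≤m+n Bₙ c)
            r≤′ : 1 ℕ.≤ Bₙ ℕ.+ c
            r≤′ = ℕ.≤-trans (ℕ.<⇒≤ (1<prime rp)) r≤
            lem : ∀ B c r → B ℕ.* (r ℕ.* r) ℕ.+ c ℕ.* (r ℕ.* r) ≡ (B ℕ.+ c) ℕ.* (r ℕ.* r)
            lem = ℕ-Ring.solve-∀

        three : ∀ s → Prime s → s ℕ.∣ b → s ≡ 3
        three s sp d = by-index (Root.k R) (Root.r≡ R)
          where
          R = root sp d
          lem : ∀ k → 4 ℕ.+ 2 ℕ.* k ≡ 2 ℕ.* (2 ℕ.+ k)
          lem = ℕ-Ring.solve-∀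
          by-index : ∀ k → s ≡ suc (2 ℕ.* k) → s ≡ 3
          by-index 0 e = ⊥-elim (ℕ.<⇒≢ (1<prime sp) (sym e))
          by-index 1 e = e
          by-index (suc (suc k)) e = ⊥-elim (not-large sp d R (subst (5 ℕ.≤_) (sym e) (s≤s (ℕ.≤-trans (ℕ.m≤m+n 4 (2 ℕ.* k)) (ℕ.≤-reflexive (lem k))))))

        3∣b : 3 ℕ.∣ b
        3∣b = let (p , pp , d) = prime-divisor 1<b in subst (ℕ._∣ b) (three p pp d) d

        module Three (R : Root 3) (k≡1 : Root.k R ≡ 1) where
          open Root R
          Q-form : (B - γ) * 1ℤ + + 2 * B * 1ℤ ≡ + 3 * B - γ
          Q-form = lem B γ
            where
            lem : ∀ B c → (B - c) * 1ℤ + + 2 * B * 1ℤ ≡ + 3 * B - c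
            lem = solve-∀

          c≡ : γ ≡ + 3 * B - 1ℤ ⊎ γ ≡ + 3 * B + 1ℤ
          c≡ with subst (λ w → ± Q B γ w ≈ 1ℤ) k≡1 Q±1
          ... | inj₁ e = inj₁ (trans (lem B γ) (cong (λ w → + 3 * B - w) (trans (sym Q-form) e)))
            where
            lem : ∀ B c → c ≡ + 3 * B - (+ 3 * B - c)
            lem = solve-∀
          ... | inj₂ e = inj₂ (trans (lem B γ) (cong (λ w → + 3 * B - w) (trans (sym Q-form) e)))
            where
            lem : ∀ B c → c ≡ + 3 * B - (+ 3 * B - c)
            lem = solve-∀

          P-form : P B γ 1 ≡ B - + 3 * γ
          P-form = lem B γ
            where
            lem : ∀ B c → (B - c) * 1ℤ - + 2 * c * 1ℤ ≡ B - + 3 * c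
            lem = solve-∀

          -- |P| = 8B ± 3 has no prime factor besides 3, and 9 would force |P| = 3.
          9∤B : ¬ (9 ℕ.∣ Bₙ)
          9∤B d = ℕ.<⇒≢ (ℕ.<-≤-trans (ℕ.m≤m+n 4 5) (ℕ.∣⇒≤ {{ℕ.m^n≢0 b y}} d)) (sym (small c≡ (trans (cong (λ w → ∣ P B γ w ∣) (sym k≡1)) (P≡r prime3 3∣b R 9∤P))))
            where
            9∣B : + 9 ∣ B
            9∣B = ℕ∣⇒ℤ∣ d
            no9 : ∀ z → ± z ≈ (+ 3) → ¬ (+ 9 ∣ B - + 3 * (+ 3 * B) + z)
            no9 z s d′ = ℕ.>⇒∤ {n = 3} (ℕ.m≤m+n 4 5) (∣⇒∣ᵤ (∣-trans (subst (+ 9 ∣_) (lem B z) (∣m∣n⇒∣m+n d′ (∣n⇒∣m*n (+ 8) 9∣B))) (proj₂ (±-∣ s))))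
              where
              lem : ∀ B z → B - + 3 * (+ 3 * B) + z + + 8 * B ≡ z
              lem = solve-∀
            9∤P : ¬ (3 ℕ.* 3 ℕ.∣ ∣ P B γ k ∣)
            9∤P d′ with c≡ | ∣ᵤ⇒∣ {+ 9} {P B γ k} d′
            ... | inj₁ e | d″ = no9 (+ 3) (inj₁ refl) (subst (+ 9 ∣_) (trans (cong (P B γ) k≡1) (trans P-form (trans (cong (λ w → B - + 3 * w) e) (lem B)))) d″)
              where
              lem : ∀ B → B - + 3 * (+ 3 * B - 1ℤ) ≡ B - + 3 * (+ 3 * B) + + 3
              lem = solve-∀
            ... | inj₂ e | d″ = no9 (- + 3) (inj₂ refl) (subst (+ 9 ∣_) (trans (cong (P B γ) k≡1) (trans P-form (trans (cong (λ w → B - + 3 * w) e) (lem B)))) d″)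
              where
              lem : ∀ B → B - + 3 * (+ 3 * B + 1ℤ) ≡ B - + 3 * (+ 3 * B) + - + 3
              lem = solve-∀
            small : (γ ≡ + 3 * B - 1ℤ ⊎ γ ≡ + 3 * B + 1ℤ) → ∣ P B γ 1 ∣ ≡ 3 → Bₙ ≡ 3
            small s e₁ = ⊥-elim (impossible s)
              where
              P∣3 : ∀ {z} → P B γ 1 ≡ z → z ∣ + 3
              P∣3 e = ∣ᵤ⇒∣ (ℕ.∣-reflexive (trans (cong ∣_∣ (sym e)) e₁))
              9≤B : 9 ℕ.≤ Bₙ
              9≤B = ℕ.∣⇒≤ {{ℕ.m^n≢0 b y}} d
              too-big : ∀ n → 3 ℕ.< n → ¬ (- + n ∣ + 3)
              too-big (suc n) lt d = ℕ.>⇒∤ {n = 3} lt (∣⇒∣ᵤ d)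
              impossible : (γ ≡ + 3 * B - 1ℤ ⊎ γ ≡ + 3 * B + 1ℤ) → ⊥
              impossible (inj₁ e) = too-big (8 ℕ.* Bₙ ℕ.∸ 3) (ℕ.≤-trans (ℕ.m≤m+n 4 65) (ℕ.∸-monoˡ-≤ 3 (ℕ.*-monoʳ-≤ 8 9≤B)))
                (P∣3 (trans P-form (trans (cong (λ w → B - + 3 * w) e) (trans (lem B) (cong -_ (trans (cong (λ w → w - + 3) (sym (pos-* 8 Bₙ))) (trans (m-n≡m⊖n (8 ℕ.* Bₙ) 3) (⊖-≥ (ℕ.≤-trans (ℕ.m≤m+n 3 69) (ℕ.*-monoʳ-≤ 8 9≤B))))))))))
                where
                lem : ∀ B → B - + 3 * (+ 3 * B - 1ℤ) ≡ - (+ 8 * B - + 3)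
                lem = solve-∀
              impossible (inj₂ e) = too-big (8 ℕ.* Bₙ ℕ.+ 3) (ℕ.≤-trans (ℕ.m≤m+n 4 71) (ℕ.+-monoˡ-≤ 3 (ℕ.*-monoʳ-≤ 8 9≤B)))
                (P∣3 (trans P-form (trans (cong (λ w → B - + 3 * w) e) (trans (lem B) (cong -_ (trans (cong (λ w → w + + 3) (sym (pos-* 8 Bₙ))) (sym (pos-+ (8 ℕ.* Bₙ) 3))))))))
                where
                lem : ∀ B → B - + 3 * (+ 3 * B + 1ℤ) ≡ - (+ 8 * B + + 3)
                lem = solve-∀

          B≡3 : Bₙ ≡ 3
          B≡3 = case (only-prime {3} {Bₙ} {{ℕ.m^n≢0 b y}} (λ s sp d → three s sp (prime∣^ℕ sp b y d)) 9∤B)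
            where
            case : Bₙ ≡ 1 ⊎ Bₙ ≡ 3 → Bₙ ≡ 3
            case (inj₁ e) = ⊥-elim (ℕ.<⇒≢ (ℕ.<-≤-trans 1<b b≤B) (sym e))
            case (inj₂ e) = e

          c≡10 : c ≡ 10
          c≡10 with c≡
          ... | inj₂ e = +-injective (trans e (cong (λ w → + 3 * + w + 1ℤ) B≡3))
          -- Here c = 8 and P = -21, so 7 would be a prime divisor of b.
          ... | inj₁ e = ⊥-elim (absurd (three 7 prime7 (∣b prime3 3∣b R 7 prime7 (∣⇒∣ᵤ (subst (+ 7 ∣_) (sym P≡) (divides (- + 3) refl))))))
            where
            absurd : 7 ≡ 3 → ⊥
            absurd ()
            P≡ : P B γ k ≡ - + 21
            P≡ = trans (cong (P B γ) k≡1) (trans P-form (trans (cong (λ w → B - + 3 * w) e) (cong (λ w → + w - + 3 * (+ 3 * + w - 1ℤ)) B≡3)))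

        three-root : Root 3
        three-root = root prime3 3∣b

        conclusion : a ≡ 13 × b ≡ 3 × c ≡ 10 × x ≡ 1 × y ≡ 1
        conclusion = a≡13 , b≡3 , T.c≡10 , x≡1 , y≡1
          where
          module T = Three three-root (sym (ℕ.*-cancelˡ-≡ 1 (Root.k three-root) 2 (ℕ.suc-injective (Root.r≡ three-root))))
          b≡3 : b ≡ 3
          b≡3 = ℕ.≤-antisym (subst (b ℕ.≤_) T.B≡3 b≤B) (ℕ.∣⇒≤ 3∣b)
          y≡1 : y ≡ 1
          y≡1 = ^-injective {3} (s≤s (s≤s z≤n)) (trans (cong (ℕ._^ y) (sym b≡3)) T.B≡3)
          a^x≡13 : a ℕ.^ x ≡ 13
          a^x≡13 = trans eq (cong₂ ℕ._+_ T.B≡3 T.c≡10)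
          a≡13 : a ≡ 13
          a≡13 = prime∣prime pr prime13 (subst (a ℕ.∣_) a^x≡13 (a∣ 1≤x))
            where
            a∣ : ∀ {n} → 1 ℕ.≤ n → a ℕ.∣ a ℕ.^ n
            a∣ {suc n} _ = ℕ.m∣m*n (a ℕ.^ n)
          x≡1 : x ≡ 1
          x≡1 = ^-injective {13} (s≤s (s≤s z≤n)) (trans (cong (ℕ._^ x) (sym a≡13)) a^x≡13)

    exceptional : a ≡ 13 × b ≡ 3 × c ≡ 10 × x ≡ 1 × y ≡ 1
    exceptional = let (m , v≈P , 1≈Q) = found in Found.conclusion m v≈P 1≈Q

-- The case c = 1 through geometric sums

module UnitGap where
  open import Data.Nat.Base
  open import Data.Nat.Properties
  open import Data.Nat.Divisibility
  open import Data.Nat.DivMod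
  open import Data.Nat.Tactic.RingSolver using (solve-∀)
  open import Data.Nat.Primality using (prime?)
  open import Relation.Nullary.Decidable using (from-yes)
  open SignedDivisibility using (prime∣^ℕ)
  open LehmerSequences using (1<prime; prime-divisor; only-prime; prime∣prime)
  open EvenGap using (prime3)

  ∣m+n∣n⇒∣m : ∀ {i m n} → i ∣ m + n → i ∣ n → i ∣ m
  ∣m+n∣n⇒∣m {i} {m} {n} d = ∣m+n∣m⇒∣n (subst (i ∣_) (+-comm m n) d)

  geo : ℕ → ℕ → ℕ
  geo u zero    = 0
  geo u (suc n) = 1 + u * geo u n

  geo-+ : ∀ u m n → geo u (m + n) ≡ geo u m + u ^ m * geo u n
  geo-+ u zero    n = sym (+-identityʳ (geo u n))
  geo-+ u (suc m) n = trans (cong (λ w → 1 + u * w) (geo-+ u m n)) (lem u (geo u m) (u ^ m) (geo u n))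
    where
    lem : ∀ u g p h → 1 + u * (g + p * h) ≡ 1 + u * g + u * p * h
    lem = solve-∀

  geo-∣ : ∀ u m t → geo u m ∣ geo u (t * m)
  geo-∣ u m zero    = _ ∣0
  geo-∣ u m (suc t) = subst (geo u m ∣_) (sym (geo-+ u m (t * m))) (∣m∣n⇒∣m+n ∣-refl (∣n⇒∣m*n (u ^ m) (geo-∣ u m t)))

  module _ (B : ℕ) where
    private u = suc B

    geo-power : ∀ n → B * geo u n + 1 ≡ u ^ n
    geo-power zero    = cong (_+ 1) (*-zeroʳ B)
    geo-power (suc n) = trans (lem B (geo u n)) (cong (u *_) (geo-power n))
      where
      lem : ∀ B g → B * (1 + (1 + B) * g) + 1 ≡ (1 + B) * (B * g + 1)
      lem = solve-∀

    geo-mod : ∀ n → ∃[ t ] geo u n ≡ n + B * t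
    geo-mod zero = 0 , sym (*-zeroʳ B)
    geo-mod (suc n) with geo-mod n
    ... | t , e = t + geo u n , trans (cong suc (cong (_+ B * geo u n) e)) (lem n B t (geo u n))
      where
      lem : ∀ n B t g → suc (n + B * t + B * g) ≡ suc n + B * (t + g)
      lem = solve-∀

    -- geo u n = n + C(n, 2) B + ..., doubled, with B n moved to the left to avoid subtraction.
    geo-mod² : ∀ n → ∃[ t ] 2 * geo u n + B * n ≡ 2 * n + B * (n * n) + B * B * t
    geo-mod² zero = 0 , lem B
      where
      lem : ∀ B → 0 + B * 0 ≡ 0 + B * 0 + B * B * 0
      lem = solve-∀
    geo-mod² (suc n) with geo-mod² n | geo-mod n
    ... | t , e | t₁ , e₁ = t + 2 * t₁ , trans (lem B n (geo u n)) (trans (cong₂ (λ p q → p + 2 * (B * q) + B + 2) e e₁) (lem′ B n t t₁))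
      where
      lem : ∀ B n g → 2 * (1 + (1 + B) * g) + B * (1 + n) ≡ (2 * g + B * n) + 2 * (B * g) + B + 2
      lem = solve-∀
      lem′ : ∀ B n t t₁ → (2 * n + B * (n * n) + B * B * t) + 2 * (B * (n + B * t₁)) + B + 2 ≡ 2 * (1 + n) + B * ((1 + n) * (1 + n)) + B * B * (t + 2 * t₁)
      lem′ = solve-∀

  module _ {a} (pr : Prime a) (5≤a : 5 ≤ a) {b x y X d : ℕ} (1<b : 1 < b) (1≤x : 1 ≤ x) (1≤y : 1 ≤ y)
    (eq : a ^ x ≡ b ^ y + 1) (Eq : a ^ X ≡ b ^ (y + d) + 1) where

    private
      B = b ^ y
      u = suc B
      instance
        b≢0 : NonZero b
        b≢0 = >-nonZero (<-trans (s≤s z≤n) 1<b)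
        B≢0 : NonZero B
        B≢0 = m^n≢0 b y
        x≢0 : NonZero x
        x≢0 = >-nonZero 1≤x
        a≢0 : NonZero a
        a≢0 = >-nonZero (≤-trans (s≤s z≤n) 5≤a)

      b∣^ : ∀ {n} → 1 ≤ n → b ∣ b ^ n
      b∣^ {suc n} _ = m∣m*n (b ^ n)

      a^x≡u : a ^ x ≡ u
      a^x≡u = trans eq (+-comm B 1)

      k = X / x
      r = X % x

      a^X : a ^ X ≡ a ^ r * (B * geo u k + 1)
      a^X = trans (cong (a ^_) (m≡m%n+[m/n]*n X x)) (trans (^-distribˡ-+-* a r (k * x)) (cong (a ^ r *_)
        (trans (cong (a ^_) (*-comm k x)) (trans (sym (^-*-assoc a x k)) (trans (cong (_^ k) a^x≡u) (sym (geo-power B k)))))))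

      a^X′ : a ^ X ≡ B * b ^ d + 1
      a^X′ = trans Eq (cong (_+ 1) (^-distribˡ-+-* b y d))

      a^r<u : a ^ r < u
      a^r<u = subst (a ^ r <_) a^x≡u (^-monoʳ-< a (≤-trans (s≤s (s≤s z≤n)) 5≤a) (m%n<n X x))

      -- u = B + 1 is 1 modulo B, hence a^r ≡ a^X ≡ 1. Since a^r < u this forces a^r = 1.
      B∣ : B ∣ a ^ r ∸ 1
      B∣ = ∣m+n∣m⇒∣n {m = B * (a ^ r * geo u k)} (subst (B ∣_) shifted (m∣m*n (b ^ d))) (m∣m*n (a ^ r * geo u k))
        where
        lem : ∀ p B g → p * (B * g + 1) ≡ B * (p * g) + p
        lem = solve-∀
        shifted : B * b ^ d ≡ B * (a ^ r * geo u k) + (a ^ r ∸ 1)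
        shifted = +-cancelʳ-≡ 1 _ _ (trans (sym a^X′) (trans a^X (trans (lem (a ^ r) B (geo u k))
          (trans (cong (B * (a ^ r * geo u k) +_) (sym (m∸n+n≡m (m^n>0 a r)))) (sym (+-assoc (B * (a ^ r * geo u k)) (a ^ r ∸ 1) 1))))))

      a^r≡1 : a ^ r ≡ 1
      a^r≡1 = trans (sym (m∸n+n≡m (m^n>0 a r))) (cong (_+ 1) (small (a ^ r ∸ 1) B∣ (≤-<-trans (≤-reflexive refl) (∸-monoˡ-< a^r<u (m^n>0 a r)))))
        where
        small : ∀ n → B ∣ n → n < B → n ≡ 0
        small zero    _ _  = refl
        small (suc n) dv lt = ⊥-elim (<⇒≱ lt (∣⇒≤ dv))

      geo-k : geo u k ≡ b ^ d
      geo-k = *-cancelˡ-≡ (geo u k) (b ^ d) B (+-cancelʳ-≡ 1 _ _ (trans (sym (trans a^X (trans (cong (_* (B * geo u k + 1)) a^r≡1) (*-identityˡ _)))) a^X′))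

      module _ (1≤d : 1 ≤ d) where
        s∣k : ∀ {s} → s ∣ b → s ∣ k
        s∣k {s} dv with geo-mod B k
        ... | t , e = ∣m+n∣n⇒∣m (subst (s ∣_) (trans (sym geo-k) e) (∣-trans dv (b∣^ 1≤d))) (∣m⇒∣m*n t (∣-trans dv (b∣^ 1≤y)))

        geo-s∣ : ∀ {s} → s ∣ b → geo u s ∣ b ^ d
        geo-s∣ {s} dv with s∣k dv
        ... | divides t e = subst (geo u s ∣_) (trans (cong (geo u) (sym e)) geo-k) (geo-∣ u s t)

        only : ∀ {s} → Prime s → s ∣ b → ∀ p → Prime p → p ∣ geo u s → p ≡ s
        only {s} sp dv p pp p∣ with geo-mod B s
        ... | t , e = prime∣prime pp sp (∣m+n∣n⇒∣m (subst (p ∣_) e p∣) (∣m⇒∣m*n t (∣-trans (prime∣^ℕ pp b d (∣-trans p∣ (geo-s∣ dv))) (b∣^ 1≤y))))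

        geo-big : ∀ {s} → 2 ≤ s → u < geo u s
        geo-big {suc zero} (s≤s ())
        geo-big {suc (suc s)} _ = s≤s (≤-trans (≤-reflexive (sym (*-identityʳ u))) (*-monoʳ-≤ u (s≤s z≤n)))

        geo-nonZero : ∀ {s} → 2 ≤ s → NonZero (geo u s)
        geo-nonZero le = >-nonZero (≤-<-trans z≤n (geo-big le))

        -- The divisor geo u s of b^d has no prime factor but s, and for odd s not its square; yet
        -- it exceeds u > s.
        two : ∀ s → Prime s → s ∣ b → s ≡ 2
        two s sp dv with s ≟ 2
        ... | yes e = e
        ... | no s≢2 = ⊥-elim (case (only-prime {s} {geo u s} {{geo-nonZero (1<prime sp)}} (only sp dv) ¬sq))
          where
          s≤B : s ≤ B
          s≤B = ∣⇒≤ (∣-trans dv (b∣^ 1≤y))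
          case : geo u s ≡ 1 ⊎ geo u s ≡ s → ⊥
          case (inj₁ e) = <⇒≱ (geo-big (1<prime sp)) (≤-trans (≤-reflexive e) (s≤s z≤n))
          case (inj₂ e) = <⇒≱ (geo-big (1<prime sp)) (≤-trans (≤-reflexive e) (≤-trans s≤B (n≤1+n B)))
          ¬sq : ¬ (s * s ∣ geo u s)
          ¬sq sq with geo-mod² B s
          ... | t , e = s≢2 (prime∣prime sp (from-yes (prime? 2)) (*-cancelʳ-∣ s {{>-nonZero (<-trans (s≤s z≤n) (1<prime sp))}}
                  (∣m+n∣n⇒∣m {n = B * (s * s) + B * B * t} (subst (s * s ∣_) (trans e (+-assoc (2 * s) (B * (s * s)) (B * B * t))) (∣m∣n⇒∣m+n (∣n⇒∣m*n 2 sq) (*-pres-∣ s∣B ∣-refl)))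
                    (∣m∣n⇒∣m+n (∣n⇒∣m*n B ∣-refl) (∣m⇒∣m*n t (*-pres-∣ s∣B s∣B))))))
            where s∣B = ∣-trans dv (b∣^ 1≤y)

        2∣b : 2 ∣ b
        2∣b = let (p , pp , dv) = prime-divisor 1<b in subst (_∣ b) (two p pp dv) dv

        -- geo u 2 = B + 2 is a power of two, and it would not be divisible by 4.
        4∤B : ¬ (4 ∣ B)
        4∤B dv = case (only-prime {2} {geo u 2} {{geo-nonZero ≤-refl}} (only (from-yes (prime? 2)) 2∣b) ¬4)
          where
          geo2 : geo u 2 ≡ B + 2
          geo2 = lem B
            where
            lem : ∀ B → 1 + (1 + B) * (1 + (1 + B) * 0) ≡ B + 2
            lem = solve-∀
          ¬4 : ¬ (2 * 2 ∣ geo u 2)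
          ¬4 d4 = >⇒∤ {n = 2} (s≤s (s≤s (s≤s z≤n))) (∣m+n∣m⇒∣n (subst (4 ∣_) geo2 d4) dv)
          case : geo u 2 ≡ 1 ⊎ geo u 2 ≡ 2 → ⊥
          case (inj₁ e) = <⇒≱ (geo-big {2} ≤-refl) (≤-trans (≤-reflexive e) (s≤s z≤n))
          case (inj₂ e) = <⇒≱ (geo-big {2} ≤-refl) (≤-trans (≤-reflexive e) (s≤s (m^n>0 b y)))

        B≡2 : B ≡ 2
        B≡2 = case (only-prime {2} {B} (λ s sp dv → two s sp (prime∣^ℕ sp b y dv)) 4∤B)
          where
          case : B ≡ 1 ⊎ B ≡ 2 → B ≡ 2
          case (inj₁ e) = ⊥-elim (<⇒≱ 1<b (≤-trans (∣⇒≤ (b∣^ 1≤y)) (≤-reflexive e)))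
          case (inj₂ e) = e

    c≢1 : 1 ≤ d → ⊥
    c≢1 1≤d = <⇒≱ (≤-trans (n≤1+n 4) 5≤a) (≤-reflexive (prime∣prime pr prime3 (subst (a ∣_) (trans eq (cong (_+ 1) (B≡2 1≤d))) (a∣ 1≤x))))
      where
      a∣ : ∀ {n} → 1 ≤ n → a ∣ a ^ n
      a∣ {suc n} _ = m∣m*n (a ^ n)

-- Fermat's theorem, orders modulo a, lifting the exponent

module LiftingExponent where
  open import Data.Nat.Primality using (euclidsLemma)
  open import Data.Integer.Base hiding (suc; NonZero)
  open import Data.Integer.Properties
  open import Data.Integer.Divisibility.Signed
  open import Data.Integer.Tactic.RingSolver using (solve-∀)
  open Siegel using (Σ<)
  open Vandermonde using (bin; bin-rec; pos-^)
  open Criterion using (∣-^)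
  open SignedDivisibility
  open LehmerSequences using (1<prime)

  binomial-sum : ∀ (e : ℤ) n j → Σ< (suc j) (λ i → + bin (suc n) i * e ^ i) ≡ (1ℤ + e) * Σ< j (λ i → + bin n i * e ^ i) + + bin n j * e ^ j
  binomial-sum e n zero = lem e
    where
    lem : ∀ e → 0ℤ + 1ℤ * 1ℤ ≡ (1ℤ + e) * 0ℤ + 1ℤ * 1ℤ
    lem = solve-∀
  binomial-sum e n (suc j) = trans (cong₂ _+_ (binomial-sum e n j) (cong (_* (e * e ^ j)) (pos-+ (bin n j) (bin n (suc j)))))
      (lem e (Σ< j (λ i → + bin n i * e ^ i)) (+ bin n j) (+ bin n (suc j)) (e ^ j))
    where
    lem : ∀ e T p q u → ((1ℤ + e) * T + p * u) + (p + q) * (e * u) ≡ (1ℤ + e) * (T + p * u) + q * (e * u)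
    lem = solve-∀

  bin-0 : ∀ n k → n ℕ.< k → bin n k ≡ 0
  bin-0 zero    (suc k) _        = refl
  bin-0 (suc n) (suc k) (s≤s lt) = cong₂ ℕ._+_ (bin-0 n k lt) (bin-0 n (suc k) (ℕ.m<n⇒m<1+n lt))

  binomial : ∀ (e : ℤ) n → (1ℤ + e) ^ n ≡ Σ< (suc n) (λ i → + bin n i * e ^ i)
  binomial e zero    = refl
  binomial e (suc n) = sym (trans (binomial-sum e n (suc n)) (trans (cong₂ (λ u v → (1ℤ + e) * u + + v * e ^ suc n) (sym (binomial e n)) (bin-0 n (suc n) ℕ.≤-refl)) (+-identityʳ _)))

  bin-self : ∀ n → bin n n ≡ 1
  bin-self zero    = refl
  bin-self (suc n) = cong₂ ℕ._+_ (bin-self n) (bin-0 n (suc n) ℕ.≤-refl)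

  prime∣bin : ∀ {p} → Prime p → ∀ {i} → 1 ℕ.≤ i → i ℕ.< p → p ℕ.∣ bin p i
  prime∣bin {suc n} pr {suc k} _ lt with euclidsLemma (suc k) (bin (suc n) (suc k)) pr (subst (suc n ℕ.∣_) (sym absorb) (ℕ.m∣m*n (bin n k)))
    where
    absorb : suc k ℕ.* bin (suc n) (suc k) ≡ suc n ℕ.* bin n k
    absorb = trans (lem k (bin n k) (bin n (suc k))) (cong (bin n k ℕ.+_) (bin-rec n k))
      where
      lem : ∀ k p q → suc k ℕ.* (p ℕ.+ q) ≡ p ℕ.+ (suc k ℕ.* q ℕ.+ k ℕ.* p)
      lem = ℕ-Ring.solve-∀
  ... | inj₁ d = ⊥-elim (ℕ.>⇒∤ lt d)
  ... | inj₂ d = d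

  freshman : ∀ {p} → Prime p → ∀ e → + p ∣ (1ℤ + e) ^ p - (1ℤ + e ^ p)
  freshman {zero} pr e = ⊥-elim (ℕ.<⇒≱ (1<prime pr) z≤n)
  freshman {suc n} pr e = subst (+ suc n ∣_) (trans (lem (Σ< (suc n) f) (e ^ suc n)) (cong (_- (1ℤ + e ^ suc n)) (sym (trans (binomial e (suc n))
      (cong (λ u → Σ< (suc n) f + + u * e ^ suc n) (bin-self (suc n))))))) (middle n ℕ.≤-refl)
    where
    f : ℕ → ℤ
    f i = + bin (suc n) i * e ^ i
    lem : ∀ s u → s - 1ℤ ≡ (s + 1ℤ * u) - (1ℤ + u)
    lem = solve-∀
    middle : ∀ j → j ℕ.≤ n → + suc n ∣ Σ< (suc j) f - 1ℤ
    middle zero    _  = divides 0ℤ refl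
    middle (suc j) le = subst (+ suc n ∣_) (lem′ (Σ< (suc j) f) (f (suc j))) (∣m∣n⇒∣m+n (middle j (ℕ.<⇒≤ le)) (∣m⇒∣m*n (e ^ suc j) (ℕ∣⇒ℤ∣ (prime∣bin pr {suc j} (s≤s z≤n) (s≤s le)))))
      where
      lem′ : ∀ s t → (s - 1ℤ) + t ≡ (s + t) - 1ℤ
      lem′ = solve-∀

  fermat : ∀ {p} → Prime p → ∀ b → + p ∣ (+ b) ^ p - + b
  fermat {suc n} pr zero = divides 0ℤ refl
  fermat {zero} pr b = ⊥-elim (ℕ.<⇒≱ (1<prime pr) z≤n)
  fermat {p@(suc _)} pr (suc b) = subst (+ p ∣_) (lem ((1ℤ + + b) ^ p) ((+ b) ^ p) (+ b)) (∣m∣n⇒∣m+n (freshman pr (+ b)) (fermat pr b))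
    where
    lem : ∀ s t b → (s - (1ℤ + t)) + (t - b) ≡ s - (1ℤ + b)
    lem = solve-∀

  module Modulo {a} (pr : Prime a) (3≤a : 3 ℕ.≤ a) (β : ℤ) where
    α = + a

    One : ℕ → Set
    One n = α ∣ β ^ n - 1ℤ

    one-* : ∀ m n → One m → One (m ℕ.* n)
    one-* m n d = subst₂ (λ u v → α ∣ u - v) (^-*-assoc β m n) (1^ n) (∣-^ {α} {β ^ m} {1ℤ} n d)
      where
      1^ : ∀ l → 1ℤ ^ l ≡ 1ℤ
      1^ zero    = refl
      1^ (suc l) = trans (*-identityˡ (1ℤ ^ l)) (1^ l)

    one-drop : ∀ m n → One m → One (m ℕ.+ n) → One n
    one-drop m n d d′ = subst (α ∣_) (trans (cong (λ u → (u - 1ℤ) - (β ^ m - 1ℤ) * β ^ n) (^-distribˡ-+-* β m n)) (lem (β ^ m) (β ^ n))) (∣m∣n⇒∣m-n d′ (∣m⇒∣m*n (β ^ n) d))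
      where
      lem : ∀ p q → (p * q - 1ℤ) - (p - 1ℤ) * q ≡ q - 1ℤ
      lem = solve-∀

    -- Otherwise β^m = -1, and its odd power β^(m (2d+1)) would be -1 as well as 1.
    halve : ∀ {d} m → One (suc (2 ℕ.* d)) → One (2 ℕ.* m) → One m
    halve {d} m od d₂ with euclidℤ pr (β ^ m - 1ℤ) (β ^ m + 1ℤ) (subst (α ∣_) (trans (cong (λ e → β ^ (m ℕ.+ e) - 1ℤ) (ℕ.+-identityʳ m)) (trans (cong (_- 1ℤ) (^-distribˡ-+-* β m m)) (lem (β ^ m)))) d₂)
      where
      lem : ∀ u → u * u - 1ℤ ≡ (u - 1ℤ) * (u + 1ℤ)
      lem = solve-∀
    ... | inj₁ d₁ = d₁
    ... | inj₂ d₋ = ⊥-elim (ℕ.>⇒∤ {n = 2} 3≤a (∣⇒∣ᵤ (subst (α ∣_) (trans (cong (λ v → (β ^ m) ^ suc (2 ℕ.* d) - 1ℤ - ((β ^ m) ^ suc (2 ℕ.* d) - v)) (neg1^ d)) (lem₂ ((β ^ m) ^ suc (2 ℕ.* d))))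
          (∣m∣n⇒∣m-n (subst (λ u → α ∣ u - 1ℤ) (trans (cong (β ^_) (ℕ.*-comm (suc (2 ℕ.* d)) m)) (sym (^-*-assoc β m (suc (2 ℕ.* d))))) (one-* (suc (2 ℕ.* d)) m od))
            (∣-^ {α} {β ^ m} { - 1ℤ} (suc (2 ℕ.* d)) d₋)))))
      where
      neg1^ : ∀ d → (- 1ℤ) ^ suc (2 ℕ.* d) ≡ - 1ℤ
      neg1^ zero    = refl
      neg1^ (suc d) = trans (cong (λ e → (- 1ℤ) ^ suc e) (ℕ.*-suc 2 d)) (cong (λ u → - 1ℤ * (- 1ℤ * u)) (neg1^ d))
      lem₂ : ∀ u → u - 1ℤ - (u - (- 1ℤ)) ≡ - + 2
      lem₂ = solve-∀

    halve-all : ∀ {d} r m → One (suc (2 ℕ.* d)) → One (2 ℕ.^ r ℕ.* m) → One m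
    halve-all zero    m od o = subst One (ℕ.*-identityˡ m) o
    halve-all {d} (suc r) m od o = halve-all {d} r m od (halve {d} (2 ℕ.^ r ℕ.* m) od (subst One (ℕ.*-assoc 2 (2 ℕ.^ r) m) o))

    cube : ∀ {d} r → a ≡ 2 ℕ.^ r ℕ.* 3 ℕ.+ 1 → ∀ {b} → β ≡ + b → ¬ (a ℕ.∣ b) → One (suc (2 ℕ.* d)) → One 3
    cube {d} r a≡ {b} refl a∤b od = halve-all {d} r 3 od (∣a (euclidℤ pr (+ b) _ (subst (α ∣_) (trans (cong (λ n → (+ b) ^ n - + b) (trans a≡ (ℕ.+-comm _ 1))) (lem (+ b) ((+ b) ^ (2 ℕ.^ r ℕ.* 3)))) (fermat pr b))))
      where
      lem : ∀ b u → b * u - b ≡ b * (u - 1ℤ)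
      lem = solve-∀
      ∣a : (α ∣ + b) ⊎ One (2 ℕ.^ r ℕ.* 3) → One (2 ℕ.^ r ℕ.* 3)
      ∣a (inj₁ d) = ⊥-elim (a∤b (ℤ∣⇒ℕ∣ d))
      ∣a (inj₂ d) = d

    order-one-or-three : One 3 → ∀ D → One D → One 1 ⊎ (3 ℕ.∣ D)
    order-one-or-three o₃ D oD = by-remainder (D ℕ.% 3) (ℕ.m%n<n D 3) refl
      where
      back : ∀ n → D ℕ.% 3 ≡ n → One n
      back n e = one-drop (3 ℕ.* (D ℕ./ 3)) n (one-* 3 (D ℕ./ 3) o₃) (subst One (trans (ℕ.m≡m%n+[m/n]*n D 3) (trans (cong₂ ℕ._+_ e (ℕ.*-comm (D ℕ./ 3) 3)) (ℕ.+-comm n _))) oD)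
      by-remainder : ∀ n → n ℕ.< 3 → D ℕ.% 3 ≡ n → One 1 ⊎ (3 ℕ.∣ D)
      by-remainder 0 _ e = inj₂ (ℕ.m%n≡0⇒n∣m D 3 e)
      by-remainder 1 _ e = inj₁ (back 1 e)
      by-remainder 2 _ e = inj₁ (one-drop 2 1 (back 2 e) o₃)
      by-remainder (suc (suc (suc _))) (s≤s (s≤s (s≤s ()))) _

  valuation : ∀ {a} → 2 ℕ.≤ a → ∀ n → 1 ℕ.≤ n → ∃[ v ] ∃[ n′ ] (n ≡ a ℕ.^ v ℕ.* n′ × ¬ (a ℕ.∣ n′))
  valuation {a} 2≤a n 1≤n = go n n ℕ.≤-refl 1≤n
    where
    go : ∀ f n → n ℕ.≤ f → 1 ℕ.≤ n → ∃[ v ] ∃[ n′ ] (n ≡ a ℕ.^ v ℕ.* n′ × ¬ (a ℕ.∣ n′))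
    go zero    n le 1≤n = ⊥-elim (ℕ.<⇒≱ 1≤n le)
    go (suc f) n le 1≤n with a ℕ.∣? n
    ... | no ¬d = 0 , n , sym (ℕ.*-identityˡ n) , ¬d
    ... | yes (ℕ.divides zero refl) = ⊥-elim (ℕ.<⇒≱ 1≤n z≤n)
    ... | yes (ℕ.divides q@(suc _) refl) with go f q (ℕ.s≤s⁻¹ (ℕ.<-≤-trans (ℕ.m<m*n q a 2≤a) le)) (s≤s z≤n)
    ... | v , n′ , e , ¬d = suc v , n′ , trans (cong (ℕ._* a) e) (lem (a ℕ.^ v) n′ a) , ¬d
      where
      lem : ∀ p n a → p ℕ.* n ℕ.* a ≡ a ℕ.* p ℕ.* n
      lem = ℕ-Ring.solve-∀

  -- The factor 6 clears the denominators of C(n, 2) and C(n, 3); over ℤ the products n (n - 1) (n -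
  -- 2) are correct for small n too.
  expand : ∀ e n → ∃[ q ] + 6 * (1ℤ + e) ^ n ≡ + 6 + + 6 * + n * e + + 3 * (+ n * (+ n - 1ℤ)) * (e * e) + + n * (+ n - 1ℤ) * (+ n - + 2) * (e * e * e) + e * e * e * e * q
  expand e zero = 0ℤ , lem e
    where
    lem : ∀ e → + 6 * 1ℤ ≡ + 6 + + 6 * 0ℤ * e + + 3 * (0ℤ * (0ℤ - 1ℤ)) * (e * e) + 0ℤ * (0ℤ - 1ℤ) * (0ℤ - + 2) * (e * e * e) + e * e * e * e * 0ℤ
    lem = solve-∀
  expand e (suc n) with expand e n
  ... | q , eq = + n * (+ n - 1ℤ) * (+ n - + 2) + q + e * q , trans (lem₀ e ((1ℤ + e) ^ n)) (trans (cong ((1ℤ + e) *_) eq) (lem e (+ n) q))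
    where
    lem₀ : ∀ e u → + 6 * ((1ℤ + e) * u) ≡ (1ℤ + e) * (+ 6 * u)
    lem₀ = solve-∀
    lem : ∀ e n q → (1ℤ + e) * (+ 6 + + 6 * n * e + + 3 * (n * (n - 1ℤ)) * (e * e) + n * (n - 1ℤ) * (n - + 2) * (e * e * e) + e * e * e * e * q)
      ≡ + 6 + + 6 * (1ℤ + n) * e + + 3 * ((1ℤ + n) * ((1ℤ + n) - 1ℤ)) * (e * e) + (1ℤ + n) * ((1ℤ + n) - 1ℤ) * ((1ℤ + n) - + 2) * (e * e * e) + e * e * e * e * (n * (n - 1ℤ) * (n - + 2) + q + e * q)
    lem = solve-∀

  expand₁ : ∀ e n → ∃[ q ] (1ℤ + e) ^ n ≡ 1ℤ + + n * e + e * e * q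
  expand₁ e zero = 0ℤ , lem e
    where
    lem : ∀ e → 1ℤ ≡ 1ℤ + 0ℤ * e + e * e * 0ℤ
    lem = solve-∀
  expand₁ e (suc n) with expand₁ e n
  ... | q , eq = + n + q + e * q , trans (cong ((1ℤ + e) *_) eq) (lem e (+ n) q)
    where
    lem : ∀ e n q → (1ℤ + e) * (1ℤ + n * e + e * e * q) ≡ 1ℤ + (1ℤ + n) * e + e * e * (n + q + e * q)
    lem = solve-∀

  -- Lifting the exponent, with the quadratic term of the binomial expansion made explicit.
  lifting : ∀ a (e : ℤ) → + a ∣ e → ∀ s n → ∃[ h ] ∃[ k ]
    ( (1ℤ + e) ^ (a ℕ.^ s ℕ.* n) ≡ 1ℤ + (+ a) ^ s * e * h
    × + 6 * (1ℤ + e) ^ (a ℕ.^ s ℕ.* n) ≡ + 6 + + 6 * + (a ℕ.^ s ℕ.* n) * e + + 3 * (+ (a ℕ.^ s ℕ.* n) * (+ (a ℕ.^ s ℕ.* n) - 1ℤ)) * (e * e) + (+ a) ^ s * (e * e * e) * k)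
  lifting a e _ zero n with expand₁ e (1 ℕ.* n) | expand e (1 ℕ.* n)
  ... | q , eq | q′ , eq′ = + (1 ℕ.* n) + e * q , + (1 ℕ.* n) * (+ (1 ℕ.* n) - 1ℤ) * (+ (1 ℕ.* n) - + 2) + e * q′ ,
      trans eq (lem e (+ (1 ℕ.* n)) q) , trans eq′ (lem′ e (+ (1 ℕ.* n)) q′)
    where
    lem : ∀ e n q → 1ℤ + n * e + e * e * q ≡ 1ℤ + 1ℤ * e * (n + e * q)
    lem = solve-∀
    lem′ : ∀ e n q → + 6 + + 6 * n * e + + 3 * (n * (n - 1ℤ)) * (e * e) + n * (n - 1ℤ) * (n - + 2) * (e * e * e) + e * e * e * e * q
      ≡ + 6 + + 6 * n * e + + 3 * (n * (n - 1ℤ)) * (e * e) + 1ℤ * (e * e * e) * (n * (n - 1ℤ) * (n - + 2) + e * q)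
    lem′ = solve-∀
  lifting a e a∣e@(divides ε refl) (suc s) n = step (lifting a e a∣e s n) (expand₁ e (a ℕ.^ s ℕ.* n))
    where
    N = a ℕ.^ s ℕ.* n
    α = + a
    step : ∃[ h ] ∃[ k ]
        ( (1ℤ + e) ^ N ≡ 1ℤ + α ^ s * e * h
        × + 6 * (1ℤ + e) ^ N ≡ + 6 + + 6 * + N * e + + 3 * (+ N * (+ N - 1ℤ)) * (e * e) + α ^ s * (e * e * e) * k) →
      ∃[ q ] (1ℤ + e) ^ N ≡ 1ℤ + + N * e + e * e * q →
      ∃[ h ] ∃[ k ]
        ( (1ℤ + e) ^ (a ℕ.^ suc s ℕ.* n) ≡ 1ℤ + α ^ suc s * e * h
        × + 6 * (1ℤ + e) ^ (a ℕ.^ suc s ℕ.* n) ≡ + 6 + + 6 * + (a ℕ.^ suc s ℕ.* n) * e + + 3 * (+ (a ℕ.^ suc s ℕ.* n) * (+ (a ℕ.^ suc s ℕ.* n) - 1ℤ)) * (e * e) + α ^ suc s * (e * e * e) * k)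
    step (h , k , e₁ , e₂) (q , e₃) = finish (expand₁ f a) (expand f a)
      where
      t = α ^ s
      f = t * e * h
      N′ : a ℕ.^ suc s ℕ.* n ≡ N ℕ.* a
      N′ = lem a (a ℕ.^ s) n
        where
        lem : ∀ a p n → a ℕ.* p ℕ.* n ≡ p ℕ.* n ℕ.* a
        lem = ℕ-Ring.solve-∀
      +N′ : + (a ℕ.^ suc s ℕ.* n) ≡ α * + N
      +N′ = trans (cong +_ N′) (trans (pos-* N a) (*-comm (+ N) α))
      power : (1ℤ + e) ^ (a ℕ.^ suc s ℕ.* n) ≡ (1ℤ + f) ^ a
      power = trans (cong ((1ℤ + e) ^_) N′) (trans (sym (^-*-assoc (1ℤ + e) N a)) (cong (_^ a) e₁))
      -- f = N e + e² q and f = a^s e h, so f² - N² e² is divisible by a^s e³.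
      f≡ : f ≡ + N * e + e * e * q
      f≡ = +-cancelˡ 1ℤ (trans (sym e₁) (trans e₃ (+-assoc 1ℤ (+ N * e) (e * e * q))))
        where
        +-cancelˡ : ∀ i {j k} → i + j ≡ i + k → j ≡ k
        +-cancelˡ i {j} {k} eq = trans (lem i j) (trans (cong (λ w → - i + w) eq) (sym (lem i k)))
          where
          lem : ∀ i j → j ≡ - i + (i + j)
          lem = solve-∀
      N≡t : + N ≡ t * + n
      N≡t = trans (pos-* (a ℕ.^ s) n) (cong (_* + n) (pos-^ a s))
      6f : + 6 * f ≡ + 6 * + N * e + + 3 * (+ N * (+ N - 1ℤ)) * (e * e) + t * (e * e * e) * k
      6f = trans (lem f) (trans (cong (_- + 6) (trans (cong (+ 6 *_) (sym e₁)) e₂)) (lem′ (+ 6 * + N * e) (+ 3 * (+ N * (+ N - 1ℤ)) * (e * e)) (t * (e * e * e) * k)))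
        where
        lem : ∀ f → + 6 * f ≡ + 6 * (1ℤ + f) - + 6
        lem = solve-∀
        lem′ : ∀ u v w → + 6 + u + v + w - + 6 ≡ u + v + w
        lem′ = solve-∀
      f² : f * f ≡ + N * + N * (e * e) + t * (e * e * e) * (q * (h + + n))
      f² = trans (lem f (+ N * e)) (trans (cong₂ (λ u v → + N * e * (+ N * e) + (u - + N * e) * (f + v)) f≡ (cong (_* e) N≡t)) (lem′ (+ N) e q t h (+ n)))
        where
        lem : ∀ f m → f * f ≡ m * m + (f - m) * (f + m)
        lem = solve-∀
        lem′ : ∀ N e q t h n → N * e * (N * e) + ((N * e + e * e * q) - N * e) * (t * e * h + t * n * e) ≡ N * N * (e * e) + t * (e * e * e) * (q * (h + n))
        lem′ = solve-∀
      finish : ∃[ q₁ ] (1ℤ + f) ^ a ≡ 1ℤ + + a * f + f * f * q₁ →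
        ∃[ q₂ ] + 6 * (1ℤ + f) ^ a ≡ + 6 + + 6 * + a * f + + 3 * (+ a * (+ a - 1ℤ)) * (f * f) + + a * (+ a - 1ℤ) * (+ a - + 2) * (f * f * f) + f * f * f * f * q₂ →
        ∃[ h ] ∃[ k ]
        ( (1ℤ + e) ^ (a ℕ.^ suc s ℕ.* n) ≡ 1ℤ + α ^ suc s * e * h
        × + 6 * (1ℤ + e) ^ (a ℕ.^ suc s ℕ.* n) ≡ + 6 + + 6 * + (a ℕ.^ suc s ℕ.* n) * e + + 3 * (+ (a ℕ.^ suc s ℕ.* n) * (+ (a ℕ.^ suc s ℕ.* n) - 1ℤ)) * (e * e) + α ^ suc s * (e * e * e) * k)
      finish (q₁ , E₁) (q₂ , E₂) = h + t * ε * h * h * q₁ , k′ ,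
          trans power (trans E₁ (lem α ε t h q₁)) ,
          trans (cong (+ 6 *_) power) (trans E₂ (trans (lem₁ α f q₂) (trans (cong₂ (λ u v → + 6 + α * u + + 3 * (α * (α - 1ℤ)) * v + α * (α - 1ℤ) * (α - + 2) * (f * f * f) + f * f * f * f * q₂) 6f f²)
            (trans (lem₂ α ε t h k (+ N) q (+ n) q₂) (cong (λ M → + 6 + + 6 * M * e + + 3 * (M * (M - 1ℤ)) * (e * e) + α ^ suc s * (e * e * e) * k′) (sym +N′))))))
        where
        -- The quadratic coefficients recombine as 3αN(N-1) + 3α(α-1)N² = 3αN(αN-1). All remaining
        -- terms contain α t e³; in f⁴ one of these factors α comes from a ∣ e.
        k′ = k + + 3 * (α - 1ℤ) * (q * (h + + n)) + (α - 1ℤ) * (α - + 2) * (t * t) * (h * h * h) + t * t * t * ε * (h * h * h * h) * q₂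
        lem : ∀ α ε t h q₁ → 1ℤ + α * (t * (ε * α) * h) + (t * (ε * α) * h) * (t * (ε * α) * h) * q₁ ≡ 1ℤ + (α * t) * (ε * α) * (h + t * ε * h * h * q₁)
        lem = solve-∀
        lem₁ : ∀ α f q → + 6 + + 6 * α * f + + 3 * (α * (α - 1ℤ)) * (f * f) + α * (α - 1ℤ) * (α - + 2) * (f * f * f) + f * f * f * f * q
          ≡ + 6 + α * (+ 6 * f) + + 3 * (α * (α - 1ℤ)) * (f * f) + α * (α - 1ℤ) * (α - + 2) * (f * f * f) + f * f * f * f * q
        lem₁ = solve-∀
        lem₂ : ∀ α ε t h k N q n q₂ →
          + 6 + α * (+ 6 * N * (ε * α) + + 3 * (N * (N - 1ℤ)) * (ε * α * (ε * α)) + t * (ε * α * (ε * α) * (ε * α)) * k)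
            + + 3 * (α * (α - 1ℤ)) * (N * N * (ε * α * (ε * α)) + t * (ε * α * (ε * α) * (ε * α)) * (q * (h + n)))
            + α * (α - 1ℤ) * (α - + 2) * ((t * (ε * α) * h) * (t * (ε * α) * h) * (t * (ε * α) * h))
            + (t * (ε * α) * h) * (t * (ε * α) * h) * (t * (ε * α) * h) * (t * (ε * α) * h) * q₂
          ≡ + 6 + + 6 * (α * N) * (ε * α) + + 3 * (α * N * (α * N - 1ℤ)) * (ε * α * (ε * α))
            + (α * t) * (ε * α * (ε * α) * (ε * α)) * (k + + 3 * (α - 1ℤ) * (q * (h + n)) + (α - 1ℤ) * (α - + 2) * (t * t) * (h * h * h) + t * t * t * ε * (h * h * h * h) * q₂)
        lem₂ = solve-∀

-- Odd difference of the exponents of b: valuations and the key equation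

module OddGap where
  open import Data.Integer.Base hiding (suc; NonZero)
  open import Data.Integer.Properties
  open import Data.Integer.Divisibility.Signed
  open import Data.Integer.Tactic.RingSolver using (solve-∀)
  open import Function.Base using (_∘_)
  open Vandermonde using (pos-^; ^≢0)
  open SignedDivisibility
  open LiftingExponent

  -- d = n₀ δ is the exponent difference, n₀ ∈ {1, 3} the order of b modulo a.
  record OddPair (a b c x y X d : ℕ) : Set where
    field
      prime : Prime a
      7≤a   : 7 ℕ.≤ a
      1<b   : 1 ℕ.< b
      1≤c   : 1 ℕ.≤ c
      1≤y   : 1 ℕ.≤ y
      x<X   : x ℕ.< X
      a∤b   : ¬ (a ℕ.∣ b)
      eq    : a ℕ.^ x ≡ b ℕ.^ y ℕ.+ c
      Eq    : a ℕ.^ X ≡ b ℕ.^ (y ℕ.+ d) ℕ.+ c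
      n₀ δ g s d′ η : ℕ
      d≡    : d ≡ n₀ ℕ.* δ
      δ≡    : δ ≡ a ℕ.^ s ℕ.* d′
      x≡    : x ≡ g ℕ.+ s
      ξ≡    : b ℕ.^ n₀ ≡ 1 ℕ.+ a ℕ.^ g ℕ.* η
      1≤g   : 1 ℕ.≤ g
      odd   : ¬ (2 ℕ.∣ δ)
      a∤d′  : ¬ (a ℕ.∣ d′)
      a∤η   : ¬ (a ℕ.∣ η)
      k     : ℤ
      key   : + 6 * ((+ a) ^ (X ℕ.∸ x) - 1ℤ) ≡
              (+ b) ^ y * (+ 6 * (+ d′ * + η) + + 3 * (+ d′ * (+ δ - 1ℤ)) * ((+ a) ^ g * (+ η * + η)) + (+ a) ^ g * (+ a) ^ g * (+ η * + η * + η) * k)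
      kind  : (n₀ ≡ 1 × 1 ℕ.≤ s) ⊎ (n₀ ≡ 3 × a ℕ.∣ b ℕ.* b ℕ.+ b ℕ.+ 1)

  module _ {a b c x y X d : ℕ} (pr : Prime a) (7≤a : 7 ℕ.≤ a) (r : ℕ) (a≡ : a ≡ 2 ℕ.^ r ℕ.* 3 ℕ.+ 1)
    (1<b : 1 ℕ.< b) (1≤c : 1 ℕ.≤ c) (1≤x : 1 ℕ.≤ x) (1≤y : 1 ℕ.≤ y) (x<X : x ℕ.< X) (a∤b : ¬ (a ℕ.∣ b))
    (eq : a ℕ.^ x ≡ b ℕ.^ y ℕ.+ c) (Eq : a ℕ.^ X ≡ b ℕ.^ (y ℕ.+ d) ℕ.+ c) (h : ℕ) (d-odd : d ≡ suc (2 ℕ.* h)) where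

    private
      α = + a
      β = + b
      D = X ℕ.∸ x
      B = β ^ y
      A = α ^ x

      3≤a : 3 ℕ.≤ a
      3≤a = ℕ.≤-trans (ℕ.m≤m+n 3 4) 7≤a
      2≤a : 2 ℕ.≤ a
      2≤a = ℕ.≤-trans (ℕ.n≤1+n 2) 3≤a

      a∣^ : ∀ {n} → 1 ℕ.≤ n → α ∣ α ^ n
      a∣^ {suc n} _ = divides (α ^ n) (*-comm α (α ^ n))

      X≡ : α ^ X ≡ A * α ^ D
      X≡ = trans (cong (α ^_) (sym (ℕ.m+[n∸m]≡n (ℕ.<⇒≤ x<X)))) (^-distribˡ-+-* α x D)

      A≡ : A ≡ B + + c
      A≡ = trans (sym (pos-^ a x)) (trans (cong +_ eq) (trans (pos-+ (b ℕ.^ y) c) (cong (_+ + c) (pos-^ b y))))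

      -- The difference of the two equations, in which c cancels.
      product : A * (α ^ D - 1ℤ) ≡ B * (β ^ d - 1ℤ)
      product = trans (lem A (α ^ D)) (trans (cong₂ _-_ (trans (sym X≡) (trans (sym (pos-^ a X)) (trans (cong +_ Eq)
          (trans (pos-+ (b ℕ.^ (y ℕ.+ d)) c) (cong (_+ + c) (trans (pos-^ b (y ℕ.+ d)) (^-distribˡ-+-* β y d))))))) A≡) (lem′ B (β ^ d) (+ c)))
        where
        lem : ∀ A u → A * (u - 1ℤ) ≡ A * u - A
        lem = solve-∀
        lem′ : ∀ B u c → (B * u + c) - (B + c) ≡ B * (u - 1ℤ)
        lem′ = solve-∀

      a∤β : ¬ (α ∣ β)
      a∤β d = a∤b (ℤ∣⇒ℕ∣ d)

      a∤B : ¬ (α ∣ B)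
      a∤B d = a∤β (prime∣^ pr β y d)

      open Modulo pr 3≤a β hiding (α)

      oneD : One d
      oneD = [ (λ e → ⊥-elim (a∤B e)) , (λ e → e) ]′ (euclidℤ pr B (β ^ d - 1ℤ) (subst (α ∣_) product (∣m⇒∣m*n (α ^ D - 1ℤ) (a∣^ 1≤x))))

      one3 : One 3
      one3 = cube {h} r a≡ refl a∤b (subst One d-odd oneD)

      module WithOrder (n₀ δ : ℕ) (1≤n₀ : 1 ℕ.≤ n₀) (d≡ : d ≡ n₀ ℕ.* δ) (one : One n₀)
        (kind′ : n₀ ≡ 1 ⊎ (n₀ ≡ 3 × a ℕ.∣ b ℕ.* b ℕ.+ b ℕ.+ 1)) where

        1<ξ : 1 ℕ.< b ℕ.^ n₀
        1<ξ = ℕ.<-≤-trans 1<b (ℕ.≤-trans (ℕ.≤-reflexive (sym (ℕ.^-identityʳ b))) (ℕ.^-monoʳ-≤ b {{ℕ.>-nonZero (ℕ.<-trans (s≤s z≤n) 1<b)}} 1≤n₀))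

        1≤δ : 1 ℕ.≤ δ
        1≤δ = ℕ.n≢0⇒n>0 λ e → ℕ.1+n≢0 (trans (sym d-odd) (trans d≡ (trans (cong (n₀ ℕ.*_) e) (ℕ.*-zeroʳ n₀))))

        module WithValuations (g η s d′ : ℕ) (ξ-1 : b ℕ.^ n₀ ℕ.∸ 1 ≡ a ℕ.^ g ℕ.* η) (a∤η : ¬ (a ℕ.∣ η))
          (δ≡ : δ ≡ a ℕ.^ s ℕ.* d′) (a∤d′ : ¬ (a ℕ.∣ d′)) where

          ξ≡ : b ℕ.^ n₀ ≡ 1 ℕ.+ a ℕ.^ g ℕ.* η
          ξ≡ = trans (sym (ℕ.m+[n∸m]≡n (ℕ.<⇒≤ 1<ξ))) (cong (1 ℕ.+_) ξ-1)

          G = α ^ g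
          e = G * + η

          βⁿ : β ^ n₀ ≡ 1ℤ + e
          βⁿ = trans (sym (pos-^ b n₀)) (trans (cong +_ ξ≡) (trans (pos-+ 1 (a ℕ.^ g ℕ.* η)) (cong (λ w → 1ℤ + w) (trans (pos-* (a ℕ.^ g) η) (cong (_* + η) (pos-^ a g))))))

          α∣e : α ∣ e
          α∣e = subst (α ∣_) (trans (cong (_- 1ℤ) βⁿ) (lem e)) one
            where
            lem : ∀ e → (1ℤ + e) - 1ℤ ≡ e
            lem = solve-∀

          1≤g : 1 ℕ.≤ g
          1≤g = ℕ.n≢0⇒n>0 λ eg → a∤η (ℤ∣⇒ℕ∣ (subst (α ∣_) (trans (cong (λ g → α ^ g * + η) eg) (*-identityˡ (+ η))) α∣e))

          βᵈ : β ^ d ≡ (1ℤ + e) ^ (a ℕ.^ s ℕ.* d′)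
          βᵈ = trans (cong (β ^_) (trans d≡ (cong (n₀ ℕ.*_) δ≡))) (trans (sym (^-*-assoc β n₀ _)) (cong (_^ (a ℕ.^ s ℕ.* d′)) βⁿ))

          t = α ^ s
          Δ = + (a ℕ.^ s ℕ.* d′)

          Δ≡ : Δ ≡ t * + d′
          Δ≡ = trans (pos-* (a ℕ.^ s) d′) (cong (_* + d′) (pos-^ a s))

          module WithExpansion (k : ℤ) (e₂ : + 6 * (1ℤ + e) ^ (a ℕ.^ s ℕ.* d′) ≡ + 6 + + 6 * Δ * e + + 3 * (Δ * (Δ - 1ℤ)) * (e * e) + t * (e * e * e) * k) where
            U = + 6 * (+ d′ * + η) + + 3 * (+ d′ * (Δ - 1ℤ)) * (G * (+ η * + η)) + G * G * (+ η * + η * + η) * k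

            sixfold : + 6 * (β ^ d - 1ℤ) ≡ t * G * U
            sixfold = trans (lem (β ^ d)) (trans (cong (_- + 6) (trans (cong (+ 6 *_) βᵈ) e₂)) (trans (cong (λ w → + 6 + + 6 * w * e + + 3 * (w * (Δ - 1ℤ)) * (e * e) + t * (e * e * e) * k - + 6) Δ≡)
              (lem′ t G (+ d′) (+ η) (Δ - 1ℤ) k)))
              where
              lem : ∀ u → + 6 * (u - 1ℤ) ≡ + 6 * u - + 6
              lem = solve-∀
              lem′ : ∀ t G d η r k → + 6 + + 6 * (t * d) * (G * η) + + 3 * (t * d * r) * (G * η * (G * η)) + t * (G * η * (G * η) * (G * η)) * k - + 6
                ≡ t * G * (+ 6 * (d * η) + + 3 * (d * r) * (G * (η * η)) + G * G * (η * η * η) * k)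
              lem′ = solve-∀

            a∤6 : ¬ (α ∣ + 6)
            a∤6 dv = ℕ.>⇒∤ {n = 6} 7≤a (∣⇒∣ᵤ dv)

            -- U ≡ 6 d′ η modulo a because g ≥ 1, and a ≥ 7.
            a∤U : ¬ (α ∣ U)
            a∤U dv = [ a∤6 , [ (λ d → a∤d′ (ℤ∣⇒ℕ∣ d)) , (λ d → a∤η (ℤ∣⇒ℕ∣ d)) ]′ ∘ euclidℤ pr (+ d′) (+ η) ]′
                (euclidℤ pr (+ 6) (+ d′ * + η) (subst (α ∣_) (lem (+ d′) (+ η) (Δ - 1ℤ) G k) (∣m∣n⇒∣m-n dv (∣m⇒∣m*n (+ 3 * (+ d′ * (Δ - 1ℤ)) * (+ η * + η) + G * (+ η * + η * + η) * k) (a∣^ 1≤g)))))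
              where
              lem : ∀ d η r G k → (+ 6 * (d * η) + + 3 * (d * r) * (G * (η * η)) + G * G * (η * η * η) * k) - G * (+ 3 * (d * r) * (η * η) + G * (η * η * η) * k) ≡ + 6 * (d * η)
              lem = solve-∀

            balanced : α ^ x * (+ 6 * (α ^ D - 1ℤ)) ≡ α ^ (g ℕ.+ s) * (B * U)
            balanced = trans (lem A (α ^ D - 1ℤ)) (trans (cong (+ 6 *_) product) (trans (sym (lem B (β ^ d - 1ℤ))) (trans (cong (B *_) sixfold)
              (trans (lem′ B t G U) (cong (_* (B * U)) (sym (^-distribˡ-+-* α g s)))))))
              where
              lem : ∀ A u → A * (+ 6 * u) ≡ + 6 * (A * u)
              lem = solve-∀
              lem′ : ∀ B t G U → B * (t * G * U) ≡ G * t * (B * U)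
              lem′ = solve-∀

            a∤right : ¬ (α ∣ B * U)
            a∤right dv = [ a∤B , a∤U ]′ (euclidℤ pr B U dv)

            1≤D : 1 ℕ.≤ D
            1≤D = ℕ.m<n⇒0<n∸m x<X

            a∤left : ¬ (α ∣ + 6 * (α ^ D - 1ℤ))
            a∤left dv = [ a∤6 , (λ d → ∤1 pr (subst (α ∣_) (lem (α ^ D)) (∣m∣n⇒∣m-n (a∣^ 1≤D) d))) ]′ (euclidℤ pr (+ 6) (α ^ D - 1ℤ) dv)
              where
              lem : ∀ u → u - (u - 1ℤ) ≡ 1ℤ
              lem = solve-∀

            same-valuation : ∀ {m n u v} → ¬ (α ∣ v) → α ^ m * u ≡ α ^ n * v → m ℕ.≤ n
            same-valuation {m} {n} {u} {v} ¬v q = ℕ.≮⇒≥ λ n<m → ¬v (∣-trans (a∣^ (ℕ.m<n⇒0<n∸m n<m)) (∣*-cancel (^≢0 n (prime≢0 pr))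
              (subst₂ _∣_ (trans (cong (α ^_) (sym (ℕ.m+[n∸m]≡n (ℕ.<⇒≤ n<m)))) (^-distribˡ-+-* α n (m ℕ.∸ n))) q (∣m⇒∣m*n u ∣-refl))))

            -- Each side of `balanced` is a power of a times a factor prime to a.
            x≡ : x ≡ g ℕ.+ s
            x≡ = ℕ.≤-antisym (same-valuation a∤right balanced) (same-valuation a∤left (sym balanced))

            key : + 6 * (α ^ D - 1ℤ) ≡ B * U
            key = *-cancelˡ-≡ A _ _ {{≢-nonZero (^≢0 x (prime≢0 pr))}} (trans balanced (cong (λ n → α ^ n * (B * U)) (sym x≡)))

            b<A : b ℕ.< a ℕ.^ x
            b<A = ℕ.<-≤-trans (ℕ.≤-<-trans (ℕ.≤-trans (ℕ.≤-reflexive (sym (ℕ.^-identityʳ b))) (ℕ.^-monoʳ-≤ b {{ℕ.>-nonZero (ℕ.<-trans (s≤s z≤n) 1<b)}} 1≤y))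
              (ℕ.m<m+n (b ℕ.^ y) 1≤c)) (ℕ.≤-reflexive (sym eq))

            kind : (n₀ ≡ 1 × 1 ℕ.≤ s) ⊎ (n₀ ≡ 3 × a ℕ.∣ b ℕ.* b ℕ.+ b ℕ.+ 1)
            kind = by-kind kind′
              where
              open ℕ.≤-Reasoning
              by-kind : n₀ ≡ 1 ⊎ (n₀ ≡ 3 × a ℕ.∣ b ℕ.* b ℕ.+ b ℕ.+ 1) → (n₀ ≡ 1 × 1 ℕ.≤ s) ⊎ (n₀ ≡ 3 × a ℕ.∣ b ℕ.* b ℕ.+ b ℕ.+ 1)
              by-kind (inj₂ q) = inj₂ q
              -- If s were 0, then a^x would divide b - 1 > 0, but b ≤ b^y < a^x.
              by-kind (inj₁ n₀≡1) = inj₁ (n₀≡1 , ℕ.n≢0⇒n>0 λ s≡0 → ℕ.<⇒≱ b<A (begin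
                a ℕ.^ x            ≡⟨ cong (a ℕ.^_) (trans x≡ (trans (cong (g ℕ.+_) s≡0) (ℕ.+-identityʳ g))) ⟩
                a ℕ.^ g            ≤⟨ ℕ.m≤m*n (a ℕ.^ g) η {{ℕ.≢-nonZero λ η≡0 → a∤η (subst (a ℕ.∣_) (sym η≡0) (a ℕ.∣0))}} ⟩
                a ℕ.^ g ℕ.* η      ≤⟨ ℕ.n≤1+n _ ⟩
                suc (a ℕ.^ g ℕ.* η) ≡⟨ sym ξ≡ ⟩
                b ℕ.^ n₀           ≡⟨ trans (cong (b ℕ.^_) n₀≡1) (ℕ.^-identityʳ b) ⟩
                b                  ∎))

            pair : OddPair a b c x y X d
            pair = record
              { prime = pr ; 7≤a = 7≤a ; 1<b = 1<b ; 1≤c = 1≤c ; 1≤y = 1≤y ; x<X = x<X ; a∤b = a∤b ; eq = eq ; Eq = Eq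
              ; n₀ = n₀ ; δ = δ ; g = g ; s = s ; d′ = d′ ; η = η ; d≡ = d≡ ; δ≡ = δ≡ ; x≡ = x≡ ; ξ≡ = ξ≡ ; 1≤g = 1≤g
              ; odd = λ dv → odd-not (ℕ.∣-trans dv (ℕ.divides n₀ d≡)) ; a∤d′ = a∤d′ ; a∤η = a∤η ; k = k
              ; key = trans key (cong (λ w → B * (+ 6 * (+ d′ * + η) + + 3 * (+ d′ * (+ w - 1ℤ)) * (G * (+ η * + η)) + G * G * (+ η * + η * + η) * k)) (sym δ≡))
              ; kind = kind }
              where
              odd-not : ¬ (2 ℕ.∣ d)
              odd-not dv = ℕ.>⇒∤ {n = 1} ℕ.≤-refl (ℕ.∣m+n∣m⇒∣n (subst (2 ℕ.∣_) (trans d-odd (ℕ.+-comm 1 (2 ℕ.* h))) dv) (ℕ.m∣m*n h))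

          pair : OddPair a b c x y X d
          pair = let (_ , k , _ , e₂) = lifting a e α∣e s d′ in WithExpansion.pair k e₂

        pair : OddPair a b c x y X d
        pair = let (g , η , ξ-1 , a∤η) = valuation 2≤a (b ℕ.^ n₀ ℕ.∸ 1) (ℕ.m<n⇒0<n∸m 1<ξ)
                   (s , d′ , δ≡ , a∤d′) = valuation 2≤a δ 1≤δ
               in WithValuations.pair g η s d′ ξ-1 a∤η δ≡ a∤d′

      order-one : One 1 → OddPair a b c x y X d
      order-one o = WithOrder.pair 1 d ℕ.≤-refl (sym (ℕ.*-identityˡ d)) o (inj₁ refl)

      order-three : ¬ One 1 → 3 ℕ.∣ d → OddPair a b c x y X d
      order-three ¬o (ℕ.divides δ e) = WithOrder.pair 3 δ (s≤s z≤n) (trans e (ℕ.*-comm δ 3)) one3 (inj₂ (refl , cyclotomic (euclidℤ pr (β - 1ℤ) (β * β + β + 1ℤ) (subst (α ∣_) (lem β) one3))))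
        where
        lem : ∀ b → b * (b * (b * 1ℤ)) - 1ℤ ≡ (b - 1ℤ) * (b * b + b + 1ℤ)
        lem = solve-∀
        cyclotomic : (α ∣ β - 1ℤ) ⊎ (α ∣ β * β + β + 1ℤ) → a ℕ.∣ b ℕ.* b ℕ.+ b ℕ.+ 1
        cyclotomic (inj₁ dv) = ⊥-elim (¬o (subst (λ w → α ∣ w - 1ℤ) (sym (*-identityʳ β)) dv))
        cyclotomic (inj₂ dv) = ℤ∣⇒ℕ∣ (subst (α ∣_) (trans (cong (λ w → w + β + 1ℤ) (sym (pos-* b b))) refl) dv)

    odd-pair : OddPair a b c x y X d
    odd-pair = by-order (α ∣? β ^ 1 - 1ℤ)
      where
      otherwise : ¬ One 1 → One 1 ⊎ (3 ℕ.∣ d) → OddPair a b c x y X d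
      otherwise ¬o (inj₁ o)  = ⊥-elim (¬o o)
      otherwise ¬o (inj₂ dv) = order-three ¬o dv
      by-order : Dec (One 1) → OddPair a b c x y X d
      by-order (yes o) = order-one o
      by-order (no ¬o) = otherwise ¬o (order-one-or-three one3 d oneD)

-- Eliminating b: the bound a^g ≤ 6561 δ⁴

module Elimination where
  open import Data.Integer.Base hiding (suc; NonZero)
  open import Data.Integer.Properties
  open import Data.Integer.Divisibility.Signed
  open import Data.Integer.Tactic.RingSolver using (solve-∀)
  open Vandermonde using (pos-^; ^≢0)
  open Criterion using (^ℤ-∣; ∣-^)
  open SignedDivisibility
  open OddGap

  n<2^n : ∀ n → n ℕ.< 2 ℕ.^ n
  n<2^n zero    = s≤s z≤n
  n<2^n (suc n) = ℕ.<-≤-trans (s≤s (n<2^n n)) (ℕ.≤-trans (ℕ.≤-reflexive (ℕ.+-comm 1 _)) (ℕ.+-monoʳ-≤ (2 ℕ.^ n) (ℕ.≤-trans (ℕ.m^n>0 2 n) (ℕ.m≤m+n _ 0))))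

  1^ℤ : ∀ l → 1ℤ ^ l ≡ 1ℤ
  1^ℤ zero    = refl
  1^ℤ (suc l) = trans (*-identityˡ (1ℤ ^ l)) (1^ℤ l)

  -- Eliminating m and j from G m = b² + b + 1, j G = 3 d m + 2 b + 1 and the congruence modulo G².
  module Second-order (G m b j d δ : ℤ)
    (r₁ : G * m ≡ b * b + b + 1ℤ) (r₂ : j * G ≡ + 3 * (d * m) + (+ 2 * b + 1ℤ)) where
    q V Z E T : ℤ
    q = + 2 * b + 1ℤ
    V = + 2 * j * G * m - + 2 * q * (j + m) + + 8 * m + (j * G - q) * (δ - 1ℤ) * m * (b * (b - 1ℤ) * (b - 1ℤ))
    Z = + 8 - + 2 * q - q * (δ - 1ℤ) * (b * (b - 1ℤ) * (b - 1ℤ))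
    E = + 3 * d * (+ 2 * j * m + j * (δ - 1ℤ) * m * (b * (b - 1ℤ) * (b - 1ℤ))) + j * Z + q * (δ - 1ℤ) * (b - 1ℤ) * m * (q - + 4)
    T = (1ℤ + + 3 * δ) * b - (+ 3 + + 3 * δ + + 6 * d * j)

    -- Reduction by `r₁` and `r₂`: cofactors are given explicitly, the ring solver checks the
    -- resulting polynomial identity, and this lemma discards the products.
    0*-drop : ∀ {u v} x → u ≡ v → (u - v) * x ≡ 0ℤ
    0*-drop {u} x refl = trans (cong (_* x) (+-inverseʳ u)) refl

    W≡GV : + 6 + + 6 * (b * (d * ((b - 1ℤ) * m))) + + 3 * (b * (d * (δ - 1ℤ))) * (G * ((b - 1ℤ) * m * ((b - 1ℤ) * m))) ≡ G * V
    W≡GV = trans (lem G m b j d δ) (trans (cong₂ (λ u v → G * V + u + v) (0*-drop _ r₁) (0*-drop _ r₂)) (trans (+-identityʳ _) (+-identityʳ _)))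
      where
      lem : ∀ G m b j d δ → + 6 + + 6 * (b * (d * ((b - 1ℤ) * m))) + + 3 * (b * (d * (δ - 1ℤ))) * (G * ((b - 1ℤ) * m * ((b - 1ℤ) * m))) ≡
        G * (+ 2 * j * G * m - + 2 * (+ 2 * b + 1ℤ) * (j + m) + + 8 * m + (j * G - (+ 2 * b + 1ℤ)) * (δ - 1ℤ) * m * (b * (b - 1ℤ) * (b - 1ℤ)))
        + (G * m - (b * b + b + 1ℤ)) * - (+ 2 * (j * G - (+ 2 * b + 1ℤ)) + + 8)
        + (j * G - (+ 3 * (d * m) + (+ 2 * b + 1ℤ))) * - (+ 2 * (b * (b - 1ℤ)) + (δ - 1ℤ) * G * m * (b * (b - 1ℤ) * (b - 1ℤ)))
      lem = solve-∀

    3dV : + 3 * d * V ≡ G * E + q * T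
    3dV = trans (lem G m b j d δ) (trans (cong₂ (λ u v → G * E + q * T + u + v) (0*-drop _ r₁) (0*-drop _ r₂)) (trans (+-identityʳ _) (+-identityʳ _)))
      where
      lem : ∀ G m b j d δ → + 3 * d * (+ 2 * j * G * m - + 2 * (+ 2 * b + 1ℤ) * (j + m) + + 8 * m + (j * G - (+ 2 * b + 1ℤ)) * (δ - 1ℤ) * m * (b * (b - 1ℤ) * (b - 1ℤ))) ≡
        G * (+ 3 * d * (+ 2 * j * m + j * (δ - 1ℤ) * m * (b * (b - 1ℤ) * (b - 1ℤ))) + j * (+ 8 - + 2 * (+ 2 * b + 1ℤ) - (+ 2 * b + 1ℤ) * (δ - 1ℤ) * (b * (b - 1ℤ) * (b - 1ℤ))) + (+ 2 * b + 1ℤ) * (δ - 1ℤ) * (b - 1ℤ) * m * ((+ 2 * b + 1ℤ) - + 4))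
        + (+ 2 * b + 1ℤ) * ((1ℤ + + 3 * δ) * b - (+ 3 + + 3 * δ + + 6 * d * j))
        + (G * m - (b * b + b + 1ℤ)) * ((+ 2 * b + 1ℤ) * (δ - 1ℤ) * (b - 1ℤ) * (+ 4 - (+ 2 * b + 1ℤ)))
        + (j * G - (+ 3 * (d * m) + (+ 2 * b + 1ℤ))) * - (+ 8 - + 2 * (+ 2 * b + 1ℤ) - (+ 2 * b + 1ℤ) * (δ - 1ℤ) * (b * (b - 1ℤ) * (b - 1ℤ)))
      lem = solve-∀

    3T : + 3 * T ≡ G * (+ 4 * m * T) - q * (q * T)
    3T = trans (lem G m b T) (trans (cong (λ u → G * (+ 4 * m * T) - q * (q * T) + u) (0*-drop _ r₁)) (+-identityʳ _))
      where
      lem : ∀ G m b T → + 3 * T ≡ G * (+ 4 * m * T) - (+ 2 * b + 1ℤ) * ((+ 2 * b + 1ℤ) * T) + (G * m - (b * b + b + 1ℤ)) * (- (+ 4 * T))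
      lem = solve-∀

    G∣3T : G ∣ V → G ∣ + 3 * T
    G∣3T dv = subst (G ∣_) (sym 3T) (∣m∣n⇒∣m-n (∣m⇒∣m*n (+ 4 * m * T) ∣-refl) (∣n⇒∣m*n q
      (subst (G ∣_) (trans (cong (_- G * E) 3dV) (lem (G * E) (q * T))) (∣m∣n⇒∣m-n (∣n⇒∣m*n (+ 3 * d) dv) (∣m⇒∣m*n E ∣-refl)))))
      where
      lem : ∀ u v → (u + v) - u ≡ v
      lem = solve-∀

    t = + 3 + + 3 * δ + + 6 * d * j
    e = 1ℤ + + 3 * δ

    -- t² + t e + e² is the resultant with respect to b of T = e b - t and b² + b + 1, both zero
    -- modulo G; b no longer occurs in it.
    G∣quadratic : G ∣ T → G ∣ t * t + t * e + e * e
    G∣quadratic dv = subst (G ∣_) (trans (cong (λ w → e * e * w - T * (t + t + T + e)) r₁) (lem b e t))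
        (∣m∣n⇒∣m-n (∣n⇒∣m*n (e * e) (∣m⇒∣m*n m ∣-refl)) (∣m⇒∣m*n (t + t + T + e) dv))
      where
      lem : ∀ b e t → e * e * (b * b + b + 1ℤ) - (e * b - t) * (t + t + (e * b - t) + e) ≡ t * t + t * e + e * e
      lem = solve-∀

  module _ {a b c x y X d : ℕ} (P : OddPair a b c x y X d) where
    open OddPair P

    private
      α = + a
      β = + b
      Gₙ = a ℕ.^ g
      G = α ^ g
      Sₙ = a ℕ.^ s
      D = X ℕ.∸ x
      B = β ^ y

      instance
        a≢0 : NonZero a
        a≢0 = ℕ.>-nonZero (ℕ.≤-trans (s≤s z≤n) 7≤a)
        b≢0 : NonZero b
        b≢0 = ℕ.>-nonZero (ℕ.<-trans (s≤s z≤n) 1<b)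
        G≢0 : NonZero Gₙ
        G≢0 = ℕ.m^n≢0 a g

      +G : + Gₙ ≡ G
      +G = pos-^ a g

      1≤d′ : 1 ℕ.≤ d′
      1≤d′ = ℕ.n≢0⇒n>0 λ e → a∤d′ (subst (a ℕ.∣_) (sym e) (a ℕ.∣0))

    S≤δ : Sₙ ℕ.≤ δ
    S≤δ = ℕ.≤-trans (ℕ.m≤m*n Sₙ d′ {{ℕ.>-nonZero 1≤d′}}) (ℕ.≤-reflexive (sym δ≡))

    1≤δ : 1 ℕ.≤ δ
    1≤δ = ℕ.≤-trans (ℕ.m^n>0 a s) S≤δ

    private
      A≡ : a ℕ.^ x ≡ Gₙ ℕ.* Sₙ
      A≡ = trans (cong (a ℕ.^_) x≡) (ℕ.^-distribˡ-+-* a g s)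

      B<A : b ℕ.^ y ℕ.< Gₙ ℕ.* Sₙ
      B<A = ℕ.<-≤-trans (ℕ.m<m+n (b ℕ.^ y) 1≤c) (ℕ.≤-reflexive (trans (sym eq) A≡))

      b^<X : b ℕ.^ (y ℕ.+ d) ℕ.< a ℕ.^ X
      b^<X = ℕ.<-≤-trans (ℕ.m<m+n _ 1≤c) (ℕ.≤-reflexive (sym Eq))

      X≡ : x ℕ.+ D ≡ X
      X≡ = ℕ.m+[n∸m]≡n (ℕ.<⇒≤ x<X)

      ^X : ∀ {n} → D ℕ.≤ n → a ℕ.^ X ℕ.≤ Gₙ ℕ.* Sₙ ℕ.* a ℕ.^ n
      ^X {n} le = ℕ.≤-trans (ℕ.^-monoʳ-≤ a (ℕ.≤-trans (ℕ.≤-reflexive (sym X≡)) (ℕ.+-monoʳ-≤ x le)))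
        (ℕ.≤-reflexive (trans (ℕ.^-distribˡ-+-* a x n) (cong (ℕ._* a ℕ.^ n) A≡)))

      a∤6 : ¬ (α ∣ + 6)
      a∤6 dv = ℕ.>⇒∤ {n = 6} 7≤a (∣⇒∣ᵤ dv)

    -- `key` modulo G: the left side is -6, and every term on the right except the first has a
    -- factor G.
    first-order : g ℕ.≤ D → G ∣ B * (+ d′ * + η) + 1ℤ
    first-order le = prime^∣* prime a∤6 g (subst (G ∣_)
        (trans (cong (λ w → w - B * R * G) (trans (lem₀ (α ^ D)) (cong (λ w → w + + 6) key))) (lem B (+ d′) (+ η) (+ δ - 1ℤ) G k))
      (∣m∣n⇒∣m-n (∣n⇒∣m*n (+ 6) (^ℤ-∣ α le)) (∣n⇒∣m*n (B * R) ∣-refl)))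
      where
      R = + 3 * (+ d′ * (+ δ - 1ℤ)) * (+ η * + η) + G * (+ η * + η * + η) * k
      lem₀ : ∀ u → + 6 * u ≡ + 6 * (u - 1ℤ) + + 6
      lem₀ = solve-∀
      lem : ∀ B d η r G k → B * (+ 6 * (d * η) + + 3 * (d * r) * (G * (η * η)) + G * G * (η * η * η) * k) + + 6 - B * (+ 3 * (d * r) * (η * η) + G * (η * η * η) * k) * G ≡ + 6 * (B * (d * η) + 1ℤ)
      lem = solve-∀

    private
      ∣⇒≤ℕ : ∀ {n} → 1 ℕ.≤ n → G ∣ + n → Gₙ ℕ.≤ n
      ∣⇒≤ℕ {suc n} _ dv = ℕ.∣⇒≤ (ℤ∣⇒ℕ∣ (subst (_∣ + suc n) (sym +G) dv))

      square-expand : ∀ u v → (u ℕ.+ v) ℕ.* (u ℕ.+ v) ℕ.≤ 2 ℕ.* (u ℕ.* u) ℕ.+ 2 ℕ.* (v ℕ.* v)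
      square-expand u v with ℕ.≤-total u v
      ... | inj₁ le = subst (λ v → (u ℕ.+ v) ℕ.* (u ℕ.+ v) ℕ.≤ 2 ℕ.* (u ℕ.* u) ℕ.+ 2 ℕ.* (v ℕ.* v)) (ℕ.m+[n∸m]≡n le) (go u (v ℕ.∸ u))
        where
        lem : ∀ u w → (u ℕ.+ (u ℕ.+ w)) ℕ.* (u ℕ.+ (u ℕ.+ w)) ℕ.+ w ℕ.* w ≡ 2 ℕ.* (u ℕ.* u) ℕ.+ 2 ℕ.* ((u ℕ.+ w) ℕ.* (u ℕ.+ w))
        lem = ℕ-Ring.solve-∀
        go : ∀ u w → (u ℕ.+ (u ℕ.+ w)) ℕ.* (u ℕ.+ (u ℕ.+ w)) ℕ.≤ 2 ℕ.* (u ℕ.* u) ℕ.+ 2 ℕ.* ((u ℕ.+ w) ℕ.* (u ℕ.+ w))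
        go u w = ℕ.≤-trans (ℕ.m≤m+n _ (w ℕ.* w)) (ℕ.≤-reflexive (lem u w))
      ... | inj₂ ge = subst (λ u → (u ℕ.+ v) ℕ.* (u ℕ.+ v) ℕ.≤ 2 ℕ.* (u ℕ.* u) ℕ.+ 2 ℕ.* (v ℕ.* v)) (ℕ.m+[n∸m]≡n ge) (go v (u ℕ.∸ v))
        where
        lem : ∀ v w → ((v ℕ.+ w) ℕ.+ v) ℕ.* ((v ℕ.+ w) ℕ.+ v) ℕ.+ w ℕ.* w ≡ 2 ℕ.* ((v ℕ.+ w) ℕ.* (v ℕ.+ w)) ℕ.+ 2 ℕ.* (v ℕ.* v)
        lem = ℕ-Ring.solve-∀
        go : ∀ v w → ((v ℕ.+ w) ℕ.+ v) ℕ.* ((v ℕ.+ w) ℕ.+ v) ℕ.≤ 2 ℕ.* ((v ℕ.+ w) ℕ.* (v ℕ.+ w)) ℕ.+ 2 ℕ.* (v ℕ.* v)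
        go v w = ℕ.≤-trans (ℕ.m≤m+n _ (w ℕ.* w)) (ℕ.≤-reflexive (lem v w))

      F : ℕ
      F = 6561 ℕ.* (δ ℕ.* δ ℕ.* (δ ℕ.* δ))

      instance
        δ≢0 : NonZero δ
        δ≢0 = ℕ.>-nonZero 1≤δ

      ≤F : ∀ {n} → n ℕ.≤ 6561 ℕ.* δ → n ℕ.≤ F
      ≤F le = ℕ.≤-trans le (ℕ.*-monoʳ-≤ 6561 (ℕ.≤-trans (ℕ.m≤m*n δ δ) (ℕ.m≤m*n (δ ℕ.* δ) (δ ℕ.* δ) {{ℕ.m*n≢0 δ δ}})))

    module Order-one (n₀≡1 : n₀ ≡ 1) (1≤s : 1 ℕ.≤ s) where
      b≡ : b ≡ 1 ℕ.+ Gₙ ℕ.* η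
      b≡ = trans (sym (trans (cong (b ℕ.^_) n₀≡1) (ℕ.^-identityʳ b))) ξ≡

      b≤B : b ℕ.≤ b ℕ.^ y
      b≤B = ℕ.≤-trans (ℕ.≤-reflexive (sym (ℕ.^-identityʳ b))) (ℕ.^-monoʳ-≤ b 1≤y)

      1≤η : 1 ℕ.≤ η
      1≤η = ℕ.n≢0⇒n>0 λ e → a∤η (subst (a ℕ.∣_) (sym e) (a ℕ.∣0))

      η<S : η ℕ.< Sₙ
      η<S = ℕ.*-cancelˡ-< Gₙ η Sₙ (ℕ.≤-<-trans (ℕ.≤-trans (ℕ.n≤1+n _) (ℕ.≤-trans (ℕ.≤-reflexive (sym b≡)) b≤B)) B<A)

      G≤b : Gₙ ℕ.≤ b
      G≤b = ℕ.≤-trans (ℕ.m≤m*n Gₙ η {{ℕ.>-nonZero 1≤η}}) (ℕ.≤-trans (ℕ.n≤1+n _) (ℕ.≤-reflexive (sym b≡)))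

      -- If D < g then a^X ≤ G² S ≤ G^(δ+1), as S ≤ δ ≤ G^(δ-1), while b^(y+d) ≥ G^(δ+1).
      g≤D : g ℕ.≤ D
      g≤D = ℕ.≮⇒≥ λ D<g → ℕ.<⇒≱ (begin-strict
          Gₙ ℕ.^ (1 ℕ.+ δ)               ≤⟨ ℕ.^-monoˡ-≤ (1 ℕ.+ δ) G≤b ⟩
          b ℕ.^ (1 ℕ.+ δ)                ≤⟨ ℕ.^-monoʳ-≤ b (ℕ.+-mono-≤ 1≤y (ℕ.≤-reflexive (sym (trans d≡ (trans (cong (ℕ._* δ) n₀≡1) (ℕ.*-identityˡ δ)))))) ⟩
          b ℕ.^ (y ℕ.+ d)                <⟨ b^<X ⟩
          a ℕ.^ X                        ≤⟨ ^X (ℕ.<⇒≤ D<g) ⟩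
          Gₙ ℕ.* Sₙ ℕ.* Gₙ ∎)
          (begin
          Gₙ ℕ.* Sₙ ℕ.* Gₙ               ≤⟨ ℕ.*-monoˡ-≤ Gₙ (ℕ.*-monoʳ-≤ Gₙ S≤G^) ⟩
          Gₙ ℕ.* Gₙ ℕ.^ (δ ℕ.∸ 1) ℕ.* Gₙ ≡⟨ trans (cong (λ w → Gₙ ℕ.^ w ℕ.* Gₙ) (ℕ.m+[n∸m]≡n 1≤δ)) (ℕ.*-comm (Gₙ ℕ.^ δ) Gₙ) ⟩
          Gₙ ℕ.^ (1 ℕ.+ δ) ∎)
        where
        open ℕ.≤-Reasoning
        2≤G : 2 ℕ.≤ Gₙ
        2≤G = ℕ.≤-trans (ℕ.≤-trans (ℕ.m≤m+n 2 5) 7≤a) (ℕ.≤-trans (ℕ.≤-reflexive (sym (ℕ.^-identityʳ a))) (ℕ.^-monoʳ-≤ a 1≤g))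
        S≤G^ : Sₙ ℕ.≤ Gₙ ℕ.^ (δ ℕ.∸ 1)
        S≤G^ = ℕ.≤-trans S≤δ (ℕ.≤-trans (ℕ.≤-trans (ℕ.≤-reflexive (sym (ℕ.m+[n∸m]≡n 1≤δ))) (n<2^n (δ ℕ.∸ 1))) (ℕ.^-monoˡ-≤ (δ ℕ.∸ 1) 2≤G))

      -- b ≡ 1 modulo G leaves d′ η + 1 ≡ 0. As 1 + G η = b < G S gives η < S, it follows that G ≤
      -- d′ η + 1 ≤ d′ S = δ.
      bound : Gₙ ℕ.≤ δ
      bound = ℕ.≤-trans (∣⇒≤ℕ {d′ ℕ.* η ℕ.+ 1} (ℕ.m≤n+m 1 _) (subst (G ∣_) (trans (lem B (+ d′ * + η)) (trans (cong (_+ 1ℤ) (sym (pos-* d′ η))) (sym (pos-+ (d′ ℕ.* η) 1))))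
          (∣m∣n⇒∣m-n (first-order g≤D) (∣m⇒∣m*n (+ d′ * + η) (subst (λ w → G ∣ B - w) (1^ℤ y) (∣-^ {G} {β} {1ℤ} y G∣b-1))))))
        (ℕ.≤-trans (ℕ.≤-trans (ℕ.≤-trans (ℕ.+-monoʳ-≤ (d′ ℕ.* η) 1≤d′) (ℕ.≤-reflexive (trans (ℕ.+-comm _ d′) (sym (ℕ.*-suc d′ η))))) (ℕ.*-monoʳ-≤ d′ η<S)) (ℕ.≤-reflexive (trans (ℕ.*-comm d′ Sₙ) (sym δ≡))))
        where
        lem : ∀ B u → B * u + 1ℤ - (B - 1ℤ) * u ≡ u + 1ℤ
        lem = solve-∀
        lem′ : ∀ e → 1ℤ + e - 1ℤ ≡ e
        lem′ = solve-∀
        G∣b-1 : G ∣ β - 1ℤ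
        G∣b-1 = subst (G ∣_) (sym (trans (cong (λ w → + w - 1ℤ) b≡) (trans (cong (_- 1ℤ) (trans (pos-+ 1 (Gₙ ℕ.* η)) (cong (λ w → 1ℤ + w) (trans (pos-* Gₙ η) (cong (_* + η) +G))))) (lem′ (G * + η))))) (∣m⇒∣m*n (+ η) ∣-refl)

    module Order-three (n₀≡3 : n₀ ≡ 3) (a∣Φ : a ℕ.∣ b ℕ.* b ℕ.+ b ℕ.+ 1) where
      d≡3δ : d ≡ 3 ℕ.* δ
      d≡3δ = trans d≡ (cong (ℕ._* δ) n₀≡3)

      +Φ : + (b ℕ.* b ℕ.+ b ℕ.+ 1) ≡ β * β + β + 1ℤ
      +Φ = cong (λ w → w + β + 1ℤ) (pos-* b b)

      a∤b-1 : ¬ (α ∣ β - 1ℤ)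
      a∤b-1 dv = ℕ.>⇒∤ {n = 3} (ℕ.≤-trans (ℕ.m≤m+n 4 3) 7≤a) (∣⇒∣ᵤ (subst (α ∣_) (lem β) (∣m∣n⇒∣m-n (subst (α ∣_) +Φ (ℕ∣⇒ℤ∣ a∣Φ)) (∣n⇒∣m*n (β + + 2) dv))))
        where
        lem : ∀ b → b * b + b + 1ℤ - (b + + 2) * (b - 1ℤ) ≡ + 3
        lem = solve-∀

      cubic : (β - 1ℤ) * (β * β + β + 1ℤ) ≡ G * + η
      cubic = trans (lem β) (trans (cong (_- 1ℤ) (trans (sym (pos-^ b 3)) (trans (cong +_ (trans (cong (b ℕ.^_) (sym n₀≡3)) ξ≡)) (trans (pos-+ 1 (Gₙ ℕ.* η)) (cong (λ w → 1ℤ + w) (trans (pos-* Gₙ η) (cong (_* + η) +G))))))) (lem′ (G * + η)))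
        where
        lem : ∀ b → (b - 1ℤ) * (b * b + b + 1ℤ) ≡ b * (b * (b * 1ℤ)) - 1ℤ
        lem = solve-∀
        lem′ : ∀ e → 1ℤ + e - 1ℤ ≡ e
        lem′ = solve-∀

      G∣Φ : Gₙ ℕ.∣ b ℕ.* b ℕ.+ b ℕ.+ 1
      G∣Φ = ℤ∣⇒ℕ∣ (subst₂ _∣_ (sym +G) (sym +Φ) (prime^∣* prime a∤b-1 g (subst (G ∣_) (sym cubic) (∣m⇒∣m*n (+ η) ∣-refl))))

      m : ℕ
      m = ℕ.quotient G∣Φ

      Gm : b ℕ.* b ℕ.+ b ℕ.+ 1 ≡ m ℕ.* Gₙ
      Gm = ℕ._∣_.equality G∣Φ

      r₁ : G * + m ≡ β * β + β + 1ℤ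
      r₁ = trans (*-comm G (+ m)) (trans (cong (+ m *_) (sym +G)) (trans (sym (pos-* m Gₙ)) (trans (cong +_ (sym Gm)) +Φ)))

      η≡ : + η ≡ (β - 1ℤ) * + m
      η≡ = *-cancelˡ-≡ G _ _ {{≢-nonZero (^≢0 g (prime≢0 prime))}} (trans (sym cubic) (trans (cong ((β - 1ℤ) *_) (sym r₁)) (lem (β - 1ℤ) G (+ m))))
        where
        lem : ∀ u G m → u * (G * m) ≡ G * (u * m)
        lem = solve-∀

      Φ<2b² : m ℕ.* Gₙ ℕ.< 2 ℕ.* (b ℕ.* b)
      Φ<2b² = ℕ.≤-<-trans (ℕ.≤-reflexive (sym Gm)) (ℕ.<-≤-trans (ℕ.≤-<-trans (ℕ.≤-reflexive (ℕ.+-assoc (b ℕ.* b) b 1)) (ℕ.+-monoʳ-< (b ℕ.* b) {b ℕ.+ 1} {b ℕ.* b} (b+1< 1<b)))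
          (ℕ.≤-reflexive (cong (b ℕ.* b ℕ.+_) (sym (ℕ.+-identityʳ (b ℕ.* b))))))
        where
        b+1< : ∀ {b} → 1 ℕ.< b → b ℕ.+ 1 ℕ.< b ℕ.* b
        b+1< {suc zero} (s≤s ())
        b+1< {suc (suc n)} _ = ℕ.≤-trans (ℕ.m≤m+n (suc (suc (suc n) ℕ.+ 1)) (3 ℕ.* n ℕ.+ n ℕ.* n)) (ℕ.≤-reflexive (lem n))
          where
          lem : ∀ n → suc (suc (suc n) ℕ.+ 1) ℕ.+ (3 ℕ.* n ℕ.+ n ℕ.* n) ≡ suc (suc n) ℕ.* suc (suc n)
          lem = ℕ-Ring.solve-∀

      1≤m : 1 ℕ.≤ m
      1≤m = ℕ.n≢0⇒n>0 λ e → ℕ.1+n≢0 (trans (ℕ.+-comm 1 (b ℕ.* b ℕ.+ b)) (trans Gm (cong (ℕ._* Gₙ) e)))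

      G<2b² : Gₙ ℕ.< 2 ℕ.* (b ℕ.* b)
      G<2b² = ℕ.≤-<-trans (ℕ.m≤n*m Gₙ m {{ℕ.>-nonZero 1≤m}}) Φ<2b²

      2b²^5 : Gₙ ℕ.^ 5 ℕ.≤ 32 ℕ.* b ℕ.^ 10
      2b²^5 = ℕ.≤-trans (ℕ.^-monoˡ-≤ 5 (ℕ.<⇒≤ G<2b²)) (ℕ.≤-reflexive (lem b))
        where
        lem : ∀ b → ((2 ℕ.* (b ℕ.* b)) ℕ.* ((2 ℕ.* (b ℕ.* b)) ℕ.* ((2 ℕ.* (b ℕ.* b)) ℕ.* ((2 ℕ.* (b ℕ.* b)) ℕ.* ((2 ℕ.* (b ℕ.* b)) ℕ.* 1))))) ≡ 32 ℕ.* (b ℕ.* (b ℕ.* (b ℕ.* (b ℕ.* (b ℕ.* (b ℕ.* (b ℕ.* (b ℕ.* (b ℕ.* (b ℕ.* 1))))))))))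
        lem = ℕ-Ring.solve-∀

      -- If a^X is small then d is at least 9 only for small G.
      short : 3 ℕ.≤ δ → D ℕ.< g ℕ.+ g → Gₙ ℕ.≤ F
      short 3≤δ D<2g = ≤F (ℕ.≤-trans (ℕ.<⇒≤ (ℕ.*-cancelˡ-< (Gₙ ℕ.* Gₙ ℕ.* Gₙ) Gₙ (32 ℕ.* δ) (begin-strict
          Gₙ ℕ.* Gₙ ℕ.* Gₙ ℕ.* Gₙ               ≤⟨ ℕ.m≤m*n _ Gₙ ⟩
          Gₙ ℕ.* Gₙ ℕ.* Gₙ ℕ.* Gₙ ℕ.* Gₙ        ≡⟨ lem Gₙ ⟩
          Gₙ ℕ.^ 5                              ≤⟨ 2b²^5 ⟩
          32 ℕ.* b ℕ.^ 10                       ≤⟨ ℕ.*-monoʳ-≤ 32 (ℕ.^-monoʳ-≤ b (ℕ.+-mono-≤ 1≤y (ℕ.≤-trans (ℕ.*-monoʳ-≤ 3 3≤δ) (ℕ.≤-reflexive (sym d≡3δ))))) ⟩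
          32 ℕ.* b ℕ.^ (y ℕ.+ d)                <⟨ ℕ.*-monoʳ-< 32 b^<X ⟩
          32 ℕ.* a ℕ.^ X                        ≤⟨ ℕ.*-monoʳ-≤ 32 (^X (ℕ.<⇒≤ D<2g)) ⟩
          32 ℕ.* (Gₙ ℕ.* Sₙ ℕ.* a ℕ.^ (g ℕ.+ g)) ≡⟨ cong (λ w → 32 ℕ.* (Gₙ ℕ.* Sₙ ℕ.* w)) (ℕ.^-distribˡ-+-* a g g) ⟩
          32 ℕ.* (Gₙ ℕ.* Sₙ ℕ.* (Gₙ ℕ.* Gₙ))    ≤⟨ ℕ.*-monoʳ-≤ 32 (ℕ.*-monoˡ-≤ (Gₙ ℕ.* Gₙ) (ℕ.*-monoʳ-≤ Gₙ S≤δ)) ⟩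
          32 ℕ.* (Gₙ ℕ.* δ ℕ.* (Gₙ ℕ.* Gₙ))     ≡⟨ lem′ Gₙ δ ⟩
          Gₙ ℕ.* Gₙ ℕ.* Gₙ ℕ.* (32 ℕ.* δ) ∎))) (ℕ.*-monoˡ-≤ δ {32} {6561} (ℕ.m≤m+n 32 6529)))
        where
        open ℕ.≤-Reasoning
        lem : ∀ G → G ℕ.* G ℕ.* G ℕ.* G ℕ.* G ≡ (G ℕ.* (G ℕ.* (G ℕ.* (G ℕ.* (G ℕ.* 1)))))
        lem = ℕ-Ring.solve-∀
        lem′ : ∀ G δ → 32 ℕ.* (G ℕ.* δ ℕ.* (G ℕ.* G)) ≡ G ℕ.* G ℕ.* G ℕ.* (32 ℕ.* δ)
        lem′ = ℕ-Ring.solve-∀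

      -- G < 2 b² and b³ ≤ b^y < G δ give G³ < 8 G² δ².
      y≥3 : 3 ℕ.≤ y → Gₙ ℕ.≤ F
      y≥3 3≤y = ℕ.≤-trans (ℕ.<⇒≤ (ℕ.*-cancelˡ-< (Gₙ ℕ.* Gₙ) Gₙ (8 ℕ.* (δ ℕ.* δ)) (begin-strict
          Gₙ ℕ.* Gₙ ℕ.* Gₙ                                        ≤⟨ ℕ.*-mono-≤ (ℕ.*-mono-≤ le le) le ⟩
          2 ℕ.* (b ℕ.* b) ℕ.* (2 ℕ.* (b ℕ.* b)) ℕ.* (2 ℕ.* (b ℕ.* b)) ≡⟨ lem b ⟩
          8 ℕ.* (b ℕ.^ 3 ℕ.* b ℕ.^ 3)                             <⟨ ℕ.*-monoʳ-< 8 (ℕ.*-mono-< b³< b³<) ⟩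
          8 ℕ.* (Gₙ ℕ.* δ ℕ.* (Gₙ ℕ.* δ))                         ≡⟨ lem′ Gₙ δ ⟩
          Gₙ ℕ.* Gₙ ℕ.* (8 ℕ.* (δ ℕ.* δ)) ∎)))
        (ℕ.*-mono-≤ {8} {6561} (ℕ.m≤m+n 8 6553) (ℕ.m≤m*n (δ ℕ.* δ) (δ ℕ.* δ) {{ℕ.m*n≢0 δ δ}}))
        where
        open ℕ.≤-Reasoning
        le = ℕ.<⇒≤ G<2b²
        b³< : b ℕ.^ 3 ℕ.< Gₙ ℕ.* δ
        b³< = ℕ.≤-<-trans (ℕ.^-monoʳ-≤ b 3≤y) (ℕ.<-≤-trans B<A (ℕ.*-monoʳ-≤ Gₙ S≤δ))
        lem : ∀ b → 2 ℕ.* (b ℕ.* b) ℕ.* (2 ℕ.* (b ℕ.* b)) ℕ.* (2 ℕ.* (b ℕ.* b)) ≡ 8 ℕ.* ((b ℕ.* (b ℕ.* (b ℕ.* 1))) ℕ.* (b ℕ.* (b ℕ.* (b ℕ.* 1))))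
        lem = ℕ-Ring.solve-∀
        lem′ : ∀ G δ → 8 ℕ.* (G ℕ.* δ ℕ.* (G ℕ.* δ)) ≡ G ℕ.* G ℕ.* (8 ℕ.* (δ ℕ.* δ))
        lem′ = ℕ-Ring.solve-∀

      -- D < g is impossible: b⁴ < a^X ≤ G² δ / a.
      g≤D : δ ≡ 1 → s ≡ 0 → g ℕ.≤ D
      g≤D refl refl = ℕ.≮⇒≥ λ D<g → ℕ.<⇒≱ (ℕ.*-monoʳ-< 7 b^<X) (begin
          7 ℕ.* a ℕ.^ X                                 ≤⟨ ℕ.*-monoˡ-≤ (a ℕ.^ X) 7≤a ⟩
          a ℕ.^ suc X                                   ≤⟨ ℕ.^-monoʳ-≤ a (ℕ.≤-trans (ℕ.≤-reflexive (cong suc (sym X≡))) (ℕ.≤-trans (ℕ.≤-reflexive (sym (ℕ.+-suc x D))) (ℕ.+-monoʳ-≤ x D<g))) ⟩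
          a ℕ.^ (x ℕ.+ g)                               ≡⟨ trans (ℕ.^-distribˡ-+-* a x g) (cong (ℕ._* Gₙ) (trans A≡ (ℕ.*-identityʳ Gₙ))) ⟩
          Gₙ ℕ.* Gₙ                                     ≤⟨ ℕ.*-mono-≤ (ℕ.<⇒≤ G<2b²) (ℕ.<⇒≤ G<2b²) ⟩
          2 ℕ.* (b ℕ.* b) ℕ.* (2 ℕ.* (b ℕ.* b))         ≡⟨ lem b ⟩
          4 ℕ.* b ℕ.^ 4                                 ≤⟨ ℕ.*-mono-≤ (ℕ.m≤m+n 4 3) (ℕ.^-monoʳ-≤ b (ℕ.+-mono-≤ 1≤y (ℕ.≤-reflexive (sym d≡3δ)))) ⟩
          7 ℕ.* b ℕ.^ (y ℕ.+ d) ∎)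
        where
        open ℕ.≤-Reasoning
        lem : ∀ b → 2 ℕ.* (b ℕ.* b) ℕ.* (2 ℕ.* (b ℕ.* b)) ≡ 4 ℕ.* (b ℕ.* (b ℕ.* (b ℕ.* (b ℕ.* 1))))
        lem = ℕ-Ring.solve-∀

      s≡0 : δ ≡ 1 → s ≡ 0
      s≡0 e = ℕ.n<1⇒n≡0 (ℕ.≰⇒> λ 1≤s → ℕ.<⇒≱ (ℕ.<-≤-trans (s≤s (s≤s z≤n)) 7≤a) (ℕ.≤-trans (ℕ.≤-reflexive (sym (ℕ.^-identityʳ a)))
        (ℕ.≤-trans (ℕ.^-monoʳ-≤ a 1≤s) (ℕ.≤-trans S≤δ (ℕ.≤-reflexive e)))))

      δ-cases : δ ≡ 1 ⊎ 3 ℕ.≤ δ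
      δ-cases = go δ 1≤δ odd
        where
        go : ∀ n → 1 ℕ.≤ n → ¬ (2 ℕ.∣ n) → n ≡ 1 ⊎ 3 ℕ.≤ n
        go 1 _ _ = inj₁ refl
        go 2 _ o = ⊥-elim (o ℕ.∣-refl)
        go (suc (suc (suc n))) _ _ = inj₂ (s≤s (s≤s (s≤s z≤n)))

      G∣first : g ℕ.≤ D → G ∣ B * (+ d′ * ((β - 1ℤ) * + m)) + 1ℤ
      G∣first le = subst (λ w → G ∣ B * (+ d′ * w) + 1ℤ) η≡ (first-order le)

      -- Now m ≤ 2 S, so the first-order congruence has small coefficients: G ≤ 2 δ b + 5 δ, to be
      -- combined with b² < G δ.
      y≡2′ : y ≡ 2 → g ℕ.≤ D → Gₙ ℕ.≤ F
      y≡2′ refl le = ℕ.≤-trans (ℕ.*-cancelˡ-≤ Gₙ (begin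
          Gₙ ℕ.* Gₙ                                                   ≤⟨ ℕ.*-mono-≤ G≤ G≤ ⟩
          (2 ℕ.* (δ ℕ.* b) ℕ.+ 5 ℕ.* δ) ℕ.* (2 ℕ.* (δ ℕ.* b) ℕ.+ 5 ℕ.* δ) ≤⟨ square-expand (2 ℕ.* (δ ℕ.* b)) (5 ℕ.* δ) ⟩
          2 ℕ.* (2 ℕ.* (δ ℕ.* b) ℕ.* (2 ℕ.* (δ ℕ.* b))) ℕ.+ 2 ℕ.* (5 ℕ.* δ ℕ.* (5 ℕ.* δ)) ≡⟨ lem δ b ⟩
          8 ℕ.* (δ ℕ.* δ) ℕ.* (b ℕ.^ 2) ℕ.+ 50 ℕ.* (δ ℕ.* δ) ℕ.* 1    ≤⟨ ℕ.+-mono-≤ (ℕ.*-monoʳ-≤ (8 ℕ.* (δ ℕ.* δ)) (ℕ.<⇒≤ b²<)) (ℕ.*-monoʳ-≤ (50 ℕ.* (δ ℕ.* δ)) (ℕ.*-mono-≤ (ℕ.m^n>0 a g) 1≤δ)) ⟩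
          8 ℕ.* (δ ℕ.* δ) ℕ.* (Gₙ ℕ.* δ) ℕ.+ 50 ℕ.* (δ ℕ.* δ) ℕ.* (Gₙ ℕ.* δ) ≡⟨ lem₁ δ Gₙ ⟩
          Gₙ ℕ.* (58 ℕ.* (δ ℕ.* δ ℕ.* (δ ℕ.* 1))) ∎))
        (ℕ.*-mono-≤ {58} {6561} (ℕ.m≤m+n 58 6503) (ℕ.*-monoʳ-≤ (δ ℕ.* δ) (ℕ.*-monoʳ-≤ δ 1≤δ)))
        where
        open ℕ.≤-Reasoning
        b²< : b ℕ.^ 2 ℕ.< Gₙ ℕ.* δ
        b²< = ℕ.<-≤-trans B<A (ℕ.*-monoʳ-≤ Gₙ S≤δ)
        lem : ∀ δ b → 2 ℕ.* (2 ℕ.* (δ ℕ.* b) ℕ.* (2 ℕ.* (δ ℕ.* b))) ℕ.+ 2 ℕ.* (5 ℕ.* δ ℕ.* (5 ℕ.* δ)) ≡ 8 ℕ.* (δ ℕ.* δ) ℕ.* ((b ℕ.* (b ℕ.* 1))) ℕ.+ 50 ℕ.* (δ ℕ.* δ) ℕ.* 1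
        lem = ℕ-Ring.solve-∀
        lem₁ : ∀ δ G → 8 ℕ.* (δ ℕ.* δ) ℕ.* (G ℕ.* δ) ℕ.+ 50 ℕ.* (δ ℕ.* δ) ℕ.* (G ℕ.* δ) ≡ G ℕ.* (58 ℕ.* (δ ℕ.* δ ℕ.* (δ ℕ.* 1)))
        lem₁ = ℕ-Ring.solve-∀
        dm≤ : d′ ℕ.* m ℕ.≤ 2 ℕ.* δ
        dm≤ = ℕ.≤-trans (ℕ.*-monoʳ-≤ d′ (ℕ.<⇒≤ (ℕ.*-cancelʳ-< Gₙ m (2 ℕ.* Sₙ) (ℕ.<-trans Φ<2b² (ℕ.<-≤-trans (ℕ.*-monoʳ-< 2 (ℕ.≤-<-trans (ℕ.≤-reflexive (cong (b ℕ.*_) (sym (ℕ.*-identityʳ b)))) B<A)) (ℕ.≤-reflexive (lem₂ Gₙ Sₙ)))))))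
          (ℕ.≤-reflexive (trans (lem₃ d′ Sₙ) (cong (2 ℕ.*_) (sym δ≡))))
          where
          lem₂ : ∀ G S → 2 ℕ.* (G ℕ.* S) ≡ 2 ℕ.* S ℕ.* G
          lem₂ = ℕ-Ring.solve-∀
          lem₃ : ∀ d S → d ℕ.* (2 ℕ.* S) ≡ 2 ℕ.* (S ℕ.* d)
          lem₃ = ℕ-Ring.solve-∀
        -- b²(b - 1) ≡ b + 2 modulo b² + b + 1
        divisible : G ∣ + (d′ ℕ.* m ℕ.* (b ℕ.+ 2) ℕ.+ 1)
        divisible = subst (G ∣_) (trans (cong (λ w → β ^ 2 * (+ d′ * ((β - 1ℤ) * + m)) + 1ℤ - (w * (+ d′ * + m * (β - + 2)))) r₁) (trans (lem₂ β (+ d′) (+ m))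
            (sym (trans (pos-+ (d′ ℕ.* m ℕ.* (b ℕ.+ 2)) 1) (cong (_+ 1ℤ) (trans (pos-* (d′ ℕ.* m) (b ℕ.+ 2)) (cong₂ _*_ (pos-* d′ m) (pos-+ b 2))))))))
          (∣m∣n⇒∣m-n (G∣first le) (∣m⇒∣m*n (+ d′ * + m * (β - + 2)) (∣m⇒∣m*n (+ m) ∣-refl)))
          where
          lem₂ : ∀ b d m → b * (b * 1ℤ) * (d * ((b - 1ℤ) * m)) + 1ℤ - (b * b + b + 1ℤ) * (d * m * (b - + 2)) ≡ d * m * (b + + 2) + 1ℤ
          lem₂ = solve-∀
        G≤ : Gₙ ℕ.≤ 2 ℕ.* (δ ℕ.* b) ℕ.+ 5 ℕ.* δ
        G≤ = begin
          Gₙ                                   ≤⟨ ∣⇒≤ℕ (ℕ.m≤n+m 1 _) divisible ⟩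
          d′ ℕ.* m ℕ.* (b ℕ.+ 2) ℕ.+ 1         ≤⟨ ℕ.+-mono-≤ (ℕ.*-monoˡ-≤ (b ℕ.+ 2) dm≤) 1≤δ ⟩
          2 ℕ.* δ ℕ.* (b ℕ.+ 2) ℕ.+ δ          ≡⟨ lem₄ δ b ⟩
          2 ℕ.* (δ ℕ.* b) ℕ.+ 5 ℕ.* δ ∎
          where
          lem₄ : ∀ δ b → 2 ℕ.* δ ℕ.* (b ℕ.+ 2) ℕ.+ δ ≡ 2 ℕ.* (δ ℕ.* b) ℕ.+ 5 ℕ.* δ
          lem₄ = ℕ-Ring.solve-∀

      module y≡1 (y≡1 : y ≡ 1) (le : g ℕ.≤ D) where
        -- b (b - 1) ≡ -(2b + 1), and multiplying by 2b + 1, whose square is -3, frees the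
        -- coefficient of d′ m from b.
        first : Gₙ ℕ.∣ 3 ℕ.* (d′ ℕ.* m) ℕ.+ (2 ℕ.* b ℕ.+ 1)
        first = ℤ∣⇒ℕ∣ (subst₂ _∣_ (sym +G) (trans (cong (λ w → (+ 2 * β + 1ℤ) * (β ^ 1 * (+ d′ * ((β - 1ℤ) * + m)) + 1ℤ) - w * ((+ 2 * β - + 3) * (+ m * + d′))) r₁) (trans (lem β (+ m) (+ d′)) (sym cast)))
            (∣m∣n⇒∣m-n (∣n⇒∣m*n (+ 2 * β + 1ℤ) (subst (λ n → G ∣ β ^ n * (+ d′ * ((β - 1ℤ) * + m)) + 1ℤ) y≡1 (G∣first le))) (∣m⇒∣m*n ((+ 2 * β - + 3) * (+ m * + d′)) (∣m⇒∣m*n (+ m) ∣-refl))))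
          where
          lem : ∀ b m d → (+ 2 * b + 1ℤ) * (b * 1ℤ * (d * ((b - 1ℤ) * m)) + 1ℤ) - (b * b + b + 1ℤ) * ((+ 2 * b - + 3) * (m * d)) ≡ + 3 * (d * m) + (+ 2 * b + 1ℤ)
          lem = solve-∀
          cast : + (3 ℕ.* (d′ ℕ.* m) ℕ.+ (2 ℕ.* b ℕ.+ 1)) ≡ + 3 * (+ d′ * + m) + (+ 2 * β + 1ℤ)
          cast = trans (pos-+ (3 ℕ.* (d′ ℕ.* m)) _) (cong₂ _+_ (trans (pos-* 3 (d′ ℕ.* m)) (cong (+ 3 *_) (pos-* d′ m))) (trans (pos-+ (2 ℕ.* b) 1) (cong (_+ 1ℤ) (pos-* 2 b))))

        j : ℕ
        j = ℕ.quotient first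

        jG : 3 ℕ.* (d′ ℕ.* m) ℕ.+ (2 ℕ.* b ℕ.+ 1) ≡ j ℕ.* Gₙ
        jG = ℕ._∣_.equality first

        r₂ : + j * G ≡ + 3 * (+ d′ * + m) + (+ 2 * β + 1ℤ)
        r₂ = trans (cong (+ j *_) (sym +G)) (trans (sym (pos-* j Gₙ)) (trans (cong +_ (sym jG))
          (trans (pos-+ (3 ℕ.* (d′ ℕ.* m)) _) (cong₂ _+_ (trans (pos-* 3 (d′ ℕ.* m)) (cong (+ 3 *_) (pos-* d′ m))) (trans (pos-+ (2 ℕ.* b) 1) (cong (_+ 1ℤ) (pos-* 2 b)))))))

        b<GS : b ℕ.< Gₙ ℕ.* Sₙ
        b<GS = subst (ℕ._< Gₙ ℕ.* Sₙ) (trans (cong (b ℕ.^_) y≡1) (ℕ.^-identityʳ b)) B<A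

        jG²≤ : j ℕ.* Gₙ ℕ.* Gₙ ℕ.≤ 6 ℕ.* d′ ℕ.* (b ℕ.* b) ℕ.+ 3 ℕ.* b ℕ.* Gₙ
        jG²≤ = begin
          j ℕ.* Gₙ ℕ.* Gₙ                                             ≡⟨ cong (ℕ._* Gₙ) (sym jG) ⟩
          (3 ℕ.* (d′ ℕ.* m) ℕ.+ (2 ℕ.* b ℕ.+ 1)) ℕ.* Gₙ               ≡⟨ lem d′ m b Gₙ ⟩
          3 ℕ.* d′ ℕ.* (m ℕ.* Gₙ) ℕ.+ (2 ℕ.* b ℕ.+ 1) ℕ.* Gₙ          ≤⟨ ℕ.+-mono-≤ (ℕ.*-monoʳ-≤ (3 ℕ.* d′) (ℕ.<⇒≤ Φ<2b²)) (ℕ.*-monoˡ-≤ Gₙ (ℕ.≤-trans (ℕ.+-monoʳ-≤ (2 ℕ.* b) (ℕ.<⇒≤ 1<b)) (ℕ.≤-reflexive (lem₁ b)))) ⟩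
          3 ℕ.* d′ ℕ.* (2 ℕ.* (b ℕ.* b)) ℕ.+ 3 ℕ.* b ℕ.* Gₙ           ≡⟨ lem₂ d′ b Gₙ ⟩
          6 ℕ.* d′ ℕ.* (b ℕ.* b) ℕ.+ 3 ℕ.* b ℕ.* Gₙ ∎
          where
          open ℕ.≤-Reasoning
          lem : ∀ d m b G → (3 ℕ.* (d ℕ.* m) ℕ.+ (2 ℕ.* b ℕ.+ 1)) ℕ.* G ≡ 3 ℕ.* d ℕ.* (m ℕ.* G) ℕ.+ (2 ℕ.* b ℕ.+ 1) ℕ.* G
          lem = ℕ-Ring.solve-∀
          lem₁ : ∀ b → 2 ℕ.* b ℕ.+ b ≡ 3 ℕ.* b
          lem₁ = ℕ-Ring.solve-∀
          lem₂ : ∀ d b G → 3 ℕ.* d ℕ.* (2 ℕ.* (b ℕ.* b)) ℕ.+ 3 ℕ.* b ℕ.* G ≡ 6 ℕ.* d ℕ.* (b ℕ.* b) ℕ.+ 3 ℕ.* b ℕ.* G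
          lem₂ = ℕ-Ring.solve-∀

        -- b < G S bounds d′ j by δ alone; hence j, unlike b and m, may stay in the final
        -- congruence.
        d′j≤ : d′ ℕ.* j ℕ.≤ 9 ℕ.* (δ ℕ.* δ)
        d′j≤ = begin
          d′ ℕ.* j                                              ≤⟨ ℕ.*-monoʳ-≤ d′ (ℕ.*-cancelʳ-≤ j _ (Gₙ ℕ.* Gₙ) {{ℕ.m*n≢0 Gₙ Gₙ}} (begin
              j ℕ.* (Gₙ ℕ.* Gₙ)                                 ≡⟨ sym (ℕ.*-assoc j Gₙ Gₙ) ⟩
              j ℕ.* Gₙ ℕ.* Gₙ                                   ≤⟨ jG²≤ ⟩
              6 ℕ.* d′ ℕ.* (b ℕ.* b) ℕ.+ 3 ℕ.* b ℕ.* Gₙ         ≤⟨ ℕ.+-mono-≤ (ℕ.*-monoʳ-≤ (6 ℕ.* d′) (ℕ.*-mono-≤ (ℕ.<⇒≤ b<GS) (ℕ.<⇒≤ b<GS))) (ℕ.*-monoˡ-≤ Gₙ (ℕ.*-monoʳ-≤ 3 (ℕ.<⇒≤ b<GS))) ⟩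
              6 ℕ.* d′ ℕ.* (Gₙ ℕ.* Sₙ ℕ.* (Gₙ ℕ.* Sₙ)) ℕ.+ 3 ℕ.* (Gₙ ℕ.* Sₙ) ℕ.* Gₙ ≡⟨ lem d′ Gₙ Sₙ ⟩
              (6 ℕ.* d′ ℕ.* (Sₙ ℕ.* Sₙ) ℕ.+ 3 ℕ.* Sₙ) ℕ.* (Gₙ ℕ.* Gₙ) ∎)) ⟩
          d′ ℕ.* (6 ℕ.* d′ ℕ.* (Sₙ ℕ.* Sₙ) ℕ.+ 3 ℕ.* Sₙ)         ≡⟨ lem₁ d′ Sₙ ⟩
          6 ℕ.* (Sₙ ℕ.* d′ ℕ.* (Sₙ ℕ.* d′)) ℕ.+ 3 ℕ.* (Sₙ ℕ.* d′) ≡⟨ cong (λ w → 6 ℕ.* (w ℕ.* w) ℕ.+ 3 ℕ.* w) (sym δ≡) ⟩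
          6 ℕ.* (δ ℕ.* δ) ℕ.+ 3 ℕ.* δ                           ≤⟨ ℕ.+-monoʳ-≤ (6 ℕ.* (δ ℕ.* δ)) (ℕ.*-monoʳ-≤ 3 (ℕ.m≤m*n δ δ)) ⟩
          6 ℕ.* (δ ℕ.* δ) ℕ.+ 3 ℕ.* (δ ℕ.* δ)                   ≡⟨ lem₂ (δ ℕ.* δ) ⟩
          9 ℕ.* (δ ℕ.* δ) ∎
          where
          open ℕ.≤-Reasoning
          lem : ∀ d G S → 6 ℕ.* d ℕ.* (G ℕ.* S ℕ.* (G ℕ.* S)) ℕ.+ 3 ℕ.* (G ℕ.* S) ℕ.* G ≡ (6 ℕ.* d ℕ.* (S ℕ.* S) ℕ.+ 3 ℕ.* S) ℕ.* (G ℕ.* G)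
          lem = ℕ-Ring.solve-∀
          lem₁ : ∀ d S → d ℕ.* (6 ℕ.* d ℕ.* (S ℕ.* S) ℕ.+ 3 ℕ.* S) ≡ 6 ℕ.* (S ℕ.* d ℕ.* (S ℕ.* d)) ℕ.+ 3 ℕ.* (S ℕ.* d)
          lem₁ = ℕ-Ring.solve-∀
          lem₂ : ∀ u → 6 ℕ.* u ℕ.+ 3 ℕ.* u ≡ 9 ℕ.* u
          lem₂ = ℕ-Ring.solve-∀

        open Second-order G (+ m) β (+ j) (+ d′) (+ δ) r₁ r₂ using (V; T; W≡GV; G∣3T; G∣quadratic)

        -- a^D vanishes modulo G², so the quadratic terms of `key` give a congruence. The resultant
        -- t² + t e + e² is positive, divisible by G and at most 3856 δ⁴.
        far : g ℕ.+ g ℕ.≤ D → Gₙ ℕ.≤ F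
        far 2g≤D = ℕ.≤-trans (∣⇒≤ℕ (ℕ.≤-trans (ℕ.*-mono-≤ 1≤e 1≤e) (ℕ.m≤n+m _ (t ℕ.* t ℕ.+ t ℕ.* e))) (subst (G ∣_) (sym cast) (G∣quadratic G∣T))) (begin
            t ℕ.* t ℕ.+ t ℕ.* e ℕ.+ e ℕ.* e  ≤⟨ ℕ.+-mono-≤ (ℕ.+-mono-≤ (ℕ.*-mono-≤ t≤ t≤) (ℕ.*-mono-≤ t≤ e≤)) (ℕ.*-mono-≤ e≤ e≤) ⟩
            60 ℕ.* Δ ℕ.* (60 ℕ.* Δ) ℕ.+ 60 ℕ.* Δ ℕ.* (4 ℕ.* Δ) ℕ.+ 4 ℕ.* Δ ℕ.* (4 ℕ.* Δ) ≡⟨ lem₁ Δ ⟩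
            3856 ℕ.* (Δ ℕ.* Δ)               ≤⟨ ℕ.*-monoˡ-≤ (Δ ℕ.* Δ) {3856} {6561} (ℕ.m≤m+n 3856 2705) ⟩
            F ∎)
          where
          open ℕ.≤-Reasoning
          t = 3 ℕ.+ 3 ℕ.* δ ℕ.+ 6 ℕ.* (d′ ℕ.* j)
          e = 1 ℕ.+ 3 ℕ.* δ
          Δ = δ ℕ.* δ
          1≤e : 1 ℕ.≤ e
          1≤e = s≤s z≤n
          1≤Δ : 1 ℕ.≤ Δ
          1≤Δ = ℕ.*-mono-≤ 1≤δ 1≤δ
          lem₁ : ∀ Δ → 60 ℕ.* Δ ℕ.* (60 ℕ.* Δ) ℕ.+ 60 ℕ.* Δ ℕ.* (4 ℕ.* Δ) ℕ.+ 4 ℕ.* Δ ℕ.* (4 ℕ.* Δ) ≡ 3856 ℕ.* (Δ ℕ.* Δ)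
          lem₁ = ℕ-Ring.solve-∀
          t≤ : t ℕ.≤ 60 ℕ.* Δ
          t≤ = ℕ.≤-trans (ℕ.+-mono-≤ (ℕ.+-mono-≤ (ℕ.*-monoʳ-≤ 3 1≤Δ) (ℕ.*-monoʳ-≤ 3 (ℕ.m≤m*n δ δ))) (ℕ.*-monoʳ-≤ 6 d′j≤)) (ℕ.≤-reflexive (lem Δ))
            where
            lem : ∀ Δ → 3 ℕ.* Δ ℕ.+ 3 ℕ.* Δ ℕ.+ 6 ℕ.* (9 ℕ.* Δ) ≡ 60 ℕ.* Δ
            lem = ℕ-Ring.solve-∀
          e≤ : e ℕ.≤ 4 ℕ.* Δ
          e≤ = ℕ.+-mono-≤ 1≤Δ (ℕ.*-monoʳ-≤ 3 (ℕ.m≤m*n δ δ))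
          +t : + t ≡ + 3 + + 3 * + δ + + 6 * + d′ * + j
          +t = trans (pos-+ (3 ℕ.+ 3 ℕ.* δ) _) (cong₂ _+_ (trans (pos-+ 3 (3 ℕ.* δ)) (cong (λ w → + 3 + w) (pos-* 3 δ))) (trans (pos-* 6 (d′ ℕ.* j)) (trans (cong (+ 6 *_) (pos-* d′ j)) (sym (*-assoc (+ 6) (+ d′) (+ j))))))
          +e : + e ≡ 1ℤ + + 3 * + δ
          +e = trans (pos-+ 1 (3 ℕ.* δ)) (cong (λ w → 1ℤ + w) (pos-* 3 δ))
          cast : + (t ℕ.* t ℕ.+ t ℕ.* e ℕ.+ e ℕ.* e) ≡ _
          cast = trans (pos-+ (t ℕ.* t ℕ.+ t ℕ.* e) (e ℕ.* e)) (cong₂ _+_ (trans (pos-+ (t ℕ.* t) (t ℕ.* e)) (cong₂ _+_ (trans (pos-* t t) (cong₂ _*_ +t +t)) (trans (pos-* t e) (cong₂ _*_ +t +e)))) (trans (pos-* e e) (cong₂ _*_ +e +e)))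
          G²∣ : G * G ∣ G * V
          G²∣ = subst (G * G ∣_) (trans (cong (λ w → w - β ^ 1 * ((+ η * + η * + η) * k) * (G * G)) six) (trans (lem β (+ d′) (+ η) (+ δ - 1ℤ) G k) (trans (cong (λ w → + 6 + + 6 * (β * (+ d′ * w)) + + 3 * (β * (+ d′ * (+ δ - 1ℤ))) * (G * (w * w))) η≡) W≡GV)))
              (∣m∣n⇒∣m-n (∣n⇒∣m*n (+ 6) (subst (_∣ α ^ D) (^-distribˡ-+-* α g g) (^ℤ-∣ α 2g≤D))) (∣n⇒∣m*n (β ^ 1 * ((+ η * + η * + η) * k)) ∣-refl))
            where
            six : + 6 * α ^ D ≡ β ^ 1 * (+ 6 * (+ d′ * + η) + + 3 * (+ d′ * (+ δ - 1ℤ)) * (G * (+ η * + η)) + G * G * (+ η * + η * + η) * k) + + 6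
            six = trans (lem₀ (α ^ D)) (cong (_+ + 6) (trans key (cong (λ n → β ^ n * (+ 6 * (+ d′ * + η) + + 3 * (+ d′ * (+ δ - 1ℤ)) * (G * (+ η * + η)) + G * G * (+ η * + η * + η) * k)) y≡1)))
              where
              lem₀ : ∀ u → + 6 * u ≡ + 6 * (u - 1ℤ) + + 6
              lem₀ = solve-∀
            lem : ∀ b d η r G k → b * 1ℤ * (+ 6 * (d * η) + + 3 * (d * r) * (G * (η * η)) + G * G * (η * η * η) * k) + + 6 - b * 1ℤ * ((η * η * η) * k) * (G * G)
              ≡ + 6 + + 6 * (b * (d * η)) + + 3 * (b * (d * r)) * (G * (η * η))
            lem = solve-∀
          a∤3 : ¬ (α ∣ + 3)
          a∤3 dv = ℕ.>⇒∤ {n = 3} (ℕ.≤-trans (ℕ.m≤m+n 4 3) 7≤a) (∣⇒∣ᵤ dv)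
          G∣T : G ∣ T
          G∣T = prime^∣* prime a∤3 g (G∣3T (∣*-cancel (^≢0 g (prime≢0 prime)) G²∣))

        -- Here d′ = S = 1, hence b ≤ G ≤ 9 b, and G⁴ ≤ 9⁴ b⁴ < 9⁴ G³. This is the origin of 6561 =
        -- 9⁴.
        near : δ ≡ 1 → D ℕ.< g ℕ.+ g → Gₙ ℕ.≤ F
        near δ≡1 D<2g = ≤F (ℕ.≤-trans (ℕ.<⇒≤ (ℕ.*-cancelˡ-< (Gₙ ℕ.* Gₙ ℕ.* Gₙ) Gₙ 6561 (begin-strict
            Gₙ ℕ.* Gₙ ℕ.* Gₙ ℕ.* Gₙ                                ≤⟨ ℕ.*-mono-≤ (ℕ.*-mono-≤ (ℕ.*-mono-≤ G≤9b G≤9b) G≤9b) G≤9b ⟩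
            9 ℕ.* b ℕ.* (9 ℕ.* b) ℕ.* (9 ℕ.* b) ℕ.* (9 ℕ.* b)      ≡⟨ lem b ⟩
            6561 ℕ.* b ℕ.^ 4                                       ≤⟨ ℕ.*-monoʳ-≤ 6561 (ℕ.^-monoʳ-≤ b (ℕ.+-mono-≤ 1≤y (ℕ.≤-reflexive (sym (trans d≡3δ (cong (3 ℕ.*_) δ≡1)))))) ⟩
            6561 ℕ.* b ℕ.^ (y ℕ.+ d)                               <⟨ ℕ.*-monoʳ-< 6561 b^<X ⟩
            6561 ℕ.* a ℕ.^ X                                       ≤⟨ ℕ.*-monoʳ-≤ 6561 (^X (ℕ.<⇒≤ D<2g)) ⟩
            6561 ℕ.* (Gₙ ℕ.* Sₙ ℕ.* a ℕ.^ (g ℕ.+ g))               ≡⟨ cong₂ (λ u v → 6561 ℕ.* (Gₙ ℕ.* u ℕ.* v)) S≡1 (ℕ.^-distribˡ-+-* a g g) ⟩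
            6561 ℕ.* (Gₙ ℕ.* 1 ℕ.* (Gₙ ℕ.* Gₙ))                    ≡⟨ lem′ Gₙ ⟩
            Gₙ ℕ.* Gₙ ℕ.* Gₙ ℕ.* 6561 ∎))) (ℕ.≤-trans (ℕ.≤-reflexive (sym (ℕ.*-identityʳ 6561))) (ℕ.*-monoʳ-≤ 6561 1≤δ)))
          where
          open ℕ.≤-Reasoning
          instance
            G³≢0 : NonZero (Gₙ ℕ.* Gₙ ℕ.* Gₙ)
            G³≢0 = ℕ.m*n≢0 (Gₙ ℕ.* Gₙ) Gₙ {{ℕ.m*n≢0 Gₙ Gₙ}}
          lem : ∀ b → 9 ℕ.* b ℕ.* (9 ℕ.* b) ℕ.* (9 ℕ.* b) ℕ.* (9 ℕ.* b) ≡ 6561 ℕ.* (b ℕ.* (b ℕ.* (b ℕ.* (b ℕ.* 1))))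
          lem = ℕ-Ring.solve-∀
          lem′ : ∀ G → 6561 ℕ.* (G ℕ.* 1 ℕ.* (G ℕ.* G)) ≡ G ℕ.* G ℕ.* G ℕ.* 6561
          lem′ = ℕ-Ring.solve-∀
          S≡1 : Sₙ ≡ 1
          S≡1 = ℕ.≤-antisym (ℕ.≤-trans S≤δ (ℕ.≤-reflexive δ≡1)) (ℕ.m^n>0 a s)
          d′≡1 : d′ ≡ 1
          d′≡1 = trans (sym (ℕ.*-identityˡ d′)) (trans (cong (ℕ._* d′) (sym S≡1)) (trans (sym δ≡) δ≡1))
          1≤j : 1 ℕ.≤ j
          1≤j = ℕ.n≢0⇒n>0 λ e → ℕ.1+n≢0 (trans (lem₃ (3 ℕ.* (d′ ℕ.* m)) (2 ℕ.* b)) (trans jG (cong (ℕ._* Gₙ) e)))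
            where
            lem₃ : ∀ u v → suc (u ℕ.+ v) ≡ u ℕ.+ (v ℕ.+ 1)
            lem₃ = ℕ-Ring.solve-∀
          b≤G : b ℕ.≤ Gₙ
          b≤G = ℕ.≤-trans (ℕ.<⇒≤ b<GS) (ℕ.≤-reflexive (trans (cong (Gₙ ℕ.*_) S≡1) (ℕ.*-identityʳ Gₙ)))
          G≤9b : Gₙ ℕ.≤ 9 ℕ.* b
          G≤9b = ℕ.*-cancelʳ-≤ Gₙ (9 ℕ.* b) Gₙ (begin
            Gₙ ℕ.* Gₙ                                      ≤⟨ ℕ.*-monoˡ-≤ Gₙ (ℕ.m≤n*m Gₙ j {{ℕ.>-nonZero 1≤j}}) ⟩
            j ℕ.* Gₙ ℕ.* Gₙ                                ≤⟨ jG²≤ ⟩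
            6 ℕ.* d′ ℕ.* (b ℕ.* b) ℕ.+ 3 ℕ.* b ℕ.* Gₙ      ≤⟨ ℕ.+-monoˡ-≤ _ (ℕ.*-mono-≤ (ℕ.≤-reflexive (cong (6 ℕ.*_) d′≡1)) (ℕ.*-monoʳ-≤ b b≤G)) ⟩
            6 ℕ.* 1 ℕ.* (b ℕ.* Gₙ) ℕ.+ 3 ℕ.* b ℕ.* Gₙ      ≡⟨ lem₄ b Gₙ ⟩
            9 ℕ.* b ℕ.* Gₙ ∎)
            where
            lem₄ : ∀ b G → 6 ℕ.* 1 ℕ.* (b ℕ.* G) ℕ.+ 3 ℕ.* b ℕ.* G ≡ 9 ℕ.* b ℕ.* G
            lem₄ = ℕ-Ring.solve-∀

      bound : Gₙ ℕ.≤ F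
      bound = by-δ δ-cases
        where
        by-y : g ℕ.≤ D → (y ≡ 1 → Gₙ ℕ.≤ F) → ∀ n → y ≡ n → Gₙ ℕ.≤ F
        by-y le h 0 e = ⊥-elim (ℕ.<⇒≢ 1≤y (sym e))
        by-y le h 1 e = h e
        by-y le h 2 e = y≡2′ e le
        by-y le h (suc (suc (suc n))) e = y≥3 (subst (3 ℕ.≤_) (sym e) (s≤s (s≤s (s≤s z≤n))))
        by-δ : δ ≡ 1 ⊎ 3 ℕ.≤ δ → Gₙ ℕ.≤ F
        by-δ (inj₁ δ≡1) = by-y le (λ e → [ y≡1.far e le , y≡1.near e le δ≡1 ]′ (ℕ.≤-<-connex (g ℕ.+ g) D)) y refl
          where le = g≤D δ≡1 (s≡0 δ≡1)
        by-δ (inj₂ 3≤δ) = [ (λ 2g≤D → let le = ℕ.≤-trans (ℕ.m≤m+n g g) 2g≤D in by-y le (λ e → y≡1.far e le 2g≤D) y refl) , short 3≤δ ]′ (ℕ.≤-<-connex (g ℕ.+ g) D)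

    elimination : a ℕ.^ g ℕ.≤ 6561 ℕ.* (δ ℕ.* δ ℕ.* (δ ℕ.* δ))
    elimination = [ (λ (e , 1≤s) → ≤F (ℕ.≤-trans (Order-one.bound e 1≤s) (ℕ.m≤n*m δ 6561))) , (λ (e , Φ) → Order-three.bound e Φ) ]′ kind

-- Explicit bounds for δ from the criterion

module Thresholds where
  open import Data.Nat.Base using (_≤ᵇ_)
  open import Data.Bool.Base using (true; false; if_then_else_; T)
  open import Data.List.Base using (List; []; _∷_)
  open import Data.Integer.Base hiding (suc; NonZero; _≤ᵇ_)
  open import Data.Integer.Properties
  open import Data.Integer.Divisibility.Signed
  open import Data.Integer.Tactic.RingSolver using (solve-∀)
  open Vandermonde using (pos-^)
  open Criterion using (^ℤ-∣)
  open Baker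
  open SignedDivisibility
  open OddGap
  open Elimination

  module _ {a b c x y X d : ℕ} (P : OddPair a b c x y X d) where
    open OddPair P

    private
      instance
        a≢0 : NonZero a
        a≢0 = ℕ.>-nonZero (ℕ.≤-trans (s≤s z≤n) 7≤a)
        b≢0 : NonZero b
        b≢0 = ℕ.>-nonZero (ℕ.<-trans (s≤s z≤n) 1<b)

      2≤a : 2 ℕ.≤ a
      2≤a = ℕ.≤-trans (ℕ.m≤m+n 2 5) 7≤a

      G = a ℕ.^ g
      ξ = b ℕ.^ n₀

      a≤G : a ℕ.≤ G
      a≤G = ℕ.≤-trans (ℕ.≤-reflexive (sym (ℕ.^-identityʳ a))) (ℕ.^-monoʳ-≤ a 1≤g)

      G<ξ : G ℕ.< ξ
      G<ξ = ℕ.≤-trans (s≤s (ℕ.m≤m*n G η {{ℕ.≢-nonZero λ e → a∤η (subst (a ℕ.∣_) (sym e) (a ℕ.∣0))}})) (ℕ.≤-reflexive (sym ξ≡))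

      G∣ξ-1 : + G ∣ + ξ - 1ℤ
      G∣ξ-1 = subst (+ G ∣_) (sym (trans (cong (λ w → + w - 1ℤ) ξ≡) (trans (cong (_- 1ℤ) (trans (pos-+ 1 (G ℕ.* η)) (cong (λ w → 1ℤ + w) (pos-* G η)))) (lem (+ G * + η))))) (∣m⇒∣m*n (+ η) ∣-refl)
        where
        lem : ∀ e → 1ℤ + e - 1ℤ ≡ e
        lem = solve-∀

      Bξ^δ : b ℕ.^ y ℕ.* ξ ℕ.^ δ ℕ.+ c ≡ a ℕ.^ X
      Bξ^δ = trans (cong (ℕ._+ c) (trans (cong (b ℕ.^ y ℕ.*_) (trans (ℕ.^-*-assoc b n₀ δ) (cong (b ℕ.^_) (sym d≡)))) (sym (ℕ.^-distribˡ-+-* b y d)))) (sym Eq)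

      -- G^τ ≤ ξ^δ ≤ a^X, and G^τ and a^X are both powers of a, so the smaller divides the larger.
      rel : ∀ τ → G ℕ.^ τ ℕ.≤ ξ ℕ.^ δ → + (G ℕ.^ τ) ∣ + (b ℕ.^ y ℕ.* ξ ℕ.^ δ ℕ.+ c)
      rel τ le = subst₂ _∣_ (trans (sym (pos-^ a (g ℕ.* τ))) (cong +_ (sym (ℕ.^-*-assoc a g τ)))) (trans (sym (pos-^ a X)) (cong +_ (sym Bξ^δ)))
        (^ℤ-∣ (+ a) {g ℕ.* τ} {X} (^-cancel-≤ 2≤a (ℕ.≤-trans (ℕ.≤-reflexive (sym (ℕ.^-*-assoc a g τ))) (ℕ.≤-trans le (ℕ.≤-trans (ℕ.≤-trans (ℕ.m≤n*m (ξ ℕ.^ δ) (b ℕ.^ y) {{ℕ.m^n≢0 b y}}) (ℕ.m≤m+n _ c)) (ℕ.≤-reflexive Bξ^δ))))))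

    baker-pair : ∀ u m n .{{_ : NonZero u}} .{{_ : NonZero m}} .{{_ : NonZero n}} → g ℕ.+ s ℕ.≤ g ℕ.* u →
      δ ℕ.+ u ℕ.≤ 8 ℕ.* u ℕ.* n → 2 ℕ.* (4 ℕ.* n) ℕ.^ 8 ℕ.* G ℕ.^ 6 ℕ.≤ G ℕ.^ (7 ℕ.* m) →
      768 ℕ.* (m ℕ.* m ℕ.* u) ℕ.+ 96 ℕ.* (m ℕ.* m) ℕ.+ 48 ℕ.* (m ℕ.* u) ℕ.≤ δ → ⊥
    baker-pair u m n le = baker G ξ δ (b ℕ.^ y) c u m n (ℕ.≤-trans 2≤a a≤G) G<ξ G∣ξ-1 (ℕ.m^n>0 b y) 1≤c
      (ℕ.≤-trans (ℕ.≤-reflexive (trans (sym eq) (cong (a ℕ.^_) x≡))) (ℕ.≤-trans (ℕ.^-monoʳ-≤ a le) (ℕ.≤-reflexive (sym (ℕ.^-*-assoc a g u))))) rel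

    private
      -- v = 9 is the least positive v with 3552 v³ ≤ 7^(v-1), whence the bound 7^8. The left side
      -- of `δ-large` for u = v and m = 2v is 3072 v³ + 480 v² ≤ 3552 v³.
      cube-bound : ∀ j → 3552 ℕ.* ((9 ℕ.+ j) ℕ.* (9 ℕ.+ j) ℕ.* (9 ℕ.+ j)) ℕ.≤ 7 ℕ.^ (8 ℕ.+ j)
      cube-bound zero    = ℕ.≤ᵇ⇒≤ _ _ _
      cube-bound (suc j) = begin
        3552 ℕ.* (suc v ℕ.* suc v ℕ.* suc v)          ≤⟨ ℕ.*-monoʳ-≤ 3552 cubes ⟩
        3552 ℕ.* (7 ℕ.* (v ℕ.* v ℕ.* v))              ≡⟨ lem (v ℕ.* v ℕ.* v) ⟩
        7 ℕ.* (3552 ℕ.* (v ℕ.* v ℕ.* v))              ≤⟨ ℕ.*-monoʳ-≤ 7 (cube-bound j) ⟩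
        7 ℕ.^ (9 ℕ.+ j) ∎
        where
        open ℕ.≤-Reasoning
        v = 9 ℕ.+ j
        lem : ∀ w → 3552 ℕ.* (7 ℕ.* w) ≡ 7 ℕ.* (3552 ℕ.* w)
        lem = ℕ-Ring.solve-∀
        lem′ : ∀ v → suc v ℕ.* suc v ℕ.* suc v ≡ v ℕ.* v ℕ.* v ℕ.+ 3 ℕ.* (v ℕ.* v) ℕ.+ 3 ℕ.* v ℕ.+ 1
        lem′ = ℕ-Ring.solve-∀
        lem″ : ∀ w → w ℕ.+ w ℕ.+ w ℕ.+ w ℕ.+ 3 ℕ.* w ≡ 7 ℕ.* w
        lem″ = ℕ-Ring.solve-∀
        3≤v : 3 ℕ.≤ v
        3≤v = ℕ.m≤m+n 3 (6 ℕ.+ j)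
        v≤v² : v ℕ.≤ v ℕ.* v
        v≤v² = ℕ.m≤m*n v v
        3w≤ : 3 ℕ.* (v ℕ.* v) ℕ.≤ v ℕ.* v ℕ.* v
        3w≤ = ℕ.≤-trans (ℕ.*-monoˡ-≤ (v ℕ.* v) 3≤v) (ℕ.≤-reflexive (ℕ.*-comm v (v ℕ.* v)))
        3v≤ : 3 ℕ.* v ℕ.≤ v ℕ.* v ℕ.* v
        3v≤ = ℕ.≤-trans (ℕ.*-monoʳ-≤ 3 v≤v²) 3w≤
        1≤ : 1 ℕ.≤ v ℕ.* v ℕ.* v
        1≤ = ℕ.≤-trans (ℕ.*-mono-≤ {1} {3} {1} {v} (s≤s z≤n) (s≤s z≤n)) 3v≤
        cubes : suc v ℕ.* suc v ℕ.* suc v ℕ.≤ 7 ℕ.* (v ℕ.* v ℕ.* v)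
        cubes = ℕ.≤-trans (ℕ.≤-reflexive (lem′ v)) (ℕ.≤-trans (ℕ.+-mono-≤ (ℕ.+-mono-≤ (ℕ.+-monoʳ-≤ (v ℕ.* v ℕ.* v) 3w≤) 3v≤) 1≤)
          (ℕ.≤-trans (ℕ.m≤m+n _ (3 ℕ.* (v ℕ.* v ℕ.* v))) (ℕ.≤-reflexive (lem″ (v ℕ.* v ℕ.* v)))))

      -- The parameters follow v, the logarithm of δ to base 7: u = v because 7^s ≤ δ < 7^v bounds
      -- s, m = 2v, and the generous n = δ.
      very-large : ∀ j → 7 ℕ.^ (8 ℕ.+ j) ℕ.< suc δ → suc δ ℕ.≤ 7 ℕ.^ (9 ℕ.+ j) → ⊥
      very-large j low high = baker-pair v (2 ℕ.* v) δ {{_}} {{_}} {{ℕ.>-nonZero (1≤δ P)}} u-ok n-ok m-ok thr-ok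
        where
        v = 9 ℕ.+ j
        7^≤δ : 7 ℕ.^ (8 ℕ.+ j) ℕ.≤ δ
        7^≤δ = ℕ.s≤s⁻¹ low
        s<v : s ℕ.< v
        s<v = ℕ.≰⇒> λ v≤s → ℕ.<⇒≱ (ℕ.<-≤-trans (ℕ.n<1+n δ) high) (ℕ.≤-trans (ℕ.^-monoˡ-≤ v 7≤a) (ℕ.≤-trans (ℕ.^-monoʳ-≤ a v≤s) (S≤δ P)))
        u-ok : g ℕ.+ s ℕ.≤ g ℕ.* v
        u-ok = ℕ.≤-trans (ℕ.+-monoʳ-≤ g (ℕ.≤-trans (ℕ.s≤s⁻¹ s<v) (ℕ.m≤n*m (8 ℕ.+ j) g {{ℕ.>-nonZero 1≤g}}))) (ℕ.≤-reflexive (sym (ℕ.*-suc g (8 ℕ.+ j))))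
        v≤δ : v ℕ.≤ δ
        v≤δ = ℕ.≤-trans (ℕ.≤-trans (ℕ.≤-trans (ℕ.m≤m*n v (v ℕ.* v)) (ℕ.≤-reflexive (sym (ℕ.*-assoc v v v)))) (ℕ.m≤n*m (v ℕ.* v ℕ.* v) 3552)) (ℕ.≤-trans (cube-bound j) 7^≤δ)
        n-ok : δ ℕ.+ v ℕ.≤ 8 ℕ.* v ℕ.* δ
        n-ok = ℕ.≤-trans (ℕ.+-monoʳ-≤ δ v≤δ) (ℕ.≤-trans (ℕ.≤-reflexive (cong (δ ℕ.+_) (sym (ℕ.+-identityʳ δ)))) (ℕ.*-monoˡ-≤ δ (ℕ.≤-trans (ℕ.m≤m+n 2 70) (ℕ.*-monoʳ-≤ 8 (ℕ.m≤m+n 9 j)))))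
        m-ok : 2 ℕ.* (4 ℕ.* δ) ℕ.^ 8 ℕ.* G ℕ.^ 6 ℕ.≤ G ℕ.^ (7 ℕ.* (2 ℕ.* v))
        m-ok = begin
          2 ℕ.* (4 ℕ.* δ) ℕ.^ 8 ℕ.* G ℕ.^ 6                ≤⟨ ℕ.*-monoˡ-≤ (G ℕ.^ 6) (ℕ.*-mono-≤ (ℕ.≤-trans 2≤a a≤G) (ℕ.^-monoˡ-≤ 8 (ℕ.*-mono-≤ (ℕ.≤-trans (ℕ.m≤m+n 4 3) (ℕ.≤-trans 7≤a a≤G)) (ℕ.≤-trans (ℕ.n≤1+n δ) (ℕ.≤-trans high (ℕ.^-monoˡ-≤ v (ℕ.≤-trans 7≤a a≤G))))))) ⟩
          G ℕ.* (G ℕ.^ suc v) ℕ.^ 8 ℕ.* G ℕ.^ 6            ≡⟨ trans (cong (λ w → G ℕ.* w ℕ.* G ℕ.^ 6) (ℕ.^-*-assoc G (suc v) 8)) (sym (ℕ.^-distribˡ-+-* G (suc (suc v ℕ.* 8)) 6)) ⟩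
          G ℕ.^ (suc (suc v ℕ.* 8) ℕ.+ 6)                  ≤⟨ ℕ.^-monoʳ-≤ G {{ℕ.m^n≢0 a g}} (ℕ.≤-trans (ℕ.m≤m+n (suc (suc (9 ℕ.+ j) ℕ.* 8) ℕ.+ 6) (39 ℕ.+ 6 ℕ.* j)) (ℕ.≤-reflexive (lem j))) ⟩
          G ℕ.^ (7 ℕ.* (2 ℕ.* v)) ∎
          where
          open ℕ.≤-Reasoning
          lem : ∀ j → suc (suc (9 ℕ.+ j) ℕ.* 8) ℕ.+ 6 ℕ.+ (39 ℕ.+ 6 ℕ.* j) ≡ 7 ℕ.* (2 ℕ.* (9 ℕ.+ j))
          lem = ℕ-Ring.solve-∀
        thr-ok : 768 ℕ.* (2 ℕ.* v ℕ.* (2 ℕ.* v) ℕ.* v) ℕ.+ 96 ℕ.* (2 ℕ.* v ℕ.* (2 ℕ.* v)) ℕ.+ 48 ℕ.* (2 ℕ.* v ℕ.* v) ℕ.≤ δ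
        thr-ok = ℕ.≤-trans (ℕ.≤-trans (ℕ.≤-reflexive (lem v)) (ℕ.≤-trans (ℕ.+-monoʳ-≤ (3072 ℕ.* (v ℕ.* v ℕ.* v)) (ℕ.*-monoʳ-≤ 480 (ℕ.m≤m*n (v ℕ.* v) v))) (ℕ.≤-reflexive (lem′ (v ℕ.* v ℕ.* v))))) (ℕ.≤-trans (cube-bound j) 7^≤δ)
          where
          lem : ∀ v → 768 ℕ.* (2 ℕ.* v ℕ.* (2 ℕ.* v) ℕ.* v) ℕ.+ 96 ℕ.* (2 ℕ.* v ℕ.* (2 ℕ.* v)) ℕ.+ 48 ℕ.* (2 ℕ.* v ℕ.* v) ≡ 3072 ℕ.* (v ℕ.* v ℕ.* v) ℕ.+ 480 ℕ.* (v ℕ.* v)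
          lem = ℕ-Ring.solve-∀
          lem′ : ∀ w → 3072 ℕ.* w ℕ.+ 480 ℕ.* w ≡ 3552 ℕ.* w
          lem′ = ℕ-Ring.solve-∀

    δ<7^8 : δ ℕ.< 7 ℕ.^ 8
    δ<7^8 = ℕ.≰⇒> λ le → let (e , low , high) = log-bracket 7 (suc δ) (s≤s (s≤s z≤n)) (s≤s (1≤δ P))
                             8≤e = ℕ.s≤s⁻¹ (^-cancel-< {8} {suc e} (ℕ.≤-<-trans le high))
                             e≡ = sym (ℕ.m+[n∸m]≡n 8≤e)
                         in very-large (e ℕ.∸ 8) (subst (λ e → 7 ℕ.^ e ℕ.< suc δ) e≡ low) (subst (λ e → suc δ ℕ.≤ 7 ℕ.^ suc e) e≡ high)
      where
      ^-cancel-< : ∀ {i j} → 7 ℕ.^ i ℕ.< 7 ℕ.^ j → i ℕ.< j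
      ^-cancel-< {i} {j} lt = ℕ.≰⇒> λ j≤i → ℕ.<⇒≱ lt (ℕ.^-monoʳ-≤ 7 j≤i)

  -- Successive applications of the criterion lower the upper bound hi for δ.
  lower : ℕ → ℕ → ℕ → ℕ → ℕ
  lower G u m hi = let n = suc ((hi ℕ.+ suc u) ℕ./ (8 ℕ.* suc u)) in
    if 2 ℕ.* (4 ℕ.* n) ℕ.^ 8 ℕ.* G ℕ.^ 6 ≤ᵇ G ℕ.^ (7 ℕ.* suc m)
    then 768 ℕ.* (suc m ℕ.* suc m ℕ.* suc u) ℕ.+ 96 ℕ.* (suc m ℕ.* suc m) ℕ.+ 48 ℕ.* (suc m ℕ.* suc u) else hi

  -- The parameter n depends on the bound already reached, so every improvement may admit a smaller
  -- m next; hence a decreasing list.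
  threshold : ℕ → ℕ → List ℕ → ℕ → ℕ
  threshold G u []       hi = hi
  threshold G u (m ∷ ms) hi = threshold G u ms (lower G u m hi)

  module _ {a b c x y X d : ℕ} (P : OddPair a b c x y X d) where
    open OddPair P

    lower-sound : ∀ u m hi → g ℕ.+ s ℕ.≤ g ℕ.* suc u → δ ℕ.< hi → δ ℕ.< lower (a ℕ.^ g) u m hi
    lower-sound u m hi u-ok lt = decide (2 ℕ.* (4 ℕ.* n) ℕ.^ 8 ℕ.* (a ℕ.^ g) ℕ.^ 6 ≤ᵇ (a ℕ.^ g) ℕ.^ (7 ℕ.* suc m)) refl
      where
      n = suc ((hi ℕ.+ suc u) ℕ./ (8 ℕ.* suc u))
      t = 768 ℕ.* (suc m ℕ.* suc m ℕ.* suc u) ℕ.+ 96 ℕ.* (suc m ℕ.* suc m) ℕ.+ 48 ℕ.* (suc m ℕ.* suc u)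
      n-ok : δ ℕ.+ suc u ℕ.≤ 8 ℕ.* suc u ℕ.* n
      n-ok = begin
        δ ℕ.+ suc u                                        ≤⟨ ℕ.+-monoˡ-≤ (suc u) (ℕ.<⇒≤ lt) ⟩
        N                                                  ≡⟨ ℕ.m≡m%n+[m/n]*n N (8 ℕ.* suc u) ⟩
        N ℕ.% (8 ℕ.* suc u) ℕ.+ N ℕ./ (8 ℕ.* suc u) ℕ.* (8 ℕ.* suc u) ≤⟨ ℕ.+-monoˡ-≤ _ (ℕ.<⇒≤ (ℕ.m%n<n N (8 ℕ.* suc u))) ⟩
        n ℕ.* (8 ℕ.* suc u)                                ≡⟨ ℕ.*-comm n (8 ℕ.* suc u) ⟩
        8 ℕ.* suc u ℕ.* n ∎
        where
        open ℕ.≤-Reasoning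
        N = hi ℕ.+ suc u
      decide : ∀ ok → (2 ℕ.* (4 ℕ.* n) ℕ.^ 8 ℕ.* (a ℕ.^ g) ℕ.^ 6 ≤ᵇ (a ℕ.^ g) ℕ.^ (7 ℕ.* suc m)) ≡ ok → δ ℕ.< (if ok then t else hi)
      decide false _ = lt
      decide true  e = ℕ.≰⇒> (baker-pair P (suc u) (suc m) n u-ok n-ok (ℕ.≤ᵇ⇒≤ (2 ℕ.* (4 ℕ.* n) ℕ.^ 8 ℕ.* (a ℕ.^ g) ℕ.^ 6) ((a ℕ.^ g) ℕ.^ (7 ℕ.* suc m)) (subst T (sym e) _)))

    threshold-sound : ∀ u ms hi → g ℕ.+ s ℕ.≤ g ℕ.* suc u → δ ℕ.< hi → δ ℕ.< threshold (a ℕ.^ g) u ms hi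
    threshold-sound u []       hi u-ok lt = lt
    threshold-sound u (m ∷ ms) hi u-ok lt = threshold-sound u ms _ u-ok (lower-sound u m hi u-ok lt)

    -- `key` modulo a, for which X > x suffices. It determines d′ modulo a once b and y are chosen,
    -- which shortens the search accordingly.
    a∣d′ηB+1 : a ℕ.∣ d′ ℕ.* (η ℕ.* b ℕ.^ y) ℕ.+ 1
    a∣d′ηB+1 = ℤ∣⇒ℕ∣ (subst (+ a ∣_) cast ([ (λ e → ⊥-elim (ℕ.>⇒∤ {n = 6} 7≤a (∣⇒∣ᵤ e))) , (λ e → e) ]′ (euclidℤ prime (+ 6) ((+ b) ^ y * (+ d′ * + η) + 1ℤ) six)))
      where
      a∣^ : ∀ {n} → 1 ℕ.≤ n → + a ∣ (+ a) ^ n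
      a∣^ {suc n} _ = divides ((+ a) ^ n) (*-comm (+ a) ((+ a) ^ n))
      G = (+ a) ^ g
      cast : (+ b) ^ y * (+ d′ * + η) + 1ℤ ≡ + (d′ ℕ.* (η ℕ.* b ℕ.^ y) ℕ.+ 1)
      cast = trans (cong (_+ 1ℤ) (trans (lem ((+ b) ^ y) (+ d′) (+ η)) (trans (cong (+ d′ *_) (trans (cong (+ η *_) (sym (pos-^ b y))) (sym (pos-* η (b ℕ.^ y))))) (sym (pos-* d′ (η ℕ.* b ℕ.^ y)))))) (sym (pos-+ (d′ ℕ.* (η ℕ.* b ℕ.^ y)) 1))
        where
        lem : ∀ B d η → B * (d * η) ≡ d * (η * B)
        lem = solve-∀
      R = + 3 * (+ d′ * (+ δ - 1ℤ)) * (+ η * + η) + G * (+ η * + η * + η) * k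
      six : + a ∣ + 6 * ((+ b) ^ y * (+ d′ * + η) + 1ℤ)
      six = subst (+ a ∣_) (trans (cong (λ w → w - (+ b) ^ y * R * G) (trans (lem₀ ((+ a) ^ (X ℕ.∸ x))) (cong (λ w → w + + 6) key))) (lem ((+ b) ^ y) (+ d′) (+ η) (+ δ - 1ℤ) G k))
        (∣m∣n⇒∣m-n (∣n⇒∣m*n (+ 6) (a∣^ (ℕ.m<n⇒0<n∸m x<X))) (∣n⇒∣m*n ((+ b) ^ y * R) (a∣^ 1≤g)))
        where
        lem₀ : ∀ u → + 6 * u ≡ + 6 * (u - 1ℤ) + + 6
        lem₀ = solve-∀
        lem : ∀ B d η r G k → B * (+ 6 * (d * η) + + 3 * (d * r) * (G * (η * η)) + G * G * (η * η * η) * k) + + 6 - B * (+ 3 * (d * r) * (η * η) + G * (η * η * η) * k) * G ≡ + 6 * (B * (d * η) + 1ℤ)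
        lem = solve-∀

-- The search program for small r

module Search where
  open import Data.Nat.Base
  open import Data.Nat.Properties
  open import Data.Nat.DivMod
  open import Data.Nat.Divisibility
  open import Data.Bool.Base using (Bool; true; false; if_then_else_; T; not; _∧_)
  open import Data.List.Base using (List; []; _∷_)
  open import Data.Unit.Base using (tt)
  open OddGap
  open Thresholds

  -- Total variants with default 0 for modulus zero, so that the program carries no `NonZero`
  -- arguments.
  rem quo : ℕ → ℕ → ℕ
  rem n zero    = 0
  rem n (suc m) = n % suc m
  quo n zero    = 0
  quo n (suc m) = n / suc m

  powmod : ℕ → ℕ → ℕ → ℕ → ℕ
  powstep : ℕ → ℕ → ℕ → ℕ → ℕ
  powmod zero    M b e       = rem 1 M
  powmod (suc f) M b zero    = rem 1 M
  powmod (suc f) M b (suc e) = powstep (rem (suc e) 2) M b (powmod f M (rem (b * b) M) (quo (suc e) 2))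
  powstep zero    M b h = h
  powstep (suc _) M b h = rem (b * h) M

  power : ℕ → ℕ → ℕ → ℕ
  power M b e = powmod e M b e

  -- w is neither one of p, p a, …, p aⁿ⁻¹ nor a multiple of p aⁿ.
  avoids : ℕ → ℕ → ℕ → ℕ → Bool
  avoids zero    a p w = not (rem w p ≡ᵇ 0)
  avoids (suc n) a p w = not (w ≡ᵇ p) ∧ (if rem w (p * a) ≡ᵇ 0 then avoids n a (p * a) w else true)

  module _ (a S T n₀ M p : ℕ) where
    -- d stands for d′, which is odd and fixed modulo a and therefore moves in steps of 2a; w
    -- follows b^(y + n₀ S d) through the constant factor q. Running out of fuel counts as failure.
    run : ℕ → (q c d w : ℕ) → Bool
    run zero    q c d w = false
    run (suc f) q c d w = if d * S <ᵇ T then avoids 11 a p (w + c) ∧ run f q c (d + 2 * a) (rem (w * q) M) else true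

    loopD : ℕ → (b q y κ c d : ℕ) → Bool
    testD : (b q y c d r : ℕ) → Bool
    -- The fuel is a, and a steps of 2 from 1 meet every odd class modulo 2a; its end is the regular
    -- end of the loop.
    loopD zero    b q y κ c d = true
    loopD (suc f) b q y κ c d = if d * S <ᵇ T then testD b q y c d (rem (d * κ + 1) a) ∧ loopD f b q y κ c (2 + d) else true
    testD b q y c d zero    = run T q c d (power M b (y + n₀ * (S * d)))
    testD b q y c d (suc _) = true

    loopY : ℕ → (A b q η y B : ℕ) → Bool
    loopY zero    A b q η y B = false
    loopY (suc f) A b q η y B = if B <ᵇ A then loopD a b q y (rem (η * B) a) (A ∸ B) 1 ∧ loopY f A b q η (suc y) (B * b) else true

    startY : (A G b : ℕ) → Bool
    -- 300 is fuel for the exponent y; were it too small, `loopY` would return `false`.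
    startY A G b = if 1 <ᵇ b then loopY 300 A b (power M b (n₀ * (S * (2 * a)))) (quo (b ^ n₀ ∸ 1) G) 1 b else true

    loopB : (A G ρ k : ℕ) → Bool
    loopB A G ρ zero    = true
    loopB A G ρ (suc k) = startY A G (ρ + G * k) ∧ loopB A G ρ k

  -- The candidates for b modulo G = a^g are 1 and the two primitive cube roots of unity w and - 1 - w.
  module _ (a G S T A M p : ℕ) where
    search : ℕ → Bool
    search w = (rem (w * w + w + 1) G ≡ᵇ 0) ∧ (suc w <ᵇ G) ∧ loopB a S T 3 M p A G w S ∧ loopB a S T 3 M p A G (G ∸ suc w) S
      ∧ (if G <ᵇ T then loopB a S T 1 M p A G 1 S else true)

  -- If w is a cube root of unity modulo a then w^(a^(g-1)) is one modulo a^g.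
  checkT : (a w g G S A T : ℕ) → Bool
  checkT a w g G S A T = if T ≤ᵇ S then true else if 6561 * (T * T * (T * T)) <ᵇ G then true
    else search a G S T A (A * a ^ 12) (A * a) (powmod G G w (a ^ (g ∸ 1)))

  module _ (ms : List ℕ) (hi : ℕ) where
    checkU : (a w g s G S u : ℕ) → Bool
    checkU a w g s G S u = (g + s ≤ᵇ g * suc u) ∧ checkT a w g G S (G * S) (threshold G u ms hi)

    -- The last argument is the ceiling of s / g, so `suc u` is the least value with g + s ≤ g (suc
    -- u); `checkU` tests that inequality itself.
    checkPair : (a w g s : ℕ) → Bool
    checkPair a w g s = checkU a w g s (a ^ g) (a ^ s) (quo (s + g ∸ 1) g)

    checkS : (a w g s : ℕ) → Bool
    checkS a w g zero    = true
    checkS a w g (suc s) = checkPair a w g s ∧ checkS a w g s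

    checkG : (a w s g : ℕ) → Bool
    checkG a w s zero    = true
    checkG a w s (suc g) = checkS a w (suc g) s ∧ checkG a w s g

  -- The list is a schedule for the parameter m of the criterion; the bound s < 8 comes from 7^s ≤ δ < 7^8.
  check : (a w g : ℕ) → Bool
  check a w g = checkG (11 ∷ 10 ∷ 9 ∷ 8 ∷ 7 ∷ 6 ∷ 5 ∷ 4 ∷ 3 ∷ 2 ∷ 1 ∷ []) (7 ^ 8) a w 8 g

  rem≡% : ∀ n M .{{_ : NonZero M}} → rem n M ≡ n % M
  rem≡% n (suc m) = refl

  quo≡/ : ∀ n M .{{_ : NonZero M}} → quo n M ≡ n / M
  quo≡/ n (suc m) = refl

  ∧-split : ∀ {p q} → T (p ∧ q) → T p × T q
  ∧-split {true} t = tt , t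

  if-yes : ∀ {c p q} → T c → T (if c then p else q) → T p
  if-yes {true} _ t = t

  if-no : ∀ {c p q} → ¬ T c → T (if c then p else q) → T q
  if-no {false} _ t = t
  if-no {true}  n _ = ⊥-elim (n tt)

  not-T : ∀ {p} → T (not p) → ¬ T p
  not-T {true} ()

  %-^ : ∀ x n M .{{_ : NonZero M}} → (x % M) ^ n % M ≡ x ^ n % M
  %-^ x zero    M = refl
  %-^ x (suc n) M = trans (%-distribˡ-* (x % M) ((x % M) ^ n) M) (trans (cong₂ (λ u v → u * v % M) (m%n%n≡m%n x M) (%-^ x n M)) (sym (%-distribˡ-* x (x ^ n) M)))

-- Soundness of the search program

module SearchSoundness where
  open import Data.Nat.Base hiding (parity)
  open import Data.Nat.Properties
  open import Data.Nat.DivMod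
  open import Data.Nat.Divisibility
  open import Data.Nat.Tactic.RingSolver using (solve-∀)
  open import Data.Bool.Base using (true; if_then_else_; T; not; _∧_)
  open import Data.List.Base using (List; []; _∷_)
  import Data.Integer.Base as ℤ
  import Data.Integer.Properties as ℤ
  import Data.Integer.Divisibility.Signed as ℤ∣
  import Data.Integer.Tactic.RingSolver as ℤ-Ring
  open SignedDivisibility
  open LehmerSequences using (parity)
  open OddGap
  open Elimination
  open Thresholds
  open Vandermonde using (pos-^)
  open Search

  powstep-correct : ∀ r M b h w .{{_ : NonZero M}} → r < 2 → w ≡ (b * b) ^ h % M → powstep r M b w ≡ b ^ (r + h * 2) % M
  powstep-correct zero          M b h w _ e = trans e (cong (_% M) (square b h))
    where
    square : ∀ b h → (b * b) ^ h ≡ b ^ (h * 2)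
    square b h = trans (cong (_^ h) (cong (b *_) (sym (*-identityʳ b)))) (trans (^-*-assoc b 2 h) (cong (b ^_) (*-comm 2 h)))
  powstep-correct (suc zero)    M b h w _ e = trans (rem≡% (b * w) M) (trans (cong (λ v → b * v % M) (trans e (cong (_% M) (square b h))))
    (trans (%-distribˡ-* b (b ^ (h * 2) % M) M) (trans (cong (λ v → (b % M) * v % M) (m%n%n≡m%n (b ^ (h * 2)) M)) (sym (%-distribˡ-* b (b ^ (h * 2)) M)))))
    where
    square : ∀ b h → (b * b) ^ h ≡ b ^ (h * 2)
    square b h = trans (cong (_^ h) (cong (b *_) (sym (*-identityʳ b)))) (trans (^-*-assoc b 2 h) (cong (b ^_) (*-comm 2 h)))
  powstep-correct (suc (suc r)) M b h w (s≤s (s≤s ())) e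

  powmod-correct : ∀ f M b e .{{_ : NonZero M}} → e ≤ f → powmod f M b e ≡ b ^ e % M
  powmod-correct zero    M b .zero   z≤n      = rem≡% 1 M
  powmod-correct (suc f) M b zero    _        = rem≡% 1 M
  powmod-correct (suc f) M b (suc e) (s≤s le) =
    trans (powstep-correct (suc e % 2) M b (suc e / 2) _ (m%n<n (suc e) 2)
      (trans (powmod-correct f M (rem (b * b) M) (suc e / 2) (≤-trans (s≤s⁻¹ (m/n<m (suc e) 2 (s≤s (s≤s z≤n)))) le))
        (trans (cong (λ v → v ^ (suc e / 2) % M) (rem≡% (b * b) M)) (%-^ (b * b) (suc e / 2) M))))
      (cong (λ v → b ^ v % M) (sym (m≡m%n+[m/n]*n (suc e) 2)))

  power-correct : ∀ M b e .{{_ : NonZero M}} → power M b e ≡ b ^ e % M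
  power-correct M b e = powmod-correct e M b e ≤-refl

  if-multiple : ∀ {q} w p .{{_ : NonZero p}} → p ∣ w → T (if rem w p ≡ᵇ 0 then q else true) → T q
  if-multiple w p p∣w = if-yes (≡⇒≡ᵇ (rem w p) 0 (trans (rem≡% w p) (n∣m⇒m%n≡0 w p p∣w)))

  module _ (a : ℕ) .{{_ : NonZero a}} where
    avoids-multiple : ∀ n p w .{{_ : NonZero p}} → p * a ^ n ∣ w → ¬ T (avoids n a p w)
    avoids-multiple zero    p w M∣w t = not-T t (≡⇒≡ᵇ (rem w p) 0 (trans (rem≡% w p) (n∣m⇒m%n≡0 w p (subst (_∣ w) (*-identityʳ p) M∣w))))
    avoids-multiple (suc n) p w M∣w t = avoids-multiple n (p * a) w {{m*n≢0 p a}} M∣w′ (if-multiple w (p * a) {{m*n≢0 p a}} (∣-trans (m∣m*n (a ^ n)) M∣w′) (proj₂ (∧-split {not (w ≡ᵇ p)} t)))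
      where
      M∣w′ = subst (_∣ w) (sym (*-assoc p a (a ^ n))) M∣w

    avoids-value : ∀ n p i .{{_ : NonZero p}} → i < n → ¬ T (avoids n a p (a ^ i * p))
    avoids-value (suc n) p zero    _        t = not-T (proj₁ (∧-split t)) (≡⇒≡ᵇ (p + 0) p (+-identityʳ p))
    avoids-value (suc n) p (suc i) (s≤s lt) t = avoids-value n (p * a) i {{m*n≢0 p a}} lt (subst (λ w → T (avoids n a (p * a) w)) (lem a (a ^ i) p)
        (if-multiple (a ^ suc i * p) (p * a) {{m*n≢0 p a}} (divides (a ^ i) (lem a (a ^ i) p)) (proj₂ (∧-split {not (a ^ suc i * p ≡ᵇ p)} t))))
      where
      lem : ∀ a u p → a * u * p ≡ u * (p * a)
      lem = solve-∀

  %-step : ∀ b y F d e M .{{_ : NonZero M}} → (b ^ (y + F * d) % M) * (b ^ (F * e) % M) % M ≡ b ^ (y + F * (d + e)) % M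
  %-step b y F d e M = trans (sym (%-distribˡ-* (b ^ (y + F * d)) (b ^ (F * e)) M)) (cong (_% M) (trans (sym (^-distribˡ-+-* b (y + F * d) (F * e))) (cong (b ^_) (lem y F d e))))
    where
    lem : ∀ y F d e → y + F * d + F * e ≡ y + F * (d + e)
    lem = solve-∀

  module _ (a S T′ n₀ M p : ℕ) .{{_ : NonZero M}} where
    private
      F = n₀ * S

    run-sound : ∀ f b y c d w i → w ≡ b ^ (y + F * d) % M → (d + 2 * a * i) * S < T′ →
      T (run a S T′ n₀ M p f (b ^ (F * (2 * a)) % M) c d w) → T (avoids 11 a p (b ^ (y + F * (d + 2 * a * i)) % M + c))
    run-sound (suc f) b y c d w i w≡ lt t = next i lt (if-yes (<⇒<ᵇ (≤-<-trans (*-monoˡ-≤ S (m≤m+n d (2 * a * i))) lt)) t)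
      where
      q = b ^ (F * (2 * a)) % M
      lem : ∀ i → d + 2 * a * suc i ≡ d + 2 * a + 2 * a * i
      lem i = trans (cong (d +_) (*-suc (2 * a) i)) (sym (+-assoc d (2 * a) (2 * a * i)))
      next : ∀ i → (d + 2 * a * i) * S < T′ → T (avoids 11 a p (w + c) ∧ run a S T′ n₀ M p f q c (d + 2 * a) (rem (w * q) M)) → T (avoids 11 a p (b ^ (y + F * (d + 2 * a * i)) % M + c))
      next zero    lt t = subst (λ v → T (avoids 11 a p (v + c))) (trans w≡ (cong (λ e → b ^ (y + F * e) % M) (sym (trans (cong (d +_) (*-zeroʳ (2 * a))) (+-identityʳ d))))) (proj₁ (∧-split t))
      next (suc i) lt t = subst (λ e → T (avoids 11 a p (b ^ (y + F * e) % M + c))) (sym (lem i))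
        (run-sound f b y c (d + 2 * a) (rem (w * q) M) i (trans (rem≡% (w * q) M) (trans (cong (λ v → v * q % M) w≡) (%-step b y F d (2 * a) M)))
          (subst (λ e → e * S < T′) (lem i) lt) (proj₂ (∧-split {avoids 11 a p (w + c)} t)))

    loopD-sound : ∀ f b q y κ c e j → j < f → (e + 2 * j) * S < T′ → rem ((e + 2 * j) * κ + 1) a ≡ 0 →
      T (loopD a S T′ n₀ M p f b q y κ c e) → T (run a S T′ n₀ M p T′ q c (e + 2 * j) (power M b (y + n₀ * (S * (e + 2 * j)))))
    loopD-sound (suc f) b q y κ c e j j<f lt ap t = next j j<f lt ap (if-yes (<⇒<ᵇ (≤-<-trans (*-monoˡ-≤ S (m≤m+n e (2 * j))) lt)) t)
      where
      lem : ∀ e j → e + 2 * suc j ≡ 2 + e + 2 * j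
      lem = solve-∀
      next : ∀ j → j < suc f → (e + 2 * j) * S < T′ → rem ((e + 2 * j) * κ + 1) a ≡ 0 →
        T (testD a S T′ n₀ M p b q y c e (rem (e * κ + 1) a) ∧ loopD a S T′ n₀ M p f b q y κ c (2 + e)) → T (run a S T′ n₀ M p T′ q c (e + 2 * j) (power M b (y + n₀ * (S * (e + 2 * j)))))
      next zero    _         lt ap t = subst (λ w → T (run a S T′ n₀ M p T′ q c w (power M b (y + n₀ * (S * w))))) (sym (+-identityʳ e))
        (subst (λ r → T (testD a S T′ n₀ M p b q y c e r)) (trans (cong (λ w → rem (w * κ + 1) a) (sym (+-identityʳ e))) ap) (proj₁ (∧-split t)))
      next (suc j) (s≤s j<f) lt ap t = subst (λ w → T (run a S T′ n₀ M p T′ q c w (power M b (y + n₀ * (S * w))))) (sym (lem e j))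
        (loopD-sound f b q y κ c (2 + e) j j<f (subst (λ w → w * S < T′) (lem e j) lt) (subst (λ w → rem (w * κ + 1) a ≡ 0) (lem e j) ap)
          (proj₂ (∧-split {testD a S T′ n₀ M p b q y c e (rem (e * κ + 1) a)} t)))

    loopY-sound : ∀ f A b q η y₀ j .{{_ : NonZero b}} → b ^ (y₀ + j) < A → T (loopY a S T′ n₀ M p f A b q η y₀ (b ^ y₀)) →
      T (loopD a S T′ n₀ M p a b q (y₀ + j) (rem (η * b ^ (y₀ + j)) a) (A ∸ b ^ (y₀ + j)) 1)
    loopY-sound (suc f) A b q η y₀ j lt t = next j lt (if-yes (<⇒<ᵇ (≤-<-trans (^-monoʳ-≤ b (m≤m+n y₀ j)) lt)) t)
      where
      next : ∀ j → b ^ (y₀ + j) < A → T (loopD a S T′ n₀ M p a b q y₀ (rem (η * b ^ y₀) a) (A ∸ b ^ y₀) 1 ∧ loopY a S T′ n₀ M p f A b q η (suc y₀) (b ^ y₀ * b)) →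
        T (loopD a S T′ n₀ M p a b q (y₀ + j) (rem (η * b ^ (y₀ + j)) a) (A ∸ b ^ (y₀ + j)) 1)
      next zero lt t = subst (λ w → T (loopD a S T′ n₀ M p a b q w (rem (η * b ^ w) a) (A ∸ b ^ w) 1)) (sym (+-identityʳ y₀)) (proj₁ (∧-split t))
      next (suc j) lt t = subst (λ w → T (loopD a S T′ n₀ M p a b q w (rem (η * b ^ w) a) (A ∸ b ^ w) 1)) (sym (+-suc y₀ j))
        (loopY-sound f A b q η (suc y₀) j (subst (λ w → b ^ w < A) (+-suc y₀ j) lt)
          (subst (λ w → T (loopY a S T′ n₀ M p f A b q η (suc y₀) w)) (*-comm (b ^ y₀) b) (proj₂ (∧-split {loopD a S T′ n₀ M p a b q y₀ (rem (η * b ^ y₀) a) (A ∸ b ^ y₀) 1} t))))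

    loopB-sound : ∀ A G ρ n k → k < n → T (loopB a S T′ n₀ M p A G ρ n) → T (startY a S T′ n₀ M p A G (ρ + G * k))
    loopB-sound A G ρ (suc n) k (s≤s k≤n) t =
      [ (λ k<n → loopB-sound A G ρ n k k<n (proj₂ (∧-split {startY a S T′ n₀ M p A G (ρ + G * n)} t)))
      , (λ e → subst (λ w → T (startY a S T′ n₀ M p A G (ρ + G * w))) (sym e) (proj₁ (∧-split t))) ]′ (m≤n⇒m<n∨m≡n k≤n)

  module _ {a b c x y X d : ℕ} (P : OddPair a b c x y X d) where
    open OddPair P

    private
      instance
        a≢0 : NonZero a
        a≢0 = >-nonZero (≤-trans (s≤s z≤n) 7≤a)
        b≢0 : NonZero b
        b≢0 = >-nonZero (<-trans (s≤s z≤n) 1<b)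

    -- Only the residue of b^(y+d) modulo a^(x+12) is known. If X ≥ x + 12, adding c gives a
    -- multiple of that modulus; otherwise b^(y+d) is its own residue and the sum is one of the
    -- eleven powers a^(x+1), ..., a^(x+11).
    not-avoids : ∀ M p .{{_ : NonZero M}} → M ≡ a ^ x * a ^ 12 → p ≡ a ^ x * a → ¬ T (avoids 11 a p (b ^ (y + d) % M + c))
    not-avoids M p M≡ p≡ t with x + 12 ≤? X
    ... | yes far = avoids-multiple a 11 p (b ^ (y + d) % M + c) (subst (_∣ b ^ (y + d) % M + c) (trans M≡ (trans (sym (*-assoc (a ^ x) a (a ^ 11))) (cong (_* a ^ 11) (sym p≡)))) (m%n≡0⇒n∣m _ M zero-mod)) t
      where
      instance
        p≢0 : NonZero p
        p≢0 = subst NonZero (sym p≡) (m*n≢0 (a ^ x) a {{m^n≢0 a x}})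
      zero-mod : (b ^ (y + d) % M + c) % M ≡ 0
      zero-mod = trans (%-distribˡ-+ (b ^ (y + d) % M) c M) (trans (cong (λ w → (w + c % M) % M) (m%n%n≡m%n (b ^ (y + d)) M))
        (trans (sym (%-distribˡ-+ (b ^ (y + d)) c M)) (n∣m⇒m%n≡0 _ M (subst₂ _∣_ (sym (trans M≡ (sym (^-distribˡ-+-* a x 12)))) Eq (divides (a ^ (X ∸ (x + 12)))
          (trans (cong (a ^_) (sym (m∸n+n≡m far))) (^-distribˡ-+-* a (X ∸ (x + 12)) (x + 12))))))))
    ... | no near = avoids-value a 11 p i {{subst NonZero (sym p≡) (m*n≢0 (a ^ x) a {{m^n≢0 a x}})}} i<11 (subst (λ w → T (avoids 11 a p w)) value t)
      where
      i = X ∸ suc x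
      X≡ : suc x + i ≡ X
      X≡ = m+[n∸m]≡n x<X
      i<11 : i < 11
      i<11 = +-cancelˡ-< (suc x) i 11 (subst₂ _<_ (sym X≡) (+-suc x 11) (≰⇒> near))
      small : b ^ (y + d) < M
      small = <-≤-trans (m<m+n (b ^ (y + d)) 1≤c) (≤-trans (≤-reflexive (sym Eq)) (≤-trans (^-monoʳ-≤ a (<⇒≤ (≰⇒> near))) (≤-reflexive (trans (^-distribˡ-+-* a x 12) (sym M≡)))))
      value : b ^ (y + d) % M + c ≡ a ^ i * p
      value = trans (cong (_+ c) (m<n⇒m%n≡m small)) (trans (sym Eq) (trans (cong (a ^_) (sym X≡)) (trans (^-distribˡ-+-* a (suc x) i) (trans (*-comm (a ^ suc x) (a ^ i)) (cong (a ^ i *_) (trans (*-comm a (a ^ x)) (sym p≡)))))))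

    b<A : b < a ^ x
    b<A = ≤-<-trans (≤-trans (≤-reflexive (sym (^-identityʳ b))) (^-monoʳ-≤ b 1≤y)) (<-≤-trans (m<m+n (b ^ y) 1≤c) (≤-reflexive (sym eq)))

    A≡GS : a ^ x ≡ a ^ g * a ^ s
    A≡GS = trans (cong (a ^_) x≡) (^-distribˡ-+-* a g s)

    -- d′ = 1 + 2j + 2a i with j < a: `loopD` reaches j, and `run` reaches i.
    startY-unsound : ∀ T′ → δ < T′ → ¬ T (startY a (a ^ s) T′ n₀ (a ^ x * a ^ 12) (a ^ x * a) (a ^ x) (a ^ g) b)
    startY-unsound T′ δ<T t = not-avoids M p refl refl (subst₂ (λ w v → T (avoids 11 a p (w + v))) power≡ c≡
        (run-sound a S T′ n₀ M p T′ b y (a ^ x ∸ b ^ y) (1 + 2 * j) (power M b (y + n₀ * (S * (1 + 2 * j)))) i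
          (trans (power-correct M b (y + n₀ * (S * (1 + 2 * j)))) (cong (λ w → b ^ (y + w) % M) (sym (*-assoc n₀ S (1 + 2 * j)))))
          in-range
          (loopD-sound a S T′ n₀ M p a b q y κ (a ^ x ∸ b ^ y) 1 j (m%n<n h a) (≤-<-trans (*-monoˡ-≤ S (m≤m+n (1 + 2 * j) (2 * a * i))) in-range)
            (trans (rem≡% ((1 + 2 * j) * κ + 1) a) same-residue) inD)))
      where
      S = a ^ s
      M = a ^ x * a ^ 12
      p = a ^ x * a
      instance
        M≢0 : NonZero M
        M≢0 = m*n≢0 (a ^ x) (a ^ 12) {{m^n≢0 a x}} {{m^n≢0 a 12}}
      κ = rem (η * b ^ y) a
      c≡ : a ^ x ∸ b ^ y ≡ c
      c≡ = trans (cong (_∸ b ^ y) eq) (m+n∸m≡n (b ^ y) c)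
      B<A : b ^ y < a ^ x
      B<A = <-≤-trans (m<m+n (b ^ y) 1≤c) (≤-reflexive (sym eq))
      odd-d′ : ∀ h → d′ ≡ 2 * h ⊎ d′ ≡ suc (2 * h) → d′ ≡ suc (2 * h)
      odd-d′ h (inj₂ e) = e
      odd-d′ h (inj₁ e) = ⊥-elim (odd (subst (2 ∣_) (sym (trans δ≡ (cong (S *_) e))) (∣n⇒∣m*n S (m∣m*n h))))
      h = proj₁ (parity d′)
      d′≡ : d′ ≡ suc (2 * h)
      d′≡ = odd-d′ h (proj₂ (parity d′))
      i j q : ℕ
      i = h / a
      j = h % a
      q = b ^ (n₀ * S * (2 * a)) % M
      d′≡′ : d′ ≡ 1 + 2 * j + 2 * a * i
      d′≡′ = trans d′≡ (cong suc (trans (cong (2 *_) (m≡m%n+[m/n]*n h a)) (lem j i a)))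
        where
        lem : ∀ j i a → 2 * (j + i * a) ≡ 2 * j + 2 * a * i
        lem = solve-∀
      in-range : (1 + 2 * j + 2 * a * i) * S < T′
      in-range = subst (λ w → w * S < T′) d′≡′ (subst (_< T′) (trans δ≡ (*-comm S d′)) δ<T)
      y≡ : 1 + (y ∸ 1) ≡ y
      y≡ = m+[n∸m]≡n 1≤y
      div : (d′ * κ + 1) % a ≡ 0
      div = trans (cong (λ w → (d′ * w + 1) % a) (rem≡% (η * b ^ y) a)) (trans (%-distribˡ-+ (d′ * (η * b ^ y % a)) 1 a) (trans (cong (λ w → (w + 1 % a) % a)
        (trans (%-distribˡ-* d′ (η * b ^ y % a) a) (trans (cong (λ w → (d′ % a) * w % a) (m%n%n≡m%n (η * b ^ y) a)) (sym (%-distribˡ-* d′ (η * b ^ y) a)))))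
        (trans (sym (%-distribˡ-+ (d′ * (η * b ^ y)) 1 a)) (n∣m⇒m%n≡0 _ a (a∣d′ηB+1 P)))))
      quo-η : quo (b ^ n₀ ∸ 1) (a ^ g) ≡ η
      quo-η = trans (quo≡/ (b ^ n₀ ∸ 1) (a ^ g) {{m^n≢0 a g}}) (trans (cong (λ w → (w / a ^ g) {{m^n≢0 a g}}) (trans (cong (_∸ 1) ξ≡) (*-comm (a ^ g) η))) (m*n/n≡m η (a ^ g) {{m^n≢0 a g}}))
      same-residue : ((1 + 2 * j) * κ + 1) % a ≡ 0
      same-residue = trans (sym (trans (cong (_% a) (lem (1 + 2 * j) a i κ)) ([m+kn]%n≡m%n ((1 + 2 * j) * κ + 1) (2 * i * κ) a))) (trans (cong (λ w → (w * κ + 1) % a) (sym d′≡′)) div)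
        where
        lem : ∀ e a i κ → (e + 2 * a * i) * κ + 1 ≡ e * κ + 1 + 2 * i * κ * a
        lem = solve-∀
      q≡ : power M b (n₀ * (S * (2 * a))) ≡ q
      q≡ = trans (power-correct M b (n₀ * (S * (2 * a)))) (cong (λ w → b ^ w % M) (sym (*-assoc n₀ S (2 * a))))
      inY : T (loopY a S T′ n₀ M p 300 (a ^ x) b q η 1 (b ^ 1))
      inY = subst₂ (λ w v → T (loopY a S T′ n₀ M p 300 (a ^ x) b v w 1 (b ^ 1))) quo-η q≡
        (subst (λ v → T (loopY a S T′ n₀ M p 300 (a ^ x) b (power M b (n₀ * (S * (2 * a)))) (quo (b ^ n₀ ∸ 1) (a ^ g)) 1 v)) (sym (^-identityʳ b)) (if-yes (<⇒<ᵇ 1<b) t))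
      inD : T (loopD a S T′ n₀ M p a b q y κ (a ^ x ∸ b ^ y) 1)
      inD = subst (λ w → T (loopD a S T′ n₀ M p a b q w (rem (η * b ^ w) a) (a ^ x ∸ b ^ w) 1)) y≡
        (loopY-sound a S T′ n₀ M p 300 (a ^ x) b q η 1 (y ∸ 1) (subst (λ w → b ^ w < a ^ x) (sym y≡) B<A) inY)
      power≡ : b ^ (y + n₀ * S * (1 + 2 * j + 2 * a * i)) % M ≡ b ^ (y + d) % M
      power≡ = cong (λ w → b ^ (y + w) % M) (sym (trans d≡ (trans (cong (n₀ *_) (trans δ≡ (cong (S *_) d′≡′))) (sym (*-assoc n₀ S (1 + 2 * j + 2 * a * i))))))

    loopB-unsound : ∀ T′ → δ < T′ → ∀ ρ → (b % a ^ g) {{m^n≢0 a g}} ≡ ρ → ¬ T (loopB a (a ^ s) T′ n₀ (a ^ x * a ^ 12) (a ^ x * a) (a ^ x) (a ^ g) ρ (a ^ s))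
    loopB-unsound T′ δ<T ρ ρ≡ t = startY-unsound T′ δ<T (subst (λ w → T (startY a (a ^ s) T′ n₀ M p (a ^ x) (a ^ g) w)) b≡ (loopB-sound a (a ^ s) T′ n₀ M p (a ^ x) (a ^ g) ρ (a ^ s) h h< t))
      where
      instance
        G≢0 : NonZero (a ^ g)
        G≢0 = m^n≢0 a g
        M≢0 : NonZero (a ^ x * a ^ 12)
        M≢0 = m*n≢0 (a ^ x) (a ^ 12) {{m^n≢0 a x}} {{m^n≢0 a 12}}
      M = a ^ x * a ^ 12
      p = a ^ x * a
      h = b / a ^ g
      b≡ : ρ + a ^ g * h ≡ b
      b≡ = trans (cong₂ _+_ (sym ρ≡) (*-comm (a ^ g) h)) (sym (m≡m%n+[m/n]*n b (a ^ g)))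
      h< : h < a ^ s
      h< = m<n*o⇒m/o<n (subst (b <_) (trans A≡GS (*-comm (a ^ g) (a ^ s))) b<A)

    private
      3<a : 3 < a
      3<a = ≤-trans (m≤m+n 4 3) 7≤a

    module Roots (w : ℕ) (root : a ^ g ∣ w * w + w + 1) (w< : suc w < a ^ g) (Φ : a ^ g ∣ b * b + b + 1) where
      private
        instance
          G≢0 : NonZero (a ^ g)
          G≢0 = m^n≢0 a g
        G = a ^ g
        +G : ℤ.+ G ≡ (ℤ.+ a) ℤ.^ g
        +G = pos-^ a g
        ω = ℤ.+ w
        β = ℤ.+ b
        u v : ℤ.ℤ
        u = β ℤ.- ω
        v = β ℤ.+ ω ℤ.+ ℤ.1ℤ

        +Φ : ∀ t → ℤ.+ (t * t + t + 1) ≡ ℤ.+ t ℤ.* ℤ.+ t ℤ.+ ℤ.+ t ℤ.+ ℤ.1ℤ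
        +Φ t = trans (ℤ.pos-+ (t * t + t) 1) (cong (λ z → z ℤ.+ ℤ.1ℤ) (trans (ℤ.pos-+ (t * t) t) (cong (λ z → z ℤ.+ ℤ.+ t) (ℤ.pos-* t t))))

        G∣uv : (ℤ.+ a) ℤ.^ g ℤ∣.∣ u ℤ.* v
        G∣uv = subst₂ ℤ∣._∣_ +G (trans (cong₂ ℤ._-_ (+Φ b) (+Φ w)) (lem β ω)) (ℤ∣.∣m∣n⇒∣m-n (ℕ∣⇒ℤ∣ Φ) (ℕ∣⇒ℤ∣ root))
          where
          lem : ∀ b w → (b ℤ.* b ℤ.+ b ℤ.+ ℤ.1ℤ) ℤ.- (w ℤ.* w ℤ.+ w ℤ.+ ℤ.1ℤ) ≡ (b ℤ.- w) ℤ.* (b ℤ.+ w ℤ.+ ℤ.1ℤ)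
          lem = ℤ-Ring.solve-∀

        a∣G : a ∣ G
        a∣G = subst (_∣ G) (^-identityʳ a) (^-∣ 1≤g)
          where
          ^-∣ : ∀ {m n} → m ≤ n → a ^ m ∣ a ^ n
          ^-∣ {m} {n} le = divides (a ^ (n ∸ m)) (trans (cong (a ^_) (sym (m∸n+n≡m le))) (^-distribˡ-+-* a (n ∸ m) m))

        -- (2w+1)² = 4 (w²+w+1) - 3, so the two roots differ modulo a.
        not-both : ℤ.+ a ℤ∣.∣ u → ℤ.+ a ℤ∣.∣ v → ⊥
        not-both a∣u a∣v = <⇒≱ 3<a (∣⇒≤ (ℤ∣⇒ℕ∣ (subst (ℤ.+ a ℤ∣.∣_) (trans (cong (λ z → ℤ.+ 4 ℤ.* z ℤ.- (v ℤ.- u) ℤ.* (v ℤ.- u)) (+Φ w)) (lem β ω))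
            (ℤ∣.∣m∣n⇒∣m-n (ℤ∣.∣n⇒∣m*n (ℤ.+ 4) (ℕ∣⇒ℤ∣ (∣-trans a∣G root))) (ℤ∣.∣m⇒∣m*n (v ℤ.- u) (ℤ∣.∣m∣n⇒∣m-n a∣v a∣u))))))
          where
          lem : ∀ b w → ℤ.+ 4 ℤ.* (w ℤ.* w ℤ.+ w ℤ.+ ℤ.1ℤ) ℤ.- ((b ℤ.+ w ℤ.+ ℤ.1ℤ) ℤ.- (b ℤ.- w)) ℤ.* ((b ℤ.+ w ℤ.+ ℤ.1ℤ) ℤ.- (b ℤ.- w)) ≡ ℤ.+ 3
          lem = ℤ-Ring.solve-∀

        ρ = b % G
        b≡ : b ≡ ρ + b / G * G
        b≡ = m≡m%n+[m/n]*n b G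

        -- 0 < ρ + t < 2G leaves G as the only multiple of G.
        residue : ∀ t → 1 ≤ t → t ≤ G → G ∣ b + t → ρ + t ≡ G
        residue t 1≤t t≤G G∣b+t = single (∣m+n∣m⇒∣n (subst (G ∣_) (trans (cong (_+ t) b≡) (lem ρ (b / G * G) t)) G∣b+t) (n∣m*n (b / G)))
          where
          lem : ∀ r q t → r + q + t ≡ q + (r + t)
          lem = solve-∀
          single : G ∣ ρ + t → ρ + t ≡ G
          single (divides zero e)          = ⊥-elim (1+n≰n (≤-trans 1≤t (≤-trans (m≤n+m t ρ) (≤-reflexive e))))
          single (divides (suc zero) e)    = trans e (+-identityʳ G)
          single (divides (suc (suc q)) e) = ⊥-elim (<⇒≱ (+-mono-<-≤ (m%n<n b G) t≤G) (≤-trans (m≤m+n (G + G) (q * G)) (≤-reflexive (trans (+-assoc G G (q * G)) (sym e)))))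

        from-v : ℤ.+ G ℤ∣.∣ v → ρ ≡ G ∸ suc w
        from-v G∣v = trans (sym (m+n∸n≡m ρ (suc w))) (cong (_∸ suc w) (residue (suc w) (s≤s z≤n) (<⇒≤ w<) (ℤ∣⇒ℕ∣ (subst (ℤ.+ G ℤ∣.∣_) v≡ G∣v))))
          where
          v≡ : v ≡ ℤ.+ (b + suc w)
          v≡ = trans (sym (trans (ℤ.pos-+ (b + w) 1) (cong (λ z → z ℤ.+ ℤ.1ℤ) (ℤ.pos-+ b w)))) (cong ℤ.+_ (trans (+-assoc b w 1) (cong (b +_) (+-comm w 1))))

        from-u : ℤ.+ G ℤ∣.∣ u → ρ ≡ w
        from-u G∣u = +-cancelʳ-≡ (G ∸ w) ρ w (trans (residue (G ∸ w) (m<n⇒0<n∸m w<G) (m∸n≤m G w) (ℤ∣⇒ℕ∣ (subst (ℤ.+ G ℤ∣.∣_) u≡ (ℤ∣.∣m∣n⇒∣m+n G∣u ℤ∣.∣-refl)))) (sym (m+[n∸m]≡n (<⇒≤ w<G))))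
          where
          w<G : w < G
          w<G = <-trans (n<1+n w) w<
          lem : ∀ b w t → b ℤ.- w ℤ.+ (w ℤ.+ t) ≡ b ℤ.+ t
          lem = ℤ-Ring.solve-∀
          u≡ : u ℤ.+ ℤ.+ G ≡ ℤ.+ (b + (G ∸ w))
          u≡ = trans (cong (λ z → u ℤ.+ z) (trans (cong ℤ.+_ (sym (m+[n∸m]≡n (<⇒≤ w<G)))) (ℤ.pos-+ w (G ∸ w)))) (trans (lem β ω (ℤ.+ (G ∸ w))) (sym (ℤ.pos-+ b (G ∸ w))))

        split : (ℤ.+ a ℤ∣.∣ u) ⊎ ¬ (ℤ.+ a ℤ∣.∣ u) → ρ ≡ w ⊎ ρ ≡ G ∸ suc w
        split (inj₁ a∣u) = inj₁ (from-u (subst (ℤ∣._∣ u) (sym +G) (prime^∣* prime (not-both a∣u) g (subst ((ℤ.+ a) ℤ.^ g ℤ∣.∣_) (ℤ.*-comm u v) G∣uv))))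
        split (inj₂ a∤u) = inj₂ (from-v (subst (ℤ∣._∣ v) (sym +G) (prime^∣* prime a∤u g G∣uv)))

      -- Subtracting the two values of t² + t + 1 shows G ∣ (b - w)(b + w + 1). G is a power of the
      -- prime a, which divides at most one of the factors.
      roots : ρ ≡ w ⊎ ρ ≡ G ∸ suc w
      roots = split (decide (ℤ.+ a ℤ∣.∣? u))
        where
        decide : ∀ {p} {Q : Set p} → Dec Q → Q ⊎ ¬ Q
        decide (yes q) = inj₁ q
        decide (no ¬q) = inj₂ ¬q

    private
      2≤G : 2 ≤ a ^ g
      2≤G = ≤-trans (≤-trans (m≤m+n 2 5) 7≤a) (≤-trans (≤-reflexive (sym (^-identityʳ a))) (^-monoʳ-≤ a 1≤g))

    order-one : ∀ T′ → δ < T′ → n₀ ≡ 1 → a ^ g < T′ × ¬ T (loopB a (a ^ s) T′ 1 (a ^ x * a ^ 12) (a ^ x * a) (a ^ x) (a ^ g) 1 (a ^ s))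
    order-one T′ δ<T n₀≡1 = <T kind , subst (λ n → ¬ T (loopB a (a ^ s) T′ n (a ^ x * a ^ 12) (a ^ x * a) (a ^ x) (a ^ g) 1 (a ^ s))) n₀≡1 (loopB-unsound T′ δ<T 1 ρ≡1)
      where
      instance
        G≢0 : NonZero (a ^ g)
        G≢0 = m^n≢0 a g
      <T : (n₀ ≡ 1 × 1 ≤ s) ⊎ (n₀ ≡ 3 × a ∣ b * b + b + 1) → a ^ g < T′
      <T (inj₁ (e , 1≤s)) = ≤-<-trans (Order-one.bound P e 1≤s) δ<T
      <T (inj₂ (e , _))   = ⊥-elim (0≢1+n (suc-injective (trans (sym n₀≡1) e)))
      ρ≡1 : b % a ^ g ≡ 1
      ρ≡1 = trans (cong (_% a ^ g) (trans (sym (trans (cong (b ^_) n₀≡1) (^-identityʳ b))) (trans ξ≡ (cong (1 +_) (*-comm (a ^ g) η))))) (trans ([m+kn]%n≡m%n 1 η (a ^ g)) (m<n⇒m%n≡m 2≤G))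

    order-three : ∀ T′ → δ < T′ → n₀ ≡ 3 → a ∣ b * b + b + 1 → ∀ w → a ^ g ∣ w * w + w + 1 → suc w < a ^ g →
      T (loopB a (a ^ s) T′ 3 (a ^ x * a ^ 12) (a ^ x * a) (a ^ x) (a ^ g) w (a ^ s)) →
      ¬ T (loopB a (a ^ s) T′ 3 (a ^ x * a ^ 12) (a ^ x * a) (a ^ x) (a ^ g) (a ^ g ∸ suc w) (a ^ s))
    order-three T′ δ<T n₀≡3 a∣Φ w root w< t₁ t₂ = [ (λ e → unsound w e t₁) , (λ e → unsound (a ^ g ∸ suc w) e t₂) ]′ (Roots.roots w root w< (Order-three.G∣Φ P n₀≡3 a∣Φ))
      where
      unsound : ∀ ρ → (b % a ^ g) {{m^n≢0 a g}} ≡ ρ → ¬ T (loopB a (a ^ s) T′ 3 (a ^ x * a ^ 12) (a ^ x * a) (a ^ x) (a ^ g) ρ (a ^ s))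
      unsound ρ e = subst (λ n → ¬ T (loopB a (a ^ s) T′ n (a ^ x * a ^ 12) (a ^ x * a) (a ^ x) (a ^ g) ρ (a ^ s))) n₀≡3 (loopB-unsound T′ δ<T ρ e)

    search-unsound : ∀ T′ → δ < T′ → ∀ w → ¬ T (search a (a ^ g) (a ^ s) T′ (a ^ x) (a ^ x * a ^ 12) (a ^ x * a) w)
    search-unsound T′ δ<T w t =
      [ (λ (e , _) → let (G<T , fail) = order-one T′ δ<T e in fail (if-yes {c = G <ᵇ T′} {q = true} (<⇒<ᵇ G<T) t₅))
      , (λ (e , Φ) → order-three T′ δ<T e Φ w root (<ᵇ⇒< (suc w) G t₂) t₃ t₄) ]′ kind
      where
      G = a ^ g
      S = a ^ s
      A = a ^ x
      M = a ^ x * a ^ 12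
      p = a ^ x * a
      c₁ = rem (w * w + w + 1) G ≡ᵇ 0
      c₂ = suc w <ᵇ G
      c₃ = loopB a S T′ 3 M p A G w S
      c₄ = loopB a S T′ 3 M p A G (G ∸ suc w) S
      c₅ = if G <ᵇ T′ then loopB a S T′ 1 M p A G 1 S else true
      t₁ : T c₁
      t₁ = proj₁ (∧-split {c₁} {c₂ ∧ c₃ ∧ c₄ ∧ c₅} t)
      r₁ : T (c₂ ∧ c₃ ∧ c₄ ∧ c₅)
      r₁ = proj₂ (∧-split {c₁} {c₂ ∧ c₃ ∧ c₄ ∧ c₅} t)
      t₂ : T c₂
      t₂ = proj₁ (∧-split {c₂} {c₃ ∧ c₄ ∧ c₅} r₁)
      r₂ : T (c₃ ∧ c₄ ∧ c₅)
      r₂ = proj₂ (∧-split {c₂} {c₃ ∧ c₄ ∧ c₅} r₁)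
      t₃ : T c₃
      t₃ = proj₁ (∧-split {c₃} {c₄ ∧ c₅} r₂)
      r₃ : T (c₄ ∧ c₅)
      r₃ = proj₂ (∧-split {c₃} {c₄ ∧ c₅} r₂)
      t₄ : T c₄
      t₄ = proj₁ (∧-split {c₄} {c₅} r₃)
      t₅ : T c₅
      t₅ = proj₂ (∧-split {c₄} {c₅} r₃)
      root : a ^ g ∣ w * w + w + 1
      root = m%n≡0⇒n∣m (w * w + w + 1) (a ^ g) {{m^n≢0 a g}} (trans (sym (rem≡% (w * w + w + 1) (a ^ g) {{m^n≢0 a g}})) (≡ᵇ⇒≡ (rem (w * w + w + 1) G) 0 t₁))

    -- T′ ≤ S contradicts S ≤ δ, and 6561 T′⁴ < G contradicts the elimination bound; only otherwise
    -- is a search run. The computed cube root needs no correctness proof, as `search` tests that it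
    -- is a root.
    checkT-unsound : ∀ w T′ → δ < T′ → ¬ T (checkT a w g (a ^ g) (a ^ s) (a ^ x) T′)
    checkT-unsound w T′ δ<T t = search-unsound T′ δ<T (powmod (a ^ g) (a ^ g) w (a ^ (g ∸ 1)))
      (if-no {6561 * (T′ * T′ * (T′ * T′)) <ᵇ a ^ g} {true} small (if-no {T′ ≤ᵇ a ^ s} {true} big t))
      where
      big : ¬ T (T′ ≤ᵇ a ^ s)
      big e = <⇒≱ δ<T (≤-trans (≤ᵇ⇒≤ T′ (a ^ s) e) (S≤δ P))
      small : ¬ T (6561 * (T′ * T′ * (T′ * T′)) <ᵇ a ^ g)
      small e = <⇒≱ (<ᵇ⇒< (6561 * (T′ * T′ * (T′ * T′))) (a ^ g) e) (≤-trans (elimination P) (*-monoʳ-≤ 6561 (*-mono-≤ (*-mono-≤ le le) (*-mono-≤ le le))))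
        where
        le = <⇒≤ δ<T

    module _ (ms : List ℕ) (hi : ℕ) (δ<hi : δ < hi) where
      checkU-unsound : ∀ w u → ¬ T (checkU ms hi a w g s (a ^ g) (a ^ s) u)
      checkU-unsound w u t = checkT-unsound w T′ (threshold-sound P u ms hi (≤ᵇ⇒≤ (g + s) (g * suc u) (proj₁ both)) δ<hi)
          (subst (λ A → T (checkT a w g (a ^ g) (a ^ s) A T′)) (sym A≡GS) (proj₂ both))
        where
        T′ = threshold (a ^ g) u ms hi
        both = ∧-split {g + s ≤ᵇ g * suc u} {checkT a w g (a ^ g) (a ^ s) (a ^ g * a ^ s) T′} t

      checkS-unsound : ∀ w n → s < n → ¬ T (checkS ms hi a w g n)
      checkS-unsound w (suc n) (s≤s s≤n) t =
        [ (λ lt → checkS-unsound w n lt (proj₂ (∧-split {checkPair ms hi a w g n} {checkS ms hi a w g n} t)))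
        , (λ e → checkU-unsound w (quo (s + g ∸ 1) g) (subst (λ m → T (checkPair ms hi a w g m)) (sym e) (proj₁ (∧-split {checkPair ms hi a w g n} {checkS ms hi a w g n} t)))) ]′ (m≤n⇒m<n∨m≡n s≤n)

      checkG-unsound : ∀ w N → s < N → ∀ n → g ≤ n → ¬ T (checkG ms hi a w N n)
      checkG-unsound w N s<N zero    g≤0 t = 1+n≰n (≤-trans 1≤g g≤0)
      checkG-unsound w N s<N (suc n) g≤n t =
        [ (λ lt → checkG-unsound w N s<N n (s≤s⁻¹ lt) (proj₂ (∧-split {checkS ms hi a w (suc n) N} {checkG ms hi a w N n} t)))
        , (λ e → checkS-unsound w N s<N (subst (λ m → T (checkS ms hi a w m N)) (sym e) (proj₁ (∧-split {checkS ms hi a w (suc n) N} {checkG ms hi a w N n} t)))) ]′ (m≤n⇒m<n∨m≡n g≤n)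

    s<8 : s < 8
    s<8 = ≰⇒> λ 8≤s → <⇒≱ (δ<7^8 P) (≤-trans (^-monoˡ-≤ 8 7≤a) (≤-trans (^-monoʳ-≤ a 8≤s) (S≤δ P)))

    g-bound : ∀ h → δ < h → ∀ n → 6561 * (h * h * (h * h)) < a ^ suc n → g ≤ n
    g-bound h δ<h n lt = s≤s⁻¹ (≰⇒> λ n<g → <⇒≱ lt (≤-trans (^-monoʳ-≤ a n<g) (≤-trans (elimination P) (*-monoʳ-≤ 6561 (*-mono-≤ (*-mono-≤ le le) (*-mono-≤ le le))))))
      where
      le = <⇒≤ δ<h

    check-unsound : ∀ w n → 6561 * (7 ^ 8 * 7 ^ 8 * (7 ^ 8 * 7 ^ 8)) < a ^ suc n → ¬ T (check a w n)
    check-unsound w n lt = checkG-unsound (11 ∷ 10 ∷ 9 ∷ 8 ∷ 7 ∷ 6 ∷ 5 ∷ 4 ∷ 3 ∷ 2 ∷ 1 ∷ []) (7 ^ 8) (δ<7^8 P) w 8 s<8 n (g-bound (7 ^ 8) (δ<7^8 P) n lt)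

-- Exponents r from 66 on

module Large where
  open import Data.Nat.Base
  open import Data.Nat.Properties
  open OddGap
  open Elimination
  open Thresholds

  -- a^s ≤ δ < 7^8 < a forces s = 0, hence u = 1, and m = 2 already satisfies `m-large`. The
  -- contradiction is 6561 * 3552^4 < 2^66 ≤ a^g.
  large : ∀ {a b c x y X d} → 2 ^ 66 ≤ a → ¬ OddPair a b c x y X d
  large {a} big P = <⇒≱ (≤-<-trans (≤-trans (elimination P) (*-monoʳ-≤ 6561 (*-mono-≤ (*-mono-≤ δ≤ δ≤) (*-mono-≤ δ≤ δ≤)))) (<ᵇ⇒< (6561 * (3552 * 3552 * (3552 * 3552))) (2 ^ 66) _)) 2^66≤G
    where
    open OddPair P
    instance
      a≢0 : NonZero a
      a≢0 = >-nonZero (≤-trans (s≤s z≤n) 7≤a)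
    G = a ^ g
    2^66≤G : 2 ^ 66 ≤ G
    2^66≤G = ≤-trans big (≤-trans (≤-reflexive (sym (^-identityʳ a))) (^-monoʳ-≤ a 1≤g))
    s≡0 : s ≡ 0
    s≡0 = n≤0⇒n≡0 (s≤s⁻¹ (≰⇒> λ 1≤s → <⇒≱ (δ<7^8 P) (≤-trans (≤-trans (≤ᵇ⇒≤ (7 ^ 8) (2 ^ 66) _) big)
      (≤-trans (≤-reflexive (sym (^-identityʳ a))) (≤-trans (^-monoʳ-≤ a 1≤s) (S≤δ P))))))
    u-ok : g + s ≤ g * 1
    u-ok = ≤-reflexive (trans (cong (g +_) s≡0) (trans (+-identityʳ g) (sym (*-identityʳ g))))
    -- 720601 is the least n with 7^8 + 1 ≤ 8 n.
    m-ok : 2 * (4 * 720601) ^ 8 * G ^ 6 ≤ G ^ 14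
    m-ok = ≤-trans (*-monoˡ-≤ (G ^ 6) (≤-trans (≤ᵇ⇒≤ (2 * (4 * 720601) ^ 8) ((2 ^ 66) ^ 8) _) (^-monoˡ-≤ 8 2^66≤G))) (≤-reflexive (sym (^-distribˡ-+-* G 8 6)))
    -- 3552 = 768 * 4 + 96 * 4 + 48 * 2 is the left side of `δ-large` for u = 1, m = 2.
    δ≤ : δ ≤ 3552
    δ≤ = <⇒≤ (≰⇒> (baker-pair P 1 2 720601 u-ok (≤-trans (+-monoˡ-≤ 1 (<⇒≤ (δ<7^8 P))) (≤ᵇ⇒≤ (7 ^ 8 + 1) (8 * 1 * 720601) _)) m-ok))

-- All admissible exponents r

module Cases where
  open import Data.Nat.Base
  open import Data.Nat.Properties
  open import Data.Bool.Base using (true; T)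
  open import Data.List.Relation.Unary.All using (All; []; _∷_)
  open import Data.Unit.Base using (tt)
  open OddGap
  open Search
  open SearchSoundness
  open Large

  record Settled (r : ℕ) : Set where
    field
      positive : 1 ≤ r
      no-pair  : ∀ {a b c x y X d} → a ≡ 2 ^ r * 3 + 1 → ¬ OddPair a b c x y X d

  -- n bounds the values of g that can occur: the elimination bound with δ < 7^8 excludes g > n.
  by-search : ∀ r w n → 1 ≤ r → T (6561 * (7 ^ 8 * 7 ^ 8 * (7 ^ 8 * 7 ^ 8)) <ᵇ (2 ^ r * 3 + 1) ^ suc n) → check (2 ^ r * 3 + 1) w n ≡ true → Settled r
  by-search r w n 1≤r lt ok = record
    { positive = 1≤r
    ; no-pair  = λ { refl P → check-unsound P w n (<ᵇ⇒< (6561 * (7 ^ 8 * 7 ^ 8 * (7 ^ 8 * 7 ^ 8))) ((2 ^ r * 3 + 1) ^ suc n) lt) (subst T (sym ok) tt) } }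

  by-size : ∀ {r} → 66 ≤ r → Settled r
  by-size {r} 66≤r = record
    { positive = ≤-trans (≤ᵇ⇒≤ 1 66 tt) 66≤r
    ; no-pair  = λ { refl → large (≤-trans (^-monoʳ-≤ 2 66≤r) (≤-trans (m≤m*n (2 ^ r) 3) (m≤m+n (2 ^ r * 3) 1))) } }

  -- The second argument of by-check is a primitive cube root of unity modulo 2^r·3 + 1.
  all-settled : All Settled rList
  all-settled = by-check 1 2 36 refl ∷ by-check 2 3 27 refl ∷ by-check 5 35 15 refl ∷ by-check 6 84 13 refl ∷ by-check 8 360 10 refl ∷ by-check 12 6048 7 refl
    ∷ by-check 18 392448 5 refl ∷ by-check 30 1610563584 3 refl ∷ by-check 36 103078821888 2 refl ∷ by-check 41 2000779854491 2 refl
    ∷ by-size′ 66 ∷ by-size′ 189 ∷ by-size′ 201 ∷ by-size′ 209 ∷ by-size′ 276 ∷ by-size′ 353 ∷ by-size′ 408 ∷ by-size′ 438 ∷ by-size′ 534 ∷ by-size′ 2208 ∷ by-size′ 2816 ∷ by-size′ 3168 ∷ by-size′ 3189 ∷ by-size′ 3912 ∷ []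
    where
    by-check : ∀ r w n {_ : T (1 ≤ᵇ r)} {_ : T (6561 * (7 ^ 8 * 7 ^ 8 * (7 ^ 8 * 7 ^ 8)) <ᵇ (2 ^ r * 3 + 1) ^ suc n)} → check (2 ^ r * 3 + 1) w n ≡ true → Settled r
    by-check r w n {1≤r} {lt} = by-search r w n (≤ᵇ⇒≤ 1 r 1≤r) lt
    by-size′ : ∀ r {_ : T (66 ≤ᵇ r)} → Settled r
    by-size′ r {le} = by-size (≤ᵇ⇒≤ 66 r le)

-- Comparing two solutions, and the exceptional triple

open import Data.Nat.Base using (_+_; _*_; _^_; _∸_; >-nonZero)
open import Data.Nat.Properties
open import Data.Nat.Divisibility using (_∣_; ∣-refl)
open import Data.List.Relation.Unary.All using (lookup)
open import Relation.Binary.Definitions using (tri<; tri≈; tri>)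
open LehmerSequences using (parity)
open EvenGap using (exceptional)
open UnitGap using (c≢1)
open OddGap using (OddPair; odd-pair)
open Cases

private
  coprime⇒∤ : ∀ {a b} → 1 < a → Coprime a b → ¬ (a ∣ b)
  coprime⇒∤ 1<a co a∣b = <⇒≢ 1<a (sym (co (∣-refl , a∣b)))

-- The conclusion records x = 1 and y = 1 for the smaller solution as well, which the count in the
-- exceptional case relies on.
two-solutions : ∀ {a b c x y X Y} → AdmissibleA a → 1 < b → 1 ≤ c → Coprime a b → Coprime a c → Coprime b c →
  Solution a b c x y → Solution a b c X Y → x < X → a ≡ 13 × b ≡ 3 × c ≡ 10 × x ≡ 1 × y ≡ 1
two-solutions {a} {b} {c} {x} {y} {X} {Y} (pr , r , r∈ , a≡) 1<b 1≤c a⊥b a⊥c b⊥c (1≤x , 1≤y , eq) (1≤X , 1≤Y , Eq) x<X =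
  by-parity (proj₁ (parity d)) (proj₂ (parity d))
  where
  open Settled (lookup all-settled r∈)
  7≤a : 7 ≤ a
  7≤a = ≤-trans (+-monoˡ-≤ 1 (*-monoˡ-≤ 3 (^-monoʳ-≤ 2 positive))) (≤-reflexive (sym a≡))
  2≤a : 2 ≤ a
  2≤a = ≤-trans (m≤m+n 2 5) 7≤a
  instance
    b≢0 : NonZero b
    b≢0 = >-nonZero (<-trans (s≤s z≤n) 1<b)
  a∤b : ¬ (a ∣ b)
  a∤b = coprime⇒∤ 2≤a a⊥b
  y<Y : y < Y
  y<Y = ≰⇒> λ Y≤y → <⇒≱ (^-monoʳ-< a 2≤a x<X) (≤-trans (≤-reflexive Eq) (≤-trans (+-monoˡ-≤ c (^-monoʳ-≤ b Y≤y)) (≤-reflexive (sym eq))))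
  d = Y ∸ y
  1≤d : 1 ≤ d
  1≤d = m<n⇒0<n∸m y<Y
  Eq′ : a ^ X ≡ b ^ (y + d) + c
  Eq′ = trans Eq (cong (λ w → b ^ w + c) (sym (m+[n∸m]≡n (<⇒≤ y<Y))))
  by-parity : ∀ e → d ≡ 2 * e ⊎ d ≡ suc (2 * e) → a ≡ 13 × b ≡ 3 × c ≡ 10 × x ≡ 1 × y ≡ 1
  by-parity e (inj₂ d≡) = ⊥-elim (no-pair a≡ (odd-pair {X = X} pr 7≤a r a≡ 1<b 1≤c 1≤x 1≤y x<X a∤b eq Eq′ e d≡))
  -- For c = 1 the form B p² + c q² represents 1, so the descent does not apply.
  by-parity e (inj₁ d≡) = [ large-c , (λ c≡1 → ⊥-elim (c≢1 pr (≤-trans (m≤m+n 5 2) 7≤a) {X = X} 1<b 1≤x 1≤y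
      (trans eq (cong (b ^ y +_) (sym c≡1))) (trans Eq′ (cong (b ^ (y + d) +_) (sym c≡1))) 1≤d)) ]′ (m≤n⇒m<n∨m≡n 1≤c)
    where
    1≤e : 1 ≤ e
    1≤e = n≢0⇒n>0 λ e≡0 → n>0⇒n≢0 1≤d (trans d≡ (cong (2 *_) e≡0))
    large-c : 1 < c → a ≡ 13 × b ≡ 3 × c ≡ 10 × x ≡ 1 × y ≡ 1
    large-c 2≤c = exceptional pr (≤-trans (m≤m+n 3 4) 7≤a) {X = X} 1<b 2≤c 1≤x 1≤y 1≤e a∤b (coprime⇒∤ 2≤a a⊥c) b⊥c eq (trans Eq′ (cong (λ w → b ^ (y + w) + c) d≡))

same-y : ∀ {a b c x y Y} → 1 < b → Solution a b c x y → Solution a b c x Y → y ≡ Y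
same-y {a} {b} {c} {x} {y} {Y} 1<b (_ , _ , eq) (_ , _ , Eq) = compare (<-cmp y Y)
  where
  powers : b ^ y ≡ b ^ Y
  powers = +-cancelʳ-≡ c _ _ (trans (sym eq) Eq)
  compare : _ → y ≡ Y
  compare (tri< lt _ _) = ⊥-elim (<⇒≢ (^-monoʳ-< b 1<b lt) powers)
  compare (tri≈ _ e _)  = e
  compare (tri> _ _ lt) = ⊥-elim (<⇒≢ (^-monoʳ-< b 1<b lt) (sym powers))

unique : ∀ {a b c} → AdmissibleA a → 1 < b → 1 ≤ c → Coprime a b → Coprime a c → Coprime b c → ¬ ((a , b , c) ≡ (13 , 3 , 10)) →
  ∀ x y x′ y′ → Solution a b c x y → Solution a b c x′ y′ → x ≡ x′ × y ≡ y′
unique {a} {b} {c} A 1<b 1≤c a⊥b a⊥c b⊥c generic x y x′ y′ S S′ = compare (<-cmp x x′) S S′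
  where
  absurd : ∀ {x y X Y} → Solution a b c x y → Solution a b c X Y → ¬ x < X
  absurd S S′ lt with two-solutions A 1<b 1≤c a⊥b a⊥c b⊥c S S′ lt
  ... | refl , refl , refl , _ = generic refl
  compare : _ → Solution a b c x y → Solution a b c x′ y′ → x ≡ x′ × y ≡ y′
  compare (tri< lt _ _)   S S′ = ⊥-elim (absurd S S′ lt)
  compare (tri≈ _ refl _) S S′ = refl , same-y {a} {b} {c} {x} 1<b S S′
  compare (tri> _ _ lt)   S S′ = ⊥-elim (absurd S′ S lt)

first : Solution 13 3 10 1 1
first = s≤s z≤n , s≤s z≤n , refl

second : Solution 13 3 10 3 7
second = s≤s z≤n , s≤s z≤n , refl

-- Of two solutions the one with the smaller first exponent has it equal to 1. This excludes 1 < u <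
-- 3 against (3, 7), and u > 3 because then 3 would be the smaller one.
exactly-two : AdmissibleA 13 → Coprime 13 3 → Coprime 13 10 → Coprime 3 10 → ∀ u v → Solution 13 3 10 u v → (u ≡ 1 × v ≡ 1) ⊎ (u ≡ 3 × v ≡ 7)
exactly-two A a⊥b a⊥c b⊥c u v S = compare (<-cmp u 1) (<-cmp u 3) S
  where
  smaller : ∀ {x y X Y} → Solution 13 3 10 x y → Solution 13 3 10 X Y → x < X → x ≡ 1
  smaller S S′ lt = proj₁ (proj₂ (proj₂ (proj₂ (two-solutions A (s≤s (s≤s z≤n)) (s≤s z≤n) a⊥b a⊥c b⊥c S S′ lt))))
  compare : _ → _ → Solution 13 3 10 u v → (u ≡ 1 × v ≡ 1) ⊎ (u ≡ 3 × v ≡ 7)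
  compare (tri< u<1 _ _)   _               S = ⊥-elim (<⇒≱ u<1 (proj₁ S))
  compare (tri≈ _ refl _)  _               S = inj₁ (refl , same-y {13} {3} {10} {1} (s≤s (s≤s z≤n)) S first)
  compare (tri> _ u≢1 _)   (tri< u<3 _ _)  S = ⊥-elim (u≢1 (smaller S second u<3))
  compare (tri> _ _ _)     (tri≈ _ refl _) S = inj₂ (refl , same-y {13} {3} {10} {3} (s≤s (s≤s z≤n)) S second)
  compare (tri> _ _ _)     (tri> _ _ 3<u)  S = ⊥-elim (3≢1 (smaller second S 3<u))
    where
    3≢1 : ¬ 3 ≡ 1
    3≢1 ()

theorem3 : (a b c : ℕ) → AdmissibleA a → 1 < b → 1 ≤ c
    → Coprime a b → Coprime a c → Coprime b c
    → (¬ ((a , b , c) ≡ (13 , 3 , 10))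
    → ∀ x y x′ y′ → Solution a b c x y → Solution a b c x′ y′ → (x ≡ x′ × y ≡ y′))
    × ((a , b , c) ≡ (13 , 3 , 10)
    → ∃[ x ] ∃[ y ] ∃[ x′ ] ∃[ y′ ] (Solution a b c x y × Solution a b c x′ y′
    × ¬ (x ≡ x′ × y ≡ y′)
    × (∀ u v → Solution a b c u v → (u ≡ x × v ≡ y) ⊎ (u ≡ x′ × v ≡ y′))))
theorem3 a b c A 1<b 1≤c a⊥b a⊥c b⊥c = unique A 1<b 1≤c a⊥b a⊥c b⊥c ,
  λ { refl → 1 , 1 , 3 , 7 , first , second , (λ ()) , exactly-two A a⊥b a⊥c b⊥c }
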